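{- Let $p$ be a prime with $p\equiv1\pmod3$, $q=p$, $s=3$, $h\in\{0,1,2\}$, $m\ge2$, $a\in\mathbb{F}_p$, $t\mid m$, $d=\gcd(m/t,3)$, and assume $p\nmid m/t$ and $d\mid h$. Let $i_0$ be the unique integer with $0\le i_0<3/d$ and $\frac{m}{dt}i_0\equiv\frac hd\pmod{3/d}$, and (for $a\neq0$) $a_0=-\frac{m}{ta}$. For $3\nmid t$ define $$Q_{t,3}=\begin{cases}p^{(t-1)/3}\pi_3^{(t-1)/3}\,\bar\chi_3(a_0)\,\zeta^{2i_0}&t\equiv1\pmod3,\\ p^{(t-2)/3}\pi_3^{(t+1)/3}\,\chi_3(a_0)\,\zeta^{2i_0}&t\equiv2\pmod3.\end{cases}$$ Then: for $a=0$, $N_t=\frac13(p^{t-1}-1)$ if $3\nmid m/t$, $3\nmid t$; $N_t=\frac13\bigl(p^{t-1}-1-2(-1)^tp^{(t-3)/3}(p-1)\mathrm{Re}(\pi_3^{t/3}\zeta^{2i_0})\bigr)$ if $3\nmid m/t$, $3\mid t$; $N_t=p^{t-1}-1$ if $3\mid m/t$. For $a\neq0$, $N_t=\frac13\bigl(p^{t-1}-2(-1)^t\mathrm{Re}\,Q_{t,3}\bigr)$ if $3\nmid m/t$, $3\nmid t$; $N_t=\frac13\bigl(p^{t-1}+2(-1)^tp^{(t-3)/3}\mathrm{Re}(\pi_3^{t/3}\zeta^{2i_0})\bigr)$ if $3\nmid m/t$, $3\mid t$; $N_t=p^{t-1}$ if $3\mid m/t$.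
   Context: $\mathrm{Tr}_m,\mathrm{Nm}_m$ are trace and norm from $\mathbb{F}_{p^m}$ to $\mathbb{F}_p$; $\gamma_m$ is a fixed primitive element of $\mathbb{F}_{p^m}$, $g=\mathrm{Nm}_m(\gamma_m)$. $N_t$ is the number of $x\in\mathbb{F}_{p^t}$ with $\mathrm{Tr}_m(x)=a$ and $\mathrm{Nm}_m(x)\in g^h\langle g^3\rangle$. $\zeta=e^{2\pi i/3}$; $\chi_3$ is the multiplicative character of order 3 of $\mathbb{F}_p$ with $\chi_3(g)=\zeta$, $\bar\chi_3$ its conjugate. Let $a_3,b_3$ be integers with $a_3^2+3b_3^2=p$, $a_3\equiv-1\pmod3$, $3b_3\equiv(2g^{(p-1)/3}+1)a_3\pmod p$, and $\pi_3=\chi_3(2)(a_3+ib_3\sqrt3)$. -}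

module Defs where

open import Level using (0ℓ)
open import Data.Bool using (Bool; true; false; _∧_; if_then_else_)
open import Data.Nat as ℕ using (ℕ; zero; suc; _∸_; _<_)
open import Data.Nat.DivMod using (_/_)
open import Data.Integer as ℤ using (ℤ; +_; -_)
import Data.Integer.Divisibility as ℤDiv
open import Data.List using (List; []; _∷_; upTo; foldr; map)
open import Data.Bool.ListAction using (any)
open import Data.List.Relation.Unary.Any using (Any)
import Data.List.Relation.Unary.Unique.Setoid as UniqueS
open import Data.Product using (∃; _×_)
open import Relation.Nullary using (¬_)
open import Relation.Nullary.Decidable using (⌊_⌋)
open import Relation.Binary using (Decidable)
open import Algebra.Bundles using (CommutativeRing)

_≡[mod_]_ : ℤ → ℕ → ℤ → Set
x ≡[mod n ] y = (+ n) ℤDiv.∣ (x ℤ.- y)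

-- Natural division by a (nonzero) divisor; only used with d = gcd(_,3) ≥ 1.
_/′_ : ℕ → ℕ → ℕ
x /′ zero = 0
x /′ suc k = x / suc k

sgn : ℕ → ℤ
sgn zero = + 1
sgn (suc t) = - sgn t

-- The ring ℤ[ζ], ζ = e^{2πi/3}, ζ² = -1 - ζ.  An element  u + v ζ  is
-- represented by the pair (u , v).

record ℤζ : Set where
  constructor _+_ζ
  field
    re₀ : ℤ
    im₀ : ℤ
open ℤζ public

infixl 7 _·_
_·_ : ℤζ → ℤζ → ℤζ
(u + v ζ) · (u′ + v′ ζ) =
  (u ℤ.* u′ ℤ.- v ℤ.* v′) + (u ℤ.* v′ ℤ.+ v ℤ.* u′ ℤ.- v ℤ.* v′) ζ

oneζ : ℤζ
oneζ = (+ 1) + (+ 0) ζ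

ζ′ : ℤζ
ζ′ = (+ 0) + (+ 1) ζ

ofℤ : ℤ → ℤζ
ofℤ z = z + (+ 0) ζ

_^ζ_ : ℤζ → ℕ → ℤζ
z ^ζ zero = oneζ
z ^ζ suc n = z · (z ^ζ n)

-- twice the real part:  2·Re(u + v ζ) = 2u - v   (Re ζ = -1/2)
twoRe : ℤζ → ℤ
twoRe (u + v ζ) = (+ 2) ℤ.* u ℤ.- v

-- i√3 = 2ζ + 1, so  a + i b √3 = (a + b) + 2b ζ
eisen : ℤ → ℤ → ℤζ
eisen a b = (a ℤ.+ b) + ((+ 2) ℤ.* b) ζ

record FiniteField : Set₁ where
  field
    commRing : CommutativeRing 0ℓ 0ℓ
  open CommutativeRing commRing public
  field
    _≟_      : Decidable _≈_
    1≉0      : ¬ (1# ≈ 0#)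
    inverse  : ∀ x → ¬ (x ≈ 0#) → ∃ λ y → (x * y) ≈ 1#
    elements : List Carrier
    complete : ∀ x → Any (x ≈_) elements
    unique   : UniqueS.Unique setoid elements

module FF (F : FiniteField) where
  open FiniteField F

  pow : Carrier → ℕ → Carrier
  pow x zero = 1#
  pow x (suc n) = x * pow x n

  fromℕ : ℕ → Carrier
  fromℕ zero = 0#
  fromℕ (suc n) = 1# + fromℕ n

  Tr : (p m : ℕ) → Carrier → Carrier
  Tr p m x = foldr _+_ 0# (map (λ i → pow x (p ℕ.^ i)) (upTo m))

  Nm : (p m : ℕ) → Carrier → Carrier
  Nm p m x = foldr _*_ 1# (map (λ i → pow x (p ℕ.^ i)) (upTo m))

  Primitive : (p m : ℕ) → Carrier → Set
  Primitive p m γ = ¬ (γ ≈ 0#) ×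
    (∀ k → 0 < k → k < p ℕ.^ m ∸ 1 → ¬ (pow γ k ≈ 1#))

  count : (Carrier → Bool) → List Carrier → ℕ
  count P [] = 0
  count P (x ∷ xs) = if P x then suc (count P xs) else count P xs

  -- N_t : number of x ∈ F_{p^t} (i.e. x^{p^t} = x) with Tr_m(x) = a and
  -- Nm_m(x) ∈ g^h ⟨g^3⟩, g = Nm_m(γ).  Since g has order p-1, the coset
  -- g^h⟨g^3⟩ is { g^(h+3j) : j < p-1 }.
  Ncount : (p m t a h : ℕ) (γ : Carrier) → ℕ
  Ncount p m t a h γ = count P elements
    where
      g = Nm p m γ
      P : Carrier → Bool
      P x = ⌊ pow x (p ℕ.^ t) ≟ x ⌋
          ∧ ⌊ Tr p m x ≟ fromℕ a ⌋
          ∧ any (λ j → ⌊ Nm p m x ≟ pow g (h ℕ.+ 3 ℕ.* j) ⌋) (upTo (p ∸ 1))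

{-# OPTIONS --safe #-}
-- For x ∈ F_{p^t} one has Tr_m x = n Tr_t x and Nm_m x = (Nm_t x)^n, so by orthogonality of the characters mod 3
-- the count reduces to S_t(a) = Σ χ(Nm_t x) over Tr_t x = a.  For F monic of degree t the weight
-- λ(F) = χ(F(0)) [next-to-leading coefficient of F = a] is summed over all monic F, and unique factorization in
-- F_p[X] yields the coefficients of the logarithmic derivative of Σ λ(F) T^deg F (Hasse–Davenport without additive
-- characters): since Σ λ(F) vanishes in degrees ≥ 2, S_{t+1} = − S_t ★ χ, with ★ the additive convolution on F_p.
-- Iterating, χ ★ χ = J χ̄, χ̄ ★ χ = p δ₀ − 1 and (p δ₀ − 1) ★ χ = p χ give S_t in closed form, J = J(χ, χ).
-- Finally J = χ(2)(a₃ + i b₃ √3): J J̄ = p, J ≡ −1 mod (1 − ζ), χ(4) J is odd (hence in ℤ[√−3]) and J vanishes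
-- modulo the prime (p, ζ − g^((p−1)/3)), which determines it among the solutions of a² + 3 b² = p.
module Submission where

open import Defs
open import Level using (0ℓ)
open import Data.Nat as ℕ using (NonZero; suc; s≤s; zero; z≤n; ℕ)
import Data.Nat.Properties as ℕₚ
open import Data.Integer as ℤ using (+_; -[1+_]; ℤ)
import Data.Integer.Properties as ℤₚ
open import Data.Maybe using (Maybe; just; nothing)
open import Relation.Nullary using (Dec; no; yes; ¬_)
open import Relation.Binary.PropositionalEquality as ≡ using (_≡_)
open import Algebra.Bundles using (CommutativeMonoid; CommutativeRing; CommutativeSemiring)
import Algebra.Solver.Ring as RingSolver
import Algebra.Solver.Ring.AlmostCommutativeRing as ACR
import Algebra.Properties.Ring as RingP
import Algebra.Properties.Semiring.Mult.TCOptimised as MultO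
import Relation.Binary.Reasoning.Setoid as SetoidR
open import Data.List using (List; []; _++_; _∷_; applyUpTo; concatMap; filter; foldr; length; map; upTo)
open import Data.List.Relation.Unary.Any as Any using (Any; here; there)
open import Data.List.Relation.Unary.All as All using (All; []; _∷_)
open import Data.List.Relation.Unary.AllPairs using ([]; _∷_)
import Data.List.Relation.Unary.Unique.Setoid as UniqueS
open import Data.Product using (_,_; _×_; proj₁; proj₂; Σ; ∃)
open import Data.Empty using (⊥-elim)
open import Relation.Binary.Bundles using (DecSetoid)
import Algebra.Properties.Semiring.Mult as MultP
import Algebra.Properties.CommutativeSemigroup as CSP
open import Function using (_∘_; module Equivalence)
open import Data.Sum using ([_,_]′; _⊎_; inj₁; inj₂)
open import Relation.Binary using (tri<; tri>; tri≈)
open import Data.Nat.Induction using (<-wellFounded)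
open import Induction.WellFounded using (Acc; acc)
open import Relation.Nullary.Decidable using (_×-dec_; fromWitness; map′; toWitness; ¬?; ⌊_⌋)
import Data.Nat.Solver as ℕSolver
open import Data.Nat.Divisibility as ∣ using (_∣_; _∤_)
open import Data.Nat.DivMod using (m%n<n; m*n/n≡m; m/n*n≡m; m≡m%n+[m/n]*n; n/1≡n)
open import Data.Nat.Primality using (Prime; euclidsLemma; prime?; prime⇒irreducible; prime⇒nonTrivial; prime⇒nonZero)
open import Data.Nat.Coprimality using (Coprime; coprime-Bézout)
open import Data.Nat.GCD as GCD using (gcd)
open import Data.Nat.Combinatorics as Comb using (k![n∸k]!∣n!; nCk≡n!/k![n-k]!; nCn≡1)
open import Data.Fin as Fin using (Fin; inject₁; toℕ)
import Data.Fin.Properties as Finₚ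
import Data.Integer.Divisibility as ℤ∣
import Data.List.Properties as Listₚ
import Data.List.Relation.Unary.Any.Properties as Anyₚ
import Data.List.Relation.Unary.All.Properties as Allₚ
import Data.List.Relation.Unary.AllPairs.Properties as AllPairsₚ
import Algebra.Properties.Semiring.Sum as VecSum
import Algebra.Properties.CommutativeSemiring.Binomial as Binomial
import Data.Integer.Solver as ℤSolver
import Data.Integer.Divisibility.Signed as ℤ∣ₛ
open import Data.Bool using (Bool; T; T?; _∧_; false; true)
open import Data.Bool.Properties using (T-∧)
open import Data.Bool.ListAction using (any)

-- Additive characters would need p-th roots of unity; convolution on F_p replaces them, so that
-- every value stays in ℤ[ζ], a ring of integer pairs with propositional equality. The price is that
-- λ carries the prescribed coefficient a: in a product H G the χ-parts multiply while the
-- next-to-leading coefficients add, so the family over all a is multiplicative for ★ only. The link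
-- to S_t: the characteristic polynomial over F_p of x in F_{p^t} is a power of its minimal
-- polynomial, hence a prime power H = P^j of degree t, and each such H belongs to exactly deg P
-- elements, deg P being the von Mangoldt weight in the logarithmic derivative. That every H is
-- reached that often follows by counting: each H is hit at most deg P times, each x hits some H,
-- and the weights add up to p^t. As χ(2)³ = 1, χ(4) J equals χ̄(2) J = (χ ★ χ)(2); centred at 1,
-- the terms of this sum pair off, which is where its oddness comes from.

-- Integer coefficients, finite sums, enumerations and power series

module IntegerMultiples (R : CommutativeRing 0ℓ 0ℓ) where
  open CommutativeRing R
  open RingP ring
  open MultO semiring using (×-homo-+; ×1-homo-*) renaming (_×_ to _×′_)
  open SetoidR setoid

  -- The canonical image of ℤ, which gives the ring solver integer coefficients, so that numerals
  -- and cancelling terms are handled in any commutative ring. The optimised multiple makes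
  -- `fromℤ (+ 1)` compute to `1#`.
  fromℤ : ℤ → Carrier
  fromℤ (+ n)    = n ×′ 1#
  fromℤ -[1+ n ] = - (suc n ×′ 1#)

  suc-× : ∀ n → suc n ×′ 1# ≈ 1# + n ×′ 1#
  suc-× = ×-homo-+ 1# 1

  fromℤ-⊖ : ∀ m n → fromℤ (m ℤ.⊖ n) ≈ m ×′ 1# - n ×′ 1#
  fromℤ-⊖ zero zero = sym (-‿inverseʳ 0#)
  fromℤ-⊖ zero (suc n) = sym (+-identityˡ _)
  fromℤ-⊖ (suc m) zero = sym (trans (+-congˡ -0#≈0#) (+-identityʳ _))
  fromℤ-⊖ (suc m) (suc n) = begin
    fromℤ (suc m ℤ.⊖ suc n)             ≡⟨ ≡.cong fromℤ (ℤₚ.[1+m]⊖[1+n]≡m⊖n m n) ⟩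
    fromℤ (m ℤ.⊖ n)                     ≈⟨ fromℤ-⊖ m n ⟩
    M - N                               ≈⟨ +-congʳ (trans (sym (+-identityˡ M)) (+-congʳ (sym (-‿inverseʳ 1#)))) ⟩
    ((1# - 1#) + M) - N                 ≈⟨ +-congʳ (trans (+-assoc _ _ _) (trans (+-congˡ (+-comm _ _)) (sym (+-assoc _ _ _)))) ⟩
    ((1# + M) - 1#) - N                 ≈⟨ +-assoc _ _ _ ⟩
    (1# + M) + (- 1# - N)               ≈⟨ +-congˡ (-‿+-comm 1# N) ⟩
    (1# + M) - (1# + N)                 ≈⟨ +-cong (suc-× m) (-‿cong (suc-× n)) ⟨
    suc m ×′ 1# - suc n ×′ 1#             ∎
    where
    M = m ×′ 1#
    N = n ×′ 1#

  fromℤ-neg : ∀ x → fromℤ (ℤ.- x) ≈ - fromℤ x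
  fromℤ-neg (+ zero)  = sym -0#≈0#
  fromℤ-neg (+ suc n) = refl
  fromℤ-neg -[1+ n ]  = sym (-‿involutive _)

  fromℤ-+ : ∀ x y → fromℤ (x ℤ.+ y) ≈ fromℤ x + fromℤ y
  fromℤ-+ (+ m) (+ n)       = ×-homo-+ 1# m n
  fromℤ-+ (+ m) -[1+ n ]    = fromℤ-⊖ m (suc n)
  fromℤ-+ -[1+ m ] (+ n)    = trans (fromℤ-⊖ n (suc m)) (+-comm _ _)
  fromℤ-+ -[1+ m ] -[1+ n ] = begin
    - (suc (suc (m ℕ.+ n)) ×′ 1#)      ≡⟨ ≡.cong (λ k → - (k ×′ 1#)) (≡.cong suc (ℕₚ.+-suc m n)) ⟨
    - ((suc m ℕ.+ suc n) ×′ 1#)        ≈⟨ -‿cong (×-homo-+ 1# (suc m) (suc n)) ⟩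
    - (suc m ×′ 1# + suc n ×′ 1#)       ≈⟨ -‿+-comm _ _ ⟨
    - (suc m ×′ 1#) - (suc n ×′ 1#)     ∎

  fromℤ-* : ∀ x y → fromℤ (x ℤ.* y) ≈ fromℤ x * fromℤ y
  fromℤ-* (+ m) (+ n) = trans (reflexive (≡.cong fromℤ (≡.sym (ℤₚ.pos-* m n)))) (×1-homo-* m n)
  fromℤ-* (+ m) -[1+ n ] = begin
    fromℤ (+ m ℤ.* -[1+ n ])        ≡⟨ ≡.cong fromℤ (≡.sym (ℤₚ.neg-distribʳ-* (+ m) (+ suc n))) ⟩
    fromℤ (ℤ.- (+ m ℤ.* + suc n))   ≈⟨ fromℤ-neg (+ m ℤ.* + suc n) ⟩
    - fromℤ (+ m ℤ.* + suc n)       ≈⟨ -‿cong (fromℤ-* (+ m) (+ suc n)) ⟩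
    - (m ×′ 1# * (suc n ×′ 1#))       ≈⟨ -‿distribʳ-* _ _ ⟩
    m ×′ 1# * - (suc n ×′ 1#)         ∎
  fromℤ-* -[1+ m ] (+ n) = begin
    fromℤ (-[1+ m ] ℤ.* + n)        ≡⟨ ≡.cong fromℤ (≡.sym (ℤₚ.neg-distribˡ-* (+ suc m) (+ n))) ⟩
    fromℤ (ℤ.- (+ suc m ℤ.* + n))   ≈⟨ fromℤ-neg (+ suc m ℤ.* + n) ⟩
    - fromℤ (+ suc m ℤ.* + n)       ≈⟨ -‿cong (fromℤ-* (+ suc m) (+ n)) ⟩
    - (suc m ×′ 1# * (n ×′ 1#))       ≈⟨ -‿distribˡ-* _ _ ⟩
    - (suc m ×′ 1#) * (n ×′ 1#)       ∎
  fromℤ-* -[1+ m ] -[1+ n ] = begin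
    (suc m ℕ.* suc n) ×′ 1#              ≈⟨ ×1-homo-* (suc m) (suc n) ⟩
    suc m ×′ 1# * (suc n ×′ 1#)           ≈⟨ *-congˡ (-‿involutive _) ⟨
    suc m ×′ 1# * (- - (suc n ×′ 1#))     ≈⟨ -‿distribʳ-* _ _ ⟨
    - (suc m ×′ 1# * - (suc n ×′ 1#))     ≈⟨ -‿distribˡ-* _ _ ⟩
    - (suc m ×′ 1#) * - (suc n ×′ 1#)     ∎

  private
    acr = ACR.fromCommutativeRing R

    morphism : ℤ.+-*-rawRing ACR.-Raw-AlmostCommutative⟶ acr
    morphism = record
      { ⟦_⟧ = fromℤ ; +-homo = fromℤ-+ ; *-homo = fromℤ-* ; -‿homo = fromℤ-neg
      ; 0-homo = refl ; 1-homo = refl }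

    coeff≟ : ∀ x y → Maybe (fromℤ x ≈ fromℤ y)
    coeff≟ x y with x ℤ.≟ y
    ... | yes eq = just (reflexive (≡.cong fromℤ eq))
    ... | no _   = nothing

  open RingSolver ℤ.+-*-rawRing acr morphism coeff≟ public
    using (solve; _:+_; _:*_; :-_; _:-_; con; _:=_)

module ListSum (R : CommutativeSemiring 0ℓ 0ℓ) where
  open CommutativeSemiring R
  open SetoidR setoid
  open MultP semiring using () renaming (_×_ to _×′_)
  private
    module +S = CSP (CommutativeSemiring.+-commutativeSemigroup R)
    variable A B : Set

  sum : List A → (A → Carrier) → Carrier
  sum []       f = 0#
  sum (x ∷ xs) f = f x + sum xs f

  sum-cong : {f g : A → Carrier} → (∀ x → f x ≈ g x) → ∀ xs → sum xs f ≈ sum xs g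
  sum-cong h []       = refl
  sum-cong h (x ∷ xs) = +-cong (h x) (sum-cong h xs)

  sum-zero : {f : A → Carrier} → (∀ x → f x ≈ 0#) → ∀ xs → sum xs f ≈ 0#
  sum-zero h []       = refl
  sum-zero h (x ∷ xs) = trans (+-cong (h x) (sum-zero h xs)) (+-identityˡ 0#)

  sum-+ : ∀ xs (f g : A → Carrier) → sum xs (λ x → f x + g x) ≈ sum xs f + sum xs g
  sum-+ []       f g = sym (+-identityˡ 0#)
  sum-+ (x ∷ xs) f g = trans (+-congˡ (sum-+ xs f g)) (+S.interchange _ _ _ _)

  *-sum : ∀ c xs (f : A → Carrier) → sum xs (λ x → c * f x) ≈ c * sum xs f
  *-sum c []       f = sym (zeroʳ c)
  *-sum c (x ∷ xs) f = trans (+-congˡ (*-sum c xs f)) (sym (distribˡ _ _ _))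

  sum-* : ∀ xs (f : A → Carrier) c → sum xs (λ x → f x * c) ≈ sum xs f * c
  sum-* xs f c = trans (sum-cong (λ x → *-comm _ _) xs) (trans (*-sum c xs f) (*-comm _ _))

  sum-swap : ∀ xs ys (f : A → B → Carrier) →
             sum xs (λ x → sum ys (f x)) ≈ sum ys (λ y → sum xs (λ x → f x y))
  sum-swap []       ys f = sym (sum-zero (λ _ → refl) ys)
  sum-swap (x ∷ xs) ys f = trans (+-congˡ (sum-swap xs ys f)) (sym (sum-+ ys _ _))

  sum-++ : ∀ xs ys (f : A → Carrier) → sum (xs ++ ys) f ≈ sum xs f + sum ys f
  sum-++ []       ys f = sym (+-identityˡ _)
  sum-++ (x ∷ xs) ys f = trans (+-congˡ (sum-++ xs ys f)) (sym (+-assoc _ _ _))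

  sum-map : ∀ (g : A → B) xs (f : B → Carrier) → sum (map g xs) f ≈ sum xs (f ∘ g)
  sum-map g []       f = refl
  sum-map g (x ∷ xs) f = +-congˡ (sum-map g xs f)

  sum-concatMap : ∀ (g : A → List B) xs (f : B → Carrier) →
                  sum (concatMap g xs) f ≈ sum xs (λ x → sum (g x) f)
  sum-concatMap g []       f = refl
  sum-concatMap g (x ∷ xs) f = trans (sum-++ (g x) (concatMap g xs) f) (+-congˡ (sum-concatMap g xs f))

  sum-const : ∀ c (xs : List A) → sum xs (λ _ → c) ≈ length xs ×′ c
  sum-const c []       = refl
  sum-const c (x ∷ xs) = +-congˡ (sum-const c xs)

  ⟦_⟧ : {P : Set} → Dec P → Carrier
  ⟦ yes _ ⟧ = 1#
  ⟦ no  _ ⟧ = 0#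

  ⟦⟧-true : {P : Set} → P → (d : Dec P) → ⟦ d ⟧ ≈ 1#
  ⟦⟧-true p (yes _) = refl
  ⟦⟧-true p (no ¬p) = ⊥-elim (¬p p)

  ⟦⟧-false : {P : Set} → ¬ P → (d : Dec P) → ⟦ d ⟧ ≈ 0#
  ⟦⟧-false ¬p (yes p) = ⊥-elim (¬p p)
  ⟦⟧-false ¬p (no _)  = refl

  ⟦⟧-cong : {P Q : Set} → (P → Q) → (Q → P) → (p : Dec P) (q : Dec Q) → ⟦ p ⟧ ≈ ⟦ q ⟧
  ⟦⟧-cong f g (yes p) q = sym (⟦⟧-true (f p) q)
  ⟦⟧-cong f g (no ¬p) q = sym (⟦⟧-false (¬p ∘ g) q)

  ⟦⟧-× : {P Q S : Set} → (P → Q × S) → (Q → S → P) →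
         (p : Dec P) (q : Dec Q) (s : Dec S) → ⟦ p ⟧ ≈ ⟦ q ⟧ * ⟦ s ⟧
  ⟦⟧-× f g p (yes q) s = trans (⟦⟧-cong (proj₂ ∘ f) (g q) p s) (sym (*-identityˡ _))
  ⟦⟧-× f g p (no ¬q) s = trans (⟦⟧-false (¬q ∘ proj₁ ∘ f) p) (sym (zeroˡ _))

  ⟦⟧-cond : {P : Set} (d : Dec P) {x y : Carrier} → (P → x ≈ y) → ⟦ d ⟧ * x ≈ ⟦ d ⟧ * y
  ⟦⟧-cond (yes p) h = *-congˡ (h p)
  ⟦⟧-cond (no  _) h = trans (zeroˡ _) (sym (zeroˡ _))

  select : {P : A → Set} → (∀ x → Dec (P x)) → List A → List (Σ A P)
  select d [] = []
  select d (x ∷ xs) with d x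
  ... | yes p = (x , p) ∷ select d xs
  ... | no  _ = select d xs

  sum-select : {P : A → Set} (d : ∀ x → Dec (P x)) (f : A → Carrier) → ∀ xs →
               sum (select d xs) (f ∘ proj₁) ≈ sum xs (λ x → ⟦ d x ⟧ * f x)
  sum-select d f [] = refl
  sum-select d f (x ∷ xs) with d x
  ... | yes p = +-cong (sym (*-identityˡ _)) (sum-select d f xs)
  ... | no  _ = trans (sum-select d f xs) (sym (trans (+-congʳ (zeroˡ _)) (+-identityˡ _)))

module ℕSum = ListSum ℕₚ.+-*-commutativeSemiring

module _ (R : CommutativeSemiring 0ℓ 0ℓ) where
  open CommutativeSemiring R
  open ListSum R
  open MultP semiring using () renaming (_×_ to _×′_; ×-homo-+ to ×′-homo-+)

  ⟦⟧-fromℕ : {P : Set} (d : Dec P) → ℕSum.⟦ d ⟧ ×′ 1# ≈ ⟦ d ⟧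
  ⟦⟧-fromℕ (yes _) = +-identityʳ 1#
  ⟦⟧-fromℕ (no  _) = refl

  sum-fromℕ : {A : Set} (f : A → ℕ) → ∀ xs → ℕSum.sum xs f ×′ 1# ≈ sum xs (λ x → f x ×′ 1#)
  sum-fromℕ f []       = refl
  sum-fromℕ f (x ∷ xs) = trans (×′-homo-+ 1# (f x) (ℕSum.sum xs f)) (+-congˡ (sum-fromℕ f xs))

-- Completeness and absence of repetitions in a single counting statement, which enters sums
-- directly: the indicator of a point sums to 1.
record Enumeration (S : DecSetoid 0ℓ 0ℓ) : Set where
  open DecSetoid S
  field
    list : List Carrier
    once : ∀ s → ℕSum.sum list (λ x → ℕSum.⟦ x ≟ s ⟧) ≡ 1

module _ (S : DecSetoid 0ℓ 0ℓ) where
  open DecSetoid S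
  open ℕSum

  unique⇒enumeration : (xs : List Carrier) → (∀ x → Any (x ≈_) xs) →
                       UniqueS.Unique setoid xs → Enumeration S
  unique⇒enumeration xs all uniq = record { list = xs ; once = λ s → go s xs (all s) uniq }
    where
    none : ∀ {s y} → s ≈ y → ∀ ys → All.All (λ z → ¬ (y ≈ z)) ys → sum ys (λ x → ⟦ x ≟ s ⟧) ≡ 0
    none s≈y []       All.[]         = ≡.refl
    none s≈y (z ∷ ys) (y≉z All.∷ hs) =
      ≡.cong₂ ℕ._+_ (⟦⟧-false (λ z≈s → y≉z (sym (trans z≈s s≈y))) (z ≟ _)) (none s≈y ys hs)
    go : ∀ s ys → Any (s ≈_) ys → UniqueS.Unique setoid ys → sum ys (λ x → ⟦ x ≟ s ⟧) ≡ 1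
    go s (y ∷ ys) (here s≈y) (hs ∷ _) = ≡.cong₂ ℕ._+_ (⟦⟧-true (sym s≈y) (y ≟ s)) (none s≈y ys hs)
    go s (y ∷ ys) (there p)  (hs ∷ u) =
      ≡.cong₂ ℕ._+_ (⟦⟧-false (λ y≈s → lookup hs p y≈s) (y ≟ s)) (go s ys p u)
      where
      lookup : ∀ {zs} → All.All (λ z → ¬ (y ≈ z)) zs → Any (s ≈_) zs → ¬ (y ≈ s)
      lookup (y≉z All.∷ _) (here s≈z) y≈s = y≉z (trans y≈s s≈z)
      lookup (_ All.∷ hs) (there q)   y≈s = lookup hs q y≈s

module EnumSum (R : CommutativeSemiring 0ℓ 0ℓ) where
  open CommutativeSemiring R
  open ListSum R
  open SetoidR setoid

  module _ {S : DecSetoid 0ℓ 0ℓ} (E : Enumeration S) where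
    private module S = DecSetoid S
    open Enumeration E

    once-in : ∀ s → sum list (λ x → ⟦ x S.≟ s ⟧) ≈ 1#
    once-in s = begin
      sum list (λ x → ⟦ x S.≟ s ⟧)                ≈⟨ sum-cong (λ x → ⟦⟧-fromℕ R (x S.≟ s)) list ⟨
      sum list (λ x → ℕSum.⟦ x S.≟ s ⟧ ×′ 1#)     ≈⟨ sum-fromℕ R (λ x → ℕSum.⟦ x S.≟ s ⟧) list ⟨
      ℕSum.sum list (λ x → ℕSum.⟦ x S.≟ s ⟧) ×′ 1# ≡⟨ ≡.cong (_×′ 1#) (once s) ⟩
      1# + 0#                                     ≈⟨ +-identityʳ 1# ⟩
      1#                                          ∎
      where open MultP semiring using () renaming (_×_ to _×′_)

    delta : (f : S.Carrier → Carrier) → (∀ {x y} → x S.≈ y → f x ≈ f y) →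
            ∀ s → sum list (λ x → ⟦ x S.≟ s ⟧ * f x) ≈ f s
    delta f f-cong s = begin
      sum list (λ x → ⟦ x S.≟ s ⟧ * f x) ≈⟨ sum-cong (λ x → ⟦⟧-cond (x S.≟ s) f-cong) list ⟩
      sum list (λ x → ⟦ x S.≟ s ⟧ * f s) ≈⟨ sum-* list _ (f s) ⟩
      sum list (λ x → ⟦ x S.≟ s ⟧) * f s ≈⟨ *-congʳ (once-in s) ⟩
      1# * f s                           ≈⟨ *-identityˡ _ ⟩
      f s                                ∎

  module _ {S T : DecSetoid 0ℓ 0ℓ} (E : Enumeration S) (G : Enumeration T) where
    private
      module S = DecSetoid S
      module T = DecSetoid T
      module E = Enumeration E
      module G = Enumeration G

    module _ (φ : S.Carrier → T.Carrier)
             (injective : ∀ {x y} → φ x T.≈ φ y → x S.≈ y)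
             (φ-cong : ∀ {x y} → x S.≈ y → φ x T.≈ φ y)
             {Image : T.Carrier → Set} (image? : ∀ y → Dec (Image y))
             (preimage : ∀ {y} → Image y → ∃ λ x → φ x T.≈ y)
             (inImage : ∀ x {y} → φ x T.≈ y → Image y) where

      image-count : ∀ y → sum E.list (λ x → ⟦ φ x T.≟ y ⟧) ≈ ⟦ image? y ⟧
      image-count y with image? y
      ... | no ∉im = sum-zero (λ x → ⟦⟧-false (∉im ∘ inImage x) (φ x T.≟ y)) E.list
      ... | yes im with preimage im
      ...   | x₀ , φx₀≈y = trans
        (sum-cong (λ x → ⟦⟧-cong (λ φx≈y → injective (T.trans φx≈y (T.sym φx₀≈y)))
                                 (λ x≈x₀ → T.trans (φ-cong x≈x₀) φx₀≈y) (φ x T.≟ y) (x S.≟ x₀)) E.list)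
        (once-in E x₀)

      -- The indicator of the image at y counts the preimages of y, of which injectivity allows at
      -- most one; exchanging the two sums leaves a point evaluation for each x.
      sum-image : (f : T.Carrier → Carrier) → (∀ {x y} → x T.≈ y → f x ≈ f y) →
                  sum G.list (λ y → ⟦ image? y ⟧ * f y) ≈ sum E.list (f ∘ φ)
      sum-image f f-cong = begin
        sum G.list (λ y → ⟦ image? y ⟧ * f y)
          ≈⟨ sum-cong (λ y → *-congʳ (sym (image-count y))) G.list ⟩
        sum G.list (λ y → sum E.list (λ x → ⟦ φ x T.≟ y ⟧) * f y)
          ≈⟨ sum-cong (λ y → sum-* E.list _ (f y)) G.list ⟨
        sum G.list (λ y → sum E.list (λ x → ⟦ φ x T.≟ y ⟧ * f y))
          ≈⟨ sum-swap G.list E.list _ ⟩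
        sum E.list (λ x → sum G.list (λ y → ⟦ φ x T.≟ y ⟧ * f y))
          ≈⟨ sum-cong (λ x → sum-cong (λ y → *-congʳ (⟦⟧-cong T.sym T.sym (φ x T.≟ y) (y T.≟ φ x))) G.list) E.list ⟩
        sum E.list (λ x → sum G.list (λ y → ⟦ y T.≟ φ x ⟧ * f y))
          ≈⟨ sum-cong (λ x → delta G f f-cong (φ x)) E.list ⟩
        sum E.list (f ∘ φ) ∎

    sum-bijection : (φ : S.Carrier → T.Carrier) (ψ : T.Carrier → S.Carrier) →
      (∀ {x y} → x S.≈ y → φ x T.≈ φ y) → (∀ {x y} → x T.≈ y → ψ x S.≈ ψ y) →
      (∀ x → ψ (φ x) S.≈ x) → (∀ y → φ (ψ y) T.≈ y) →
      (f : T.Carrier → Carrier) → (∀ {x y} → x T.≈ y → f x ≈ f y) →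
      sum E.list (f ∘ φ) ≈ sum G.list f
    sum-bijection φ ψ φ-cong ψ-cong ψφ φψ f f-cong = begin
      sum E.list (f ∘ φ)
        ≈⟨ sum-image φ (λ {x} {y} eq → S.trans (S.sym (ψφ x)) (S.trans (ψ-cong eq) (ψφ y)))
             φ-cong {Image = λ y → ∃ λ x → φ x T.≈ y} (λ y → yes (ψ y , φψ y)) (λ im → im) (λ x eq → x , eq) f f-cong ⟨
      sum G.list (λ y → 1# * f y)
        ≈⟨ sum-cong (λ y → *-identityˡ (f y)) G.list ⟩
      sum G.list f ∎

module IntervalSum (R : CommutativeSemiring 0ℓ 0ℓ) where
  open CommutativeSemiring R
  open ListSum R

  sum-upTo-suc : ∀ n (f : ℕ → Carrier) → sum (upTo (suc n)) f ≈ f 0 + sum (upTo n) (f ∘ suc)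
  sum-upTo-suc n f = +-congˡ (shift n (λ i → i))
    where
    shift : ∀ n (h : ℕ → ℕ) → sum (applyUpTo (suc ∘ h) n) f ≈ sum (applyUpTo h n) (f ∘ suc)
    shift zero    h = refl
    shift (suc n) h = +-congˡ (shift n (h ∘ suc))

  sum-upTo-last : ∀ n (f : ℕ → Carrier) → sum (upTo (suc n)) f ≈ sum (upTo n) f + f n
  sum-upTo-last zero    f = +-comm _ _
  sum-upTo-last (suc n) f = begin
    sum (upTo (suc (suc n))) f                       ≈⟨ sum-upTo-suc (suc n) f ⟩
    f 0 + sum (upTo (suc n)) (f ∘ suc)               ≈⟨ +-congˡ (sum-upTo-last n (f ∘ suc)) ⟩
    f 0 + (sum (upTo n) (f ∘ suc) + f (suc n))       ≈⟨ +-assoc _ _ _ ⟨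
    f 0 + sum (upTo n) (f ∘ suc) + f (suc n)         ≈⟨ +-congʳ (sum-upTo-suc n f) ⟨
    sum (upTo (suc n)) f + f (suc n)                 ∎
    where open SetoidR setoid

  sum-upTo-+ : ∀ m n (f : ℕ → Carrier) →
               sum (upTo (m ℕ.+ n)) f ≈ sum (upTo m) f + sum (upTo n) (λ i → f (m ℕ.+ i))
  sum-upTo-+ zero    n f = sym (+-identityˡ _)
  sum-upTo-+ (suc m) n f = trans (sum-upTo-suc (m ℕ.+ n) f)
    (trans (+-congˡ (sum-upTo-+ m n (f ∘ suc)))
    (trans (sym (+-assoc _ _ _)) (+-congʳ (sym (sum-upTo-suc m f)))))

  sum-upTo-single : ∀ n (f : ℕ → Carrier) e → e ℕ.< n → (∀ i → ¬ (i ≡ e) → f i ≈ 0#) → sum (upTo n) f ≈ f e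
  sum-upTo-single (suc n) f zero e<n h = trans (sum-upTo-suc n f)
    (trans (+-congˡ (sum-zero (λ i → h (suc i) (λ ())) (upTo n))) (+-identityʳ _))
  sum-upTo-single (suc n) f (suc e) (s≤s e<n) h = trans (sum-upTo-suc n f)
    (trans (+-cong (h 0 (λ ())) (sum-upTo-single n (f ∘ suc) e e<n (λ i i≢e → h (suc i) (i≢e ∘ ℕₚ.suc-injective)))) (+-identityˡ _))

module _ {S : DecSetoid 0ℓ 0ℓ} (E : Enumeration S) where
  open DecSetoid S
  open Enumeration E

  private
    sum-nonzero⇒any : {A : Set} {P : A → Set} (P? : ∀ x → Dec (P x)) → ∀ xs →
                      ¬ (ℕSum.sum xs (λ x → ℕSum.⟦ P? x ⟧) ≡ 0) → Any P xs
    sum-nonzero⇒any P? [] h = ⊥-elim (h ≡.refl)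
    sum-nonzero⇒any P? (x ∷ xs) h with P? x
    ... | yes p = here p
    ... | no _  = there (sum-nonzero⇒any P? xs h)

  covers : ∀ s → Any (_≈ s) list
  covers s = sum-nonzero⇒any (λ x → x ≟ s) list (λ z → 1≢0 (≡.trans (≡.sym (once s)) z))
    where
    1≢0 : ¬ (1 ≡ 0)
    1≢0 ()

  -- A search through the list. Divisibility and irreducibility of polynomials are decided this way.
  exists? : {P : Carrier → Set} → (∀ {x y} → x ≈ y → P x → P y) → (∀ x → Dec (P x)) → Dec (∃ P)
  exists? {P} resp P? with Any.any? P? list
  ... | yes any = yes (Any.satisfied any)
  ... | no ¬any = no (λ (x , px) → ¬any (Any.map (λ y≈x → resp (sym y≈x) px) (covers x)))

-- Polynomials are coefficient sequences ℕ → R, i.e. formal power series; degrees are imposed as side conditions.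
module Series (R : CommutativeRing 0ℓ 0ℓ) where
  open CommutativeRing R
  open RingP ring
  open IntegerMultiples R using (solve; _:+_; _:*_; _:=_)
  open SetoidR setoid

  Series : Set
  Series = ℕ → Carrier

  infix 4 _≋_
  _≋_ : Series → Series → Set
  P ≋ Q = ∀ i → P i ≈ Q i

  infixl 6 _⊕_
  infixl 7 _⊛_
  _⊕_ : Series → Series → Series
  (P ⊕ Q) i = P i + Q i

  neg : Series → Series
  neg P i = - P i

  scale : Carrier → Series → Series
  scale c P i = c * P i

  0s 1s : Series
  0s _ = 0#
  1s zero    = 1#
  1s (suc _) = 0#

  -- The Cauchy product with the left factor peeled off coefficient by coefficient, so that its laws
  -- follow by induction on the index without inner sums.
  _⊛_ : Series → Series → Series
  (P ⊛ Q) zero    = P 0 * Q 0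
  (P ⊛ Q) (suc n) = P 0 * Q (suc n) + ((P ∘ suc) ⊛ Q) n

  ⊛-cong : ∀ {P P′ Q Q′} → P ≋ P′ → Q ≋ Q′ → P ⊛ Q ≋ P′ ⊛ Q′
  ⊛-cong p q zero    = *-cong (p 0) (q 0)
  ⊛-cong p q (suc n) = +-cong (*-cong (p 0) (q (suc n))) (⊛-cong (p ∘ suc) q n)

  ⊛-distribʳ : ∀ Q P P′ → (P ⊕ P′) ⊛ Q ≋ P ⊛ Q ⊕ P′ ⊛ Q
  ⊛-distribʳ Q P P′ zero    = distribʳ _ _ _
  ⊛-distribʳ Q P P′ (suc n) = trans (+-congˡ (⊛-distribʳ Q (P ∘ suc) (P′ ∘ suc) n))
    (solve 5 (λ p p′ q a b → (p :+ p′) :* q :+ (a :+ b) := p :* q :+ a :+ (p′ :* q :+ b)) refl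
       (P 0) (P′ 0) (Q (suc n)) _ _)

  ⊛-zeroˡ : ∀ P → 0s ⊛ P ≋ 0s
  ⊛-zeroˡ P zero    = zeroˡ _
  ⊛-zeroˡ P (suc n) = trans (+-cong (zeroˡ _) (⊛-zeroˡ P n)) (+-identityˡ _)

  ⊛-identityˡ : ∀ P → 1s ⊛ P ≋ P
  ⊛-identityˡ P zero    = *-identityˡ _
  ⊛-identityˡ P (suc n) = trans (+-cong (*-identityˡ _) (⊛-zeroˡ P n)) (+-identityʳ _)

  scale-⊛ : ∀ c P Q → scale c P ⊛ Q ≋ scale c (P ⊛ Q)
  scale-⊛ c P Q zero    = *-assoc _ _ _
  scale-⊛ c P Q (suc n) = trans (+-congˡ (scale-⊛ c (P ∘ suc) Q n))
    (solve 4 (λ c p q a → c :* p :* q :+ c :* a := c :* (p :* q :+ a)) refl c (P 0) (Q (suc n)) _)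

  ⊛-sucʳ : ∀ P Q n → (P ⊛ Q) (suc n) ≈ (P ⊛ (Q ∘ suc)) n + P (suc n) * Q 0
  ⊛-sucʳ P Q zero    = refl
  ⊛-sucʳ P Q (suc n) = trans (+-congˡ (⊛-sucʳ (P ∘ suc) Q n)) (sym (+-assoc _ _ _))

  ⊛-comm : ∀ P Q → P ⊛ Q ≋ Q ⊛ P
  ⊛-comm P Q zero    = *-comm _ _
  ⊛-comm P Q (suc n) = begin
    P 0 * Q (suc n) + ((P ∘ suc) ⊛ Q) n ≈⟨ +-cong (*-comm _ _) (⊛-comm (P ∘ suc) Q n) ⟩
    Q (suc n) * P 0 + (Q ⊛ (P ∘ suc)) n ≈⟨ +-comm _ _ ⟩
    (Q ⊛ (P ∘ suc)) n + Q (suc n) * P 0 ≈⟨ ⊛-sucʳ Q P n ⟨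
    (Q ⊛ P) (suc n)                     ∎

  ⊛-assoc : ∀ P Q S → (P ⊛ Q) ⊛ S ≋ P ⊛ (Q ⊛ S)
  ⊛-assoc P Q S zero    = *-assoc _ _ _
  ⊛-assoc P Q S (suc n) = begin
    P 0 * Q 0 * S (suc n) + (((P ⊛ Q) ∘ suc) ⊛ S) n
      ≈⟨ +-congˡ (⊛-distribʳ S (scale (P 0) (Q ∘ suc)) ((P ∘ suc) ⊛ Q) n) ⟩
    P 0 * Q 0 * S (suc n) + ((scale (P 0) (Q ∘ suc) ⊛ S) n + (((P ∘ suc) ⊛ Q) ⊛ S) n)
      ≈⟨ +-congˡ (+-cong (scale-⊛ (P 0) (Q ∘ suc) S n) (⊛-assoc (P ∘ suc) Q S n)) ⟩
    P 0 * Q 0 * S (suc n) + (P 0 * ((Q ∘ suc) ⊛ S) n + ((P ∘ suc) ⊛ (Q ⊛ S)) n)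
      ≈⟨ solve 5 (λ p q s a b → p :* q :* s :+ (p :* a :+ b) := p :* (q :* s :+ a) :+ b) refl
           (P 0) (Q 0) (S (suc n)) _ _ ⟩
    P 0 * (Q ⊛ S) (suc n) + ((P ∘ suc) ⊛ (Q ⊛ S)) n ∎

  seriesRing : CommutativeRing 0ℓ 0ℓ
  seriesRing = record
    { Carrier = Series ; _≈_ = _≋_ ; _+_ = _⊕_ ; _*_ = _⊛_ ; -_ = neg ; 0# = 0s ; 1# = 1s
    ; isCommutativeRing = record
      { isRing = record
        { +-isAbelianGroup = record
          { isGroup = record
            { isMonoid = record
              { isSemigroup = record
                { isMagma = record
                  { isEquivalence = record
                    { refl = λ i → refl ; sym = λ p i → sym (p i) ; trans = λ p q i → trans (p i) (q i) }
                  ; ∙-cong = λ p q i → +-cong (p i) (q i) }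
                ; assoc = λ P Q S i → +-assoc _ _ _ }
              ; identity = (λ P i → +-identityˡ _) , (λ P i → +-identityʳ _) }
            ; inverse = (λ P i → -‿inverseˡ _) , (λ P i → -‿inverseʳ _)
            ; ⁻¹-cong = λ p i → -‿cong (p i) }
          ; comm = λ P Q i → +-comm _ _ }
        ; *-cong = ⊛-cong
        ; *-assoc = ⊛-assoc
        ; *-identity = ⊛-identityˡ , λ P i → trans (⊛-comm P 1s i) (⊛-identityˡ P i)
        ; distrib = (λ P Q S i → trans (⊛-comm P (Q ⊕ S) i)
                      (trans (⊛-distribʳ P Q S i) (+-cong (⊛-comm Q P i) (⊛-comm S P i))))
                  , ⊛-distribʳ }
      ; *-comm = ⊛-comm } }

module InitialProduct (M : CommutativeMonoid 0ℓ 0ℓ) where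
  open CommutativeMonoid M

  -- One product for three monoids: field multiplication (norms), field addition (traces) and
  -- multiplication of polynomials.
  prod : ℕ → (ℕ → Carrier) → Carrier
  prod zero    f = ε
  prod (suc n) f = f 0 ∙ prod n (f ∘ suc)

  power : Carrier → ℕ → Carrier
  power x n = prod n (λ _ → x)

  prod-cong : ∀ n {f g} → (∀ i → f i ≈ g i) → prod n f ≈ prod n g
  prod-cong zero    h = refl
  prod-cong (suc n) h = ∙-cong (h 0) (prod-cong n (h ∘ suc))

  power-cong : ∀ n {x y} → x ≈ y → power x n ≈ power y n
  power-cong n h = prod-cong n (λ _ → h)

  prod-last : ∀ n f → prod (suc n) f ≈ prod n f ∙ f n
  prod-last zero    f = comm _ _
  prod-last (suc n) f = trans (∙-congˡ (prod-last n (f ∘ suc))) (sym (assoc _ _ _))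

  prod-+ : ∀ m n f → prod (m ℕ.+ n) f ≈ prod m f ∙ prod n (λ i → f (m ℕ.+ i))
  prod-+ zero    n f = sym (identityˡ _)
  prod-+ (suc m) n f = trans (∙-congˡ (prod-+ m n (f ∘ suc))) (sym (assoc _ _ _))

  -- Each period contributes the same factor. This yields Nm_m = (Nm_t)^n and Tr_m = n Tr_t on
  -- F_{p^t}, and makes a characteristic polynomial a power of the minimal polynomial.
  prod-periodic : ∀ j d f → (∀ i → f (d ℕ.+ i) ≈ f i) → prod (j ℕ.* d) f ≈ power (prod d f) j
  prod-periodic zero    d f h = refl
  prod-periodic (suc j) d f h = trans (prod-+ d (j ℕ.* d) f)
    (∙-congˡ (trans (prod-cong (j ℕ.* d) h) (prod-periodic j d f h)))

  -- The term `f n` enters where `f 0` leaves. It is applied to Frobenius, which moves the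
  -- conjugates of an element one place along.
  prod-rotate : ∀ n f → f n ≈ f 0 → prod n (f ∘ suc) ≈ prod n f
  prod-rotate zero    f h = refl
  prod-rotate (suc n) f h = trans (prod-last n (f ∘ suc)) (trans (∙-congˡ h) (comm _ _))

-- Polynomials over a field

module FieldPoly (k : FiniteField) where
  open FiniteField k
  open RingP ring
  open SetoidR setoid
  open Series commRing public
  private
    module S = CommutativeRing seriesRing
    module SP = RingP S.ring
    module SS = SetoidR S.setoid
    module SI = IntegerMultiples seriesRing

  domain : ∀ {x y} → ¬ (x ≈ 0#) → x * y ≈ 0# → y ≈ 0#
  domain {x} {y} x≉0 xy≈0 with inverse x x≉0
  ... | x⁻¹ , xx⁻¹≈1 = begin
    y               ≈⟨ *-identityˡ y ⟨
    1# * y          ≈⟨ *-congʳ (trans (*-comm _ _) xx⁻¹≈1) ⟨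
    x⁻¹ * x * y     ≈⟨ *-assoc _ _ _ ⟩
    x⁻¹ * (x * y)   ≈⟨ *-congˡ xy≈0 ⟩
    x⁻¹ * 0#        ≈⟨ zeroʳ _ ⟩
    0#              ∎

  Bd : ℕ → Series → Set
  Bd N P = ∀ i → N ℕ.≤ i → P i ≈ 0#

  Monic : ℕ → Series → Set
  Monic n P = P n ≈ 1# × Bd (suc n) P

  Bounded : Series → Set
  Bounded P = ∃ λ N → Bd N P

  Bd-≋ : ∀ {N P Q} → P ≋ Q → Bd N P → Bd N Q
  Bd-≋ eq b i N≤i = trans (sym (eq i)) (b i N≤i)

  Bd-≤ : ∀ {M N P} → M ℕ.≤ N → Bd M P → Bd N P
  Bd-≤ M≤N b i N≤i = b i (ℕₚ.≤-trans M≤N N≤i)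

  Bd-⊕ : ∀ {N P Q} → Bd N P → Bd N Q → Bd N (P ⊕ Q)
  Bd-⊕ p q i N≤i = trans (+-cong (p i N≤i) (q i N≤i)) (+-identityˡ _)

  Bd-neg : ∀ {N P} → Bd N P → Bd N (neg P)
  Bd-neg p i N≤i = trans (-‿cong (p i N≤i)) -0#≈0#

  Bd-scale : ∀ {N P} c → Bd N P → Bd N (scale c P)
  Bd-scale c p i N≤i = trans (*-congˡ (p i N≤i)) (zeroʳ _)

  Bd-1s : Bd 1 1s
  Bd-1s (suc i) _ = refl

  abstract
    Bd-⊛ : ∀ m n {P Q} → Bd (suc m) P → Bd (suc n) Q → Bd (suc (m ℕ.+ n)) (P ⊛ Q)
    Bd-⊛ zero n {P} {Q} p q (suc i) (s≤s n≤i) = begin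
      P 0 * Q (suc i) + ((P ∘ suc) ⊛ Q) i  ≈⟨ +-cong (*-congˡ (q (suc i) (s≤s n≤i))) (⊛-cong {P ∘ suc} {0s} (λ j → p (suc j) (s≤s z≤n)) (λ _ → refl) i) ⟩
      P 0 * 0# + (0s ⊛ Q) i                ≈⟨ +-cong (zeroʳ _) (⊛-zeroˡ Q i) ⟩
      0# + 0#                              ≈⟨ +-identityˡ _ ⟩
      0#                                   ∎
    Bd-⊛ (suc m) n {P} {Q} p q (suc i) (s≤s le) = begin
      P 0 * Q (suc i) + ((P ∘ suc) ⊛ Q) i  ≈⟨ +-cong (*-congˡ (q (suc i) (s≤s (ℕₚ.≤-trans (ℕₚ.m≤n+m n (suc m)) le))))
                                                 (Bd-⊛ m n (λ j le′ → p (suc j) (s≤s le′)) q i le) ⟩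
      P 0 * 0# + 0#                        ≈⟨ +-cong (zeroʳ _) refl ⟩
      0# + 0#                              ≈⟨ +-identityˡ _ ⟩
      0#                                   ∎

  abstract
    ⊛-top : ∀ m n {P Q} → Bd (suc m) P → Bd (suc n) Q → (P ⊛ Q) (m ℕ.+ n) ≈ P m * Q n
    ⊛-top zero zero p q = refl
    ⊛-top zero (suc n) {P} {Q} p q = begin
      P 0 * Q (suc n) + ((P ∘ suc) ⊛ Q) n  ≈⟨ +-congˡ (⊛-cong {P ∘ suc} {0s} (λ j → p (suc j) (s≤s z≤n)) (λ _ → refl) n) ⟩
      P 0 * Q (suc n) + (0s ⊛ Q) n         ≈⟨ +-congˡ (⊛-zeroˡ Q n) ⟩
      P 0 * Q (suc n) + 0#                 ≈⟨ +-identityʳ _ ⟩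
      P 0 * Q (suc n)                      ∎
    ⊛-top (suc m) n {P} {Q} p q = begin
      P 0 * Q (suc (m ℕ.+ n)) + ((P ∘ suc) ⊛ Q) (m ℕ.+ n)
        ≈⟨ +-cong (*-congˡ (q _ (s≤s (ℕₚ.m≤n+m n m)))) (⊛-top m n (λ j le → p (suc j) (s≤s le)) q) ⟩
      P 0 * 0# + P (suc m) * Q n  ≈⟨ +-congʳ (zeroʳ _) ⟩
      0# + P (suc m) * Q n        ≈⟨ +-identityˡ _ ⟩
      P (suc m) * Q n             ∎

  abstract
    Bounded-⊕ : ∀ {P Q} → Bounded P → Bounded Q → Bounded (P ⊕ Q)
    Bounded-⊕ (M , p) (N , q) = M ℕ.+ N , Bd-⊕ (Bd-≤ (ℕₚ.m≤m+n M N) p) (Bd-≤ (ℕₚ.m≤n+m N M) q)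

  Bounded-neg : ∀ {P} → Bounded P → Bounded (neg P)
  Bounded-neg (N , p) = N , Bd-neg p

  Bounded-scale : ∀ {P} c → Bounded P → Bounded (scale c P)
  Bounded-scale c (N , p) = N , Bd-scale c p

  abstract
    Bounded-⊛ : ∀ {P Q} → Bounded P → Bounded Q → Bounded (P ⊛ Q)
    Bounded-⊛ (M , p) (N , q) = suc (M ℕ.+ N) , Bd-⊛ M N (Bd-≤ (ℕₚ.n≤1+n M) p) (Bd-≤ (ℕₚ.n≤1+n N) q)

  monic-bounded : ∀ {n P} → Monic n P → Bounded P
  monic-bounded {n} (_ , b) = suc n , b

  abstract
    monic-≋ : ∀ {n P Q} → P ≋ Q → Monic n P → Monic n Q
    monic-≋ {n} eq (l , b) = trans (sym (eq n)) l , Bd-≋ eq b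

  abstract
    monic-1s : Monic 0 1s
    monic-1s = refl , Bd-1s

  monic-zero : ∀ {P} → Monic 0 P → P ≋ 1s
  monic-zero (l , b) zero    = l
  monic-zero (l , b) (suc i) = b (suc i) (s≤s z≤n)

  abstract
    monic-⊛ : ∀ {m n P Q} → Monic m P → Monic n Q → Monic (m ℕ.+ n) (P ⊛ Q)
    monic-⊛ {m} {n} (lp , bp) (lq , bq) =
      trans (⊛-top m n bp bq) (trans (*-cong lp lq) (*-identityˡ 1#)) , Bd-⊛ m n bp bq

  exact-degree : ∀ {m n P} → Monic m P → ¬ (P n ≈ 0#) → Bd (suc n) P → n ≡ m
  exact-degree {m} {n} (l , b) Pn≉0 b′ with ℕₚ.<-cmp n m
  ... | tri< n<m _ _ = ⊥-elim (1≉0 (trans (sym l) (b′ m n<m)))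
  ... | tri≈ _ n≡m _ = n≡m
  ... | tri> _ _ n>m = ⊥-elim (Pn≉0 (b n n>m))

  monic-degree : ∀ {m n P} → Monic m P → Monic n P → n ≡ m
  monic-degree p (l , b) = exact-degree p (λ z → 1≉0 (trans (sym l) z)) b

  leading : ∀ N A → Bd N A → A ≋ 0s ⊎ (∃ λ e → e ℕ.< N × ¬ (A e ≈ 0#) × Bd (suc e) A)
  leading zero    A b = inj₁ (λ i → b i z≤n)
  leading (suc N) A b with A N ≟ 0#
  ... | no AN≉0 = inj₂ (N , ℕₚ.≤-refl , AN≉0 , b)
  ... | yes AN≈0 with leading N A b′
    where
    b′ : Bd N A
    b′ i N≤i with ℕₚ.m≤n⇒m<n∨m≡n N≤i
    ... | inj₁ N<i = b i N<i
    ... | inj₂ ≡.refl = AN≈0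
  ...   | inj₁ z = inj₁ z
  ...   | inj₂ (e , e<N , rest) = inj₂ (e , ℕₚ.m<n⇒m<1+n e<N , rest)

  monic-domain : ∀ {n A D} → Monic n A → Bounded D → A ⊛ D ≋ 0s → D ≋ 0s
  monic-domain {n} {A} {D} (l , b) (N , bD) AD≋0 with leading N D bD
  ... | inj₁ z = z
  ... | inj₂ (e , _ , De≉0 , be) = ⊥-elim (De≉0 (begin
    D e                ≈⟨ *-identityˡ _ ⟨
    1# * D e           ≈⟨ *-congʳ l ⟨
    A n * D e          ≈⟨ ⊛-top n e b be ⟨
    (A ⊛ D) (n ℕ.+ e)  ≈⟨ AD≋0 (n ℕ.+ e) ⟩
    0#                 ∎))

  ⊛-cancelˡ : ∀ {n A G H} → Monic n A → Bounded G → Bounded H → A ⊛ G ≋ A ⊛ H → G ≋ H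
  ⊛-cancelˡ {A = A} {G} {H} mA bG bH eq i =
    x∙y⁻¹≈ε⇒x≈y (G i) (H i) (monic-domain mA (Bounded-⊕ bG (Bounded-neg bH)) difference i)
    where
    difference : A ⊛ (G ⊕ neg H) ≋ 0s
    difference = S.trans (SP.x[y-z]≈xy-xz A G H) (SP.x≈y⇒x∙y⁻¹≈ε eq)

  -- P has leading coefficient 1, so the top coefficient of the product is that of Q; it must
  -- therefore sit in degree t and equal 1.
  quotient-monic : ∀ {n t P F Q} → Monic n P → Monic t F → Bounded Q → P ⊛ Q ≋ F →
                   ∃ λ e → n ℕ.+ e ≡ t × Monic e Q
  quotient-monic {n} {t} {P} {F} {Q} mP mF (N , bQ) eq with leading N Q bQ
  ... | inj₁ Q≋0 = ⊥-elim (1≉0 (begin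
    1#            ≈⟨ proj₁ mF ⟨
    F t           ≈⟨ eq t ⟨
    (P ⊛ Q) t     ≈⟨ ⊛-cong {P} (λ _ → refl) Q≋0 t ⟩
    (P ⊛ 0s) t    ≈⟨ S.zeroʳ P t ⟩
    0#            ∎))
  ... | inj₂ (e , _ , Qe≉0 , be) = e , deg , trans (sym Fn+e) (trans (reflexive (≡.cong F deg)) (proj₁ mF)) , be
    where
    Fn+e : F (n ℕ.+ e) ≈ Q e
    Fn+e = trans (sym (eq _)) (trans (⊛-top n e (proj₂ mP) be) (trans (*-congʳ (proj₁ mP)) (*-identityˡ _)))
    deg : n ℕ.+ e ≡ t
    deg = exact-degree mF (λ z → Qe≉0 (trans (sym Fn+e) z)) (Bd-≋ eq (Bd-⊛ n e (proj₂ mP) be))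

  infix 4 _∣ₚ_
  _∣ₚ_ : Series → Series → Set
  P ∣ₚ A = ∃ λ Q → Bounded Q × P ⊛ Q ≋ A

  ∣ₚ-refl : ∀ {P} → P ∣ₚ P
  ∣ₚ-refl {P} = 1s , (1 , Bd-1s) , S.*-identityʳ P

  ∣ₚ-trans : ∀ {P Q A} → P ∣ₚ Q → Q ∣ₚ A → P ∣ₚ A
  ∣ₚ-trans {P} (U , bU , PU) (V , bV , QV) =
    U ⊛ V , Bounded-⊛ bU bV , S.trans (S.sym (S.*-assoc P U V)) (S.trans (S.*-congʳ {V} PU) QV)

  ∣ₚ-resp : ∀ {P A B} → A ≋ B → P ∣ₚ A → P ∣ₚ B
  ∣ₚ-resp eq (Q , bQ , PQ) = Q , bQ , S.trans PQ eq

  ∣ₚ-⊛ : ∀ {P A} B → Bounded B → P ∣ₚ A → P ∣ₚ A ⊛ B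
  ∣ₚ-⊛ {P} B bB (Q , bQ , PQ) =
    Q ⊛ B , Bounded-⊛ bQ bB , S.trans (S.sym (S.*-assoc P Q B)) (S.*-congʳ {B} PQ)

  ∣ₚ-minus : ∀ {P A B} → P ∣ₚ A → P ∣ₚ B → P ∣ₚ A S.- B
  ∣ₚ-minus {P} (U , bU , PU) (V , bV , PV) =
    U S.- V , Bounded-⊕ bU (Bounded-neg bV) , S.trans (SP.x[y-z]≈xy-xz P U V) (S.+-cong PU (S.-‿cong PV))

  monomial : ℕ → Carrier → Series
  monomial zero    c zero    = c
  monomial zero    c (suc i) = 0#
  monomial (suc e) c zero    = 0#
  monomial (suc e) c (suc i) = monomial e c i

  monomial-top : ∀ e c → monomial e c e ≈ c
  monomial-top zero    c = refl
  monomial-top (suc e) c = monomial-top e c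

  monomial-Bd : ∀ e c → Bd (suc e) (monomial e c)
  monomial-Bd zero    c (suc i) _        = refl
  monomial-Bd (suc e) c (suc i) (s≤s le) = monomial-Bd e c i le

  divMod : ∀ {n B} → Monic n B → ∀ N A → Bd N A →
           ∃ λ Q → ∃ λ R → Bounded Q × Bd n R × A ≋ B ⊛ Q ⊕ R
  divMod {n} {B} mB zero A b = 0s , A , (0 , λ _ _ → refl) , Bd-≤ z≤n b ,
    S.sym (S.trans (S.+-congʳ (S.zeroʳ B)) (S.+-identityˡ A))
  divMod {n} {B} mB (suc N) A b with n ℕ.≤? N
  ... | no n≰N = 0s , A , (0 , λ _ _ → refl) , Bd-≤ (ℕₚ.≰⇒> n≰N) b ,
    S.sym (S.trans (S.+-congʳ (S.zeroʳ B)) (S.+-identityˡ A))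
  ... | yes n≤N with divMod mB N A′ A′-Bd
    where
    e = N ℕ.∸ n
    M = monomial e (A N)
    n+e≡N : n ℕ.+ e ≡ N
    n+e≡N = ℕₚ.m+[n∸m]≡n n≤N
    A′ = A S.- B ⊛ M
    A′-Bd : Bd N A′
    A′-Bd i N≤i with ℕₚ.m≤n⇒m<n∨m≡n N≤i
    ... | inj₁ N<i = Bd-⊕ b (Bd-neg (≡.subst (λ z → Bd (suc z) (B ⊛ M)) n+e≡N
                       (Bd-⊛ n e (proj₂ mB) (monomial-Bd e (A N))))) i N<i
    ... | inj₂ ≡.refl = x≈y⇒x∙y⁻¹≈ε (sym (begin
      (B ⊛ M) N          ≡⟨ ≡.cong (B ⊛ M) n+e≡N ⟨
      (B ⊛ M) (n ℕ.+ e)  ≈⟨ ⊛-top n e (proj₂ mB) (monomial-Bd e (A N)) ⟩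
      B n * M e          ≈⟨ *-cong (proj₁ mB) (monomial-top e (A N)) ⟩
      1# * A N           ≈⟨ *-identityˡ _ ⟩
      A N                ∎))
  ...   | Q , R , bQ , bR , eq = Q ⊕ M , R , Bounded-⊕ bQ (suc e , monomial-Bd e (A N)) , bR , (SS.begin
      A                                 SS.≈⟨ SI.solve 2 (λ a b → a SI.:= a SI.:- b SI.:+ b) S.refl A (B ⊛ M) ⟩
      (A S.- B ⊛ M) ⊕ B ⊛ M             SS.≈⟨ S.+-congʳ eq ⟩
      B ⊛ Q ⊕ R ⊕ B ⊛ M                 SS.≈⟨ SI.solve 4 (λ b q r m → b SI.:* q SI.:+ r SI.:+ b SI.:* m
                                              SI.:= b SI.:* (q SI.:+ m) SI.:+ r) S.refl B Q R M ⟩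
      B ⊛ (Q ⊕ M) ⊕ R                   SS.∎)
    where
    e = N ℕ.∸ n
    M = monomial e (A N)

  record Irreducible (n : ℕ) (P : Series) : Set where
    field
      monic    : Monic n P
      positive : 0 ℕ.< n
      split    : ∀ {d e D E} → Monic d D → Monic e E → D ⊛ E ≋ P → d ≡ 0 ⊎ e ≡ 0

  module _ {n P} (irr : Irreducible n P) where
    open Irreducible irr

    private
      -- {C | P divides A C} is an ideal containing P; its elements of degree below n descend to 1 by division into P.
      descend : ∀ N A C → N ℕ.≤ n → Bounded A → Bd N C → ¬ (C ≋ 0s) → P ∣ₚ A ⊛ C → P ∣ₚ A
      descend N A C N≤n bA bC C≉0 P∣AC with leading N C bC
      ... | inj₁ C≋0 = ⊥-elim (C≉0 C≋0)
      descend (suc N) A C N≤n bA bC C≉0 (U , bU , PU≋AC)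
        | inj₂ (e , s≤s e≤N , Ce≉0 , be) with inverse (C e) Ce≉0
      ... | c⁻¹ , cc⁻¹≈1 with divMod mC′ (suc n) P (proj₂ monic)
        where
        mC′ : Monic e (scale c⁻¹ C)
        mC′ = trans (*-comm _ _) cc⁻¹≈1 , Bd-scale c⁻¹ be
      ...   | Q , R , bQ , bR , P≋ = conclude (leading e R bR)
        where
        C′ = scale c⁻¹ C
        mC′ : Monic e C′
        mC′ = trans (*-comm _ _) cc⁻¹≈1 , Bd-scale c⁻¹ be
        A⊛scale : A ⊛ C′ ≋ scale c⁻¹ (A ⊛ C)
        A⊛scale i = trans (⊛-comm A C′ i) (trans (scale-⊛ c⁻¹ C A i) (*-congˡ (⊛-comm C A i)))
        P∣AC′ : P ∣ₚ A ⊛ C′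
        P∣AC′ = scale c⁻¹ U , Bounded-scale c⁻¹ bU , λ i →
          trans (⊛-comm P (scale c⁻¹ U) i) (trans (scale-⊛ c⁻¹ U P i)
            (trans (*-congˡ (trans (⊛-comm U P i) (PU≋AC i))) (sym (A⊛scale i))))
        AR : A ⊛ P S.- A ⊛ C′ ⊛ Q ≋ A ⊛ R
        AR = S.trans (S.+-congʳ (S.*-congˡ {A} P≋))
          (SI.solve 4 (λ a c q r → a SI.:* (c SI.:* q SI.:+ r) SI.:- a SI.:* c SI.:* q SI.:= a SI.:* r) S.refl A C′ Q R)
        P∣AR : P ∣ₚ A ⊛ R
        P∣AR = ∣ₚ-resp AR (∣ₚ-minus (A , bA , ⊛-comm P A) (∣ₚ-⊛ Q bQ P∣AC′))
        conclude : R ≋ 0s ⊎ (∃ λ r → r ℕ.< e × ¬ (R r ≈ 0#) × Bd (suc r) R) → P ∣ₚ A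
        conclude (inj₂ (r , r<e , Rr≉0 , br)) =
          descend N A R (ℕₚ.≤-trans (ℕₚ.n≤1+n N) N≤n) bA
            (Bd-≤ (ℕₚ.≤-trans r<e e≤N) br) (λ R≋0 → Rr≉0 (R≋0 r)) P∣AR
        -- A zero remainder makes C′ a divisor of P. Either C′ is 1, and P divides A, or C′ has the
        -- full degree n, which e < n excludes.
        conclude (inj₁ R≋0) with quotient-monic mC′ monic bQ C′Q≋P
          where
          C′Q≋P : C′ ⊛ Q ≋ P
          C′Q≋P = S.sym (S.trans P≋ (S.trans (S.+-congˡ R≋0) (S.+-identityʳ _)))
        ... | q , e+q≡n , mQ with split mC′ mQ (S.sym (S.trans P≋ (S.trans (S.+-congˡ R≋0) (S.+-identityʳ _))))
        ...   | inj₁ ≡.refl = ∣ₚ-resp (S.trans (S.*-congˡ {A} (monic-zero mC′)) (S.*-identityʳ A)) P∣AC′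
        ...   | inj₂ ≡.refl = ⊥-elim (ℕₚ.1+n≰n (ℕₚ.≤-trans (s≤s e≤N)
                  (≡.subst (suc N ℕ.≤_) (≡.trans (≡.sym e+q≡n) (ℕₚ.+-identityʳ e)) N≤n)))

    -- Division of B by P leaves either no remainder, and P divides B, or a nonzero remainder of
    -- degree below n, to which the descent applies.
    euclid : ∀ {A B} → Bounded A → Bounded B → P ∣ₚ A ⊛ B → P ∣ₚ A ⊎ P ∣ₚ B
    euclid {A} {B} bA (N , bB) P∣AB with divMod monic N B bB
    ... | Q , R , bQ , bR , B≋ with leading n R bR
    ...   | inj₁ R≋0 = inj₂ (Q , bQ , S.sym (S.trans B≋ (S.trans (S.+-congˡ R≋0) (S.+-identityʳ _))))
    ...   | inj₂ (r , r<n , Rr≉0 , br) =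
            inj₁ (descend n A R ℕₚ.≤-refl bA bR (λ R≋0 → Rr≉0 (R≋0 r)) P∣AR)
      where
      AR : A ⊛ B S.- P ⊛ (A ⊛ Q) ≋ A ⊛ R
      AR = S.trans (S.+-congʳ (S.*-congˡ {A} B≋))
        (SI.solve 4 (λ a p q r → a SI.:* (p SI.:* q SI.:+ r) SI.:- p SI.:* (a SI.:* q) SI.:= a SI.:* r) S.refl A P Q R)
      P∣AR : P ∣ₚ A ⊛ R
      P∣AR = ∣ₚ-resp AR (∣ₚ-minus P∣AB (A ⊛ Q , Bounded-⊛ bA bQ , S.refl))

    ∣-irreducible : ∀ {q Q} → Monic q Q → ¬ (q ≡ 0) → Q ∣ₚ P → Q ≋ P
    ∣-irreducible {q} {Q} mQ q≢0 (E , bE , QE≋P) with quotient-monic mQ monic bE QE≋P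
    ... | e , _ , mE with split mQ mE QE≋P
    ...   | inj₁ q≡0 = ⊥-elim (q≢0 q≡0)
    ...   | inj₂ ≡.refl = S.trans (S.sym (S.*-identityʳ Q)) (S.trans (S.*-congˡ {Q} (S.sym (monic-zero mE))) QE≋P)

  linear : Carrier → Series
  linear y zero          = y
  linear y (suc zero)    = 1#
  linear y (suc (suc i)) = 0#

  abstract
    linear-monic : ∀ y → Monic 1 (linear y)
    linear-monic y = refl , λ { (suc (suc i)) _ → refl ; (suc zero) (s≤s ()) }

  linear-irreducible : ∀ y → Irreducible 1 (linear y)
  linear-irreducible y = record
    { monic = linear-monic y ; positive = s≤s z≤n
    ; split = λ mD mE eq → go (monic-degree (linear-monic y) (monic-≋ eq (monic-⊛ mD mE))) }
    where
    go : ∀ {d e} → d ℕ.+ e ≡ 1 → d ≡ 0 ⊎ e ≡ 0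
    go {zero} _ = inj₁ ≡.refl
    go {suc d} {e} eq = inj₂ (ℕₚ.m+n≡0⇒n≡0 d (ℕₚ.suc-injective eq))

  linear-injective : ∀ {y z} → linear z ∣ₚ linear y → z ≈ y
  linear-injective {y} {z} div = ∣-irreducible (linear-irreducible y) (linear-monic z) (λ ()) div 0

  abstract
    -- Distinct linear factors do not divide each other, so by Euclid's lemma all the others survive
    -- in the cofactor once one is split off.
    root-bound : ∀ {n D} → Monic n D → ∀ ys → UniqueS.Unique setoid ys →
                 All (λ y → linear y ∣ₚ D) ys → length ys ℕ.≤ n
    root-bound mD [] _ _ = z≤n
    root-bound {n} {D} mD (y ∷ ys) (y∉ys ∷ u) ((D′ , bD′ , eq) All.∷ hs)
      with quotient-monic (linear-monic y) mD bD′ eq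
    ... | e , ≡.refl , mD′ = s≤s (root-bound mD′ ys u (All.zipWith cofactor (y∉ys , hs)))
      where
      cofactor : ∀ {z} → ¬ (y ≈ z) × linear z ∣ₚ D → linear z ∣ₚ D′
      cofactor {z} (y≉z , div) with euclid (linear-irreducible z) (monic-bounded (linear-monic y)) bD′ (∣ₚ-resp (S.sym eq) div)
      ... | inj₁ z∣y = ⊥-elim (y≉z (sym (linear-injective z∣y)))
      ... | inj₂ z∣D′ = z∣D′


-- Unique factorization and the logarithmic derivative

module Factorization (k : FiniteField) where
  open FiniteField k
  open FieldPoly k public
  private
    module S = CommutativeRing seriesRing
    module SI = IntegerMultiples seriesRing
    module SS = SetoidR S.setoid
  open InitialProduct S.*-commutativeMonoid public using (power)

  decSetoid : DecSetoid 0ℓ 0ℓ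
  decSetoid = record { Carrier = Carrier ; _≈_ = _≈_
    ; isDecEquivalence = record { isEquivalence = isEquivalence ; _≟_ = _≟_ } }

  fieldEnum : Enumeration decSetoid
  fieldEnum = unique⇒enumeration decSetoid elements complete unique

  abstract
    ≋-dec : ∀ N P Q → Bd N P → Bd N Q → Dec (P ≋ Q)
    ≋-dec zero    P Q p q = yes (λ i → trans (p i z≤n) (sym (q i z≤n)))
    ≋-dec (suc N) P Q p q = map′ (λ { (h , t) zero → h ; (h , t) (suc i) → t i }) (λ h → h 0 , h ∘ suc)
      (P 0 ≟ Q 0 ×-dec ≋-dec N (P ∘ suc) (Q ∘ suc) (λ i le → p (suc i) (s≤s le)) (λ i le → q (suc i) (s≤s le)))

    ≋-dec-monic : ∀ {m n P Q} → Monic m P → Monic n Q → Dec (P ≋ Q)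
    ≋-dec-monic {m} {n} {P} {Q} p q = ≋-dec (suc m ℕ.+ suc n) P Q
      (Bd-≤ (ℕₚ.m≤m+n _ _) (proj₂ p)) (Bd-≤ (ℕₚ.m≤n+m _ (suc m)) (proj₂ q))

  Mono : ℕ → Set
  Mono n = Σ Series (Monic n)

  monoSetoid : ℕ → DecSetoid 0ℓ 0ℓ
  monoSetoid n = record { Carrier = Mono n ; _≈_ = λ P Q → proj₁ P ≋ proj₁ Q
    ; isDecEquivalence = record
      { isEquivalence = record { refl = λ {P} → S.refl {proj₁ P} ; sym = S.sym ; trans = S.trans }
      ; _≟_ = λ P Q → ≋-dec-monic (proj₂ P) (proj₂ Q) } }

  cons : Carrier → Series → Series
  cons c P zero    = c
  cons c P (suc i) = P i

  consᵐ : ∀ {n} → Carrier → Mono n → Mono (suc n)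
  consᵐ c (P , l , b) = cons c P , l , λ { (suc i) (s≤s le) → b i le }

  -- A monic polynomial of degree n + 1 is X P + c. The constant term is the innermost summation
  -- variable, so that a character of it can be summed away with everything else fixed.
  monics : ∀ n → List (Mono n)
  monics zero    = (1s , monic-1s) ∷ []
  monics (suc n) = concatMap (λ P → map (λ c → consᵐ c P) elements) (monics n)

  module MonicSum (R : CommutativeSemiring 0ℓ 0ℓ) where
    open CommutativeSemiring R using () renaming (Carrier to C; _≈_ to _≈ᴿ_; trans to transᴿ)
    open ListSum R

    sum-monics-suc : ∀ n (f : Mono (suc n) → C) →
      sum (monics (suc n)) f ≈ᴿ sum (monics n) (λ P → sum elements (λ c → f (consᵐ c P)))
    sum-monics-suc n f = transᴿ (sum-concatMap _ (monics n) f)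
      (sum-cong (λ P → sum-map (λ c → consᵐ c P) elements f) (monics n))

  monicEnum : ∀ n → Enumeration (monoSetoid n)
  monicEnum n = record { list = monics n ; once = once′ n }
    where
    open ℕSum
    open ≡.≡-Reasoning
    once′ : ∀ n F → sum (monics n) (λ P → ⟦ DecSetoid._≟_ (monoSetoid n) P F ⟧) ≡ 1
    once′ zero F = ≡.trans (ℕₚ.+-identityʳ _)
      (⟦⟧-true (S.sym (monic-zero (proj₂ F))) (DecSetoid._≟_ (monoSetoid 0) (1s , monic-1s) F))
    once′ (suc n) F@(F₀ , l , b) = begin
      sum (monics (suc n)) (λ P → ⟦ DecSetoid._≟_ (monoSetoid (suc n)) P F ⟧)
        ≡⟨ MonicSum.sum-monics-suc ℕₚ.+-*-commutativeSemiring n _ ⟩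
      sum (monics n) (λ P → sum elements (λ c → ⟦ DecSetoid._≟_ (monoSetoid (suc n)) (consᵐ c P) F ⟧))
        ≡⟨ sum-cong (λ P → sum-cong (λ c → ⟦⟧-× (λ h → h 0 , h ∘ suc) (λ h t → λ { zero → h ; (suc i) → t i })
             (DecSetoid._≟_ (monoSetoid (suc n)) (consᵐ c P) F) (c ≟ F₀ 0) (DecSetoid._≟_ (monoSetoid n) P F′)) elements) (monics n) ⟩
      sum (monics n) (λ P → sum elements (λ c → ⟦ c ≟ F₀ 0 ⟧ ℕ.* ⟦ DecSetoid._≟_ (monoSetoid n) P F′ ⟧))
        ≡⟨ sum-cong (λ P → ≡.trans (sum-* elements (λ c → ⟦ c ≟ F₀ 0 ⟧) _)
             (≡.trans (≡.cong (ℕ._* ⟦ DecSetoid._≟_ (monoSetoid n) P F′ ⟧) (Enumeration.once fieldEnum (F₀ 0))) (ℕₚ.*-identityˡ _))) (monics n) ⟩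
      sum (monics n) (λ P → ⟦ DecSetoid._≟_ (monoSetoid n) P F′ ⟧)
        ≡⟨ once′ n F′ ⟩
      1 ∎
      where
      F′ : Mono n
      F′ = F₀ ∘ suc , l , λ i le → b (suc i) (s≤s le)

  abstract
    monic-power : ∀ {d P} j → Monic d P → Monic (j ℕ.* d) (power P j)
    monic-power zero    m = monic-1s
    monic-power (suc j) m = monic-⊛ m (monic-power j m)

  cofactor : ∀ {r t A F} → Monic r A → Monic t F → A ∣ₚ F →
             ∃ λ e → r ℕ.+ e ≡ t × Σ (Mono e) λ G → A ⊛ proj₁ G ≋ F
  cofactor mA mF (G , bG , eq) with quotient-monic mA mF bG eq
  ... | e , r+e≡t , mG = e , r+e≡t , (G , mG) , eq

  abstract
    divides? : ∀ {r t A F} → Monic r A → Monic t F → Dec (A ∣ₚ F)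
    divides? {r} {t} {A} {F} mA mF with r ℕ.≤? t
    ... | no r≰t = no (λ div → r≰t (let _ , eq , _ = cofactor mA mF div in ≡.subst (r ℕ.≤_) eq (ℕₚ.m≤m+n r _)))
    ... | yes r≤t = map′ (λ ((G , mG) , eq) → G , monic-bounded mG , eq) back
            (exists? (monicEnum (t ℕ.∸ r)) {P = λ G → A ⊛ proj₁ G ≋ F}
              (λ eq h → S.trans (S.*-congˡ {A} (S.sym eq)) h) (λ (G , mG) → ≋-dec-monic (monic-⊛ mA mG) mF))
      where
      back : A ∣ₚ F → Σ (Mono (t ℕ.∸ r)) (λ G → A ⊛ proj₁ G ≋ F)
      back div with cofactor mA mF div
      ... | e , ≡.refl , G , eq = ≡.subst (λ z → Σ (Mono z) (λ G → A ⊛ proj₁ G ≋ F)) (≡.sym (ℕₚ.m+n∸m≡n r e)) (G , eq)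

  irreducible-resp : ∀ {n P Q} → P ≋ Q → Irreducible n P → Irreducible n Q
  irreducible-resp eq irr = record { monic = monic-≋ eq monic ; positive = positive
    ; split = λ mD mE h → split mD mE (S.trans h (S.sym eq)) }
    where open Irreducible irr

  ProperDivisor : Series → ℕ → Set
  ProperDivisor P a = ¬ (a ≡ 0) × Σ (Mono a) λ D → proj₁ D ∣ₚ P

  irreducible-or-reducible : ∀ {n P} → 0 ℕ.< n → Monic n P → Irreducible n P ⊎ (∃ λ a → a ℕ.< n × ProperDivisor P a)
  irreducible-or-reducible {n} {P} 0<n mP with ℕₚ.anyUpTo? {P = ProperDivisor P} proper? n
    where
    proper? : ∀ a → Dec (ProperDivisor P a)
    proper? a = ¬? (a ℕ.≟ 0) ×-dec exists? (monicEnum a) {P = λ D → proj₁ D ∣ₚ P}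
      (λ eq (Q , bQ , h) → Q , bQ , S.trans (S.*-congʳ {Q} (S.sym eq)) h) (λ D → divides? (proj₂ D) mP)
  ... | yes red = inj₂ red
  ... | no ¬red = inj₁ (record { monic = mP ; positive = 0<n ; split = split })
    where
    split : ∀ {d e D E} → Monic d D → Monic e E → D ⊛ E ≋ P → d ≡ 0 ⊎ e ≡ 0
    split {zero} _ _ _ = inj₁ ≡.refl
    split {suc d} {zero} _ _ _ = inj₂ ≡.refl
    split {suc d} {suc e} {D} {E} mD mE eq = ⊥-elim (¬red (suc d , lt , (λ ()) , (D , mD) , E , monic-bounded mE , eq))
      where
      lt : suc d ℕ.< n
      lt = ≡.subst (suc d ℕ.<_) (monic-degree mP (monic-≋ eq (monic-⊛ mD mE)))
             (ℕₚ.m<m+n (suc d) (s≤s z≤n))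

  abstract
    irreducible? : ∀ {n} (P : Mono (suc n)) → Dec (Irreducible (suc n) (proj₁ P))
    irreducible? {n} (P , mP) with irreducible-or-reducible (s≤s z≤n) mP
    ... | inj₁ irr = yes irr
    ... | inj₂ (a , a<n , a≢0 , (D , mD) , Q , bQ , eq) = no contradiction′
      where
      contradiction′ : ¬ Irreducible (suc n) P
      contradiction′ irr with quotient-monic mD mP bQ eq
      ... | e , a+e≡n , mQ with Irreducible.split irr mD mQ eq
      ...   | inj₁ a≡0 = a≢0 a≡0
      ...   | inj₂ ≡.refl = ℕₚ.<-irrefl (≡.trans (≡.sym (ℕₚ.+-identityʳ a)) a+e≡n) a<n

  irreducible-divisor : ∀ {t F} → 0 ℕ.< t → Monic t F → ∃ λ n → ∃ λ P → Irreducible n P × P ∣ₚ F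
  irreducible-divisor 0<t mF = go _ (<-wellFounded _) 0<t mF
    where
    go : ∀ t → Acc ℕ._<_ t → ∀ {F} → 0 ℕ.< t → Monic t F → ∃ λ n → ∃ λ P → Irreducible n P × P ∣ₚ F
    go t (acc rec) {F} 0<t mF with irreducible-or-reducible 0<t mF
    ... | inj₁ irr = t , F , irr , ∣ₚ-refl
    ... | inj₂ (a , a<t , a≢0 , (D , mD) , D∣F) with go a (rec a<t) (ℕₚ.n≢0⇒n>0 a≢0) mD
    ...   | n , P , irr , P∣D = n , P , irr , ∣ₚ-trans P∣D D∣F

  -- Euclid's lemma is applied to Q rather than P: in Q F = P^j G the irreducible Q cannot divide P,
  -- so it divides G and cancels.
  power-∣-other : ∀ {p q P Q F} j → Irreducible p P → Irreducible q Q → ¬ (P ≋ Q) → Bounded F →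
                  power P j ∣ₚ Q ⊛ F → power P j ∣ₚ F
  power-∣-other {q = q} {P} {Q} {F} j irrP irrQ P≉Q bF (G , bG , eq) =
    finish (descend j (F , bF , S.sym eq))
    where
    module P = Irreducible irrP
    module Q = Irreducible irrQ
    bPow : ∀ i → Bounded (power P i)
    bPow i = monic-bounded (monic-power i P.monic)
    descend : ∀ i → Q ∣ₚ power P i ⊛ G → Q ∣ₚ G
    descend zero    div = ∣ₚ-resp (S.*-identityˡ G) div
    descend (suc i) div with euclid irrQ (monic-bounded P.monic) (Bounded-⊛ (bPow i) bG)
                               (∣ₚ-resp (S.*-assoc P (power P i) G) div)
    ... | inj₁ Q∣P = ⊥-elim (P≉Q (S.sym (∣-irreducible irrP Q.monic (λ q≡0 → ℕₚ.<-irrefl (≡.sym q≡0) Q.positive) Q∣P)))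
    ... | inj₂ rest = descend i rest
    finish : Q ∣ₚ G → power P j ∣ₚ F
    finish (H , bH , QH≋G) = H , bH , ⊛-cancelˡ Q.monic (Bounded-⊛ (bPow j) bH) bF
      (S.trans (SI.solve 3 (λ a b c → a SI.:* (b SI.:* c) SI.:= b SI.:* (a SI.:* c)) S.refl Q (power P j) H)
        (S.trans (S.*-congˡ {power P j} QH≋G) eq))

  power-suc-∣ : ∀ {n P F} j → Monic n P → Bounded F → power P (suc j) ∣ₚ P ⊛ F → power P j ∣ₚ F
  power-suc-∣ {P = P} {F} j mP bF (G , bG , eq) = G , bG ,
    ⊛-cancelˡ mP (Bounded-⊛ (monic-bounded (monic-power j mP)) bG) bF
      (S.trans (S.sym (S.*-assoc P (power P j) G)) eq)

  power-suc-∣⁻ : ∀ {P F} j → power P j ∣ₚ F → power P (suc j) ∣ₚ P ⊛ F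
  power-suc-∣⁻ {P} j (G , bG , eq) = G , bG , S.trans (S.*-assoc P (power P j) G) (S.*-congˡ {P} eq)

  Irred : ℕ → Set
  Irred d = Σ (Mono (suc d)) λ P → Irreducible (suc d) (proj₁ P)

  irreds : ∀ d → List (Irred d)
  irreds d = ℕSum.select irreducible? (monics d′)
    where d′ = suc d

  irreducible-count : ∀ {q Q} (irrQ : Irreducible (suc q) Q) →
    ℕSum.sum (irreds q) (λ P → ℕSum.⟦ ≋-dec-monic (proj₂ (proj₁ P)) (Irreducible.monic irrQ) ⟧) ≡ 1
  irreducible-count {q} {Q} irrQ = begin
    sum (irreds q) (λ P → ⟦ same (proj₁ P) ⟧)
      ≡⟨ sum-select irreducible? (λ P → ⟦ same P ⟧) (monics (suc q)) ⟩
    sum (monics (suc q)) (λ P → ⟦ irreducible? P ⟧ ℕ.* ⟦ same P ⟧)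
      ≡⟨ sum-cong (λ P → ≡.trans (ℕₚ.*-comm ⟦ irreducible? P ⟧ _)
           (≡.cong (ℕ._* _) (⟦⟧-cong (λ h → h) (λ h → h) (same P) (P M.≟ Q′)))) (monics (suc q)) ⟩
    sum (monics (suc q)) (λ P → ⟦ P M.≟ Q′ ⟧ ℕ.* ⟦ irreducible? P ⟧)
      ≡⟨ EnumSum.delta ℕₚ.+-*-commutativeSemiring (monicEnum (suc q)) (λ P → ⟦ irreducible? P ⟧)
           (λ {P} {P′} eq → ⟦⟧-cong (irreducible-resp eq) (irreducible-resp (S.sym eq)) (irreducible? P) (irreducible? P′)) Q′ ⟩
    ⟦ irreducible? Q′ ⟧       ≡⟨ ⟦⟧-true irrQ (irreducible? Q′) ⟩
    1                         ∎
    where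
    open ℕSum
    open ≡.≡-Reasoning
    module M = DecSetoid (monoSetoid (suc q))
    Q′ : Mono (suc q)
    Q′ = Q , Irreducible.monic irrQ
    same : ∀ (P : Mono (suc q)) → Dec (proj₁ P ≋ Q)
    same P = ≋-dec-monic (proj₂ P) (Irreducible.monic irrQ)

  -- A prime power P ^ (1 + i) with deg P = 1 + d.
  record PrimePower : Set where
    constructor primePower
    field
      {d}  : ℕ
      base : Irred d
      i    : ℕ
    degree : ℕ
    degree = suc d
    size : ℕ
    size = suc i ℕ.* suc d
    value : Series
    value = power (proj₁ (proj₁ base)) (suc i)
    value-monic : Monic size value
    value-monic = monic-power (suc i) (proj₂ (proj₁ base))

  -- A finite stock that represents every prime power of size at most N. Larger ones occur too and
  -- drop out through the conditions on `size` or on divisibility.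
  primePowers : ℕ → List PrimePower
  primePowers N = concatMap (λ d → concatMap (λ P → map (primePower P) (upTo N)) (irreds d)) (upTo N)

  private
    open ℕSum
    open IntervalSum ℕₚ.+-*-commutativeSemiring

    -- The exponent of P in F, as the number of i < N with P^(i+1) dividing F; this is the true
    -- exponent as soon as N is at least the degree of F.
    multiplicity : ∀ {d t F} → ℕ → Irred d → Monic t F → ℕ
    multiplicity N ((P , mP) , _) mF = sum (upTo N) (λ i → ⟦ divides? (monic-power (suc i) mP) mF ⟧)

    -- For P different from Q the same powers of P divide F and F′. For P = Q, P^(i+2) divides F
    -- exactly when P^(i+1) divides F′, so the count shifts by one place and gains the divisor P
    -- itself.
    multiplicity-step : ∀ {d q t Q F F′} N (P : Irred d) (irrQ : Irreducible q Q) →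
      (mF : Monic (q ℕ.+ t) F) (mF′ : Monic t F′) → Q ⊛ F′ ≋ F → q ℕ.+ t ℕ.≤ N →
      multiplicity N P mF ≡ multiplicity N P mF′ ℕ.+ ⟦ ≋-dec-monic (proj₂ (proj₁ P)) (Irreducible.monic irrQ) ⟧
    multiplicity-step {d} {q} {t} {Q} {F} {F′} N ((P , mP) , irrP) irrQ mF mF′ eq le
      with ≋-dec-monic mP (Irreducible.monic irrQ)
    ... | no P≉Q = ≡.trans (sum-cong (λ i → ⟦⟧-cong
            (λ h → power-∣-other (suc i) irrP irrQ P≉Q (monic-bounded mF′) (∣ₚ-resp (S.sym eq) h))
            (λ h → ∣ₚ-resp (S.trans (S.*-comm F′ Q) eq) (∣ₚ-⊛ Q (monic-bounded (Irreducible.monic irrQ)) h))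
            (divides? (monic-power (suc i) mP) mF) (divides? (monic-power (suc i) mP) mF′)) (upTo N))
            (≡.sym (ℕₚ.+-identityʳ _))
    multiplicity-step {d} {q} {t} {Q} {F} {F′} zero ((P , mP) , irrP) irrQ mF mF′ eq le
        | yes P≋Q = ⊥-elim (ℕₚ.<-irrefl ≡.refl (ℕₚ.≤-trans (Irreducible.positive irrQ) (ℕₚ.≤-trans (ℕₚ.m≤m+n q t) le)))
    multiplicity-step {d} {q} {t} {Q} {F} {F′} (suc N) ((P , mP) , irrP) irrQ mF mF′ eq le
        | yes P≋Q = begin
      sum (upTo (suc N)) f                        ≡⟨ sum-upTo-suc N f ⟩
      f 0 ℕ.+ sum (upTo N) (f ∘ suc)              ≡⟨ ≡.cong₂ ℕ._+_ first (sum-cong shift (upTo N)) ⟩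
      1 ℕ.+ sum (upTo N) f′                       ≡⟨ ℕₚ.+-comm 1 _ ⟩
      sum (upTo N) f′ ℕ.+ 1                       ≡⟨ ≡.cong (ℕ._+ 1) (≡.trans (≡.sym (ℕₚ.+-identityʳ _)) (≡.cong (sum (upTo N) f′ ℕ.+_) (≡.sym last))) ⟩
      (sum (upTo N) f′ ℕ.+ f′ N) ℕ.+ 1            ≡⟨ ≡.cong (ℕ._+ 1) (≡.sym (sum-upTo-last N f′)) ⟩
      sum (upTo (suc N)) f′ ℕ.+ 1                 ∎
      where
      open ≡.≡-Reasoning
      f f′ : ℕ → ℕ
      f i = ⟦ divides? (monic-power (suc i) mP) mF ⟧
      f′ i = ⟦ divides? (monic-power (suc i) mP) mF′ ⟧
      PF′≋F : P ⊛ F′ ≋ F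
      PF′≋F = S.trans (S.*-congʳ {F′} P≋Q) eq
      first : f 0 ≡ 1
      first = ⟦⟧-true (∣ₚ-resp PF′≋F (power-suc-∣⁻ 0 (F′ , monic-bounded mF′ , S.*-identityˡ F′))) (divides? (monic-power 1 mP) mF)
      shift : ∀ i → f (suc i) ≡ f′ i
      shift i = ⟦⟧-cong (λ h → power-suc-∣ (suc i) mP (monic-bounded mF′) (∣ₚ-resp (S.sym PF′≋F) h))
                        (λ h → ∣ₚ-resp PF′≋F (power-suc-∣⁻ (suc i) h))
                        (divides? (monic-power (suc (suc i)) mP) mF) (divides? (monic-power (suc i) mP) mF′)
      -- Both counts use the same range, so the shift must lose nothing at the top: P^(N+1) has
      -- degree above t, because q + t ≤ N + 1 and q > 0.
      last : f′ N ≡ 0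
      last = ⟦⟧-false tooLarge (divides? (monic-power (suc N) mP) mF′)
        where
        tooLarge : ¬ (power P (suc N) ∣ₚ F′)
        tooLarge div with cofactor (monic-power (suc N) mP) mF′ div
        ... | e , size≡t , _ = ℕₚ.<-irrefl ≡.refl (ℕₚ.<-≤-trans
            (ℕₚ.<-≤-trans (ℕₚ.m<n+m t (Irreducible.positive irrQ)) le)
            (ℕₚ.≤-trans (ℕₚ.m≤m*n (suc N) (suc d)) (ℕₚ.≤-trans (ℕₚ.m≤m+n _ e) (ℕₚ.≤-reflexive size≡t))))

    total : ∀ {t F} → ℕ → Monic t F → ℕ
    total N mF = sum (upTo N) (λ d → sum (irreds d) (λ P → suc d ℕ.* multiplicity N P mF))

    same-count : ∀ {q Q} N (irrQ : Irreducible q Q) → q ℕ.≤ N →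
      sum (upTo N) (λ d → sum (irreds d) (λ P → suc d ℕ.* ⟦ ≋-dec-monic (proj₂ (proj₁ P)) (Irreducible.monic irrQ) ⟧)) ≡ q
    same-count {zero} N irrQ q≤N = ⊥-elim (ℕₚ.n≮0 (Irreducible.positive irrQ))
    same-count {suc q} {Q} N irrQ q≤N = begin
      sum (upTo N) g                      ≡⟨ sum-upTo-single N g q q≤N other ⟩
      g q                                 ≡⟨ *-sum (suc q) (irreds q) _ ⟩
      suc q ℕ.* sum (irreds q) (λ P → ⟦ same (proj₁ P) ⟧) ≡⟨ ≡.cong (suc q ℕ.*_) (irreducible-count irrQ) ⟩
      suc q ℕ.* 1                         ≡⟨ ℕₚ.*-identityʳ (suc q) ⟩
      suc q                               ∎
      where
      open ≡.≡-Reasoning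
      same : ∀ {d} (P : Mono (suc d)) → Dec (proj₁ P ≋ Q)
      same P = ≋-dec-monic (proj₂ P) (Irreducible.monic irrQ)
      g : ℕ → ℕ
      g d = sum (irreds d) (λ P → suc d ℕ.* ⟦ same (proj₁ P) ⟧)
      other : ∀ d → ¬ (d ≡ q) → g d ≡ 0
      other d d≢q = sum-zero (λ P → ≡.trans (≡.cong (suc d ℕ.*_) (⟦⟧-false
        (λ eq → d≢q (ℕₚ.suc-injective (monic-degree (Irreducible.monic irrQ) (monic-≋ eq (proj₂ (proj₁ P)))))) (same (proj₁ P))))
        (ℕₚ.*-zeroʳ (suc d))) (irreds d)

    total-step : ∀ {q t Q F F′} N (irrQ : Irreducible q Q) (mF : Monic (q ℕ.+ t) F) (mF′ : Monic t F′) →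
                 Q ⊛ F′ ≋ F → q ℕ.+ t ℕ.≤ N → total N mF ≡ total N mF′ ℕ.+ q
    total-step {q} {t} N irrQ mF mF′ eq le = begin
      total N mF
        ≡⟨ sum-cong (λ d → sum-cong (λ P → ≡.trans (≡.cong (suc d ℕ.*_) (multiplicity-step N P irrQ mF mF′ eq le))
             (ℕₚ.*-distribˡ-+ (suc d) (multiplicity N P mF′) _)) (irreds d)) (upTo N) ⟩
      sum (upTo N) (λ d → sum (irreds d) (λ P → suc d ℕ.* multiplicity N P mF′ ℕ.+ suc d ℕ.* ⟦ same P ⟧))
        ≡⟨ sum-cong (λ d → sum-+ (irreds d) _ _) (upTo N) ⟩
      sum (upTo N) (λ d → sum (irreds d) (λ P → suc d ℕ.* multiplicity N P mF′) ℕ.+ sum (irreds d) (λ P → suc d ℕ.* ⟦ same P ⟧))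
        ≡⟨ sum-+ (upTo N) _ _ ⟩
      total N mF′ ℕ.+ sum (upTo N) (λ d → sum (irreds d) (λ P → suc d ℕ.* ⟦ same P ⟧))
        ≡⟨ ≡.cong (total N mF′ ℕ.+_) (same-count N irrQ (ℕₚ.≤-trans (ℕₚ.m≤m+n q t) le)) ⟩
      total N mF′ ℕ.+ q ∎
      where
      open ≡.≡-Reasoning
      same : ∀ {d} (P : Irred d) → Dec (proj₁ (proj₁ P) ≋ _)
      same P = ≋-dec-monic (proj₂ (proj₁ P)) (Irreducible.monic irrQ)

    -- Splitting off one irreducible divisor of degree q lowers both sides by q.
    total-degree : ∀ N t → Acc ℕ._<_ t → ∀ {F} (mF : Monic t F) → t ℕ.≤ N → total N mF ≡ t
    total-degree N zero _ {F} mF _ = sum-zero (λ d → sum-zero (λ P → ≡.trans (≡.cong (suc d ℕ.*_)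
      (sum-zero (λ i → ⟦⟧-false (none P i) (divides? (monic-power (suc i) (proj₂ (proj₁ P))) mF)) (upTo N))) (ℕₚ.*-zeroʳ (suc d))) (irreds d)) (upTo N)
      where
      none : ∀ {d} (P : Irred d) i → ¬ (power (proj₁ (proj₁ P)) (suc i) ∣ₚ F)
      none P i div with cofactor (monic-power (suc i) (proj₂ (proj₁ P))) mF div
      ... | _ , () , _
    total-degree N t@(suc _) (acc rec) {F} mF t≤N with irreducible-divisor (s≤s z≤n) mF
    ... | q , Q , irrQ , Q∣F with cofactor (Irreducible.monic irrQ) mF Q∣F
    ...   | e , q+e≡t , (F′ , mF′) , eq = go q+e≡t mF t≤N
      where
      go : ∀ {t} → q ℕ.+ e ≡ t → (mF : Monic t F) → t ℕ.≤ N → total N mF ≡ t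
      go ≡.refl mF t≤N = ≡.trans (total-step N irrQ mF mF′ eq t≤N)
        (≡.trans (≡.cong (ℕ._+ q) (total-degree N e (rec (≡.subst (e ℕ.<_) q+e≡t (ℕₚ.m<n+m e (Irreducible.positive irrQ))))
           mF′ (ℕₚ.≤-trans (ℕₚ.m≤n+m e q) t≤N))) (ℕₚ.+-comm e q))

  module _ (R : CommutativeSemiring 0ℓ 0ℓ) where
    open CommutativeSemiring R using () renaming (Carrier to C; _≈_ to _≈ᴿ_; trans to transᴿ)
    private module L = ListSum R
    sum-primePowers : ∀ N (f : PrimePower → C) →
      L.sum (primePowers N) f ≈ᴿ
      L.sum (upTo N) (λ d → L.sum (irreds d) (λ P → L.sum (upTo N) (λ i → f (primePower P i))))
    sum-primePowers N f = transᴿ (L.sum-concatMap _ (upTo N) f)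
      (L.sum-cong (λ d → transᴿ (L.sum-concatMap _ (irreds d) f)
        (L.sum-cong (λ P → L.sum-map (primePower P) (upTo N) f) (irreds d))) (upTo N))

  open PrimePower using (degree; size; value; value-monic)

  -- Unique factorization in numerical form: the weights Λ(H) of the prime powers dividing F add up
  -- to deg F, the analogue of Σ Λ(d) = log n over the divisors d of n.
  degree-count : ∀ {N t F} → t ℕ.≤ N → (mF : Monic t F) →
    sum (primePowers N) (λ H → degree H ℕ.* ⟦ divides? (value-monic H) mF ⟧) ≡ t
  degree-count {N} {t} t≤N mF = ≡.trans (sum-primePowers ℕₚ.+-*-commutativeSemiring N _)
    (≡.trans (sum-cong (λ d → sum-cong (λ P → *-sum (suc d) (upTo N) _) (irreds d)) (upTo N))
      (total-degree N t (<-wellFounded t) mF t≤N))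

  -- The coefficient identity behind T L′(T) = L(T) · Σ Λ(H) T^deg H for L(T) = Σ φ(F) T^deg F.
  module Newton (R : CommutativeSemiring 0ℓ 0ℓ) where
    open CommutativeSemiring R using () renaming
      (Carrier to C; _≈_ to _≈ᴿ_; _*_ to _*ᴿ_; 1# to 1ᴿ; setoid to setoidᴿ; semiring to semiringᴿ;
       *-assoc to *ᴿ-assoc; *-comm to *ᴿ-comm; *-congˡ to *ᴿ-congˡ; *-congʳ to *ᴿ-congʳ; zeroˡ to zeroˡᴿ;
       reflexive to reflexiveᴿ; sym to symᴿ; trans to transᴿ; refl to reflᴿ; *-identityˡ to *ᴿ-identityˡ)
    private module L = ListSum R
    open MultP semiringᴿ using () renaming (_×_ to _×ᴿ_; ×1-homo-* to ×ᴿ-homo-*)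
    open SetoidR setoidᴿ

    multiples-sum : ∀ {t r A} → (mA : Monic r A) → (φ : Series → C) → (∀ {P Q} → P ≋ Q → φ P ≈ᴿ φ Q) →
      L.sum (monics t) (λ F → L.⟦ divides? mA (proj₂ F) ⟧ *ᴿ φ (proj₁ F)) ≈ᴿ
      L.⟦ r ℕ.≤? t ⟧ *ᴿ L.sum (monics (t ℕ.∸ r)) (λ G → φ (A ⊛ proj₁ G))
    multiples-sum {t} {r} {A} mA φ φ-cong = by-size (r ℕ.≤? t)
      where
      by-size : (le? : Dec (r ℕ.≤ t)) →
        L.sum (monics t) (λ F → L.⟦ divides? mA (proj₂ F) ⟧ *ᴿ φ (proj₁ F)) ≈ᴿ
        L.⟦ le? ⟧ *ᴿ L.sum (monics (t ℕ.∸ r)) (λ G → φ (A ⊛ proj₁ G))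
      by-size (no r≰t) = transᴿ (L.sum-zero (λ F → transᴿ (*ᴿ-congʳ (L.⟦⟧-false (none F) (divides? mA (proj₂ F)))) (zeroˡᴿ _)) (monics t)) (symᴿ (zeroˡᴿ _))
        where
        none : ∀ F → ¬ (A ∣ₚ proj₁ F)
        none F div with cofactor mA (proj₂ F) div
        ... | e , eq , _ = r≰t (≡.subst (r ℕ.≤_) eq (ℕₚ.m≤m+n r e))
      by-size (yes r≤t) = transᴿ
        (EnumSum.sum-image R (monicEnum (t ℕ.∸ r)) (monicEnum t) mult
          (λ {G} {G′} eq → ⊛-cancelˡ mA (monic-bounded (proj₂ G)) (monic-bounded (proj₂ G′)) eq)
          (λ eq → S.*-congˡ {A} eq)
          {Image = λ F → A ∣ₚ proj₁ F} (λ F → divides? mA (proj₂ F)) (λ {F} → preimage {F})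
          (λ G eq → proj₁ G , monic-bounded (proj₂ G) , eq)
          (φ ∘ proj₁) φ-cong)
        (symᴿ (*ᴿ-identityˡ _))
        where
        mult : Mono (t ℕ.∸ r) → Mono t
        mult (G , mG) = A ⊛ G , ≡.subst (λ z → Monic z (A ⊛ G)) (ℕₚ.m+[n∸m]≡n r≤t) (monic-⊛ mA mG)
        preimage : ∀ {F : Mono t} → A ∣ₚ proj₁ F → Σ (Mono (t ℕ.∸ r)) λ G → A ⊛ proj₁ G ≋ proj₁ F
        preimage {F , mF} div with cofactor mA mF div
        ... | e , ≡.refl , G , eq = ≡.subst (λ z → Σ (Mono z) λ G → A ⊛ proj₁ G ≋ F) (≡.sym (ℕₚ.m+n∸m≡n r e)) (G , eq)

    -- The factor t is the degree of each F and is expanded as the weighted count of prime powers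
    -- dividing F; after exchanging the sums, each H contributes its multiples of degree t.
    newton : ∀ {N t} → t ℕ.≤ N → (φ : Series → C) → (∀ {P Q} → P ≋ Q → φ P ≈ᴿ φ Q) →
      (t ×ᴿ 1ᴿ) *ᴿ L.sum (monics t) (φ ∘ proj₁) ≈ᴿ
      L.sum (primePowers N) (λ H → (degree H ×ᴿ 1ᴿ) *ᴿ
        (L.⟦ size H ℕ.≤? t ⟧ *ᴿ L.sum (monics (t ℕ.∸ size H)) (λ G → φ (value H ⊛ proj₁ G))))
    newton {N} {t} t≤N φ φ-cong = begin
      (t ×ᴿ 1ᴿ) *ᴿ L.sum (monics t) (φ ∘ proj₁)
        ≈⟨ L.*-sum _ (monics t) _ ⟨
      L.sum (monics t) (λ F → (t ×ᴿ 1ᴿ) *ᴿ φ (proj₁ F))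
        ≈⟨ L.sum-cong (λ F → *ᴿ-congʳ (expand F)) (monics t) ⟩
      L.sum (monics t) (λ F → L.sum (primePowers N) (λ H → (degree H ×ᴿ 1ᴿ) *ᴿ L.⟦ divides? (value-monic H) (proj₂ F) ⟧) *ᴿ φ (proj₁ F))
        ≈⟨ L.sum-cong (λ F → L.sum-* (primePowers N) _ _) (monics t) ⟨
      L.sum (monics t) (λ F → L.sum (primePowers N) (λ H → (degree H ×ᴿ 1ᴿ) *ᴿ L.⟦ divides? (value-monic H) (proj₂ F) ⟧ *ᴿ φ (proj₁ F)))
        ≈⟨ L.sum-swap (monics t) (primePowers N) _ ⟩
      L.sum (primePowers N) (λ H → L.sum (monics t) (λ F → (degree H ×ᴿ 1ᴿ) *ᴿ L.⟦ divides? (value-monic H) (proj₂ F) ⟧ *ᴿ φ (proj₁ F)))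
        ≈⟨ L.sum-cong (λ H → transᴿ (L.sum-cong (λ F → *ᴿ-assoc _ _ _) (monics t)) (transᴿ (L.*-sum _ (monics t) _)
             (*ᴿ-congˡ (multiples-sum {t} (value-monic H) φ φ-cong)))) (primePowers N) ⟩
      L.sum (primePowers N) (λ H → (degree H ×ᴿ 1ᴿ) *ᴿ
        (L.⟦ size H ℕ.≤? t ⟧ *ᴿ L.sum (monics (t ℕ.∸ size H)) (λ G → φ (value H ⊛ proj₁ G)))) ∎
      where
      expand : ∀ F → t ×ᴿ 1ᴿ ≈ᴿ L.sum (primePowers N) (λ H → (degree H ×ᴿ 1ᴿ) *ᴿ L.⟦ divides? (value-monic H) (proj₂ F) ⟧)
      expand (F , mF) = begin
        t ×ᴿ 1ᴿ
          ≡⟨ ≡.cong (_×ᴿ 1ᴿ) (≡.sym (degree-count {N} t≤N mF)) ⟩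
        sum (primePowers N) (λ H → degree H ℕ.* ⟦ divides? (value-monic H) mF ⟧) ×ᴿ 1ᴿ
          ≈⟨ sum-fromℕ R _ (primePowers N) ⟩
        L.sum (primePowers N) (λ H → (degree H ℕ.* ⟦ divides? (value-monic H) mF ⟧) ×ᴿ 1ᴿ)
          ≈⟨ L.sum-cong (λ H → transᴿ (×ᴿ-homo-* (degree H) ⟦ divides? (value-monic H) mF ⟧)
               (*ᴿ-congˡ (⟦⟧-fromℕ R (divides? (value-monic H) mF)))) (primePowers N) ⟩
        L.sum (primePowers N) (λ H → (degree H ×ᴿ 1ᴿ) *ᴿ L.⟦ divides? (value-monic H) mF ⟧) ∎

-- Sums over the prime powers of a given degree

module PrimePowerSums (k : FiniteField) where
  open FiniteField k
  open RingP ring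
  open Factorization k
  open PrimePower using (degree; size; value; value-monic)
  private
    module S = CommutativeRing seriesRing
    module I = IntegerMultiples commRing

  -- The next-to-leading coefficient (junk value 0 in degree 0).
  sub : ℕ → Series → Carrier
  sub zero    P = 0#
  sub (suc n) P = P n

  sub-cong : ∀ n {P Q} → P ≋ Q → sub n P ≈ sub n Q
  sub-cong zero    eq = refl
  sub-cong (suc n) eq = eq n

  -- The next-to-leading coefficient is, up to sign, the sum of the roots, hence additive. The value
  -- 0 in degree 0 makes this hold for the factor 1 as well.
  sub-⊛ : ∀ m n {P Q} → Monic m P → Monic n Q → sub (m ℕ.+ n) (P ⊛ Q) ≈ sub m P + sub n Q
  sub-⊛ zero n {P} {Q} mP mQ = trans (sub-cong n (S.trans (S.*-congʳ {Q} (monic-zero mP)) (S.*-identityˡ Q))) (sym (+-identityˡ _))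
  sub-⊛ (suc m) zero {P} {Q} mP mQ = trans (S.trans (S.*-congˡ {P} (monic-zero mQ)) (S.*-identityʳ P) (m ℕ.+ 0))
    (trans (reflexive (≡.cong P (ℕₚ.+-identityʳ m))) (sym (+-identityʳ _)))
  sub-⊛ (suc m) (suc n) mP mQ = go m mP mQ
    where
    go : ∀ m {P Q n} → Monic (suc m) P → Monic (suc n) Q → (P ⊛ Q) (m ℕ.+ suc n) ≈ P m + Q n
    go zero {P} {Q} {n} (l , b) (l′ , b′) = +-cong (trans (*-congˡ l′) (*-identityʳ _))
      (trans (S.*-congʳ {Q} (monic-zero (l , λ i le → b (suc i) (s≤s le))) n) (⊛-identityˡ Q n))
    go (suc m) {P} {Q} {n} (l , b) (l′ , b′) = trans
      (+-cong (trans (*-congˡ (b′ _ (s≤s (ℕₚ.m≤n+m (suc n) m)))) (zeroʳ _))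
              (go m {n = n} (l , λ i le → b (suc i) (s≤s le)) (l′ , b′)))
      (+-identityˡ _)

  solve-shift : ∀ {a b c} → a + b ≈ c → b ≈ c - a
  solve-shift {a} {b} {c} eq = trans (I.solve 2 (λ a b → b I.:= a I.:+ b I.:- a) refl a b) (+-congʳ eq)

  solve-shift⁻ : ∀ {a b c} → b ≈ c - a → a + b ≈ c
  solve-shift⁻ {a} {b} {c} eq = trans (+-congˡ eq) (I.solve 2 (λ a c → a I.:+ (c I.:- a) I.:= c) refl a c)

  q : ℕ
  q = length elements

  module SplitSize (R : CommutativeSemiring 0ℓ 0ℓ) where
    private module R = CommutativeSemiring R
    open ListSum R

    -- Separates the prime powers of full size t + 1, whose sum is the unknown, from the smaller
    -- ones, whose cofactors still have positive degree and can be summed out.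
    split-size : ∀ r t {X Y Z} → (r ℕ.≤ t → X R.≈ Y) → (r ≡ suc t → X R.≈ Z) →
                 ⟦ r ℕ.≤? suc t ⟧ R.* X R.≈ ⟦ r ℕ.≤? t ⟧ R.* Y R.+ ⟦ r ℕ.≟ suc t ⟧ R.* Z
    split-size r t {X} {Y} {Z} XY XZ = go (r ℕ.≤? suc t) (r ℕ.≤? t) (r ℕ.≟ suc t)
      where
      one : ∀ {X Y} → X R.≈ Y → R.1# R.* X R.≈ R.1# R.* Y R.+ R.0# R.* Z
      one eq = R.trans (R.*-congˡ eq) (R.sym (R.trans (R.+-congˡ (R.zeroˡ Z)) (R.+-identityʳ _)))
      go : (a : Dec (r ℕ.≤ suc t)) (b : Dec (r ℕ.≤ t)) (c : Dec (r ≡ suc t)) →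
           ⟦ a ⟧ R.* X R.≈ ⟦ b ⟧ R.* Y R.+ ⟦ c ⟧ R.* Z
      go (yes _) (yes r≤t) (no _) = one (XY r≤t)
      go (yes _) (yes r≤t) (yes ≡.refl) = ⊥-elim (ℕₚ.1+n≰n r≤t)
      go (yes _) (no _) (yes eq) = R.trans (R.*-congˡ (XZ eq)) (R.sym (R.trans (R.+-congʳ (R.zeroˡ Y)) (R.+-identityˡ _)))
      go (yes r≤) (no r≰t) (no r≢) = ⊥-elim (r≢ (ℕₚ.≤-antisym r≤ (ℕₚ.≰⇒> r≰t)))
      go (no r≰) (yes r≤t) _ = ⊥-elim (r≰ (ℕₚ.m≤n⇒m≤1+n r≤t))
      go (no r≰) (no _) (yes ≡.refl) = ⊥-elim (r≰ ℕₚ.≤-refl)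
      go (no _) (no _) (no _) = R.trans (R.zeroˡ X) (R.sym (R.trans (R.+-cong (R.zeroˡ Y) (R.zeroˡ Z)) (R.+-identityˡ _)))

  private
    ℕ-semiring = ℕₚ.+-*-commutativeSemiring
    open ℕSum
    open MonicSum ℕ-semiring
    open Newton ℕ-semiring
    open SplitSize ℕ-semiring
    open MultP (CommutativeSemiring.semiring ℕ-semiring) using () renaming (_×_ to _×′_)

    ×′1 : ∀ n → n ×′ 1 ≡ n
    ×′1 zero    = ≡.refl
    ×′1 (suc n) = ≡.cong suc (×′1 n)

    sum-const-ℕ : ∀ {A : Set} c (xs : List A) → sum xs (λ _ → c) ≡ length xs ℕ.* c
    sum-const-ℕ c []       = ≡.refl
    sum-const-ℕ c (x ∷ xs) = ≡.cong (c ℕ.+_) (sum-const-ℕ c xs)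

    newton-ℕ : ∀ {N t} → t ℕ.≤ N → (φ : Series → ℕ) → (∀ {P Q} → P ≋ Q → φ P ≡ φ Q) →
      t ℕ.* sum (monics t) (φ ∘ proj₁) ≡
      sum (primePowers N) (λ H → degree H ℕ.* (⟦ size H ℕ.≤? t ⟧ ℕ.* sum (monics (t ℕ.∸ size H)) (λ G → φ (value H ⊛ proj₁ G))))
    newton-ℕ {N} {t} t≤N φ φ-cong = ≡.trans (≡.cong (ℕ._* sum (monics t) (φ ∘ proj₁)) (≡.sym (×′1 t)))
      (≡.trans (newton t≤N φ φ-cong) (sum-cong (λ H → ≡.cong (ℕ._* (⟦ size H ℕ.≤? t ⟧ ℕ.* sum (monics (t ℕ.∸ size H)) (λ G → φ (value H ⊛ proj₁ G)))) (×′1 (degree H))) (primePowers N)))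

    newton-split : ∀ {N t} → suc t ℕ.≤ N → (φ : Series → ℕ) → (∀ {P Q} → P ≋ Q → φ P ≡ φ Q) →
      (Y Z : PrimePower → ℕ) →
      (∀ H → size H ℕ.≤ t → sum (monics (suc t ℕ.∸ size H)) (λ G → φ (value H ⊛ proj₁ G)) ≡ Y H) →
      (∀ H → size H ≡ suc t → φ (value H) ≡ Z H) →
      suc t ℕ.* sum (monics (suc t)) (φ ∘ proj₁) ≡
      sum (primePowers N) (λ H → degree H ℕ.* (⟦ size H ℕ.≤? t ⟧ ℕ.* Y H)) ℕ.+
      sum (primePowers N) (λ H → degree H ℕ.* (⟦ size H ℕ.≟ suc t ⟧ ℕ.* Z H))
    newton-split {N} {t} t≤N φ φ-cong Y Z hY hZ = ≡.trans (newton-ℕ t≤N φ φ-cong)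
      (≡.trans (sum-cong (λ H → ≡.trans
         (≡.cong (degree H ℕ.*_) (split-size (size H) t {Y = Y H} {Z H} (hY H) (λ eq → ≡.trans (last H eq) (hZ H eq))))
         (ℕₚ.*-distribˡ-+ (degree H) (⟦ size H ℕ.≤? t ⟧ ℕ.* Y H) _)) (primePowers N))
       (sum-+ (primePowers N) _ _))
      where
      last : ∀ H → size H ≡ suc t → sum (monics (suc t ℕ.∸ size H)) (λ G → φ (value H ⊛ proj₁ G)) ≡ φ (value H)
      last H eq = ≡.trans (≡.cong (λ n → sum (monics n) (λ G → φ (value H ⊛ proj₁ G))) (≡.trans (≡.cong (suc t ℕ.∸_) eq) (ℕₚ.n∸n≡0 t)))
        (≡.trans (ℕₚ.+-identityʳ _) (φ-cong (S.*-identityʳ (value H))))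

    suc-∸ : ∀ {r t} → r ℕ.≤ t → suc t ℕ.∸ r ≡ suc (t ℕ.∸ r)
    suc-∸ = ℕₚ.+-∸-assoc 1

    monics-count : ∀ n → sum (monics n) (λ _ → 1) ≡ q ℕ.^ n
    monics-count zero = ≡.refl
    monics-count (suc n) = ≡.trans (sum-monics-suc n (λ _ → 1))
      (≡.trans (sum-cong (λ P → ≡.trans (sum-const-ℕ 1 elements) (ℕₚ.*-comm q 1)) (monics n))
      (≡.trans (*-sum 1 (monics n) _) (≡.trans (ℕₚ.*-identityˡ _) (≡.trans (sum-cong (λ _ → ≡.sym (ℕₚ.*-identityʳ q)) (monics n))
      (≡.trans (*-sum q (monics n) (λ _ → 1)) (≡.cong (q ℕ.*_) (monics-count n)))))))

    weighted : ∀ {N t} → t ℕ.≤ N →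
      sum (primePowers N) (λ H → degree H ℕ.* (⟦ size H ℕ.≤? t ⟧ ℕ.* q ℕ.^ (t ℕ.∸ size H))) ≡ t ℕ.* q ℕ.^ t
    weighted {N} {t} t≤N = ≡.trans
      (sum-cong (λ H → ≡.cong (λ z → degree H ℕ.* (⟦ size H ℕ.≤? t ⟧ ℕ.* z)) (≡.sym (monics-count (t ℕ.∸ size H)))) (primePowers N))
      (≡.trans (≡.sym (newton-ℕ t≤N (λ _ → 1) (λ _ → ≡.refl))) (≡.cong (t ℕ.*_) (monics-count t)))

  -- The exact prime polynomial theorem. Newton's identity for the constant function 1 in degree t +
  -- 1, minus q times the one in degree t, leaves only the prime powers of size t + 1.
  degree-sum : ∀ {N t} → suc t ℕ.≤ N → sum (primePowers N) (λ H → degree H ℕ.* ⟦ size H ℕ.≟ suc t ⟧) ≡ q ℕ.^ suc t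
  degree-sum {N} {t} t<N = ℕₚ.+-cancelˡ-≡ (q ℕ.* (t ℕ.* q ℕ.^ t)) _ _ (begin
    q ℕ.* (t ℕ.* q ℕ.^ t) ℕ.+ sum (primePowers N) (λ H → degree H ℕ.* ⟦ size H ℕ.≟ suc t ⟧)
      ≡⟨ ≡.cong₂ ℕ._+_ (≡.trans (≡.cong (q ℕ.*_) (≡.sym (weighted (ℕₚ.<⇒≤ t<N)))) (≡.trans (≡.sym (*-sum q (primePowers N) _))
            (sum-cong (λ H → solve 4 (λ q d i x → q :* (d :* (i :* x)) := d :* (i :* (q :* x))) ≡.refl q (degree H) ⟦ size H ℕ.≤? t ⟧ (q ℕ.^ (t ℕ.∸ size H))) (primePowers N))))
          (sum-cong (λ H → ≡.cong (degree H ℕ.*_) (≡.sym (ℕₚ.*-identityʳ ⟦ size H ℕ.≟ suc t ⟧))) (primePowers N)) ⟩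
    sum (primePowers N) (λ H → degree H ℕ.* (⟦ size H ℕ.≤? t ⟧ ℕ.* (q ℕ.* q ℕ.^ (t ℕ.∸ size H)))) ℕ.+
    sum (primePowers N) (λ H → degree H ℕ.* (⟦ size H ℕ.≟ suc t ⟧ ℕ.* 1))
      ≡⟨ newton-split t<N (λ _ → 1) (λ _ → ≡.refl) (λ H → q ℕ.* q ℕ.^ (t ℕ.∸ size H)) (λ _ → 1)
           (λ H le → ≡.trans (monics-count (suc t ℕ.∸ size H)) (≡.cong (q ℕ.^_) (suc-∸ le))) (λ _ _ → ≡.refl) ⟨
    suc t ℕ.* sum (monics (suc t)) (λ _ → 1)
      ≡⟨ ≡.cong (suc t ℕ.*_) (monics-count (suc t)) ⟩
    suc t ℕ.* q ℕ.^ suc t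
      ≡⟨ solve 3 (λ q t x → (con 1 :+ t) :* (q :* x) := q :* (t :* x) :+ q :* x) ≡.refl q t (q ℕ.^ t) ⟩
    q ℕ.* (t ℕ.* q ℕ.^ t) ℕ.+ q ℕ.^ suc t ∎)
    where
    open ≡.≡-Reasoning
    open ℕSolver.+-*-Solver using (solve; _:+_; _:*_; con; _:=_)

  monics-sub-count : ∀ n a → sum (monics (suc n)) (λ F → ⟦ sub (suc n) (proj₁ F) ≟ a ⟧) ≡ q ℕ.^ n
  monics-sub-count zero a = ≡.trans (sum-monics-suc 0 (λ F → ⟦ sub 1 (proj₁ F) ≟ a ⟧))
    (≡.trans (ℕₚ.+-identityʳ _) (Enumeration.once fieldEnum a))
  monics-sub-count (suc n) a = begin
    sum (monics (suc (suc n))) (λ F → ⟦ sub (suc (suc n)) (proj₁ F) ≟ a ⟧)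
      ≡⟨ sum-monics-suc (suc n) (λ F → ⟦ sub (suc (suc n)) (proj₁ F) ≟ a ⟧) ⟩
    sum (monics (suc n)) (λ P → sum elements (λ c → ⟦ sub (suc n) (proj₁ P) ≟ a ⟧))
      ≡⟨ sum-cong (λ P → sum-const-ℕ _ elements) (monics (suc n)) ⟩
    sum (monics (suc n)) (λ P → q ℕ.* ⟦ sub (suc n) (proj₁ P) ≟ a ⟧)
      ≡⟨ *-sum q (monics (suc n)) _ ⟩
    q ℕ.* sum (monics (suc n)) (λ P → ⟦ sub (suc n) (proj₁ P) ≟ a ⟧)
      ≡⟨ ≡.cong (q ℕ.*_) (monics-sub-count n a) ⟩
    q ℕ.^ suc n ∎
    where open ≡.≡-Reasoning

  -- For sizes up to t the cofactor has positive degree and an unconstrained next-to-leading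
  -- coefficient, so these prime powers contribute t q^t whatever a is. The whole is (t + 1) q^t.
  degree-sum-sub : ∀ {N t} → suc t ℕ.≤ N → ∀ a →
    sum (primePowers N) (λ H → degree H ℕ.* (⟦ size H ℕ.≟ suc t ⟧ ℕ.* ⟦ sub (suc t) (value H) ≟ a ⟧)) ≡ q ℕ.^ t
  degree-sum-sub {N} {t} t<N a = ℕₚ.+-cancelˡ-≡ (t ℕ.* q ℕ.^ t) _ _ (begin
    t ℕ.* q ℕ.^ t ℕ.+ T₀
      ≡⟨ ≡.cong (ℕ._+ T₀) (≡.sym (weighted (ℕₚ.<⇒≤ t<N))) ⟩
    sum (primePowers N) (λ H → degree H ℕ.* (⟦ size H ℕ.≤? t ⟧ ℕ.* q ℕ.^ (t ℕ.∸ size H))) ℕ.+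
    T₀
      ≡⟨ newton-split t<N (λ F → ⟦ sub (suc t) F ≟ a ⟧)
           (λ {P} {Q} eq → ⟦⟧-cong (trans (sym (eq t))) (trans (eq t)) (P t ≟ a) (Q t ≟ a)) _ _
           smaller (λ _ _ → ≡.refl) ⟨
    suc t ℕ.* sum (monics (suc t)) (λ F → ⟦ sub (suc t) (proj₁ F) ≟ a ⟧)
      ≡⟨ ≡.cong (suc t ℕ.*_) (monics-sub-count t a) ⟩
    q ℕ.^ t ℕ.+ t ℕ.* q ℕ.^ t
      ≡⟨ ℕₚ.+-comm (q ℕ.^ t) _ ⟩
    t ℕ.* q ℕ.^ t ℕ.+ q ℕ.^ t ∎)
    where
    open ≡.≡-Reasoning
    T₀ : ℕ
    T₀ = sum (primePowers N) (λ H → degree H ℕ.* (⟦ size H ℕ.≟ suc t ⟧ ℕ.* ⟦ sub (suc t) (value H) ≟ a ⟧))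
    smaller : ∀ H → size H ℕ.≤ t → sum (monics (suc t ℕ.∸ size H)) (λ G → ⟦ sub (suc t) (value H ⊛ proj₁ G) ≟ a ⟧) ≡ q ℕ.^ (t ℕ.∸ size H)
    smaller H le = ≡.trans (≡.cong (λ n → sum (monics n) (λ G → ⟦ sub (suc t) (value H ⊛ proj₁ G) ≟ a ⟧)) (suc-∸ le))
      (≡.trans (sum-cong (λ G → ⟦⟧-cong (λ eq → solve-shift (trans (sym (additive G)) eq)) (λ eq → trans (additive G) (solve-shift⁻ eq))
          (sub (suc t) (value H ⊛ proj₁ G) ≟ a) (sub (suc e) (proj₁ G) ≟ (a - sub (size H) (value H)))) (monics (suc e)))
      (monics-sub-count e (a - sub (size H) (value H))))
      where
      e = t ℕ.∸ size H
      additive : ∀ (G : Mono (suc e)) → sub (suc t) (value H ⊛ proj₁ G) ≈ sub (size H) (value H) + sub (suc e) (proj₁ G)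
      additive G = trans (reflexive (≡.cong (λ n → sub n (value H ⊛ proj₁ G))
          (≡.sym (≡.trans (≡.cong (size H ℕ.+_) (≡.sym (suc-∸ le))) (ℕₚ.m+[n∸m]≡n (ℕₚ.m≤n⇒m≤1+n le))))))
        (sub-⊛ (size H) (suc e) (value-monic H) (proj₂ G))

  module Character (R : CommutativeSemiring 0ℓ 0ℓ) where
    private module R = CommutativeSemiring R
    private module L = ListSum R
    private module SS = SplitSize R
    private module MS = MonicSum R
    private module NR = Newton R
    open MultP R.semiring using () renaming (_×_ to _×ᴿ_)
    open SetoidR R.setoid

    module ForCharacter (χ : Carrier → R.Carrier) (χ-cong : ∀ {x y} → x ≈ y → χ x R.≈ χ y)
             (χ-* : ∀ x y → χ (x * y) R.≈ χ x R.* χ y) (χ-1 : χ 1# R.≈ R.1#)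
             (χ-sum : L.sum elements χ R.≈ R.0#) where

      -- By the correspondence below, the sum of χ(Nm x) over the x in the extension of degree t with Tr x = a.
      primePowerSum : ℕ → ℕ → Carrier → R.Carrier
      primePowerSum N t a = L.sum (primePowers N) λ H →
        (degree H ×ᴿ R.1#) R.* (L.⟦ size H ℕ.≟ t ⟧ R.* (χ (value H 0) R.* L.⟦ sub t (value H) ≟ a ⟧))

      private
        φ : ℕ → Carrier → Series → R.Carrier
        φ t a F = χ (F 0) R.* L.⟦ sub t F ≟ a ⟧

        φ-cong : ∀ t a {P Q} → P ≋ Q → φ t a P R.≈ φ t a Q
        φ-cong t a {P} {Q} eq = R.*-cong (χ-cong (eq 0))
          (L.⟦⟧-cong (trans (sym (sub-cong t eq))) (trans (sub-cong t eq)) (sub t P ≟ a) (sub t Q ≟ a))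

        -- The constant term is multiplicative and the next-to-leading coefficient additive, so
        -- removing A shifts the prescribed coefficient. Summed over A, this shift becomes the
        -- convolution.
        φ-⊛ : ∀ {r n t} a {A G} → r ℕ.+ n ≡ t → Monic r A → Monic n G →
              φ t a (A ⊛ G) R.≈ χ (A 0) R.* φ n (a - sub r A) G
        φ-⊛ {r} {n} {t} a {A} {G} ≡.refl mA mG = R.trans (R.*-cong (χ-* (A 0) (G 0))
          (L.⟦⟧-cong (λ eq → solve-shift (trans (sym additive) eq)) (λ eq → trans additive (solve-shift⁻ eq))
             (sub t (A ⊛ G) ≟ a) (sub n G ≟ (a - sub r A))))
          (R.*-assoc _ _ _)
          where
          additive : sub (r ℕ.+ n) (A ⊛ G) ≈ sub r A + sub n G
          additive = sub-⊛ r n mA mG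

        -- From degree 2 on, the constant term and the next-to-leading coefficient are different
        -- coefficients; the former runs freely over the field and χ sums to zero.
        vanish : ∀ n a → L.sum (monics (suc (suc n))) (λ F → φ (suc (suc n)) a (proj₁ F)) R.≈ R.0#
        vanish n a = R.trans (MS.sum-monics-suc (suc n) (λ F → φ (suc (suc n)) a (proj₁ F)))
          (L.sum-zero (λ P → R.trans (L.sum-* elements χ L.⟦ sub (suc n) (proj₁ P) ≟ a ⟧) (R.trans (R.*-congʳ χ-sum) (R.zeroˡ _))) (monics (suc n)))

        -- In degree 1 the two coefficients coincide, and prescribing one leaves a single term.
        linear-sum : ∀ a → L.sum (monics 1) (λ F → φ 1 a (proj₁ F)) R.≈ χ a
        linear-sum a = R.trans (MS.sum-monics-suc 0 (λ F → φ 1 a (proj₁ F)))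
          (R.trans (R.+-identityʳ _) (R.trans (L.sum-cong (λ c → R.*-comm (χ c) _) elements) (EnumSum.delta R fieldEnum χ χ-cong a)))

        shifted : ∀ {n a} (H : PrimePower) m → n ℕ.∸ size H ≡ m → size H ℕ.≤ n →
          L.sum (monics (n ℕ.∸ size H)) (λ G → φ n a (value H ⊛ proj₁ G)) R.≈
          χ (value H 0) R.* L.sum (monics m) (λ G → φ m (a - sub (size H) (value H)) (proj₁ G))
        shifted {n} {a} H m ≡.refl le = R.trans
          (L.sum-cong (λ G → φ-⊛ a (ℕₚ.m+[n∸m]≡n le) (value-monic H) (proj₂ G)) (monics (n ℕ.∸ size H)))
          (L.*-sum _ (monics m) _)

        last : ∀ {t} a H → size H ≡ t → L.sum (monics (t ℕ.∸ size H)) (λ G → φ t a (value H ⊛ proj₁ G)) R.≈ φ t a (value H)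
        last {t} a H eq = R.trans
          (R.reflexive (≡.cong (λ n → L.sum (monics n) (λ G → φ t a (value H ⊛ proj₁ G))) (≡.trans (≡.cong (t ℕ.∸_) eq) (ℕₚ.n∸n≡0 t))))
          (R.trans (R.+-identityʳ _) (φ-cong t a (S.*-identityʳ (value H))))

      primePowerSum-one : ∀ {N} → 1 ℕ.≤ N → ∀ a → primePowerSum N 1 a R.≈ χ a
      primePowerSum-one {N} 1≤N a = begin
        primePowerSum N 1 a
          ≈⟨ L.sum-cong (λ H → R.*-congˡ (R.sym (R.trans
               (SS.split-size (size H) 0 {Y = R.0#} {Z = φ 1 a (value H)} (λ ()) (last a H))
               (R.trans (R.+-congʳ (R.zeroʳ _)) (R.+-identityˡ _))))) (primePowers N) ⟩
        L.sum (primePowers N) (λ H → (degree H ×ᴿ R.1#) R.*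
          (L.⟦ size H ℕ.≤? 1 ⟧ R.* L.sum (monics (1 ℕ.∸ size H)) (λ G → φ 1 a (value H ⊛ proj₁ G))))
          ≈⟨ NR.newton 1≤N (φ 1 a) (φ-cong 1 a) ⟨
        (1 ×ᴿ R.1#) R.* L.sum (monics 1) (φ 1 a ∘ proj₁)
          ≈⟨ R.*-cong (R.+-identityʳ _) (linear-sum a) ⟩
        R.1# R.* χ a   ≈⟨ R.*-identityˡ _ ⟩
        χ a            ∎

      -- In Newton's identity of degree t + 2 the left side vanishes. On the right, cofactors of
      -- degree at least 2 sum to zero, those of degree 1 give the convolution with χ, and the
      -- cofactor 1 gives the new sum.
      primePowerSum-suc : ∀ {N t} → suc (suc t) ℕ.≤ N → ∀ a →
        primePowerSum N (suc (suc t)) a R.+ L.sum elements (λ b → primePowerSum N (suc t) b R.* χ (a - b)) R.≈ R.0#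
      primePowerSum-suc {N} {t} le a = begin
        primePowerSum N T₀ a R.+ L.sum elements (λ b → primePowerSum N (suc t) b R.* χ (a - b))
          ≈⟨ R.+-comm _ _ ⟩
        L.sum elements (λ b → primePowerSum N (suc t) b R.* χ (a - b)) R.+ primePowerSum N T₀ a
          ≈⟨ R.+-congʳ convolution ⟩
        L.sum (primePowers N) (λ H → (degree H ×ᴿ R.1#) R.* (L.⟦ size H ℕ.≤? suc t ⟧ R.* Y H)) R.+ primePowerSum N T₀ a
          ≈⟨ L.sum-+ (primePowers N) _ _ ⟨
        L.sum (primePowers N) (λ H → (degree H ×ᴿ R.1#) R.* (L.⟦ size H ℕ.≤? suc t ⟧ R.* Y H) R.+
          (degree H ×ᴿ R.1#) R.* (L.⟦ size H ℕ.≟ T₀ ⟧ R.* φ T₀ a (value H)))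
          ≈⟨ L.sum-cong (λ H → R.trans (R.sym (R.distribˡ _ _ _)) (R.*-congˡ (R.sym
               (SS.split-size (size H) (suc t) {Y = Y H} {Z = φ T₀ a (value H)} (smaller H) (last a H))))) (primePowers N) ⟩
        L.sum (primePowers N) (λ H → (degree H ×ᴿ R.1#) R.*
          (L.⟦ size H ℕ.≤? T₀ ⟧ R.* L.sum (monics (T₀ ℕ.∸ size H)) (λ G → φ T₀ a (value H ⊛ proj₁ G))))
          ≈⟨ NR.newton le (φ T₀ a) (φ-cong T₀ a) ⟨
        (T₀ ×ᴿ R.1#) R.* L.sum (monics T₀) (φ T₀ a ∘ proj₁)
          ≈⟨ R.*-congˡ (vanish t a) ⟩
        (T₀ ×ᴿ R.1#) R.* R.0#  ≈⟨ R.zeroʳ _ ⟩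
        R.0# ∎
        where
        T₀ = suc (suc t)
        Y : PrimePower → R.Carrier
        Y H = L.⟦ size H ℕ.≟ suc t ⟧ R.* (χ (value H 0) R.* χ (a - sub (suc t) (value H)))

        smaller : ∀ H → size H ℕ.≤ suc t →
          L.sum (monics (T₀ ℕ.∸ size H)) (λ G → φ T₀ a (value H ⊛ proj₁ G)) R.≈ Y H
        smaller H le with size H ℕ.≟ suc t
        ... | yes eq = R.trans (shifted {T₀} {a} H 1 (≡.trans (≡.cong (T₀ ℕ.∸_) eq) (ℕₚ.m+n∸n≡m 1 (suc t))) (ℕₚ.m≤n⇒m≤1+n le))
                (R.trans (R.*-congˡ (R.trans (linear-sum _) (χ-cong (+-congˡ (-‿cong (reflexive (≡.cong (λ n → sub n (value H)) eq)))))))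
                  (R.sym (R.*-identityˡ _)))
        ... | no neq = R.trans (shifted {T₀} {a} H (suc (suc (t ℕ.∸ size H)))
                  (≡.trans (suc-∸ le) (≡.cong suc (suc-∸ r≤t))) (ℕₚ.m≤n⇒m≤1+n le))
                (R.trans (R.*-congˡ (vanish (t ℕ.∸ size H) _)) (R.trans (R.zeroʳ _) (R.sym (R.zeroˡ _))))
          where
          r≤t : size H ℕ.≤ t
          r≤t = ℕₚ.≤-pred (ℕₚ.≤∧≢⇒< le neq)

        convolution : L.sum elements (λ b → primePowerSum N (suc t) b R.* χ (a - b)) R.≈
                      L.sum (primePowers N) (λ H → (degree H ×ᴿ R.1#) R.* (L.⟦ size H ℕ.≤? suc t ⟧ R.* Y H))
        convolution = begin
          L.sum elements (λ b → primePowerSum N (suc t) b R.* χ (a - b))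
            ≈⟨ L.sum-cong (λ b → L.sum-* (primePowers N) _ (χ (a - b))) elements ⟨
          L.sum elements (λ b → L.sum (primePowers N) (λ H → W H R.* (D H R.* (χ (value H 0) R.* L.⟦ s H ≟ b ⟧)) R.* χ (a - b)))
            ≈⟨ L.sum-swap elements (primePowers N) _ ⟩
          L.sum (primePowers N) (λ H → L.sum elements (λ b → W H R.* (D H R.* (χ (value H 0) R.* L.⟦ s H ≟ b ⟧)) R.* χ (a - b)))
            ≈⟨ L.sum-cong (λ H → L.sum-cong (λ b → regroup H b) elements) (primePowers N) ⟩
          L.sum (primePowers N) (λ H → L.sum elements (λ b → W H R.* (D H R.* χ (value H 0)) R.* (L.⟦ b ≟ s H ⟧ R.* χ (a - b))))
            ≈⟨ L.sum-cong (λ H → R.trans (L.*-sum _ elements _) (R.*-congˡ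
                 (EnumSum.delta R fieldEnum (λ b → χ (a - b)) (λ eq → χ-cong (+-congˡ (-‿cong eq))) (s H)))) (primePowers N) ⟩
          L.sum (primePowers N) (λ H → W H R.* (D H R.* χ (value H 0)) R.* χ (a - s H))
            ≈⟨ L.sum-cong (λ H → R.trans (R.*-assoc _ _ _) (R.*-congˡ (R.trans (R.*-assoc _ _ _) (bounded H)))) (primePowers N) ⟩
          L.sum (primePowers N) (λ H → W H R.* (L.⟦ size H ℕ.≤? suc t ⟧ R.* Y H)) ∎
          where
          W D : PrimePower → R.Carrier
          W H = degree H ×ᴿ R.1#
          D H = L.⟦ size H ℕ.≟ suc t ⟧
          s : PrimePower → Carrier
          s H = sub (suc t) (value H)
          regroup : ∀ H b → W H R.* (D H R.* (χ (value H 0) R.* L.⟦ s H ≟ b ⟧)) R.* χ (a - b) R.≈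
                    W H R.* (D H R.* χ (value H 0)) R.* (L.⟦ b ≟ s H ⟧ R.* χ (a - b))
          regroup H b = R.trans (R.*-congʳ (R.trans (R.*-congˡ (R.sym (R.*-assoc _ _ _))) (R.sym (R.*-assoc _ _ _))))
            (R.trans (R.*-assoc _ _ _) (R.*-congˡ (R.*-congʳ (L.⟦⟧-cong sym sym (s H ≟ b) (b ≟ s H)))))
          bounded : ∀ H → D H R.* (χ (value H 0) R.* χ (a - s H)) R.≈ L.⟦ size H ℕ.≤? suc t ⟧ R.* Y H
          bounded H with size H ℕ.≟ suc t
          ... | yes eq = R.sym (R.trans (R.*-congʳ (L.⟦⟧-true (ℕₚ.≤-reflexive eq) (size H ℕ.≤? suc t))) (R.*-identityˡ _))
          ... | no _   = R.trans (R.zeroˡ _) (R.sym (R.trans (R.*-congˡ (R.zeroˡ _)) (R.zeroʳ _)))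

-- Cyclic fields, Frobenius and subfields

module TightSums where
  open ℕSum

  sum-mono : {A : Set} {f g : A → ℕ} → (∀ x → f x ℕ.≤ g x) → ∀ xs → sum xs f ℕ.≤ sum xs g
  sum-mono h []       = z≤n
  sum-mono h (x ∷ xs) = ℕₚ.+-mono-≤ (h x) (sum-mono h xs)

  -- Termwise bounds with equal totals have no slack anywhere. Surjectivity statements are obtained
  -- from this by counting.
  tight : {A : Set} {f g : A → ℕ} → (∀ x → f x ℕ.≤ g x) → ∀ xs → sum xs g ℕ.≤ sum xs f → All (λ x → f x ≡ g x) xs
  tight h [] le = []
  tight {f = f} {g} h (x ∷ xs) le with ℕₚ.m≤n⇒m<n∨m≡n (h x)
  ... | inj₁ fx<gx = ⊥-elim (ℕₚ.<-irrefl ≡.refl (ℕₚ.<-≤-trans (ℕₚ.+-mono-<-≤ fx<gx (sum-mono h xs)) le))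
  ... | inj₂ fx≡gx = fx≡gx ∷ tight h xs (ℕₚ.+-cancelˡ-≤ (g x) _ _ (≡.subst (λ z → g x ℕ.+ sum xs g ℕ.≤ z ℕ.+ sum xs f) fx≡gx le))

  sum-one : {A : Set} (xs : List A) → sum xs (λ _ → 1) ≡ length xs
  sum-one []       = ≡.refl
  sum-one (x ∷ xs) = ≡.cong suc (sum-one xs)

  module _ (S : DecSetoid 0ℓ 0ℓ) where
    open DecSetoid S

    unique-count≤1 : ∀ ys → UniqueS.Unique setoid ys → ∀ x → sum ys (λ y → ⟦ y ≟ x ⟧) ℕ.≤ 1
    unique-count≤1 [] u x = z≤n
    unique-count≤1 (y ∷ ys) (y∉ys ∷ u) x with y ≟ x
    ... | no _    = unique-count≤1 ys u x
    ... | yes y≈x = s≤s (ℕₚ.≤-reflexive (none ys y∉ys))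
      where
      none : ∀ ys → All (λ z → ¬ (y ≈ z)) ys → sum ys (λ z → ⟦ z ≟ x ⟧) ≡ 0
      none [] [] = ≡.refl
      none (z ∷ zs) (h ∷ hs) = ≡.cong₂ ℕ._+_ (⟦⟧-false (λ z≈x → h (trans y≈x (sym z≈x))) (z ≟ x)) (none zs hs)

    -- Every element occurs at most once in `ys`, and the occurrences total the size of the set, so
    -- every element occurs exactly once.
    pigeonhole : (E : Enumeration S) → ∀ ys → UniqueS.Unique setoid ys →
                 length ys ≡ length (Enumeration.list E) → ∀ x → Any (x ≈_) ys
    pigeonhole E ys u len x = Any.map sym (extract ys (Any.satisfied (combine (covers E x)
      (tight (unique-count≤1 ys u) xs (ℕₚ.≤-reflexive totals)))))
      where
      open Enumeration E renaming (list to xs)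
      totals : sum xs (λ _ → 1) ≡ sum xs (λ x → sum ys (λ y → ⟦ y ≟ x ⟧))
      totals = ≡.trans (sum-one xs) (≡.trans (≡.sym len) (≡.trans (≡.sym (sum-one ys)) (≡.sym
        (≡.trans (sum-swap xs ys _) (sum-cong (λ y → ≡.trans (sum-cong (λ x → ⟦⟧-cong sym sym (y ≟ x) (x ≟ y)) xs) (once y)) ys)))))
      combine : ∀ {zs} → Any (_≈ x) zs → All (λ z → sum ys (λ y → ⟦ y ≟ z ⟧) ≡ 1) zs →
                Any (λ z → z ≈ x × sum ys (λ y → ⟦ y ≟ z ⟧) ≡ 1) zs
      combine (here p) (q ∷ _)  = here (p , q)
      combine (there p) (_ ∷ qs) = there (combine p qs)
      extract : ∀ ys → ∃ (λ z → z ≈ x × sum ys (λ y → ⟦ y ≟ z ⟧) ≡ 1) → Any (_≈ x) ys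
      extract (y ∷ ys) (z , z≈x , eq) with y ≟ z
      ... | yes y≈z = here (trans y≈z z≈x)
      ... | no _    = there (extract ys (z , z≈x , eq))

-- The sum 1 + q + ... + q^(n-1) in Horner form. It is the exponent of the norm map and the index of
-- the unit group of a subfield.
geometric : ℕ → ℕ → ℕ
geometric q zero    = 0
geometric q (suc n) = 1 ℕ.+ q ℕ.* geometric q n

geometric-∸ : ∀ q n → geometric (suc q) n ℕ.* q ≡ suc q ℕ.^ n ℕ.∸ 1
geometric-∸ q n = ≡.cong (ℕ._∸ 1) (go n)
  where
  open ℕSolver.+-*-Solver using (solve; _:+_; _:*_; con; _:=_)
  go : ∀ n → suc (geometric (suc q) n ℕ.* q) ≡ suc q ℕ.^ n
  go zero    = ≡.refl
  go (suc n) = ≡.trans (solve 2 (λ q g → con 1 :+ (con 1 :+ (con 1 :+ q) :* g) :* q := (con 1 :+ q) :* (con 1 :+ g :* q)) ≡.refl q (geometric (suc q) n))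
                 (≡.cong (suc q ℕ.*_) (go n))

prime∤! : ∀ {p} → Prime p → ∀ n → n ℕ.< p → ¬ (p ∣ n ℕ.!)
prime∤! {p} pr zero n<p div = ℕₚ.<-irrefl (≡.sym (∣.∣1⇒≡1 div)) (ℕ.nonTrivial⇒n>1 p {{prime⇒nonTrivial pr}})
prime∤! pr (suc n) n<p div with euclidsLemma (suc n) (n ℕ.!) pr div
... | inj₁ d = ∣.>⇒∤ n<p d
... | inj₂ d = prime∤! pr n (ℕₚ.<-trans (ℕₚ.n<1+n n) n<p) d

prime∣C : ∀ {p k} → Prime p → 0 ℕ.< k → k ℕ.< p → p ∣ p Comb.C k
prime∣C {suc p′} {k} pr 0<k k<p with euclidsLemma (p Comb.C k) (k ℕ.! ℕ.* (p ℕ.∸ k) ℕ.!) pr p∣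
  where
  p = suc p′
  instance _ = k ℕₚ.!* (p ℕ.∸ k) !≢0
  p∣ : p ∣ (p Comb.C k) ℕ.* (k ℕ.! ℕ.* (p ℕ.∸ k) ℕ.!)
  p∣ = ≡.subst (p ∣_) (≡.sym (≡.trans (≡.cong (ℕ._* (k ℕ.! ℕ.* (p ℕ.∸ k) ℕ.!)) (nCk≡n!/k![n-k]! (ℕₚ.<⇒≤ k<p)))
         (m/n*n≡m (k![n∸k]!∣n! (ℕₚ.<⇒≤ k<p))))) (∣.m∣m*n (p′ ℕ.!))
... | inj₁ d = d
... | inj₂ d with euclidsLemma (k ℕ.!) _ pr d
...   | inj₁ d′ = ⊥-elim (prime∤! pr k k<p d′)
...   | inj₂ d′ = ⊥-elim (prime∤! pr (suc p′ ℕ.∸ k) (ℕₚ.∸-monoʳ-< 0<k (ℕₚ.<⇒≤ k<p)) d′)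

module Powers (F : FiniteField) where
  open FiniteField F
  open FF F using (pow)

  pow-cong : ∀ n {x y} → x ≈ y → pow x n ≈ pow y n
  pow-cong zero    eq = refl
  pow-cong (suc n) eq = *-cong eq (pow-cong n eq)

  pow-+ : ∀ x m n → pow x (m ℕ.+ n) ≈ pow x m * pow x n
  pow-+ x zero    n = sym (*-identityˡ _)
  pow-+ x (suc m) n = trans (*-congˡ (pow-+ x m n)) (sym (*-assoc _ _ _))

  pow-*-base : ∀ n x y → pow (x * y) n ≈ pow x n * pow y n
  pow-*-base zero    x y = sym (*-identityˡ _)
  pow-*-base (suc n) x y = trans (*-congˡ (pow-*-base n x y))
    (solve 4 (λ x y a b → x :* y :* (a :* b) := x :* a :* (y :* b)) refl x y (pow x n) (pow y n))
    where open IntegerMultiples commRing using (solve; _:*_; _:=_)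

  pow-1 : ∀ n → pow 1# n ≈ 1#
  pow-1 zero    = refl
  pow-1 (suc n) = trans (*-identityˡ _) (pow-1 n)

  pow-* : ∀ x m n → pow x (m ℕ.* n) ≈ pow (pow x m) n
  pow-* x zero    n = sym (pow-1 n)
  pow-* x (suc m) n = trans (pow-+ x n (m ℕ.* n)) (trans (*-congˡ (pow-* x m n)) (sym (pow-*-base n x (pow x m))))

  pow-*′ : ∀ x m n → pow x (m ℕ.* n) ≈ pow (pow x n) m
  pow-*′ x m n = trans (reflexive (≡.cong (pow x) (ℕₚ.*-comm m n))) (pow-* x n m)

  pow-0 : ∀ n → 0 ℕ.< n → pow 0# n ≈ 0#
  pow-0 (suc n) _ = zeroˡ _

  open FieldPoly F using (domain)

  pow-nonzero : ∀ {x} n → ¬ (x ≈ 0#) → ¬ (pow x n ≈ 0#)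
  pow-nonzero zero    x≉0 = 1≉0
  pow-nonzero (suc n) x≉0 = λ z → pow-nonzero n x≉0 (domain x≉0 z)

  *-cancelˡ : ∀ {x y z} → ¬ (x ≈ 0#) → x * y ≈ x * z → y ≈ z
  *-cancelˡ {x} {y} {z} x≉0 eq = x∙y⁻¹≈ε⇒x≈y y z (domain x≉0 (trans (x[y-z]≈xy-xz x y z) (x≈y⇒x∙y⁻¹≈ε eq)))
    where open RingP ring

  pow-cancel : ∀ {x} i j → ¬ (x ≈ 0#) → i ℕ.≤ j → pow x i ≈ pow x j → pow x (j ℕ.∸ i) ≈ 1#
  pow-cancel {x} i j x≉0 i≤j eq = *-cancelˡ (pow-nonzero i x≉0) (trans (sym (pow-+ x i (j ℕ.∸ i)))
    (trans (reflexive (≡.cong (pow x) (ℕₚ.m+[n∸m]≡n i≤j))) (trans (sym eq) (sym (*-identityʳ _)))))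

module CyclicField (F : FiniteField) (p m : ℕ) (prime : Prime p)
                   (order : length (FiniteField.elements F) ≡ p ℕ.^ m)
                   (γ : FiniteField.Carrier F) (γ-primitive : FF.Primitive F p m γ) where
  open FiniteField F
  open FF F using (pow)
  open Powers F
  open Factorization F using (decSetoid; fieldEnum; domain)
  open MultP semiring using () renaming (_×_ to _·1×_; ×1-homo-* to ·×1-homo-*; ×-congʳ to ·×-congʳ; ×-assocˡ to ·×-assocˡ)
  open RingP ring
  open SetoidR setoid

  instance
    p≢0 : NonZero p
    p≢0 = prime⇒nonZero prime

  1<p : 1 ℕ.< p
  1<p = ℕ.nonTrivial⇒n>1 p {{prime⇒nonTrivial prime}}

  infixr 30 _·1
  _·1 : ℕ → Carrier
  n ·1 = n ·1× 1#

  private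
    -- Translation by 1 permutes the field, so the sum of all elements is unchanged when 1 is added
    -- to each of them. As a field has no zero divisors, p · 1 = 0 follows.
    order·1 : (p ℕ.^ m) ·1 ≈ 0#
    order·1 = +-cancelˡ (sum elements (λ x → x)) _ _ (begin
      sum elements (λ x → x) + (p ℕ.^ m) ·1
        ≈⟨ +-congˡ (trans (sum-const 1# elements) (reflexive (≡.cong _·1 order))) ⟨
      sum elements (λ x → x) + sum elements (λ _ → 1#)
        ≈⟨ sum-+ elements (λ x → x) (λ _ → 1#) ⟨
      sum elements (λ x → x + 1#)
        ≈⟨ EnumSum.sum-bijection commutativeSemiring fieldEnum fieldEnum (_+ 1#) (_- 1#)
             +-congʳ +-congʳ (λ x → solve 1 (λ x → x :+ con (+ 1) :- con (+ 1) := x) refl x)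
             (λ x → solve 1 (λ x → x :- con (+ 1) :+ con (+ 1) := x) refl x) (λ x → x) (λ eq → eq) ⟩
      sum elements (λ x → x)
        ≈⟨ +-identityʳ _ ⟨
      sum elements (λ x → x) + 0# ∎)
      where
      open ListSum commutativeSemiring
      open IntegerMultiples commRing using (solve; _:+_; _:-_; con; _:=_)

  abstract
    characteristic : p ·1 ≈ 0#
    characteristic with (p ·1) ≟ 0#
    ... | yes p≈0 = p≈0
    ... | no p≉0 = ⊥-elim (nonzero m order·1)
      where
      nonzero : ∀ m → ¬ ((p ℕ.^ m) ·1 ≈ 0#)
      nonzero zero    z = 1≉0 (trans (sym (+-identityʳ 1#)) z)
      nonzero (suc m) z = nonzero m (domain p≉0 (trans (sym (·×1-homo-* p (p ℕ.^ m))) z))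

  ∣⇒·1≈0 : ∀ {n} → p ∣ n → n ·1 ≈ 0#
  ∣⇒·1≈0 (∣.divides q ≡.refl) = trans (·×1-homo-* q p) (trans (*-congˡ characteristic) (zeroʳ _))

  ·1≈0⇒∣ : ∀ {n} → n ·1 ≈ 0# → p ∣ n
  ·1≈0⇒∣ {n} n≈0 with p ∣.∣? n
  ... | yes d = d
  ... | no p∤n = ⊥-elim (1≉0 (bézout (coprime-Bézout (coprime n p∤n))))
    where
    coprime : ∀ n → p ∤ n → Coprime p n
    coprime n p∤n (d∣p , d∣n) with prime⇒irreducible prime d∣p
    ... | inj₁ d≡1 = d≡1
    ... | inj₂ ≡.refl = ⊥-elim (p∤n d∣n)
    vanish : ∀ x → n ·1 ≈ 0# → (x ℕ.* n) ·1 ≈ 0#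
    vanish x z = trans (·×1-homo-* x n) (trans (*-congˡ z) (zeroʳ _))
    bézout : GCD.Bézout.Identity 1 p n → 1# ≈ 0#
    bézout (GCD.Bézout.+- x y eq) = begin
      1#                          ≈⟨ +-identityʳ 1# ⟨
      1# + 0#                     ≈⟨ +-congˡ (vanish y n≈0) ⟨
      (1 ℕ.+ y ℕ.* n) ·1          ≡⟨ ≡.cong _·1 eq ⟩
      (x ℕ.* p) ·1                ≈⟨ ∣⇒·1≈0 (∣.n∣m*n x) ⟩
      0#                          ∎
    bézout (GCD.Bézout.-+ x y eq) = begin
      1#                          ≈⟨ +-identityʳ 1# ⟨
      1# + 0#                     ≈⟨ +-congˡ (∣⇒·1≈0 (∣.n∣m*n x)) ⟨
      (1 ℕ.+ x ℕ.* p) ·1          ≡⟨ ≡.cong _·1 eq ⟩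
      (y ℕ.* n) ·1                ≈⟨ vanish y n≈0 ⟩
      0#                          ∎

  open IntegerMultiples commRing using (fromℤ)

  fromℤ-pos : ∀ n → fromℤ (+ n) ≈ n ·1
  fromℤ-pos n = sym (MultO.×ᵤ≈× semiring n 1#)

  fromℤ≈0⇒∣ : ∀ z → fromℤ z ≈ 0# → (+ p) ℤ∣.∣ z
  fromℤ≈0⇒∣ (+ n) eq = ·1≈0⇒∣ (trans (sym (fromℤ-pos n)) eq)
  fromℤ≈0⇒∣ -[1+ n ] eq = ·1≈0⇒∣ (trans (sym (fromℤ-pos (suc n))) (trans (sym (-‿involutive _)) (trans (-‿cong eq) -0#≈0#)))

  ∣⇒fromℤ≈0 : ∀ z → (+ p) ℤ∣.∣ z → fromℤ z ≈ 0#
  ∣⇒fromℤ≈0 (+ n) d = trans (fromℤ-pos n) (∣⇒·1≈0 d)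
  ∣⇒fromℤ≈0 -[1+ n ] d = trans (-‿cong (trans (fromℤ-pos (suc n)) (∣⇒·1≈0 d))) -0#≈0#

  private
    p-multiple : ∀ {c} x → p ∣ c → c ·1× x ≈ 0#
    p-multiple x (∣.divides c ≡.refl) = begin
      (c ℕ.* p) ·1× x     ≈⟨ ·×-assocˡ x c p ⟨
      c ·1× (p ·1× x)     ≈⟨ ·×-congʳ c (begin
        p ·1× x             ≈⟨ ·×-congʳ p (*-identityˡ x) ⟨
        p ·1× (1# * x)      ≈⟨ MultP.×-assoc-* semiring p 1# x ⟨
        p ·1 * x            ≈⟨ *-congʳ characteristic ⟩
        0# * x              ≈⟨ zeroˡ x ⟩
        0#                  ∎) ⟩
      c ·1× 0#            ≈⟨ ·×-congʳ c (zeroʳ 0#) ⟨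
      c ·1× (0# * 0#)     ≈⟨ MultP.×-assoc-* semiring c 0# 0# ⟨
      (c ·1× 0#) * 0#     ≈⟨ zeroʳ _ ⟩
      0#                  ∎

  abstract
    frobenius-+ : ∀ x y → pow (x + y) p ≈ pow x p + pow y p
    frobenius-+ x y = expand p prime ≡.refl
      where
      module B = Binomial commutativeSemiring
      module V = VecSum semiring
      -- A variable n stands in for p so that it can be matched as a successor; this exposes the
      -- first and last terms of the binomial expansion, and the ones between are multiples of p.
      expand : ∀ n → Prime n → n ≡ p → pow (x + y) n ≈ pow x n + pow y n
      expand zero pr _ = ⊥-elim (ℕₚ.n≮0 (ℕ.nonTrivial⇒n>1 0 {{prime⇒nonTrivial pr}}))
      expand (suc n) pr n≡p = begin
        pow (x + y) (suc n)                           ≈⟨ pow≈^ (x + y) (suc n) ⟩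
        (x + y) ^′ suc n                              ≈⟨ B.theorem (suc n) x y ⟩
        B.binomialExpansion x y (suc n)               ≡⟨⟩
        term Fin.zero + V.sum (term ∘ Fin.suc)                ≈⟨ +-cong first (V.sum-init-last (term ∘ Fin.suc)) ⟩
        pow y (suc n) + (V.sum (λ i → term (Fin.suc (inject₁ i))) + term (Fin.suc (Fin.fromℕ n)))
          ≈⟨ +-congˡ (+-cong (trans (V.sum-cong-≋ middle) (V.sum-replicate-zero n)) last) ⟩
        pow y (suc n) + (0# + pow x (suc n))          ≈⟨ +-congˡ (+-identityˡ _) ⟩
        pow y (suc n) + pow x (suc n)                 ≈⟨ +-comm _ _ ⟩
        pow x (suc n) + pow y (suc n)                 ∎
        where
        open import Algebra.Properties.Semiring.Exp semiring using () renaming (_^_ to _^′_)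
        pow≈^ : ∀ z k → pow z k ≈ z ^′ k
        pow≈^ z zero    = refl
        pow≈^ z (suc k) = *-congˡ (pow≈^ z k)
        term : Fin (suc (suc n)) → Carrier
        term = B.binomialTerm x y (suc n)
        first : term Fin.zero ≈ pow y (suc n)
        first = trans (+-identityʳ _) (trans (*-identityˡ _) (sym (pow≈^ y (suc n))))
        last : term (Fin.suc (Fin.fromℕ n)) ≈ pow x (suc n)
        last = begin
          (suc n Comb.C suc (toℕ (Fin.fromℕ n))) ·1× (x ^′ suc (toℕ (Fin.fromℕ n)) * y ^′ (n ℕ.∸ toℕ (Fin.fromℕ n)))
            ≡⟨ ≡.cong (λ k → (suc n Comb.C suc k) ·1× (x ^′ suc k * y ^′ (n ℕ.∸ k))) (Finₚ.toℕ-fromℕ n) ⟩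
          (suc n Comb.C suc n) ·1× (x ^′ suc n * y ^′ (n ℕ.∸ n))
            ≡⟨ ≡.cong₂ (λ c e → c ·1× (x ^′ suc n * y ^′ e)) (nCn≡1 (suc n)) (ℕₚ.n∸n≡0 n) ⟩
          x ^′ suc n * 1# + 0#    ≈⟨ +-identityʳ _ ⟩
          x ^′ suc n * 1#         ≈⟨ *-identityʳ _ ⟩
          x ^′ suc n              ≈⟨ pow≈^ x (suc n) ⟨
          pow x (suc n)           ∎
        middle : ∀ i → term (Fin.suc (inject₁ i)) ≈ 0#
        middle i = p-multiple _ (≡.subst (_∣ (suc n Comb.C suc (toℕ (inject₁ i)))) n≡p
          (prime∣C pr (s≤s z≤n) (s≤s (≡.subst (ℕ._< n) (≡.sym (Finₚ.toℕ-inject₁ i)) (Finₚ.toℕ<n i)))))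

  frob : ℕ → Carrier → Carrier
  frob i x = pow x (p ℕ.^ i)

  frob-cong : ∀ i {x y} → x ≈ y → frob i x ≈ frob i y
  frob-cong i = pow-cong (p ℕ.^ i)

  frob-0 : ∀ x → frob 0 x ≈ x
  frob-0 x = *-identityʳ x

  frob-suc : ∀ i x → frob (suc i) x ≈ pow (frob i x) p
  frob-suc i x = pow-*′ x p (p ℕ.^ i)

  frob-frob : ∀ i j x → frob (i ℕ.+ j) x ≈ frob i (frob j x)
  frob-frob i j x = trans (reflexive (≡.cong (pow x) (≡.trans (ℕₚ.^-distribˡ-+-* p i j) (ℕₚ.*-comm (p ℕ.^ i) _)))) (pow-* x (p ℕ.^ j) (p ℕ.^ i))

  abstract
    frob-+ : ∀ i x y → frob i (x + y) ≈ frob i x + frob i y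
    frob-+ zero    x y = distribʳ 1# x y
    frob-+ (suc i) x y = trans (frob-suc i (x + y)) (trans (pow-cong p (frob-+ i x y))
      (trans (frobenius-+ (frob i x) (frob i y)) (sym (+-cong (frob-suc i x) (frob-suc i y)))))

  abstract
    frob-* : ∀ i x y → frob i (x * y) ≈ frob i x * frob i y
    frob-* i = pow-*-base (p ℕ.^ i)

  frob-1 : ∀ i → frob i 1# ≈ 1#
  frob-1 i = pow-1 (p ℕ.^ i)

  frob-zero : ∀ i → frob i 0# ≈ 0#
  frob-zero i = pow-0 (p ℕ.^ i) (ℕₚ.m^n>0 p i)

  abstract
    frob-neg : ∀ i x → frob i (- x) ≈ - frob i x
    frob-neg i x = +-inverseˡ-unique (frob i (- x)) (frob i x)
      (trans (sym (frob-+ i (- x) x)) (trans (frob-cong i (-‿inverseˡ x)) (frob-zero i)))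

  groupOrder : ℕ
  groupOrder = p ℕ.^ m ℕ.∸ 1

  suc-groupOrder : suc groupOrder ≡ p ℕ.^ m
  suc-groupOrder = ℕₚ.m+[n∸m]≡n (ℕₚ.m^n>0 p m)

  γ≉0 : ¬ (γ ≈ 0#)
  γ≉0 = proj₁ γ-primitive

  private
    γ-powers-distinct : ∀ {i j} → i ℕ.< j → j ℕ.< groupOrder → ¬ (pow γ i ≈ pow γ j)
    γ-powers-distinct {i} {j} i<j j<M eq = proj₂ γ-primitive (j ℕ.∸ i) (ℕₚ.m<n⇒0<n∸m i<j)
      (ℕₚ.≤-<-trans (ℕₚ.m∸n≤m j i) j<M) (pow-cancel i j γ≉0 (ℕₚ.<⇒≤ i<j) eq)

  powers : List Carrier
  powers = 0# ∷ applyUpTo (pow γ) groupOrder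

  powers-unique : UniqueS.Unique setoid powers
  powers-unique = Allₚ.applyUpTo⁺₂ (pow γ) groupOrder (λ i z → pow-nonzero i γ≉0 (sym z))
                  ∷ AllPairsₚ.applyUpTo⁺₁ (pow γ) groupOrder γ-powers-distinct

  -- Primitivity directly gives only that the powers of γ below p^m - 1 are distinct; together with
  -- 0 they are p^m elements, hence all of them.
  powers-complete : ∀ x → Any (x ≈_) powers
  powers-complete = TightSums.pigeonhole decSetoid fieldEnum powers powers-unique
    (≡.trans (≡.cong suc (Listₚ.length-applyUpTo (pow γ) groupOrder)) (≡.trans suc-groupOrder (≡.sym order)))

  abstract
    generates : ∀ x → ¬ (x ≈ 0#) → ∃ λ i → i ℕ.< groupOrder × x ≈ pow γ i
    generates x x≉0 with powers-complete x
    ... | here x≈0 = ⊥-elim (x≉0 x≈0)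
    ... | there any = Anyₚ.applyUpTo⁻ (pow γ) any

  abstract
    -- This power is nonzero, hence some γ^i with i < p^m - 1; i > 0 would give γ^(p^m - 1 - i) = 1,
    -- which primitivity forbids.
    γ-order : pow γ groupOrder ≈ 1#
    γ-order with generates (pow γ groupOrder) (pow-nonzero groupOrder γ≉0)
    ... | zero , _ , eq = eq
    ... | i@(suc _) , i<M , eq = ⊥-elim (proj₂ γ-primitive (groupOrder ℕ.∸ i) (ℕₚ.m<n⇒0<n∸m i<M)
            (ℕₚ.∸-monoʳ-< (s≤s z≤n) (ℕₚ.<⇒≤ i<M)) (pow-cancel i groupOrder γ≉0 (ℕₚ.<⇒≤ i<M) (sym eq)))

  private
    1<order : 1 ℕ.< p ℕ.^ m
    1<order = ≡.subst (1 ℕ.<_) order (two elements (complete 0#) (complete 1#))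
      where
      two : ∀ xs → Any (0# ≈_) xs → Any (1# ≈_) xs → 1 ℕ.< length xs
      two (x ∷ []) (here p) (here q) = ⊥-elim (1≉0 (trans q (sym p)))
      two (x ∷ y ∷ xs) _ _ = s≤s (s≤s z≤n)

    instance
      groupOrder≢0 : NonZero groupOrder
      groupOrder≢0 = ℕ.>-nonZero (ℕₚ.m<n⇒0<n∸m 1<order)

  γ-power≈1 : ∀ n → pow γ n ≈ 1# → groupOrder ∣ n
  γ-power≈1 n eq with n ℕ.% groupOrder in r-eq | m%n<n n groupOrder
  ... | zero  | _ = ∣.m%n≡0⇒n∣m n groupOrder r-eq
  ... | r@(suc _) | r<M = ⊥-elim (proj₂ γ-primitive r (s≤s z≤n) r<M (begin
    pow γ r                                      ≈⟨ *-identityʳ _ ⟨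
    pow γ r * 1#                                 ≈⟨ *-congˡ (pow-1 d) ⟨
    pow γ r * pow 1# d                           ≈⟨ *-congˡ (pow-cong d γ-order) ⟨
    pow γ r * pow (pow γ groupOrder) d           ≈⟨ *-congˡ (pow-*′ γ d groupOrder) ⟨
    pow γ r * pow γ (d ℕ.* groupOrder)           ≈⟨ pow-+ γ r _ ⟨
    pow γ (r ℕ.+ d ℕ.* groupOrder)               ≡⟨ ≡.cong (λ z → pow γ (z ℕ.+ d ℕ.* groupOrder)) r-eq ⟨
    pow γ (n ℕ.% groupOrder ℕ.+ d ℕ.* groupOrder) ≡⟨ ≡.cong (pow γ) (m≡m%n+[m/n]*n n groupOrder) ⟨
    pow γ n                                      ≈⟨ eq ⟩
    1#                                           ∎))
    where
    d = n ℕ./ groupOrder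

  module Subfield (t n : ℕ) (m≡nt : m ≡ n ℕ.* t) (0<n : 0 ℕ.< n) (0<t : 0 ℕ.< t) where

    subOrder : ℕ
    subOrder = p ℕ.^ t ℕ.∸ 1

    suc-subOrder : suc subOrder ≡ p ℕ.^ t
    suc-subOrder = ℕₚ.m+[n∸m]≡n (ℕₚ.m^n>0 p t)

    index : ℕ
    index = geometric (p ℕ.^ t) n

    index*subOrder : index ℕ.* subOrder ≡ groupOrder
    index*subOrder = ≡.trans (≡.cong (λ z → geometric z n ℕ.* subOrder) (≡.sym suc-subOrder))
      (≡.trans (geometric-∸ subOrder n) (≡.cong (ℕ._∸ 1)
        (≡.trans (≡.cong (ℕ._^ n) suc-subOrder) (≡.trans (ℕₚ.^-*-assoc p t n)
          (≡.cong (p ℕ.^_) (≡.trans (ℕₚ.*-comm t n) (≡.sym m≡nt)))))))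

    instance
      index≢0 : NonZero index
      index≢0 = positive n 0<n
        where
        positive : ∀ n → 0 ℕ.< n → NonZero (geometric (p ℕ.^ t) n)
        positive (suc n) _ = _

    instance
      subOrder≢0 : NonZero subOrder
      subOrder≢0 = ℕ.>-nonZero (ℕₚ.m<n⇒0<n∸m (ℕₚ.<-≤-trans 1<p (≡.subst (ℕ._≤ p ℕ.^ t) (ℕₚ.^-identityʳ p) (ℕₚ.^-monoʳ-≤ p 0<t))))

    generator : Carrier
    generator = pow γ index

    generator≉0 : ¬ (generator ≈ 0#)
    generator≉0 = pow-nonzero index γ≉0

    abstract
      generator-order : pow generator subOrder ≈ 1#
      generator-order = trans (sym (pow-* γ index subOrder)) (trans (reflexive (≡.cong (pow γ) index*subOrder)) γ-order)

    generator-power≈1 : ∀ i → pow generator i ≈ 1# → subOrder ∣ i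
    generator-power≈1 i eq = ∣.*-cancelˡ-∣ index (≡.subst (_∣ index ℕ.* i) (≡.sym index*subOrder)
      (γ-power≈1 (index ℕ.* i) (trans (pow-* γ index i) eq)))

    generator-distinct : ∀ {i j} → i ℕ.< j → j ℕ.< subOrder → ¬ (pow generator i ≈ pow generator j)
    generator-distinct {i} {j} i<j j<M eq = ∣.>⇒∤ {{ℕ.>-nonZero (ℕₚ.m<n⇒0<n∸m i<j)}} (ℕₚ.≤-<-trans (ℕₚ.m∸n≤m j i) j<M)
      (generator-power≈1 (j ℕ.∸ i) (pow-cancel i j generator≉0 (ℕₚ.<⇒≤ i<j) eq))

    Fixed : Carrier → Set
    Fixed x = frob t x ≈ x

    fixed-resp : ∀ {x y} → x ≈ y → Fixed x → Fixed y
    fixed-resp eq fx = trans (frob-cong t (sym eq)) (trans fx eq)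

    abstract
      fixed-* : ∀ {x y} → Fixed x → Fixed y → Fixed (x * y)
      fixed-* fx fy = trans (frob-* t _ _) (*-cong fx fy)

    abstract
      fixed-+ : ∀ {x y} → Fixed x → Fixed y → Fixed (x + y)
      fixed-+ fx fy = trans (frob-+ t _ _) (+-cong fx fy)

    abstract
      fixed-pow : ∀ {x} i → Fixed x → Fixed (pow x i)
      fixed-pow zero    fx = frob-1 t
      fixed-pow (suc i) fx = fixed-* fx (fixed-pow i fx)

    abstract
      fixed-generator : Fixed generator
      fixed-generator = trans (reflexive (≡.cong (pow generator) (≡.sym suc-subOrder)))
        (trans (*-congˡ generator-order) (*-identityʳ _))

    Carrierₛ : Set
    Carrierₛ = Σ Carrier Fixed

    generatorₛ : Carrierₛ
    generatorₛ = generator , fixed-generator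

    power : ℕ → Carrierₛ
    power i = pow generator i , fixed-pow i fixed-generator

    -- If x = γ^i is fixed then γ^(i (p^t - 1)) = 1, so the order of γ divides i (p^t - 1), and
    -- cancelling p^t - 1 leaves that `index` divides i.
    generatesₛ : ∀ x → Fixed x → ¬ (x ≈ 0#) → ∃ λ i → i ℕ.< subOrder × x ≈ pow generator i
    generatesₛ x fx x≉0 with generates x x≉0
    ... | i , i<M , x≈γⁱ with ∣.*-cancelʳ-∣ {index} {i} subOrder (≡.subst (_∣ i ℕ.* subOrder) (≡.sym index*subOrder)
          (γ-power≈1 (i ℕ.* subOrder) (begin
            pow γ (i ℕ.* subOrder)     ≈⟨ pow-* γ i subOrder ⟩
            pow (pow γ i) subOrder     ≈⟨ pow-cong subOrder x≈γⁱ ⟨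
            pow x subOrder             ≈⟨ *-cancelˡ x≉0 (trans (reflexive (≡.cong (pow x) suc-subOrder)) (trans fx (sym (*-identityʳ x)))) ⟩
            1#                         ∎)))
    ...   | ∣.divides j ≡.refl = j , ℕₚ.*-cancelʳ-< index _ _ (≡.subst (j ℕ.* index ℕ.<_) (≡.trans (≡.sym index*subOrder) (ℕₚ.*-comm index subOrder)) i<M) ,
            trans x≈γⁱ (pow-*′ γ j index)

    ring-structure : CommutativeRing 0ℓ 0ℓ
    ring-structure = record
      { Carrier = Carrierₛ ; _≈_ = λ x y → proj₁ x ≈ proj₁ y
      ; _+_ = λ (x , fx) (y , fy) → x + y , fixed-+ fx fy
      ; _*_ = λ (x , fx) (y , fy) → x * y , fixed-* fx fy
      ; -_ = λ (x , fx) → - x , trans (frob-neg t x) (-‿cong fx)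
      ; 0# = 0# , frob-zero t ; 1# = 1# , frob-1 t
      ; isCommutativeRing = record
        { isRing = record
          { +-isAbelianGroup = record
            { isGroup = record
              { isMonoid = record
                { isSemigroup = record
                  { isMagma = record
                    { isEquivalence = record { refl = refl ; sym = sym ; trans = trans }
                    ; ∙-cong = +-cong }
                  ; assoc = λ _ _ _ → +-assoc _ _ _ }
                ; identity = (λ _ → +-identityˡ _) , (λ _ → +-identityʳ _) }
              ; inverse = (λ _ → -‿inverseˡ _) , (λ _ → -‿inverseʳ _)
              ; ⁻¹-cong = -‿cong }
            ; comm = λ _ _ → +-comm _ _ }
          ; *-cong = *-cong
          ; *-assoc = λ _ _ _ → *-assoc _ _ _
          ; *-identity = (λ _ → *-identityˡ _) , (λ _ → *-identityʳ _)
          ; distrib = (λ _ _ _ → distribˡ _ _ _) , (λ _ _ _ → distribʳ _ _ _) }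
        ; *-comm = λ _ _ → *-comm _ _ } }

    -- Listing 0 and the powers of the generator, instead of filtering the large field, makes the
    -- order p^t immediate.
    subfield : FiniteField
    subfield = record
      { commRing = ring-structure
      ; _≟_ = λ x y → proj₁ x ≟ proj₁ y
      ; 1≉0 = 1≉0
      ; inverse = inverseₛ
      ; elements = CommutativeRing.0# ring-structure ∷ applyUpTo power subOrder
      ; complete = completeₛ
      ; unique = Allₚ.applyUpTo⁺₂ power subOrder (λ i z → pow-nonzero i generator≉0 (sym z))
                 ∷ AllPairsₚ.applyUpTo⁺₁ power subOrder generator-distinct }
      where
      inverseₛ : ∀ (x : Carrierₛ) → ¬ (proj₁ x ≈ 0#) → Σ Carrierₛ λ y → proj₁ x * proj₁ y ≈ 1#
      inverseₛ (x , fx) x≉0 with inverse x x≉0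
      ... | y , xy≈1 = (y , *-cancelˡ x≉0 (begin
        x * frob t y         ≈⟨ *-congʳ fx ⟨
        frob t x * frob t y  ≈⟨ frob-* t x y ⟨
        frob t (x * y)       ≈⟨ frob-cong t xy≈1 ⟩
        frob t 1#            ≈⟨ frob-1 t ⟩
        1#                   ≈⟨ xy≈1 ⟨
        x * y                ∎)) , xy≈1
      completeₛ : ∀ (x : Carrierₛ) → Any (λ y → proj₁ x ≈ proj₁ y) (CommutativeRing.0# ring-structure ∷ applyUpTo power subOrder)
      completeₛ (x , fx) with x ≟ 0#
      ... | yes x≈0 = here x≈0
      ... | no x≉0 with generatesₛ x fx x≉0
      ...   | i , i<M , eq = there (Anyₚ.applyUpTo⁺ power eq i<M)

    subfield-order : length (FiniteField.elements subfield) ≡ p ℕ.^ t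
    subfield-order = ≡.trans (≡.cong suc (Listₚ.length-applyUpTo power subOrder)) suc-subOrder

-- Characteristic polynomials: field elements and prime powers

module FoldProduct (M : CommutativeMonoid 0ℓ 0ℓ) where
  open CommutativeMonoid M
  open InitialProduct M

  foldr-upTo : ∀ n (f : ℕ → Carrier) → foldr _∙_ ε (map f (upTo n)) ≡ prod n f
  foldr-upTo n f = ≡.trans (≡.cong (foldr _∙_ ε) (Listₚ.map-upTo f n)) (go n f)
    where
    go : ∀ n (f : ℕ → Carrier) → foldr _∙_ ε (applyUpTo f n) ≡ prod n f
    go zero    f = ≡.refl
    go (suc n) f = ≡.cong (f 0 ∙_) (go n (f ∘ suc))

least-positive : {Q : ℕ → Set} → (∀ i → Dec (Q i)) → ∀ {t} → 0 ℕ.< t → Q t →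
                 ∃ λ d → 0 ℕ.< d × Q d × (∀ i → 0 ℕ.< i → i ℕ.< d → ¬ Q i)
least-positive {Q} Q? 0<t Qt = go _ (<-wellFounded _) 0<t Qt
  where
  go : ∀ t → Acc ℕ._<_ t → 0 ℕ.< t → Q t → ∃ λ d → 0 ℕ.< d × Q d × (∀ i → 0 ℕ.< i → i ℕ.< d → ¬ Q i)
  go t (acc rec) 0<t Qt with ℕₚ.anyUpTo? {P = λ i → 0 ℕ.< i × Q i} (λ i → (0 ℕ.<? i) ×-dec Q? i) t
  ... | yes (i , i<t , 0<i , Qi) = go i (rec i<t) 0<i Qi
  ... | no none = t , 0<t , Qt , λ i 0<i i<t Qi → none (i , i<t , 0<i , Qi)

module Correspondence
  (F : FiniteField) (p m : ℕ) (prime : Prime p)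
  (order : length (FiniteField.elements F) ≡ p ℕ.^ m)
  (γ : FiniteField.Carrier F) (γ-primitive : FF.Primitive F p m γ) (0<m : 0 ℕ.< m)
  (t n : ℕ) (m≡nt : m ≡ n ℕ.* t) (0<n : 0 ℕ.< n) (0<t : 0 ℕ.< t) where
  open CyclicField F p m prime order γ γ-primitive
  open FiniteField F
  open FF F using (pow; Tr; Nm)
  module SubK = Subfield t n m≡nt 0<n 0<t
  module Subk = Subfield 1 m (≡.sym (ℕₚ.*-identityʳ m)) 0<m (s≤s z≤n)

  K k : FiniteField
  K = SubK.subfield
  k = Subk.subfield

  module K = FiniteField K
  module k = FiniteField k
  module PF = FieldPoly F
  module Pk = Factorization k
  private
    module S = CommutativeRing PF.seriesRing
    module SF = PrimePowerSums F
    module SFk = PrimePowerSums k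

  open PF using (Series; _≋_; _⊛_; linear; Monic; monic-⊛; _∣ₚ_)
  open InitialProduct S.*-commutativeMonoid using (prod; prod-cong; prod-periodic; prod-rotate) renaming (power to powerF; power-cong to powerF-cong)

  embed : Pk.Series → Series
  embed P i = proj₁ (P i)

  embed-⊛ : ∀ P Q → embed (P Pk.⊛ Q) ≋ embed P ⊛ embed Q
  embed-⊛ P Q zero    = refl
  embed-⊛ P Q (suc i) = +-congˡ (embed-⊛ (P ∘ suc) Q i)

  embed-1s : embed Pk.1s ≋ PF.1s
  embed-1s zero    = refl
  embed-1s (suc i) = refl

  embed-power : ∀ P j → embed (Pk.power P j) ≋ powerF (embed P) j
  embed-power P zero    = embed-1s
  embed-power P (suc j) = S.trans (embed-⊛ P (Pk.power P j)) (S.*-congˡ {embed P} (embed-power P j))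

  Φ : Series → Series
  Φ P i = frob 1 (P i)

  Φ-⊛ : ∀ P Q → Φ (P ⊛ Q) ≋ Φ P ⊛ Φ Q
  Φ-⊛ P Q zero    = frob-* 1 (P 0) (Q 0)
  Φ-⊛ P Q (suc i) = trans (frob-+ 1 _ _) (+-cong (frob-* 1 (P 0) (Q (suc i))) (Φ-⊛ (P ∘ suc) Q i))

  Φ-linear : ∀ y → Φ (linear y) ≋ linear (frob 1 y)
  Φ-linear y zero          = refl
  Φ-linear y (suc zero)    = frob-1 1
  Φ-linear y (suc (suc i)) = frob-zero 1

  Φ-prod : ∀ n f → Φ (prod n f) ≋ prod n (Φ ∘ f)
  Φ-prod zero    f zero    = frob-1 1
  Φ-prod zero    f (suc i) = frob-zero 1
  Φ-prod (suc n) f = S.trans (Φ-⊛ (f 0) (prod n (f ∘ suc))) (S.*-congˡ {Φ (f 0)} (Φ-prod n (f ∘ suc)))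

  linear-cong : ∀ {y z} → y ≈ z → linear y ≋ linear z
  linear-cong eq zero          = eq
  linear-cong eq (suc zero)    = refl
  linear-cong eq (suc (suc i)) = refl

  abstract
    prod-monic : ∀ n {f} → (∀ i → Monic 1 (f i)) → Monic n (prod n f)
    prod-monic zero    h = PF.monic-1s
    prod-monic (suc n) h = monic-⊛ (h 0) (prod-monic n (h ∘ suc))

  -- The factors are X + x^(p^i), so that the coefficients are norm and trace without signs.
  orbitPoly : ℕ → Carrier → Series
  orbitPoly d x = prod d (λ i → linear (frob i x))

  abstract
    orbitPoly-monic : ∀ d x → Monic d (orbitPoly d x)
    orbitPoly-monic d x = prod-monic d (λ i → PF.linear-monic (frob i x))

  abstract
    -- Frobenius carries each factor to the next one, and the cycle closes because x^(p^d) = x. So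
    -- the coefficients lie in F_p.
    orbitPoly-fixed : ∀ d x → frob d x ≈ x → Φ (orbitPoly d x) ≋ orbitPoly d x
    orbitPoly-fixed d x fx = S.trans (Φ-prod d _) (S.trans
      (prod-cong d (λ i → S.trans (Φ-linear (frob i x)) (linear-cong (sym (frob-frob 1 i x)))))
      (prod-rotate d (λ i → linear (frob i x)) (linear-cong (trans fx (sym (frob-0 x))))))

  charPoly : ∀ d x → frob d x ≈ x → Pk.Mono d
  charPoly d x fx = (λ i → orbitPoly d x i , orbitPoly-fixed d x fx i) , orbitPoly-monic d x

  linear∣orbitPoly : ∀ d x → 0 ℕ.< d → linear x ∣ₚ orbitPoly d x
  linear∣orbitPoly (suc d) x _ = prod d (λ i → linear (frob (suc i) x)) ,
    PF.monic-bounded (prod-monic d (λ i → PF.linear-monic (frob (suc i) x))) ,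
    S.*-congʳ {prod d (λ i → linear (frob (suc i) x))} (linear-cong (sym (frob-0 x)))

  -- D has coefficients in F_p and is fixed by Frobenius, which turns the factor X + y into X + y^p.
  conjugate-divides : ∀ {D y} → Pk.Bounded D → linear y ∣ₚ embed D → ∀ i → linear (frob i y) ∣ₚ embed D
  conjugate-divides {D} {y} bD (Q , bQ , eq) zero = Q , bQ , S.trans (S.*-congʳ {Q} (linear-cong (frob-0 y))) eq
  conjugate-divides {D} {y} bD div (suc i) with conjugate-divides {D} bD div i
  ... | Q , (N , bQ) , eq = Φ Q , (N , λ j le → trans (frob-cong 1 (bQ j le)) (frob-zero 1)) ,
    S.trans (S.*-congʳ {Φ Q} (S.trans (linear-cong (frob-frob 1 i y)) (S.sym (Φ-linear (frob i y)))))
    (S.trans (S.sym (Φ-⊛ (linear (frob i y)) Q))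
    (S.trans (λ j → frob-cong 1 (eq j)) (λ j → proj₂ (D j))))

  frob-multiple : ∀ {d x} j → frob d x ≈ x → frob (j ℕ.* d) x ≈ x
  frob-multiple {d} {x} zero fx = frob-0 x
  frob-multiple {d} {x} (suc j) fx = trans (frob-frob d (j ℕ.* d) x) (trans (frob-cong d (frob-multiple j fx)) fx)

  module Minimal (x : Carrier) (d : ℕ) (0<d : 0 ℕ.< d) (fx : frob d x ≈ x)
                 (minimal : ∀ i → 0 ℕ.< i → i ℕ.< d → ¬ (frob i x ≈ x)) where

    period-divides : ∀ {s} → frob s x ≈ x → d ∣ s
    period-divides {s} fs = remainder (s ℕ.% d) ≡.refl
      where
      instance d≢0 = ℕ.>-nonZero 0<d
      remainder : ∀ r → s ℕ.% d ≡ r → d ∣ s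
      remainder zero    eq = ∣.m%n≡0⇒n∣m s d eq
      remainder (suc r) eq = ⊥-elim (minimal (suc r) (s≤s z≤n) (≡.subst (ℕ._< d) eq (m%n<n s d)) (trans
        (frob-cong (suc r) (sym (frob-multiple (s ℕ./ d) fx)))
        (trans (sym (frob-frob (suc r) (s ℕ./ d ℕ.* d) x))
        (trans (reflexive (≡.cong (λ z → frob z x) (≡.sym (≡.trans (m≡m%n+[m/n]*n s d) (≡.cong (ℕ._+ s ℕ./ d ℕ.* d) eq))))) fs))))

    conjugates-distinct : ∀ {i j} → i ℕ.< j → j ℕ.< d → ¬ (frob i x ≈ frob j x)
    -- Applying the Frobenius power d - j to x^(p^i) = x^(p^j) makes x fixed under the power d - j +
    -- i, which lies strictly between 0 and d.
    conjugates-distinct {i} {j} i<j j<d eq = minimal (d ℕ.∸ j ℕ.+ i)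
      (ℕₚ.<-≤-trans (ℕₚ.m<n⇒0<n∸m j<d) (ℕₚ.m≤m+n _ i))
      (≡.subst (d ℕ.∸ j ℕ.+ i ℕ.<_) (ℕₚ.m∸n+n≡m (ℕₚ.<⇒≤ j<d)) (ℕₚ.+-monoʳ-< (d ℕ.∸ j) i<j))
      (trans (frob-frob (d ℕ.∸ j) i x) (trans (frob-cong (d ℕ.∸ j) eq)
        (trans (sym (frob-frob (d ℕ.∸ j) j x)) (trans (reflexive (≡.cong (λ z → frob z x) (ℕₚ.m∸n+n≡m (ℕₚ.<⇒≤ j<d)))) fx))))

    degree≥period : ∀ {e D} → Pk.Monic e D → linear x ∣ₚ embed D → d ℕ.≤ e
    degree≥period {e} {D} mD div = ≡.subst (ℕ._≤ e) (Listₚ.length-applyUpTo (λ i → frob i x) d)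
      (PF.root-bound mD (applyUpTo (λ i → frob i x) d) (AllPairsₚ.applyUpTo⁺₁ _ d conjugates-distinct)
        (Allₚ.applyUpTo⁺₂ (λ i → frob i x) d (conjugate-divides {D} (Pk.monic-bounded {e} {D} mD) div)))

    -- Euclid's lemma is used over the large field: X + x divides one of the two factors, which then
    -- contains all d distinct conjugates and has degree at least d, so the other has degree 0.
    minimalPoly-irreducible : Pk.Irreducible d (proj₁ (charPoly d x fx))
    minimalPoly-irreducible = record { monic = proj₂ (charPoly d x fx) ; positive = 0<d ; split = split }
      where
      split : ∀ {a b D E} → Pk.Monic a D → Pk.Monic b E → D Pk.⊛ E Pk.≋ proj₁ (charPoly d x fx) → a ≡ 0 ⊎ b ≡ 0
      split {a} {b} {D} {E} mD mE eq with PF.euclid (PF.linear-irreducible x) (Pk.monic-bounded {a} {D} mD) (Pk.monic-bounded {b} {E} mE)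
              (PF.∣ₚ-resp (S.sym (S.trans (S.sym (embed-⊛ D E)) eq)) (linear∣orbitPoly d x 0<d))
      ... | inj₁ x∣D = inj₂ (ℕₚ.n≤0⇒n≡0 (ℕₚ.+-cancelˡ-≤ a b 0 (ℕₚ.≤-trans (ℕₚ.≤-reflexive a+b≡d) (ℕₚ.≤-trans (degree≥period {a} {D} mD x∣D) (ℕₚ.m≤m+n a 0)))))
        where
        a+b≡d : a ℕ.+ b ≡ d
        a+b≡d = Pk.monic-degree {d} {a ℕ.+ b} {proj₁ (charPoly d x fx)} (proj₂ (charPoly d x fx))
          (Pk.monic-≋ {a ℕ.+ b} {D Pk.⊛ E} {proj₁ (charPoly d x fx)} eq (Pk.monic-⊛ {a} {b} {D} {E} mD mE))
      ... | inj₂ x∣E = inj₁ (ℕₚ.n≤0⇒n≡0 (ℕₚ.+-cancelʳ-≤ b a 0 (ℕₚ.≤-trans (ℕₚ.≤-reflexive a+b≡d) (degree≥period {b} {E} mE x∣E))))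
        where
        a+b≡d : a ℕ.+ b ≡ d
        a+b≡d = Pk.monic-degree {d} {a ℕ.+ b} {proj₁ (charPoly d x fx)} (proj₂ (charPoly d x fx))
          (Pk.monic-≋ {a ℕ.+ b} {D Pk.⊛ E} {proj₁ (charPoly d x fx)} eq (Pk.monic-⊛ {a} {b} {D} {E} mD mE))

    charPoly-power : ∀ j {s} (fs : frob s x ≈ x) → s ≡ j ℕ.* d →
                     Pk.power (proj₁ (charPoly d x fx)) j Pk.≋ proj₁ (charPoly s x fs)
    charPoly-power j fs ≡.refl = S.trans (embed-power (proj₁ (charPoly d x fx)) j)
      (S.sym (prod-periodic j d (λ i → linear (frob i x)) (λ i → linear-cong
        (trans (reflexive (≡.cong (λ z → frob z x) (ℕₚ.+-comm d i))) (trans (frob-frob i d x) (frob-cong i fx))))))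

  char : K.Carrier → Pk.Mono t
  char (x , fx) = charPoly t x fx

  open ℕSum
  open Pk using (PrimePower; primePower; primePowers)
  open PrimePower using (degree; size; value; value-monic)
  open TightSums

  match? : ∀ x H → Dec (proj₁ (char x) Pk.≋ value H)
  match? x H = Pk.≋-dec-monic {t} {size H} {proj₁ (char x)} {value H} (proj₂ (char x)) (value-monic H)

  hit : K.Carrier → PrimePower → ℕ
  hit x H = ⟦ size H ℕ.≟ t ⟧ ℕ.* ⟦ match? x H ⟧

  private
    sum-filter : {A : Set} {P : A → Set} (P? : ∀ x → Dec (P x)) → ∀ xs → sum xs (λ x → ⟦ P? x ⟧) ≡ length (filter P? xs)
    sum-filter P? [] = ≡.refl
    sum-filter P? (x ∷ xs) with P? x
    ... | yes _ = ≡.cong suc (sum-filter P? xs)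
    ... | no  _ = sum-filter P? xs

    -- If the characteristic polynomial of x is a power of P, then X + x divides P. Distinct x give
    -- distinct linear factors of P.
    roots≤degree : ∀ H → sum K.elements (λ x → ⟦ match? x H ⟧) ℕ.≤ degree H
    roots≤degree H@(primePower ((P , mP) , irr) i) = ≡.subst (ℕ._≤ degree H)
      (≡.trans (Listₚ.length-map proj₁ matching) (≡.sym (sum-filter (λ x → match? x H) K.elements)))
      (PF.root-bound mP (map proj₁ matching) (AllPairsₚ.map⁺ (AllPairsₚ.filter⁺ (λ x → match? x H) K.unique))
        (Allₚ.map⁺ (All.map (λ {x} → root {x}) (Allₚ.all-filter (λ x → match? x H) K.elements))))
      where
      matching : List K.Carrier
      matching = filter (λ x → match? x H) K.elements
      descend : ∀ {y} j → linear y ∣ₚ embed (Pk.power P (suc j)) → linear y ∣ₚ embed P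
      descend {y} zero div = PF.∣ₚ-resp (S.trans (embed-power P 1) (S.*-identityʳ (embed P))) div
      descend {y} (suc j) div = [ (λ d → d) , descend j ]′
        (PF.euclid (PF.linear-irreducible y) (Pk.monic-bounded {degree H} {P} mP) (Pk.monic-bounded {suc j ℕ.* degree H} {Pk.power P (suc j)} (Pk.monic-power (suc j) mP))
          (PF.∣ₚ-resp (embed-⊛ P (Pk.power P (suc j))) div))
      root : ∀ {x} → proj₁ (char x) Pk.≋ value H → linear (proj₁ x) ∣ₚ embed P
      root {x , fx} eq = descend i (PF.∣ₚ-resp eq (linear∣orbitPoly t x 0<t))

    term≤sum : ∀ n (f : ℕ → ℕ) e → e ℕ.< n → f e ℕ.≤ sum (upTo n) f
    term≤sum (suc n) f zero    _ = ℕₚ.m≤m+n (f 0) _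
    term≤sum (suc n) f (suc e) (s≤s e<n) = ≡.subst (f (suc e) ℕ.≤_) (≡.sym (IntervalSum.sum-upTo-suc ℕₚ.+-*-commutativeSemiring n f))
      (ℕₚ.≤-trans (term≤sum n (f ∘ suc) e e<n) (ℕₚ.m≤n+m _ (f 0)))

    -- With d the least period of x under Frobenius, the orbit product over d steps is irreducible
    -- and the characteristic polynomial is its power with exponent t / d.
    some-hit : ∀ x → 1 ℕ.≤ sum (primePowers t) (hit x)
    some-hit (x , fx) with least-positive (λ i → frob i x ≟ x) 0<t fx
    ... | zero , () , _
    ... | suc d , 0<d , fd , minimal = from-period (Minimal.period-divides x (suc d) 0<d fd minimal fx)
      where
      open Minimal x (suc d) 0<d fd minimal
      P₀ = proj₁ (charPoly (suc d) x fd)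
      from-period : suc d ∣ t → 1 ℕ.≤ sum (primePowers t) (hit (x , fx))
      from-period (∣.divides zero t≡0) = ⊥-elim (ℕₚ.<-irrefl (≡.sym t≡0) 0<t)
      from-period (∣.divides (suc i) t≡) = ≡.subst (1 ℕ.≤_) (≡.sym (Pk.sum-primePowers ℕₚ.+-*-commutativeSemiring t (hit (x , fx))))
        (ℕₚ.≤-trans (ℕₚ.≤-trans (ℕₚ.≤-reflexive (≡.sym (Pk.irreducible-count minimalPoly-irreducible)))
          (sum-mono (λ P → ℕₚ.≤-trans (one-hit P) (term≤sum t (λ j → hit (x , fx) (primePower P j)) i i<t)) (Pk.irreds d)))
          (term≤sum t (λ d → sum (Pk.irreds d) (λ P → sum (upTo t) (λ j → hit (x , fx) (primePower P j)))) d d<t))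
        where
        i<t : i ℕ.< t
        i<t = ≡.subst (suc i ℕ.≤_) (≡.sym t≡) (ℕₚ.m≤m*n (suc i) (suc d))
        d<t : d ℕ.< t
        d<t = ≡.subst (suc d ℕ.≤_) (≡.sym t≡) (ℕₚ.m≤n*m (suc d) (suc i))
        one-hit : ∀ P → ⟦ Pk.≋-dec-monic (proj₂ (proj₁ P)) (Pk.Irreducible.monic minimalPoly-irreducible) ⟧ ℕ.≤ hit (x , fx) (primePower P i)
        one-hit P = by-cases (Pk.≋-dec-monic (proj₂ (proj₁ P)) (Pk.Irreducible.monic minimalPoly-irreducible))
          where
          by-cases : (same? : Dec (proj₁ (proj₁ P) Pk.≋ P₀)) → ⟦ same? ⟧ ℕ.≤ hit (x , fx) (primePower P i)
          by-cases (no _) = z≤n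
          by-cases (yes P≋P₀) = ℕₚ.≤-reflexive (≡.sym (≡.cong₂ ℕ._*_ (⟦⟧-true (≡.sym t≡) (size (primePower P i) ℕ.≟ t))
               (⟦⟧-true (S.sym (S.trans
                 (S.trans (embed-power (proj₁ (proj₁ P)) (suc i)) (S.trans (powerF-cong (suc i) P≋P₀) (S.sym (embed-power P₀ (suc i)))))
                 (charPoly-power (suc i) fx t≡))) (match? (x , fx) (primePower P i)))))

    q≡p : SFk.q ≡ p
    q≡p = ≡.trans Subk.subfield-order (ℕₚ.^-identityʳ p)

    weight : PrimePower → ℕ
    weight H = degree H ℕ.* ⟦ size H ℕ.≟ t ⟧

    total-weight : sum (primePowers t) weight ≡ length K.elements
    total-weight = ≡.trans (go t 0<t) (≡.sym SubK.subfield-order)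
      where
      go : ∀ s → 0 ℕ.< s → sum (primePowers s) (λ H → degree H ℕ.* ⟦ size H ℕ.≟ s ⟧) ≡ p ℕ.^ s
      go (suc s) _ = ≡.trans (SFk.degree-sum ℕₚ.≤-refl) (≡.cong (ℕ._^ suc s) q≡p)

    hits≤weight : ∀ H → sum K.elements (λ x → hit x H) ℕ.≤ weight H
    hits≤weight H = ℕₚ.≤-trans (ℕₚ.≤-reflexive (*-sum ⟦ size H ℕ.≟ t ⟧ K.elements _))
      (ℕₚ.≤-trans (ℕₚ.*-monoʳ-≤ ⟦ size H ℕ.≟ t ⟧ (roots≤degree H)) (ℕₚ.≤-reflexive (ℕₚ.*-comm ⟦ size H ℕ.≟ t ⟧ (degree H))))

    swap : sum K.elements (λ x → sum (primePowers t) (hit x)) ≡ sum (primePowers t) (λ H → sum K.elements (λ x → hit x H))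
    swap = sum-swap K.elements (primePowers t) hit

    -- In the chain p^t ≤ number of hits ≤ Σ Λ(H) = p^t, closed by the prime polynomial theorem,
    -- both inequalities are termwise, hence termwise equalities.
    each-x : All (λ x → 1 ≡ sum (primePowers t) (hit x)) K.elements
    each-x = tight some-hit K.elements (ℕₚ.≤-trans (ℕₚ.≤-reflexive swap)
      (ℕₚ.≤-trans (sum-mono hits≤weight (primePowers t)) (ℕₚ.≤-reflexive (≡.trans total-weight (≡.sym (sum-one K.elements))))))

    each-H : All (λ H → sum K.elements (λ x → hit x H) ≡ weight H) (primePowers t)
    each-H = tight hits≤weight (primePowers t) (ℕₚ.≤-trans (ℕₚ.≤-reflexive (≡.trans total-weight (≡.sym (sum-one K.elements))))
      (ℕₚ.≤-trans (sum-mono some-hit K.elements) (ℕₚ.≤-reflexive swap)))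

  -- Summing over K is summing over prime powers: every prime power of degree t has at most deg P roots, and the totals agree.
  module _ (R : CommutativeSemiring 0ℓ 0ℓ) where
    private
      module R = CommutativeSemiring R
      module L = ListSum R
    open MultP R.semiring using () renaming (_×_ to _×ᴿ_; ×1-homo-* to ×ᴿ-homo-*)
    open SetoidR R.setoid

    private
      sum-cong-All : {A : Set} {f g : A → R.Carrier} → ∀ {xs} → All (λ x → f x R.≈ g x) xs → L.sum xs f R.≈ L.sum xs g
      sum-cong-All []       = R.refl
      sum-cong-All (h ∷ hs) = R.+-cong h (sum-cong-All hs)

    sum-correspondence : (f : Pk.Series → R.Carrier) → (∀ {P Q} → P Pk.≋ Q → f P R.≈ f Q) →
      L.sum K.elements (λ x → f (proj₁ (char x))) R.≈
      L.sum (primePowers t) (λ H → (degree H ×ᴿ R.1#) R.* (L.⟦ size H ℕ.≟ t ⟧ R.* f (value H)))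
    sum-correspondence f f-cong = begin
      L.sum K.elements (λ x → f (proj₁ (char x)))
        ≈⟨ sum-cong-All (All.map (λ {x} eq → R.sym (R.trans (R.*-congʳ
             (R.trans (R.reflexive (≡.cong (_×ᴿ R.1#) (≡.sym eq))) (R.+-identityʳ R.1#))) (R.*-identityˡ _))) each-x) ⟩
      L.sum K.elements (λ x → (sum (primePowers t) (hit x) ×ᴿ R.1#) R.* f (proj₁ (char x)))
        ≈⟨ L.sum-cong (λ x → R.trans (R.*-congʳ (sum-fromℕ R (hit x) (primePowers t))) (R.sym (L.sum-* (primePowers t) _ _))) K.elements ⟩
      L.sum K.elements (λ x → L.sum (primePowers t) (λ H → (hit x H ×ᴿ R.1#) R.* f (proj₁ (char x))))
        ≈⟨ L.sum-swap K.elements (primePowers t) _ ⟩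
      L.sum (primePowers t) (λ H → L.sum K.elements (λ x → (hit x H ×ᴿ R.1#) R.* f (proj₁ (char x))))
        ≈⟨ L.sum-cong (λ H → R.trans (L.sum-cong (λ x → at-hit x H) K.elements) (L.sum-* K.elements _ _)) (primePowers t) ⟩
      L.sum (primePowers t) (λ H → L.sum K.elements (λ x → hit x H ×ᴿ R.1#) R.* f (value H))
        ≈⟨ L.sum-cong (λ H → R.*-congʳ (R.sym (sum-fromℕ R (λ x → hit x H) K.elements))) (primePowers t) ⟩
      L.sum (primePowers t) (λ H → (sum K.elements (λ x → hit x H) ×ᴿ R.1#) R.* f (value H))
        ≈⟨ sum-cong-All (All.map (λ {H} eq → R.trans (R.*-congʳ (R.trans (R.reflexive (≡.cong (_×ᴿ R.1#) eq))
             (R.trans (×ᴿ-homo-* (degree H) ⟦ size H ℕ.≟ t ⟧) (R.*-congˡ (⟦⟧-fromℕ R (size H ℕ.≟ t)))))) (R.*-assoc _ _ _)) each-H) ⟩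
      L.sum (primePowers t) (λ H → (degree H ×ᴿ R.1#) R.* (L.⟦ size H ℕ.≟ t ⟧ R.* f (value H))) ∎
      where
      at-hit : ∀ x H → (hit x H ×ᴿ R.1#) R.* f (proj₁ (char x)) R.≈ (hit x H ×ᴿ R.1#) R.* f (value H)
      at-hit x H with match? x H
      ... | yes eq = R.*-congˡ (f-cong eq)
      ... | no _   = R.trans (zero-hit _) (R.sym (zero-hit _))
        where
        zero-hit : ∀ c → ((⟦ size H ℕ.≟ t ⟧ ℕ.* 0) ×ᴿ R.1#) R.* c R.≈ R.0#
        zero-hit c = R.trans (R.*-congʳ (R.reflexive (≡.cong (_×ᴿ R.1#) (ℕₚ.*-zeroʳ ⟦ size H ℕ.≟ t ⟧)))) (R.zeroˡ c)

  module Sum+ = InitialProduct +-commutativeMonoid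
  module Prod* = InitialProduct *-commutativeMonoid

  prod-constant : ∀ n f → prod n f 0 ≈ Prod*.prod n (λ i → f i 0)
  prod-constant zero    f = refl
  prod-constant (suc n) f = *-congˡ (prod-constant n (f ∘ suc))

  prod-sub : ∀ n y → SF.sub n (prod n (linear ∘ y)) ≈ Sum+.prod n y
  prod-sub zero    y = refl
  prod-sub (suc n) y = trans (SF.sub-⊛ 1 n (PF.linear-monic (y 0)) (prod-monic n (λ i → PF.linear-monic (y (suc i)))))
    (+-congˡ (prod-sub n (y ∘ suc)))

  char-constant : ∀ x → proj₁ (proj₁ (char x) 0) ≈ Prod*.prod t (λ i → frob i (proj₁ x))
  char-constant (x , fx) = prod-constant t (λ i → linear (frob i x))

  sub-embed : ∀ s P → proj₁ (SFk.sub s P) ≈ SF.sub s (embed P)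
  sub-embed zero    P = refl
  sub-embed (suc s) P = refl

  char-sub : ∀ x → proj₁ (SFk.sub t (proj₁ (char x))) ≈ Sum+.prod t (λ i → frob i (proj₁ x))
  char-sub (x , fx) = trans (sub-embed t (proj₁ (charPoly t x fx))) (prod-sub t (λ i → frob i x))

  frob-periodic : ∀ {x} → frob t x ≈ x → ∀ i → frob (t ℕ.+ i) x ≈ frob i x
  frob-periodic {x} fx i = trans (reflexive (≡.cong (λ z → frob z x) (ℕₚ.+-comm t i))) (trans (frob-frob i t x) (frob-cong i fx))

  norm-fixed : ∀ x → Nm p m (proj₁ x) ≈ pow (proj₁ (proj₁ (char x) 0)) n
  norm-fixed (x , fx) = trans (reflexive (FoldProduct.foldr-upTo *-commutativeMonoid m (λ i → frob i x)))
    (trans (reflexive (≡.cong (λ z → Prod*.prod z (λ i → frob i x)) m≡nt))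
    (trans (Prod*.prod-periodic n t (λ i → frob i x) (frob-periodic fx))
    (trans (Prod*.power-cong n (sym (char-constant (x , fx)))) (as-pow n))))
    where
    as-pow : ∀ {y} n → Prod*.power y n ≈ pow y n
    as-pow zero    = refl
    as-pow (suc n) = *-congˡ (as-pow n)

  trace-fixed : ∀ x → Tr p m (proj₁ x) ≈ (n ·1) * proj₁ (SFk.sub t (proj₁ (char x)))
  trace-fixed (x , fx) = trans (reflexive (FoldProduct.foldr-upTo +-commutativeMonoid m (λ i → frob i x)))
    (trans (reflexive (≡.cong (λ z → Sum+.prod z (λ i → frob i x)) m≡nt))
    (trans (Sum+.prod-periodic n t (λ i → frob i x) (frob-periodic fx))
    (trans (Sum+.power-cong n (sym (char-sub (x , fx)))) (as-mult n))))
    where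
    as-mult : ∀ {y} n → Sum+.power y n ≈ (n ·1) * y
    as-mult {y} zero    = sym (zeroˡ y)
    as-mult {y} (suc n) = trans (+-cong (sym (*-identityˡ y)) (as-mult n)) (sym (distribʳ _ _ _))

-- Cubic characters and Jacobi sums

module Eisenstein where
  open ℤSolver.+-*-Solver
  open ≡ using (refl; cong; cong₂; sym; trans)

  infixl 6 _⊞_
  _⊞_ : ℤζ → ℤζ → ℤζ
  (u + v ζ) ⊞ (u′ + v′ ζ) = (u ℤ.+ u′) + (v ℤ.+ v′) ζ

  ⊟_ : ℤζ → ℤζ
  ⊟ (u + v ζ) = (ℤ.- u) + (ℤ.- v) ζ

  0ζ : ℤζ
  0ζ = (+ 0) + (+ 0) ζ

  ·-assoc : ∀ x y z → (x · y) · z ≡ x · (y · z)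
  ·-assoc (a + b ζ) (c + d ζ) (e + f ζ) = cong₂ _+_ζ
    (solve 6 (λ a b c d e f → (a :* c :- b :* d) :* e :- (a :* d :+ b :* c :- b :* d) :* f
       := a :* (c :* e :- d :* f) :- b :* (c :* f :+ d :* e :- d :* f)) refl a b c d e f)
    (solve 6 (λ a b c d e f → (a :* c :- b :* d) :* f :+ (a :* d :+ b :* c :- b :* d) :* e :- (a :* d :+ b :* c :- b :* d) :* f
       := a :* (c :* f :+ d :* e :- d :* f) :+ b :* (c :* e :- d :* f) :- b :* (c :* f :+ d :* e :- d :* f)) refl a b c d e f)

  ·-comm : ∀ x y → x · y ≡ y · x
  ·-comm (a + b ζ) (c + d ζ) = cong₂ _+_ζ
    (solve 4 (λ a b c d → a :* c :- b :* d := c :* a :- d :* b) refl a b c d)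
    (solve 4 (λ a b c d → a :* d :+ b :* c :- b :* d := c :* b :+ d :* a :- d :* b) refl a b c d)

  ·-identityˡ : ∀ x → oneζ · x ≡ x
  ·-identityˡ (a + b ζ) = cong₂ _+_ζ
    (solve 2 (λ a b → con (+ 1) :* a :- con (+ 0) :* b := a) refl a b)
    (solve 2 (λ a b → con (+ 1) :* b :+ con (+ 0) :* a :- con (+ 0) :* b := b) refl a b)

  ·-distribʳ : ∀ x y z → (y ⊞ z) · x ≡ y · x ⊞ z · x
  ·-distribʳ (a + b ζ) (c + d ζ) (e + f ζ) = cong₂ _+_ζ
    (solve 6 (λ a b c d e f → (c :+ e) :* a :- (d :+ f) :* b := (c :* a :- d :* b) :+ (e :* a :- f :* b)) refl a b c d e f)
    (solve 6 (λ a b c d e f → (c :+ e) :* b :+ (d :+ f) :* a :- (d :+ f) :* b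
       := (c :* b :+ d :* a :- d :* b) :+ (e :* b :+ f :* a :- f :* b)) refl a b c d e f)

  ringζ : CommutativeRing 0ℓ 0ℓ
  ringζ = record
    { Carrier = ℤζ ; _≈_ = _≡_ ; _+_ = _⊞_ ; _*_ = _·_ ; -_ = ⊟_ ; 0# = 0ζ ; 1# = oneζ
    ; isCommutativeRing = record
      { isRing = record
        { +-isAbelianGroup = record
          { isGroup = record
            { isMonoid = record
              { isSemigroup = record
                { isMagma = record { isEquivalence = ≡.isEquivalence ; ∙-cong = cong₂ _⊞_ }
                ; assoc = λ (a + b ζ) (c + d ζ) (e + f ζ) → cong₂ _+_ζ (ℤₚ.+-assoc a c e) (ℤₚ.+-assoc b d f) }
              ; identity = (λ (a + b ζ) → cong₂ _+_ζ (ℤₚ.+-identityˡ a) (ℤₚ.+-identityˡ b))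
                         , (λ (a + b ζ) → cong₂ _+_ζ (ℤₚ.+-identityʳ a) (ℤₚ.+-identityʳ b)) }
            ; inverse = (λ (a + b ζ) → cong₂ _+_ζ (ℤₚ.+-inverseˡ a) (ℤₚ.+-inverseˡ b))
                      , (λ (a + b ζ) → cong₂ _+_ζ (ℤₚ.+-inverseʳ a) (ℤₚ.+-inverseʳ b))
            ; ⁻¹-cong = cong ⊟_ }
          ; comm = λ (a + b ζ) (c + d ζ) → cong₂ _+_ζ (ℤₚ.+-comm a c) (ℤₚ.+-comm b d) }
        ; *-cong = cong₂ _·_
        ; *-assoc = ·-assoc
        ; *-identity = ·-identityˡ , λ x → trans (·-comm x oneζ) (·-identityˡ x)
        ; distrib = (λ x y z → trans (·-comm x (y ⊞ z)) (trans (·-distribʳ x y z) (cong₂ _⊞_ (·-comm y x) (·-comm z x))))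
                  , ·-distribʳ }
      ; *-comm = ·-comm } }

  semiringζ : CommutativeSemiring 0ℓ 0ℓ
  semiringζ = CommutativeRing.commutativeSemiring ringζ

  module Rζ = CommutativeRing ringζ
  module Iζ = IntegerMultiples ringζ

  ofℤ-* : ∀ x y → ofℤ (x ℤ.* y) ≡ ofℤ x · ofℤ y
  ofℤ-* x y = cong₂ _+_ζ
    (solve 2 (λ x y → x :* y := x :* y :- con (+ 0) :* con (+ 0)) refl x y)
    (solve 2 (λ x y → con (+ 0) := x :* con (+ 0) :+ con (+ 0) :* y :- con (+ 0) :* con (+ 0)) refl x y)

  ofℤ-injective : ∀ {x y} → ofℤ x ≡ ofℤ y → x ≡ y
  ofℤ-injective = cong re₀

  conj : ℤζ → ℤζ
  conj (u + v ζ) = (u ℤ.- v) + (ℤ.- v) ζ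

  conj-⊞ : ∀ x y → conj (x ⊞ y) ≡ conj x ⊞ conj y
  conj-⊞ (a + b ζ) (c + d ζ) = cong₂ _+_ζ
    (solve 4 (λ a b c d → a :+ c :- (b :+ d) := a :- b :+ (c :- d)) refl a b c d)
    (solve 2 (λ b d → :- (b :+ d) := :- b :+ :- d) refl b d)

  conj-· : ∀ x y → conj (x · y) ≡ conj x · conj y
  conj-· (a + b ζ) (c + d ζ) = cong₂ _+_ζ
    (solve 4 (λ a b c d → (a :* c :- b :* d) :- (a :* d :+ b :* c :- b :* d)
        := (a :- b) :* (c :- d) :- (:- b) :* (:- d)) refl a b c d)
    (solve 4 (λ a b c d → :- (a :* d :+ b :* c :- b :* d)
        := (a :- b) :* (:- d) :+ (:- b) :* (c :- d) :- (:- b) :* (:- d)) refl a b c d)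

  conj-conj : ∀ x → conj (conj x) ≡ x
  conj-conj (a + b ζ) = cong₂ _+_ζ (solve 2 (λ a b → a :- b :- (:- b) := a) refl a b) (solve 1 (λ b → :- (:- b) := b) refl b)

  ⊞-conj : ∀ x → x ⊞ conj x ≡ ofℤ (twoRe x)
  ⊞-conj (a + b ζ) = cong₂ _+_ζ (solve 2 (λ a b → a :+ (a :- b) := con (+ 2) :* a :- b) refl a b) (solve 1 (λ b → b :+ :- b := con (+ 0)) refl b)

  twoRe-ofℤ : ∀ c x → twoRe (ofℤ c · x) ≡ c ℤ.* twoRe x
  twoRe-ofℤ c (a + b ζ) = solve 3 (λ c a b → con (+ 2) :* (c :* a :- con (+ 0) :* b) :- (c :* b :+ con (+ 0) :* a :- con (+ 0) :* b)
    := c :* (con (+ 2) :* a :- b)) refl c a b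

  eisen-norm : ∀ a b → eisen a b · conj (eisen a b) ≡ ofℤ (a ℤ.* a ℤ.+ (+ 3) ℤ.* b ℤ.* b)
  eisen-norm a b = cong₂ _+_ζ
    (solve 2 (λ a b → (a :+ b) :* (a :+ b :- con (+ 2) :* b) :- con (+ 2) :* b :* (:- (con (+ 2) :* b))
       := a :* a :+ con (+ 3) :* b :* b) refl a b)
    (solve 2 (λ a b → (a :+ b) :* (:- (con (+ 2) :* b)) :+ con (+ 2) :* b :* (a :+ b :- con (+ 2) :* b) :- con (+ 2) :* b :* (:- (con (+ 2) :* b))
       := con (+ 0)) refl a b)

  ^ζ-+ : ∀ z m n → z ^ζ (m ℕ.+ n) ≡ (z ^ζ m) · (z ^ζ n)
  ^ζ-+ z zero    n = sym (·-identityˡ _)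
  ^ζ-+ z (suc m) n = trans (cong (z ·_) (^ζ-+ z m n)) (sym (·-assoc z (z ^ζ m) (z ^ζ n)))

  one-^ζ : ∀ n → oneζ ^ζ n ≡ oneζ
  one-^ζ zero    = refl
  one-^ζ (suc n) = trans (·-identityˡ _) (one-^ζ n)

  ζ³ᵐ : ∀ n → ζ′ ^ζ (n ℕ.* 3) ≡ oneζ
  ζ³ᵐ zero    = refl
  ζ³ᵐ (suc n) = trans (^ζ-+ ζ′ 3 (n ℕ.* 3)) (trans (·-identityˡ _) (ζ³ᵐ n))

  conj-ζ^ : ∀ i → conj (ζ′ ^ζ i) ≡ ζ′ ^ζ (2 ℕ.* i)
  conj-ζ^ zero    = refl
  conj-ζ^ (suc i) = trans (conj-· ζ′ (ζ′ ^ζ i)) (trans (cong (conj ζ′ ·_) (conj-ζ^ i))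
    (trans (sym (^ζ-+ ζ′ 2 (2 ℕ.* i))) (cong (ζ′ ^ζ_) (sym (ℕₚ.*-distribˡ-+ 2 1 i)))))

  ζ^-cube : ∀ i → (ζ′ ^ζ i) · ((ζ′ ^ζ i) · (ζ′ ^ζ i)) ≡ oneζ
  ζ^-cube i = trans (cong ((ζ′ ^ζ i) ·_) (sym (^ζ-+ ζ′ i i))) (trans (sym (^ζ-+ ζ′ i (i ℕ.+ i)))
    (trans (cong (ζ′ ^ζ_) (trans (cong (λ z → i ℕ.+ (i ℕ.+ z)) (sym (ℕₚ.+-identityʳ i))) (ℕₚ.*-comm 3 i))) (ζ³ᵐ i)))

  -- In coordinates (ζ - 1) z = 0 leads to 3 v = 0. This instance of cancellation is what makes
  -- character sums vanish.
  ζ-fixed⇒0 : ∀ z → ζ′ · z ≡ z → z ≡ 0ζ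
  ζ-fixed⇒0 (u + v ζ) eq = cong₂ _+_ζ u≡0 v≡0
    where
    -v≡u : ℤ.- v ≡ u
    -v≡u = trans (solve 2 (λ u v → :- v := con (+ 0) :* u :- con (+ 1) :* v) refl u v) (cong re₀ eq)
    u-v≡v : u ℤ.- v ≡ v
    u-v≡v = trans (solve 2 (λ u v → u :- v := con (+ 0) :* v :+ con (+ 1) :* u :- con (+ 1) :* v) refl u v) (cong im₀ eq)
    v≡0 : v ≡ + 0
    v≡0 = ℤₚ.*-cancelˡ-≡ (+ 3) v (+ 0) (trans (solve 2 (λ u v → con (+ 3) :* v := v :- (u :- v) :+ (u :- (:- v))) refl u v)
      (trans (cong₂ ℤ._+_ (cong (λ z → v ℤ.- z) u-v≡v) (cong (λ z → u ℤ.- z) -v≡u)) (solve 2 (λ u v → v :- v :+ (u :- u) := con (+ 0)) refl u v)))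
    u≡0 : u ≡ + 0
    u≡0 = trans (sym -v≡u) (cong ℤ.-_ v≡0)

module CubicCharacter
  (k : FiniteField) (p : ℕ) (prime : Prime p) (order : length (FiniteField.elements k) ≡ p ℕ.^ 1)
  (g : FiniteField.Carrier k) (g-primitive : FF.Primitive k p 1 g)
  (e : ℕ) (groupOrder≡ : p ℕ.^ 1 ℕ.∸ 1 ≡ e ℕ.* 3) where

  open FiniteField k
  open FF k using (pow)
  open CyclicField k p 1 prime order g g-primitive using (generates; γ-power≈1) renaming (γ≉0 to g≉0)
  open Powers k
  open Factorization k using (fieldEnum)
  open RingP ring using (-‿involutive; -0#≈0#)
  open IntegerMultiples commRing using (solve; _:+_; _:*_; :-_; _:-_; con; _:=_)
  open Eisenstein
  open ListSum semiringζ
  open EnumSum semiringζ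
  open ≡.≡-Reasoning

  private
    -- Exponents of g are determined modulo its order, a multiple of 3, so their class modulo 3 is
    -- well defined.
    ζ^-periodic : ∀ i j → i ℕ.≤ j → pow g i ≈ pow g j → ζ′ ^ζ i ≡ ζ′ ^ζ j
    ζ^-periodic i j i≤j eq with γ-power≈1 (j ℕ.∸ i) (pow-cancel i j g≉0 i≤j eq)
    ... | ∣.divides c j∸i≡ = ≡.sym (begin
      ζ′ ^ζ j                                  ≡⟨ ≡.cong (ζ′ ^ζ_) (ℕₚ.m+[n∸m]≡n i≤j) ⟨
      ζ′ ^ζ (i ℕ.+ (j ℕ.∸ i))                  ≡⟨ ^ζ-+ ζ′ i (j ℕ.∸ i) ⟩
      (ζ′ ^ζ i) · (ζ′ ^ζ (j ℕ.∸ i))            ≡⟨ ≡.cong (λ z → (ζ′ ^ζ i) · (ζ′ ^ζ z)) (≡.trans j∸i≡ (≡.trans (≡.cong (c ℕ.*_) groupOrder≡) (≡.sym (ℕₚ.*-assoc c e 3)))) ⟩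
      (ζ′ ^ζ i) · (ζ′ ^ζ (c ℕ.* e ℕ.* 3))      ≡⟨ ≡.cong ((ζ′ ^ζ i) ·_) (ζ³ᵐ (c ℕ.* e)) ⟩
      (ζ′ ^ζ i) · oneζ                         ≡⟨ Rζ.*-identityʳ _ ⟩
      ζ′ ^ζ i                                  ∎)

    ζ^-cong : ∀ i j → pow g i ≈ pow g j → ζ′ ^ζ i ≡ ζ′ ^ζ j
    ζ^-cong i j eq with ℕₚ.≤-total i j
    ... | inj₁ i≤j = ζ^-periodic i j i≤j eq
    ... | inj₂ j≤i = ≡.sym (ζ^-periodic j i j≤i (sym eq))

  abstract
    -- The discrete logarithm comes from a search and is sealed; outside this block χ is accessible
    -- only through `χ-zero` and `χ-power`.
    χ : Carrier → ℤζ
    χ x with x ≟ 0#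
    ... | yes _ = 0ζ
    ... | no x≉0 = ζ′ ^ζ proj₁ (generates x x≉0)

    χ-zero : ∀ {x} → x ≈ 0# → χ x ≡ 0ζ
    χ-zero {x} x≈0 with x ≟ 0#
    ... | yes _  = ≡.refl
    ... | no x≉0 = ⊥-elim (x≉0 x≈0)

    χ-power : ∀ {x} i → x ≈ pow g i → χ x ≡ ζ′ ^ζ i
    χ-power {x} i x≈gⁱ with x ≟ 0#
    ... | yes x≈0 = ⊥-elim (pow-nonzero i g≉0 (trans (sym x≈gⁱ) x≈0))
    ... | no x≉0 with generates x x≉0
    ...   | j , _ , x≈gʲ = ζ^-cong j i (trans (sym x≈gʲ) x≈gⁱ)

  dlog : ∀ {x} → ¬ (x ≈ 0#) → ∃ λ i → x ≈ pow g i
  dlog {x} x≉0 with generates x x≉0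
  ... | i , _ , eq = i , eq

  χ-cong : ∀ {x y} → x ≈ y → χ x ≡ χ y
  χ-cong {x} {y} x≈y with x ≟ 0#
  ... | yes x≈0 = ≡.trans (χ-zero x≈0) (≡.sym (χ-zero (trans (sym x≈y) x≈0)))
  ... | no x≉0 with dlog x≉0
  ...   | i , eq = ≡.trans (χ-power i eq) (≡.sym (χ-power i (trans (sym x≈y) eq)))

  χ-* : ∀ x y → χ (x * y) ≡ χ x · χ y
  χ-* x y with x ≟ 0# | y ≟ 0#
  ... | yes x≈0 | _ = ≡.trans (χ-zero (trans (*-congʳ x≈0) (zeroˡ y))) (≡.sym (≡.trans (≡.cong (_· χ y) (χ-zero x≈0)) (Rζ.zeroˡ (χ y))))
  ... | no _ | yes y≈0 = ≡.trans (χ-zero (trans (*-congˡ y≈0) (zeroʳ x))) (≡.sym (≡.trans (≡.cong (χ x ·_) (χ-zero y≈0)) (Rζ.zeroʳ (χ x))))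
  ... | no x≉0 | no y≉0 with dlog x≉0 | dlog y≉0
  ...   | i , x≈ | j , y≈ = ≡.trans (χ-power (i ℕ.+ j) (trans (*-cong x≈ y≈) (sym (pow-+ g i j))))
            (≡.trans (^ζ-+ ζ′ i j) (≡.sym (≡.cong₂ _·_ (χ-power i x≈) (χ-power j y≈))))

  χ-1 : χ 1# ≡ oneζ
  χ-1 = χ-power 0 refl

  χ-g : χ g ≡ ζ′
  χ-g = ≡.trans (χ-power 1 (sym (*-identityʳ g))) (Rζ.*-identityʳ ζ′)

  χ-cube : ∀ {x} → ¬ (x ≈ 0#) → χ x · (χ x · χ x) ≡ oneζ
  χ-cube x≉0 with dlog x≉0
  ... | i , eq = ≡.trans (≡.cong (λ z → z · (z · z)) (χ-power i eq)) (ζ^-cube i)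

  χ-unit : ∀ {x} → ¬ (x ≈ 0#) → conj (χ x) · χ x ≡ oneζ
  χ-unit x≉0 with dlog x≉0
  ... | i , eq = ≡.trans (≡.cong (λ z → conj z · z) (χ-power i eq))
    (≡.trans (≡.cong (_· (ζ′ ^ζ i)) (conj-ζ^ i)) (≡.trans (≡.sym (^ζ-+ ζ′ (2 ℕ.* i) i))
      (≡.trans (≡.cong (ζ′ ^ζ_) (≡.trans (ℕₚ.+-comm (2 ℕ.* i) i) (ℕₚ.*-comm 3 i))) (ζ³ᵐ i))))

  conj-χ : ∀ x → conj (χ x) ≡ χ x · χ x
  conj-χ x with x ≟ 0#
  ... | yes x≈0 = ≡.trans (≡.cong conj (χ-zero x≈0)) (≡.sym (≡.cong (λ z → z · z) (χ-zero x≈0)))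
  ... | no x≉0 with dlog x≉0
  ...   | i , eq = ≡.trans (≡.cong conj (χ-power i eq)) (≡.trans (conj-ζ^ i)
            (≡.trans (≡.cong (λ z → ζ′ ^ζ (i ℕ.+ z)) (ℕₚ.+-identityʳ i)) (≡.trans (^ζ-+ ζ′ i i) (≡.sym (≡.cong (λ z → z · z) (χ-power i eq))))))

  -1≉0 : ¬ (- 1# ≈ 0#)
  -1≉0 eq = 1≉0 (trans (sym (-‿involutive 1#)) (trans (-‿cong eq) -0#≈0#))

  -- −1 is a cube.
  χ-neg : ∀ x → χ (- x) ≡ χ x
  χ-neg x = begin
    χ (- x)                 ≡⟨ χ-cong (solve 1 (λ x → :- x := con (ℤ.- (+ 1)) :* x) refl x) ⟩
    χ (- 1# * x)            ≡⟨ χ-* (- 1#) x ⟩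
    χ (- 1#) · χ x          ≡⟨ ≡.cong (_· χ x) χ-minus-one ⟩
    oneζ · χ x              ≡⟨ Rζ.*-identityˡ (χ x) ⟩
    χ x                     ∎
    where
    χ-minus-one : χ (- 1#) ≡ oneζ
    χ-minus-one = begin
      χ (- 1#)                              ≡⟨ χ-cong (solve 0 (con (ℤ.- (+ 1)) := con (ℤ.- (+ 1)) :* (con (ℤ.- (+ 1)) :* con (ℤ.- (+ 1)))) refl) ⟩
      χ (- 1# * (- 1# * - 1#))              ≡⟨ ≡.trans (χ-* _ _) (≡.cong (χ (- 1#) ·_) (χ-* _ _)) ⟩
      χ (- 1#) · (χ (- 1#) · χ (- 1#))      ≡⟨ χ-cube -1≉0 ⟩
      oneζ                                  ∎

  reindex : (φ ψ : Carrier → Carrier) → (∀ {x y} → x ≈ y → φ x ≈ φ y) → (∀ {x y} → x ≈ y → ψ x ≈ ψ y) →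
            (∀ x → ψ (φ x) ≈ x) → (∀ y → φ (ψ y) ≈ y) →
            (f : Carrier → ℤζ) → (∀ {x y} → x ≈ y → f x ≡ f y) → sum elements f ≡ sum elements (f ∘ φ)
  reindex φ ψ φ-cong ψ-cong ψφ φψ f f-cong = ≡.sym (sum-bijection fieldEnum fieldEnum φ ψ φ-cong ψ-cong ψφ φψ f f-cong)

  reindex-* : ∀ {c} → ¬ (c ≈ 0#) → (f : Carrier → ℤζ) → (∀ {x y} → x ≈ y → f x ≡ f y) → sum elements f ≡ sum elements (λ x → f (c * x))
  reindex-* {c} c≉0 f f-cong with inverse c c≉0
  ... | c⁻¹ , cc⁻¹≈1 = reindex (c *_) (c⁻¹ *_) *-congˡ *-congˡ
    (λ x → trans (sym (*-assoc _ _ _)) (trans (*-congʳ (trans (*-comm _ _) cc⁻¹≈1)) (*-identityˡ x)))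
    (λ x → trans (sym (*-assoc _ _ _)) (trans (*-congʳ cc⁻¹≈1) (*-identityˡ x))) f f-cong

  reindex-reflect : ∀ a (f : Carrier → ℤζ) → (∀ {x y} → x ≈ y → f x ≡ f y) → sum elements f ≡ sum elements (λ x → f (a - x))
  reindex-reflect a = reindex (λ x → a - x) (λ x → a - x) (+-congˡ ∘ -‿cong) (+-congˡ ∘ -‿cong) involution involution
    where
    involution : ∀ x → a - (a - x) ≈ x
    involution x = solve 2 (λ a x → a :- (a :- x) := x) refl a x

  -- Substituting g x for x multiplies the sum by ζ.
  χ-sum : sum elements χ ≡ 0ζ
  χ-sum = ζ-fixed⇒0 _ (begin
    ζ′ · sum elements χ               ≡⟨ *-sum ζ′ elements χ ⟨
    sum elements (λ x → ζ′ · χ x)     ≡⟨ sum-cong (λ x → ≡.trans (χ-* g x) (≡.cong (_· χ x) χ-g)) elements ⟨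
    sum elements (λ x → χ (g * x))    ≡⟨ reindex-* g≉0 χ χ-cong ⟨
    sum elements χ                    ∎)

  conj-sum : ∀ {A : Set} (xs : List A) f → conj (sum xs f) ≡ sum xs (conj ∘ f)
  conj-sum [] f = ≡.refl
  conj-sum (x ∷ xs) f = ≡.trans (conj-⊞ (f x) (sum xs f)) (≡.cong (conj (f x) ⊞_) (conj-sum xs f))

  χ̄ : Carrier → ℤζ
  χ̄ = conj ∘ χ

  χ̄-cong : ∀ {x y} → x ≈ y → χ̄ x ≡ χ̄ y
  χ̄-cong eq = ≡.cong conj (χ-cong eq)

  χ̄-sum : sum elements χ̄ ≡ 0ζ
  χ̄-sum = ≡.trans (≡.sym (conj-sum elements χ)) (≡.cong conj χ-sum)

  _★_ : (Carrier → ℤζ) → (Carrier → ℤζ) → Carrier → ℤζ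
  (f ★ h) a = sum elements (λ b → f b · h (a - b))

  ★-cong : ∀ {f f′ : Carrier → ℤζ} h → (∀ x → f x ≡ f′ x) → ∀ a → (f ★ h) a ≡ (f′ ★ h) a
  ★-cong h eq a = sum-cong (λ b → ≡.cong (_· h (a - b)) (eq b)) elements

  ★-scale : ∀ c f h a → ((λ x → c · f x) ★ h) a ≡ c · (f ★ h) a
  ★-scale c f h a = ≡.trans (sum-cong (λ b → Rζ.*-assoc c (f b) (h (a - b))) elements) (*-sum c elements _)

  J : ℤζ
  J = (χ ★ χ) 1#

  -- For a ≠ 0 the substitution b = a c pulls out χ(a)² = χ̄(a). For a = 0 the terms are χ(b) χ(-b)
  -- = χ(b)² = χ̄(b), which sum to zero.
  χ★χ : ∀ a → (χ ★ χ) a ≡ J · χ̄ a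
  χ★χ a with a ≟ 0#
  ... | yes a≈0 = begin
    sum elements (λ b → χ b · χ (a - b))
      ≡⟨ sum-cong (λ b → ≡.trans (≡.cong (χ b ·_) (≡.trans (χ-cong (trans (+-congʳ a≈0) (+-identityˡ (- b)))) (χ-neg b))) (≡.sym (conj-χ b))) elements ⟩
    sum elements χ̄     ≡⟨ χ̄-sum ⟩
    0ζ                 ≡⟨ Rζ.zeroʳ J ⟨
    J · 0ζ             ≡⟨ ≡.cong (λ z → J · conj z) (χ-zero a≈0) ⟨
    J · χ̄ a            ∎
  ... | no a≉0 = begin
    sum elements (λ b → χ b · χ (a - b))
      ≡⟨ reindex-* a≉0 (λ b → χ b · χ (a - b)) (λ eq → ≡.cong₂ _·_ (χ-cong eq) (χ-cong (+-congˡ (-‿cong eq)))) ⟩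
    sum elements (λ c → χ (a * c) · χ (a - a * c))
      ≡⟨ sum-cong (λ c → ≡.cong₂ _·_ (χ-* a c) (≡.trans (χ-cong (solve 2 (λ a c → a :- a :* c := a :* (con (+ 1) :- c)) refl a c)) (χ-* a (1# - c)))) elements ⟩
    sum elements (λ c → (χ a · χ c) · (χ a · χ (1# - c)))
      ≡⟨ sum-cong (λ c → Iζ.solve 3 (λ a c d → (a Iζ.:* c) Iζ.:* (a Iζ.:* d) Iζ.:= (a Iζ.:* a) Iζ.:* (c Iζ.:* d)) ≡.refl (χ a) (χ c) (χ (1# - c))) elements ⟩
    sum elements (λ c → (χ a · χ a) · (χ c · χ (1# - c)))
      ≡⟨ *-sum (χ a · χ a) elements (λ c → χ c · χ (1# - c)) ⟩
    (χ a · χ a) · J    ≡⟨ Rζ.*-comm _ J ⟩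
    J · (χ a · χ a)    ≡⟨ ≡.cong (J ·_) (conj-χ a) ⟨
    J · χ̄ a            ∎

  pζ : ℤζ
  pζ = ofℤ (+ p)

  sum-one : sum elements (λ _ → oneζ) ≡ pζ
  sum-one = ≡.trans (go elements) (≡.cong (ofℤ ∘ +_) (≡.trans order (ℕₚ.^-identityʳ p)))
    where
    go : ∀ {A : Set} (xs : List A) → sum xs (λ _ → oneζ) ≡ ofℤ (+ length xs)
    go []       = ≡.refl
    go (x ∷ xs) = ≡.cong (oneζ ⊞_) (go xs)

  [_≈0] : Carrier → ℤζ
  [ x ≈0] = ⟦ x ≟ 0# ⟧

  D : Carrier → ℤζ
  D a = pζ · [ a ≈0] ⊞ ⊟ oneζ

  [≈0]-cong : ∀ {x y} → x ≈ y → [ x ≈0] ≡ [ y ≈0]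
  [≈0]-cong {x} {y} eq = ⟦⟧-cong (trans (sym eq)) (trans eq) (x ≟ 0#) (y ≟ 0#)

  sum-sub : ∀ (f h : Carrier → ℤζ) → sum elements (λ x → f x ⊞ ⊟ h x) ≡ sum elements f ⊞ ⊟ sum elements h
  sum-sub f h = ≡.trans (sum-+ elements f (⊟_ ∘ h)) (≡.cong (sum elements f ⊞_)
    (≡.trans (sum-cong (λ x → Iζ.solve 1 (λ z → Iζ.:- z Iζ.:= Iζ.con (ℤ.- (+ 1)) Iζ.:* z) ≡.refl (h x)) elements)
    (≡.trans (*-sum (⊟ oneζ) elements h) (Iζ.solve 1 (λ z → Iζ.con (ℤ.- (+ 1)) Iζ.:* z Iζ.:= Iζ.:- z) ≡.refl (sum elements h)))))

  χ̄χ : ∀ x → χ̄ x · χ x ≡ oneζ ⊞ ⊟ [ x ≈0]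
  χ̄χ x with x ≟ 0#
  ... | yes x≈0 = ≡.trans (≡.cong (χ̄ x ·_) (χ-zero x≈0)) (Rζ.zeroʳ (χ̄ x))
  ... | no x≉0 = χ-unit x≉0

  private
    abstract
      -- Inversion made total by sending 0 to 0, so that it is an involution of the whole field and
      -- can reindex sums over it.
      inv : Carrier → Carrier
      inv x with x ≟ 0#
      ... | yes _ = 0#
      ... | no x≉0 = proj₁ (inverse x x≉0)

      inv-zero : ∀ {x} → x ≈ 0# → inv x ≈ 0#
      inv-zero {x} x≈0 with x ≟ 0#
      ... | yes _ = refl
      ... | no x≉0 = ⊥-elim (x≉0 x≈0)

      inv-* : ∀ {x} → ¬ (x ≈ 0#) → x * inv x ≈ 1#
      inv-* {x} x≉0 with x ≟ 0#
      ... | yes x≈0 = ⊥-elim (x≉0 x≈0)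
      ... | no x≉0′ = proj₂ (inverse x x≉0′)

    inv-nonzero : ∀ {x} → ¬ (x ≈ 0#) → ¬ (inv x ≈ 0#)
    inv-nonzero x≉0 eq = 1≉0 (trans (sym (inv-* x≉0)) (trans (*-congˡ eq) (zeroʳ _)))

    inv-cong : ∀ {x y} → x ≈ y → inv x ≈ inv y
    inv-cong {x} {y} eq = go (x ≟ 0#)
      where
      go : Dec (x ≈ 0#) → inv x ≈ inv y
      go (yes x≈0) = trans (inv-zero x≈0) (sym (inv-zero (trans (sym eq) x≈0)))
      go (no x≉0) = *-cancelˡ x≉0 (trans (inv-* x≉0) (sym (trans (*-congʳ eq) (inv-* (λ y≈0 → x≉0 (trans eq y≈0))))))

    inv-inv : ∀ x → inv (inv x) ≈ x
    inv-inv x = go (x ≟ 0#)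
      where
      go : Dec (x ≈ 0#) → inv (inv x) ≈ x
      go (yes x≈0) = trans (inv-zero (inv-zero x≈0)) (sym x≈0)
      go (no x≉0) = *-cancelˡ (inv-nonzero x≉0) (trans (inv-* (inv-nonzero x≉0)) (sym (trans (*-comm _ _) (inv-* x≉0))))

    χ̄-inv : ∀ {x} → ¬ (x ≈ 0#) → χ̄ (inv x) ≡ χ x
    χ̄-inv {x} x≉0 = begin
      χ̄ (inv x)                         ≡⟨ Rζ.*-identityˡ _ ⟨
      oneζ · χ̄ (inv x)                  ≡⟨ ≡.cong (_· χ̄ (inv x)) (≡.trans (χ-cong (inv-* x≉0)) χ-1) ⟨
      χ (x * inv x) · χ̄ (inv x)         ≡⟨ ≡.cong (_· χ̄ (inv x)) (χ-* x (inv x)) ⟩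
      (χ x · χ (inv x)) · χ̄ (inv x)     ≡⟨ Iζ.solve 3 (λ a b c → (a Iζ.:* b) Iζ.:* c Iζ.:= a Iζ.:* (c Iζ.:* b)) ≡.refl (χ x) (χ (inv x)) (χ̄ (inv x)) ⟩
      χ x · (χ̄ (inv x) · χ (inv x))     ≡⟨ ≡.cong (χ x ·_) (χ-unit (inv-nonzero x≉0)) ⟩
      χ x · oneζ                        ≡⟨ Rζ.*-identityʳ _ ⟩
      χ x                               ∎

  -- For a ≠ 0 scaling reduces to a sum of χ̄(c) χ(1 - c). Replacing c by 1/c turns the summand into
  -- χ(c - 1) = χ(1 - c) for c ≠ 0; the full sum of χ vanishes and the missing term c = 0 accounts
  -- for -1.
  χ̄★χ : ∀ a → (χ̄ ★ χ) a ≡ D a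
  χ̄★χ a with a ≟ 0#
  ... | yes a≈0 = begin
    sum elements (λ b → χ̄ b · χ (a - b))
      ≡⟨ sum-cong (λ b → ≡.trans (≡.cong (χ̄ b ·_) (≡.trans (χ-cong (trans (+-congʳ a≈0) (+-identityˡ (- b)))) (χ-neg b))) (χ̄χ b)) elements ⟩
    sum elements (λ b → oneζ ⊞ ⊟ [ b ≈0])
      ≡⟨ sum-sub (λ _ → oneζ) [_≈0] ⟩
    sum elements (λ _ → oneζ) ⊞ ⊟ sum elements [_≈0]
      ≡⟨ ≡.cong₂ (λ y z → y ⊞ ⊟ z) (≡.trans sum-one (≡.sym (Rζ.*-identityʳ pζ))) (once-in fieldEnum 0#) ⟩
    pζ · oneζ ⊞ ⊟ oneζ ∎
  ... | no a≉0 = begin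
    sum elements (λ b → χ̄ b · χ (a - b))
      ≡⟨ reindex-* a≉0 (λ b → χ̄ b · χ (a - b)) (λ eq → ≡.cong₂ _·_ (χ̄-cong eq) (χ-cong (+-congˡ (-‿cong eq)))) ⟩
    sum elements (λ c → χ̄ (a * c) · χ (a - a * c))
      ≡⟨ sum-cong (λ c → ≡.cong₂ _·_ (≡.trans (≡.cong conj (χ-* a c)) (conj-· (χ a) (χ c)))
           (≡.trans (χ-cong (solve 2 (λ a c → a :- a :* c := a :* (con (+ 1) :- c)) refl a c)) (χ-* a (1# - c)))) elements ⟩
    sum elements (λ c → (χ̄ a · χ̄ c) · (χ a · χ (1# - c)))
      ≡⟨ sum-cong (λ c → Iζ.solve 4 (λ a′ c a d → (a′ Iζ.:* c) Iζ.:* (a Iζ.:* d) Iζ.:= (a′ Iζ.:* a) Iζ.:* (c Iζ.:* d)) ≡.refl (χ̄ a) (χ̄ c) (χ a) (χ (1# - c))) elements ⟩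
    sum elements (λ c → (χ̄ a · χ a) · (χ̄ c · χ (1# - c)))
      ≡⟨ *-sum (χ̄ a · χ a) elements f ⟩
    (χ̄ a · χ a) · sum elements f
      ≡⟨ ≡.cong (_· sum elements f) (χ-unit a≉0) ⟩
    oneζ · sum elements f   ≡⟨ Rζ.*-identityˡ _ ⟩
    sum elements f
      ≡⟨ reindex inv inv inv-cong inv-cong inv-inv inv-inv f (λ eq → ≡.cong₂ _·_ (χ̄-cong eq) (χ-cong (+-congˡ (-‿cong eq)))) ⟩
    sum elements (f ∘ inv)
      ≡⟨ sum-cong f-inv elements ⟩
    sum elements (λ c → χ (1# - c) ⊞ ⊟ [ c ≈0])
      ≡⟨ sum-sub (λ c → χ (1# - c)) [_≈0] ⟩
    sum elements (λ c → χ (1# - c)) ⊞ ⊟ sum elements [_≈0]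
      ≡⟨ ≡.cong₂ (λ y z → y ⊞ ⊟ z) (≡.trans (≡.sym (reindex-reflect 1# χ χ-cong)) χ-sum) (once-in fieldEnum 0#) ⟩
    0ζ ⊞ ⊟ oneζ             ≡⟨ ≡.cong (_⊞ ⊟ oneζ) (Rζ.zeroʳ pζ) ⟨
    pζ · 0ζ ⊞ ⊟ oneζ        ∎
    where
    f : Carrier → ℤζ
    f c = χ̄ c · χ (1# - c)
    f-inv : ∀ c → f (inv c) ≡ χ (1# - c) ⊞ ⊟ [ c ≈0]
    f-inv c with c ≟ 0#
    ... | yes c≈0 = begin
      χ̄ (inv c) · χ (1# - inv c)   ≡⟨ ≡.cong (λ z → conj z · χ (1# - inv c)) (χ-zero (inv-zero c≈0)) ⟩
      0ζ · χ (1# - inv c)          ≡⟨ Rζ.zeroˡ (χ (1# - inv c)) ⟩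
      oneζ ⊞ ⊟ oneζ                ≡⟨ ≡.cong (_⊞ ⊟ oneζ) (≡.trans (χ-cong (trans (+-congˡ (trans (-‿cong c≈0) -0#≈0#)) (+-identityʳ 1#))) χ-1) ⟨
      χ (1# - c) ⊞ ⊟ oneζ          ∎
    ... | no c≉0 = begin
      χ̄ (inv c) · χ (1# - inv c)   ≡⟨ ≡.cong (_· χ (1# - inv c)) (χ̄-inv c≉0) ⟩
      χ c · χ (1# - inv c)         ≡⟨ χ-* c (1# - inv c) ⟨
      χ (c * (1# - inv c))         ≡⟨ χ-cong (trans (solve 2 (λ c d → c :* (con (+ 1) :- d) := :- (c :* d :- c)) refl c (inv c))
                                        (-‿cong (+-congʳ (inv-* c≉0)))) ⟩
      χ (- (1# - c))               ≡⟨ χ-neg (1# - c) ⟩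
      χ (1# - c)                   ≡⟨ Rζ.+-identityʳ _ ⟨
      χ (1# - c) ⊞ ⊟ 0ζ            ∎

  D★χ : ∀ a → (D ★ χ) a ≡ pζ · χ a
  D★χ a = begin
    sum elements (λ b → (pζ · [ b ≈0] ⊞ ⊟ oneζ) · χ (a - b))
      ≡⟨ sum-cong (λ b → Iζ.solve 3 (λ p d c → (p Iζ.:* d Iζ.:+ Iζ.con (ℤ.- (+ 1))) Iζ.:* c Iζ.:= p Iζ.:* (d Iζ.:* c) Iζ.:+ Iζ.:- c) ≡.refl pζ [ b ≈0] (χ (a - b))) elements ⟩
    sum elements (λ b → pζ · ([ b ≈0] · χ (a - b)) ⊞ ⊟ χ (a - b))
      ≡⟨ sum-sub (λ b → pζ · ([ b ≈0] · χ (a - b))) (λ b → χ (a - b)) ⟩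
    sum elements (λ b → pζ · ([ b ≈0] · χ (a - b))) ⊞ ⊟ sum elements (λ b → χ (a - b))
      ≡⟨ ≡.cong₂ (λ y z → y ⊞ ⊟ z) (*-sum pζ elements _) (≡.trans (≡.sym (reindex-reflect a χ χ-cong)) χ-sum) ⟩
    pζ · sum elements (λ b → [ b ≈0] · χ (a - b)) ⊞ ⊟ 0ζ
      ≡⟨ Rζ.+-identityʳ _ ⟩
    pζ · sum elements (λ b → [ b ≈0] · χ (a - b))
      ≡⟨ ≡.cong (pζ ·_) (delta fieldEnum (λ b → χ (a - b)) (λ eq → χ-cong (+-congˡ (-‿cong eq))) 0#) ⟩
    pζ · χ (a - 0#)
      ≡⟨ ≡.cong (pζ ·_) (χ-cong (trans (+-congˡ -0#≈0#) (+-identityʳ a))) ⟩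
    pζ · χ a ∎

  -- Associativity of ★: χ ★ χ ★ χ̄ at 1, grouped to the left, is J χ̄ ★ χ̄ = J J̄ χ; grouped to the
  -- right, it is χ ★ D = p χ.
  J-norm : J · conj J ≡ pζ
  J-norm = begin
    J · conj J                                        ≡⟨ ≡.cong (J ·_) (≡.trans (≡.cong (conj J ·_) χ-1) (Rζ.*-identityʳ (conj J))) ⟨
    J · (conj J · χ 1#)                               ≡⟨ ≡.cong (J ·_) (χ̄★χ̄ 1#) ⟨
    J · sum elements (λ b → χ̄ b · χ̄ (1# - b))
      ≡⟨ *-sum J elements _ ⟨
    sum elements (λ b → J · (χ̄ b · χ̄ (1# - b)))
      ≡⟨ sum-cong (λ b → ≡.trans (≡.sym (Rζ.*-assoc J (χ̄ b) (χ̄ (1# - b)))) (≡.cong (_· χ̄ (1# - b)) (≡.sym (χ★χ b)))) elements ⟩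
    sum elements (λ b → sum elements (λ c → χ c · χ (b - c)) · χ̄ (1# - b))
      ≡⟨ sum-cong (λ b → sum-* elements _ (χ̄ (1# - b))) elements ⟨
    sum elements (λ b → sum elements (λ c → (χ c · χ (b - c)) · χ̄ (1# - b)))
      ≡⟨ sum-swap elements elements _ ⟩
    sum elements (λ c → sum elements (λ b → (χ c · χ (b - c)) · χ̄ (1# - b)))
      ≡⟨ sum-cong (λ c → ≡.trans (sum-cong (λ b → Rζ.*-assoc (χ c) (χ (b - c)) (χ̄ (1# - b))) elements) (*-sum (χ c) elements _)) elements ⟩
    sum elements (λ c → χ c · sum elements (λ b → χ (b - c) · χ̄ (1# - b)))
      ≡⟨ sum-cong (λ c → ≡.cong (χ c ·_) (inner c)) elements ⟩
    sum elements (λ c → χ c · D (1# - c))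
      ≡⟨ reindex-reflect 1# (λ c → χ c · D (1# - c)) (λ eq → ≡.cong₂ _·_ (χ-cong eq) (≡.cong (λ z → pζ · z ⊞ ⊟ oneζ) ([≈0]-cong (+-congˡ (-‿cong eq))))) ⟩
    sum elements (λ c → χ (1# - c) · D (1# - (1# - c)))
      ≡⟨ sum-cong (λ c → ≡.trans (Rζ.*-comm (χ (1# - c)) _) (≡.cong (λ z → (pζ · z ⊞ ⊟ oneζ) · χ (1# - c))
           ([≈0]-cong (solve 1 (λ c → con (+ 1) :- (con (+ 1) :- c) := c) refl c)))) elements ⟩
    (D ★ χ) 1#       ≡⟨ D★χ 1# ⟩
    pζ · χ 1#        ≡⟨ ≡.cong (pζ ·_) χ-1 ⟩
    pζ · oneζ        ≡⟨ Rζ.*-identityʳ pζ ⟩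
    pζ               ∎
    where
    χ̄★χ̄ : ∀ a → (χ̄ ★ χ̄) a ≡ conj J · χ a
    χ̄★χ̄ a = ≡.trans (sum-cong (λ b → ≡.sym (conj-· (χ b) (χ (a - b)))) elements)
      (≡.trans (≡.sym (conj-sum elements _)) (≡.trans (≡.cong conj (χ★χ a)) (≡.trans (conj-· J (χ̄ a)) (≡.cong (conj J ·_) (conj-conj (χ a))))))
    inner : ∀ c → sum elements (λ b → χ (b - c) · χ̄ (1# - b)) ≡ D (1# - c)
    inner c = ≡.trans (reindex-reflect 1# (λ b → χ (b - c) · χ̄ (1# - b)) (λ eq → ≡.cong₂ _·_ (χ-cong (+-congʳ eq)) (χ̄-cong (+-congˡ (-‿cong eq)))))
      (≡.trans (sum-cong (λ d → ≡.trans (≡.cong₂ _·_ (χ-cong (solve 2 (λ c d → con (+ 1) :- d :- c := con (+ 1) :- c :- d) refl c d))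
          (χ̄-cong (solve 1 (λ d → con (+ 1) :- (con (+ 1) :- d) := d) refl d))) (Rζ.*-comm (χ (1# - c - d)) (χ̄ d))) elements)
      (χ̄★χ (1# - c)))

-- The value of the cubic Jacobi sum

module IntegerLemmas where
  open ℤSolver.+-*-Solver
  open ≡ using (refl; sym; trans; cong; cong₂)
  open ≡.≡-Reasoning

  square-abs : ∀ i → i ℤ.* i ≡ + (ℤ.∣ i ∣ ℕ.* ℤ.∣ i ∣)
  square-abs (+ n)    = sym (ℤₚ.pos-* n n)
  square-abs -[1+ n ] = refl

  abs-cases : ∀ i {n} → ℤ.∣ i ∣ ≡ n → i ≡ + n ⊎ i ≡ ℤ.- (+ n)
  abs-cases (+ n)    refl = inj₁ refl
  abs-cases -[1+ n ] refl = inj₂ refl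

  ℕ-square-injective : ∀ m n → m ℕ.* m ≡ n ℕ.* n → m ≡ n
  ℕ-square-injective m n eq with ℕₚ.<-cmp m n
  ... | tri< m<n _ _ = ⊥-elim (ℕₚ.<⇒≢ (ℕₚ.*-mono-< m<n m<n) eq)
  ... | tri≈ _ m≡n _ = m≡n
  ... | tri> _ _ n<m = ⊥-elim (ℕₚ.<⇒≢ (ℕₚ.*-mono-< n<m n<m) (sym eq))

  -- (Aa + 3Bb)² + 3(Ab − aB)² = P² leaves no room for a nonzero multiple Ab − aB of P.
  representation-unique : ∀ (A B a b : ℤ) (P : ℕ) → 0 ℕ.< P →
    A ℤ.* A ℤ.+ (+ 3) ℤ.* B ℤ.* B ≡ + P → a ℤ.* a ℤ.+ (+ 3) ℤ.* b ℤ.* b ≡ + P →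
    (+ P) ℤ∣.∣ (A ℤ.* b ℤ.- a ℤ.* B) →
    (∃ λ c → A ≡ ℤ.- (+ 1) ℤ.+ (+ 3) ℤ.* c) → (∃ λ c → a ≡ ℤ.- (+ 1) ℤ.+ (+ 3) ℤ.* c) → A ≡ a × B ≡ b
  representation-unique A B a b P 0<P normA norma div (c , A≡) (c′ , a≡) = conclude (abs-cases Y |Y|≡P)
    where
    instance
      P≢0 : ℕ.NonZero P
      P≢0 = ℕ.>-nonZero 0<P
    X = A ℤ.* b ℤ.- a ℤ.* B
    Y = A ℤ.* a ℤ.+ (+ 3) ℤ.* B ℤ.* b
    q = ℤ∣ₛ._∣_.quotient (ℤ∣ₛ.∣ᵤ⇒∣ {+ P} {X} div)
    X≡qP : X ≡ q ℤ.* (+ P)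
    X≡qP = ℤ∣ₛ._∣_.equality (ℤ∣ₛ.∣ᵤ⇒∣ {+ P} {X} div)
    -- Multiplicativity of the norm: Y + X √-3 is the product of a + b √-3 with the conjugate of A +
    -- B √-3.
    norms : Y ℤ.* Y ℤ.+ (+ 3) ℤ.* (X ℤ.* X) ≡ (+ P) ℤ.* (+ P)
    norms = trans (solve 4 (λ A B a b → (A :* a :+ con (+ 3) :* B :* b) :* (A :* a :+ con (+ 3) :* B :* b)
                     :+ con (+ 3) :* ((A :* b :- a :* B) :* (A :* b :- a :* B))
                     := (A :* A :+ con (+ 3) :* B :* B) :* (a :* a :+ con (+ 3) :* b :* b)) refl A B a b)
                  (cong₂ ℤ._*_ normA norma)
    y = ℤ.∣ Y ∣
    x = ℤ.∣ q ∣
    norms-ℕ : y ℕ.* y ℕ.+ 3 ℕ.* (x ℕ.* x ℕ.* (P ℕ.* P)) ≡ P ℕ.* P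
    norms-ℕ = ℤₚ.+-injective (begin
      + (y ℕ.* y) ℤ.+ + (3 ℕ.* (x ℕ.* x ℕ.* (P ℕ.* P)))
        ≡⟨ cong₂ ℤ._+_ (sym (square-abs Y)) (trans (ℤₚ.pos-* 3 (x ℕ.* x ℕ.* (P ℕ.* P))) (cong ((+ 3) ℤ.*_) {+ (x ℕ.* x ℕ.* (P ℕ.* P))} {q ℤ.* q ℤ.* ((+ P) ℤ.* (+ P))} (trans (ℤₚ.pos-* (x ℕ.* x) (P ℕ.* P))
             (cong₂ ℤ._*_ (sym (square-abs q)) (ℤₚ.pos-* P P))))) ⟩
      Y ℤ.* Y ℤ.+ (+ 3) ℤ.* (q ℤ.* q ℤ.* ((+ P) ℤ.* (+ P)))
        ≡⟨ cong (λ z → Y ℤ.* Y ℤ.+ (+ 3) ℤ.* z) (solve 2 (λ q P → q :* q :* (P :* P) := q :* P :* (q :* P)) refl q (+ P)) ⟩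
      Y ℤ.* Y ℤ.+ (+ 3) ℤ.* (q ℤ.* (+ P) ℤ.* (q ℤ.* (+ P)))
        ≡⟨ cong (λ z → Y ℤ.* Y ℤ.+ (+ 3) ℤ.* (z ℤ.* z)) (sym X≡qP) ⟩
      Y ℤ.* Y ℤ.+ (+ 3) ℤ.* (X ℤ.* X) ≡⟨ norms ⟩
      (+ P) ℤ.* (+ P) ≡⟨ sym (ℤₚ.pos-* P P) ⟩
      + (P ℕ.* P) ∎)
    q≡0 : x ≡ 0
    q≡0 = go x norms-ℕ
      where
      go : ∀ x → y ℕ.* y ℕ.+ 3 ℕ.* (x ℕ.* x ℕ.* (P ℕ.* P)) ≡ P ℕ.* P → x ≡ 0
      go zero _ = refl
      go (suc x) eq = ⊥-elim (ℕₚ.<-irrefl refl (ℕₚ.<-≤-trans (ℕₚ.<-≤-trans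
        (ℕₚ.m<m+n (P ℕ.* P) {2 ℕ.* (P ℕ.* P)} (ℕₚ.m<n⇒0<n∸m {0} (ℕₚ.*-mono-< {0} {2} {0} {P ℕ.* P} (s≤s z≤n) (ℕₚ.*-mono-< 0<P 0<P))))
        (ℕₚ.*-monoʳ-≤ 3 (ℕₚ.m≤n*m (P ℕ.* P) (suc x ℕ.* suc x))))
        (ℕₚ.≤-trans (ℕₚ.m≤n+m _ (y ℕ.* y)) (ℕₚ.≤-reflexive eq))))
    |Y|≡P : y ≡ P
    |Y|≡P = ℕ-square-injective y P (trans (sym (ℕₚ.+-identityʳ _)) (trans (cong (λ z → y ℕ.* y ℕ.+ 3 ℕ.* (z ℕ.* z ℕ.* (P ℕ.* P))) (sym q≡0)) norms-ℕ))
    X≡0 : X ≡ + 0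
    X≡0 = trans X≡qP (cong (ℤ._* (+ P)) {q} {+ 0} (ℤₚ.∣i∣≡0⇒i≡0 q≡0))
    AP : A ℤ.* (+ P) ≡ a ℤ.* Y
    AP = trans (cong (A ℤ.*_) (sym norma)) (trans (solve 4 (λ A B a b → A :* (a :* a :+ con (+ 3) :* b :* b)
           := a :* (A :* a :+ con (+ 3) :* B :* b) :+ con (+ 3) :* b :* (A :* b :- a :* B)) refl A B a b)
           (trans (cong (λ z → a ℤ.* Y ℤ.+ (+ 3) ℤ.* b ℤ.* z) X≡0) (solve 2 (λ u b → u :+ con (+ 3) :* b :* con (+ 0) := u) refl (a ℤ.* Y) b)))
    BP : B ℤ.* (+ P) ≡ b ℤ.* Y
    BP = trans (cong (B ℤ.*_) (sym norma)) (trans (solve 4 (λ A B a b → B :* (a :* a :+ con (+ 3) :* b :* b)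
           := b :* (A :* a :+ con (+ 3) :* B :* b) :- a :* (A :* b :- a :* B)) refl A B a b)
           (trans (cong (λ z → b ℤ.* Y ℤ.- a ℤ.* z) X≡0) (solve 2 (λ u a → u :- a :* con (+ 0) := u) refl (b ℤ.* Y) a)))
    conclude : Y ≡ + P ⊎ Y ≡ ℤ.- (+ P) → A ≡ a × B ≡ b
    conclude (inj₁ Y≡P) = ℤₚ.*-cancelʳ-≡ A a (+ P) (trans AP (cong (a ℤ.*_) Y≡P)) , ℤₚ.*-cancelʳ-≡ B b (+ P) (trans BP (cong (b ℤ.*_) Y≡P))
    -- Here A = -a. Both being -1 modulo 3, their sum 0 would be -2 modulo 3.
    conclude (inj₂ Y≡-P) = ⊥-elim (2≢3k (c ℤ.+ c′) (begin
      + 2    ≡⟨ solve 2 (λ A a → con (+ 2) := con (+ 2) :+ (A :+ a) :- (A :+ a)) refl A a ⟩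
      (+ 2) ℤ.+ (A ℤ.+ a) ℤ.- (A ℤ.+ a) ≡⟨ cong₂ (λ u v → (+ 2) ℤ.+ u ℤ.- v) (cong₂ ℤ._+_ A≡ a≡) A+a≡0 ⟩
      (+ 2) ℤ.+ (ℤ.- (+ 1) ℤ.+ (+ 3) ℤ.* c ℤ.+ (ℤ.- (+ 1) ℤ.+ (+ 3) ℤ.* c′)) ℤ.- (+ 0)
        ≡⟨ solve 2 (λ c c′ → con (+ 2) :+ (con (ℤ.- (+ 1)) :+ con (+ 3) :* c :+ (con (ℤ.- (+ 1)) :+ con (+ 3) :* c′)) :- con (+ 0) := con (+ 3) :* (c :+ c′)) refl c c′ ⟩
      (+ 3) ℤ.* (c ℤ.+ c′) ∎))
      where
      A+a≡0 : A ℤ.+ a ≡ + 0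
      A+a≡0 = ℤₚ.*-cancelʳ-≡ (A ℤ.+ a) (+ 0) (+ P) (trans (ℤₚ.*-distribʳ-+ (+ P) A a)
        (trans (cong (ℤ._+ a ℤ.* (+ P)) (trans AP (cong (a ℤ.*_) Y≡-P))) (solve 2 (λ a P → a :* (:- P) :+ a :* P := con (+ 0)) refl a (+ P))))
      2≢3k : ∀ k → ¬ (+ 2 ≡ (+ 3) ℤ.* k)
      2≢3k k eq = ∣.>⇒∤ (s≤s (s≤s (s≤s z≤n))) (∣.divides ℤ.∣ k ∣ (trans (cong ℤ.∣_∣ eq) (trans (ℤₚ.abs-* (+ 3) k) (ℕₚ.*-comm 3 ℤ.∣ k ∣))))

  mod-witness : ∀ x y n → x ≡[mod n ] y → ∃ λ c → x ≡ y ℤ.+ (+ n) ℤ.* c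
  mod-witness x y n div with ℤ∣ₛ.∣ᵤ⇒∣ {+ n} {x ℤ.- y} div
  ... | ℤ∣ₛ.divides q eq = q , trans (solve 2 (λ x y → x := y :+ (x :- y)) refl x y)
    (cong (λ z → y ℤ.+ z) (trans eq (ℤₚ.*-comm q (+ n))))

module JacobiSum
  (k : FiniteField) (p : ℕ) (prime : Prime p) (order : length (FiniteField.elements k) ≡ p ℕ.^ 1)
  (g : FiniteField.Carrier k) (g-primitive : FF.Primitive k p 1 g)
  (e : ℕ) (groupOrder≡ : p ℕ.^ 1 ℕ.∸ 1 ≡ e ℕ.* 3) where

  open FiniteField k hiding (zero)
  open FF k using (pow)
  open CyclicField k p 1 prime order g g-primitive
    using (groupOrder; γ-power≈1; γ-order; suc-groupOrder; characteristic; 1<p; _·1)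
    renaming (γ≉0 to g≉0)
  open Powers k
  open Factorization k using (fieldEnum; domain)
  open CubicCharacter k p prime order g g-primitive e groupOrder≡ public
  open Eisenstein
  open IntegerLemmas
  open IntegerMultiples commRing using (fromℤ; fromℤ-+; fromℤ-*; fromℤ-neg)
  private
    module I = IntegerMultiples commRing
    module Lζ = ListSum semiringζ
    module Lk = ListSum commutativeSemiring
  open RingP ring using (x∙y⁻¹≈ε⇒x≈y; x≈y⇒x∙y⁻¹≈ε)

  p≡1+M : p ≡ suc groupOrder
  p≡1+M = ≡.sym (≡.trans suc-groupOrder (ℕₚ.^-identityʳ p))

  M>0 : 0 ℕ.< groupOrder
  M>0 = ℕₚ.≤-pred (≡.subst (1 ℕ.<_) p≡1+M 1<p)

  module ClosedForm (N : ℕ) (S : ℕ → Carrier → ℤζ) (S-one : 1 ℕ.≤ N → ∀ a → S 1 a ≡ χ a)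
    (S-suc : ∀ t → suc (suc t) ℕ.≤ N → ∀ a → S (suc (suc t)) a ⊞ (S (suc t) ★ χ) a ≡ 0ζ) where
    open ≡.≡-Reasoning

    -- The scalar (-1)^(t-1) p^i J^j.
    coeff : ℕ → ℕ → ℕ → ℤζ
    coeff t i j = ofℤ (ℤ.- sgn t) · (ofℤ (+ (p ℕ.^ i)) · (J ^ζ j))

    private
      step : ∀ t c f → suc (suc t) ℕ.≤ N → (∀ a → S (suc t) a ≡ c · f a) → ∀ a → S (suc (suc t)) a ≡ ⊟ (c · (f ★ χ) a)
      step t c f le eq a = begin
        S (suc (suc t)) a
          ≡⟨ Iζ.solve 2 (λ x y → x Iζ.:= x Iζ.:+ y Iζ.:- y) ≡.refl (S (suc (suc t)) a) ((S (suc t) ★ χ) a) ⟩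
        (S (suc (suc t)) a ⊞ (S (suc t) ★ χ) a) ⊞ ⊟ (S (suc t) ★ χ) a
          ≡⟨ ≡.cong₂ (λ u v → u ⊞ ⊟ v) (S-suc t le a) (≡.trans (★-cong χ eq a) (★-scale c f χ a)) ⟩
        0ζ ⊞ ⊟ (c · (f ★ χ) a)   ≡⟨ Rζ.+-identityˡ _ ⟩
        ⊟ (c · (f ★ χ) a)        ∎

      sign-flip : ∀ t u v → ⊟ (ofℤ (ℤ.- sgn t) · u · v) ≡ ofℤ (ℤ.- sgn (suc t)) · (u · v)
      sign-flip t u v = Iζ.solve 3 (λ s u v → Iζ.:- (Iζ.:- s Iζ.:* u Iζ.:* v) Iζ.:= Iζ.:- (Iζ.:- s) Iζ.:* (u Iζ.:* v)) ≡.refl (ofℤ (sgn t)) u v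

    mutual
      -- Three convolutions lead from χ through χ̄ and D back to χ, so the residue of t modulo 3
      -- decides which function appears, and each full turn costs the factor -p J.
      closed₁ : ∀ j → suc (j ℕ.* 3) ℕ.≤ N → ∀ a → S (suc (j ℕ.* 3)) a ≡ coeff (suc (j ℕ.* 3)) j j · χ a
      closed₁ zero le a = ≡.trans (S-one le a) (≡.sym (≡.trans (≡.cong (_· χ a) (≡.trans (Rζ.*-identityˡ _) (Rζ.*-identityˡ oneζ))) (Rζ.*-identityˡ (χ a))))
      closed₁ (suc j) le a = begin
        S (suc (suc (suc (suc (j ℕ.* 3))))) a
          ≡⟨ step (suc (suc (j ℕ.* 3))) (coeff (suc j ℕ.* 3) j (suc j)) D le (closed₃ j (ℕₚ.≤-trans (ℕₚ.n≤1+n _) le)) a ⟩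
        ⊟ (coeff (suc (suc (suc (j ℕ.* 3)))) j (suc j) · (D ★ χ) a)
          ≡⟨ ≡.cong (λ z → ⊟ (coeff (suc (suc (suc (j ℕ.* 3)))) j (suc j) · z)) (D★χ a) ⟩
        ⊟ (coeff (suc (suc (suc (j ℕ.* 3)))) j (suc j) · (pζ · χ a))
          ≡⟨ sign-flip (suc (suc (suc (j ℕ.* 3)))) (ofℤ (+ (p ℕ.^ j)) · (J ^ζ suc j)) (pζ · χ a) ⟩
        ofℤ (ℤ.- sgn (suc (suc j ℕ.* 3))) · ((ofℤ (+ (p ℕ.^ j)) · (J ^ζ suc j)) · (pζ · χ a))
          ≡⟨ Iζ.solve 5 (λ s q w P x → s Iζ.:* ((q Iζ.:* w) Iζ.:* (P Iζ.:* x)) Iζ.:= s Iζ.:* ((P Iζ.:* q) Iζ.:* w) Iζ.:* x) ≡.refl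
               (ofℤ (ℤ.- sgn (suc (suc j ℕ.* 3)))) (ofℤ (+ (p ℕ.^ j))) (J ^ζ suc j) pζ (χ a) ⟩
        ofℤ (ℤ.- sgn (suc (suc j ℕ.* 3))) · ((pζ · ofℤ (+ (p ℕ.^ j))) · (J ^ζ suc j)) · χ a
          ≡⟨ ≡.cong (λ z → ofℤ (ℤ.- sgn (suc (suc j ℕ.* 3))) · (z · (J ^ζ suc j)) · χ a)
               (≡.trans (≡.sym (ofℤ-* (+ p) (+ (p ℕ.^ j)))) (≡.cong ofℤ (≡.sym (ℤₚ.pos-* p (p ℕ.^ j))))) ⟩
        coeff (suc (suc j ℕ.* 3)) (suc j) (suc j) · χ a ∎

      closed₂ : ∀ j → suc (suc (j ℕ.* 3)) ℕ.≤ N → ∀ a → S (suc (suc (j ℕ.* 3))) a ≡ coeff (suc (suc (j ℕ.* 3))) j (suc j) · χ̄ a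
      closed₂ j le a = begin
        S (suc (suc (j ℕ.* 3))) a
          ≡⟨ step (j ℕ.* 3) (coeff (suc (j ℕ.* 3)) j j) χ le (closed₁ j (ℕₚ.≤-trans (ℕₚ.n≤1+n _) le)) a ⟩
        ⊟ (coeff (suc (j ℕ.* 3)) j j · (χ ★ χ) a)
          ≡⟨ ≡.cong (λ z → ⊟ (coeff (suc (j ℕ.* 3)) j j · z)) (χ★χ a) ⟩
        ⊟ (coeff (suc (j ℕ.* 3)) j j · (J · χ̄ a))
          ≡⟨ sign-flip (suc (j ℕ.* 3)) (ofℤ (+ (p ℕ.^ j)) · (J ^ζ j)) (J · χ̄ a) ⟩
        ofℤ (ℤ.- sgn (suc (suc (j ℕ.* 3)))) · ((ofℤ (+ (p ℕ.^ j)) · (J ^ζ j)) · (J · χ̄ a))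
          ≡⟨ Iζ.solve 5 (λ s q w P x → s Iζ.:* ((q Iζ.:* w) Iζ.:* (P Iζ.:* x)) Iζ.:= s Iζ.:* (q Iζ.:* (P Iζ.:* w)) Iζ.:* x) ≡.refl
               (ofℤ (ℤ.- sgn (suc (suc (j ℕ.* 3))))) (ofℤ (+ (p ℕ.^ j))) (J ^ζ j) J (χ̄ a) ⟩
        coeff (suc (suc (j ℕ.* 3))) j (suc j) · χ̄ a ∎

      closed₃ : ∀ j → suc j ℕ.* 3 ℕ.≤ N → ∀ a → S (suc j ℕ.* 3) a ≡ coeff (suc j ℕ.* 3) j (suc j) · D a
      closed₃ j le a = begin
        S (suc j ℕ.* 3) a
          ≡⟨ step (suc (j ℕ.* 3)) (coeff (suc (suc (j ℕ.* 3))) j (suc j)) χ̄ le (closed₂ j (ℕₚ.≤-trans (ℕₚ.n≤1+n _) le)) a ⟩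
        ⊟ (coeff (suc (suc (j ℕ.* 3))) j (suc j) · (χ̄ ★ χ) a)
          ≡⟨ ≡.cong (λ z → ⊟ (coeff (suc (suc (j ℕ.* 3))) j (suc j) · z)) (χ̄★χ a) ⟩
        ⊟ (coeff (suc (suc (j ℕ.* 3))) j (suc j) · D a)
          ≡⟨ sign-flip (suc (suc (j ℕ.* 3))) (ofℤ (+ (p ℕ.^ j)) · (J ^ζ suc j)) (D a) ⟩
        ofℤ (ℤ.- sgn (suc j ℕ.* 3)) · ((ofℤ (+ (p ℕ.^ j)) · (J ^ζ suc j)) · D a)
          ≡⟨ Rζ.*-assoc (ofℤ (ℤ.- sgn (suc j ℕ.* 3))) (ofℤ (+ (p ℕ.^ j)) · (J ^ζ suc j)) (D a) ⟨
        coeff (suc j ℕ.* 3) j (suc j) · D a ∎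

  -- Congruence modulo the prime 1 − ζ above 3.
  infix 4 _~_
  record _~_ (x y : ℤζ) : Set where
    constructor mod
    field
      quotient : ℤζ
      equality : x ≡ y ⊞ (ζ′ ⊞ ⊟ oneζ) · quotient

  ~-trans : ∀ {x y z} → x ~ y → y ~ z → x ~ z
  ~-trans {z = z} (mod u ≡.refl) (mod v ≡.refl) = mod (v ⊞ u)
    (Iζ.solve 4 (λ z l u v → z Iζ.:+ l Iζ.:* v Iζ.:+ l Iζ.:* u Iζ.:= z Iζ.:+ l Iζ.:* (v Iζ.:+ u)) ≡.refl z (ζ′ ⊞ ⊟ oneζ) u v)

  ~-reflexive : ∀ {x y} → x ≡ y → x ~ y
  ~-reflexive {x} {y} eq = mod 0ζ (≡.trans eq (Iζ.solve 2 (λ y l → y Iζ.:= y Iζ.:+ l Iζ.:* Iζ.con (+ 0)) ≡.refl y (ζ′ ⊞ ⊟ oneζ)))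

  ~-· : ∀ {x x′ y y′} → x ~ x′ → y ~ y′ → x · y ~ x′ · y′
  ~-· {x′ = x′} {y′ = y′} (mod u ≡.refl) (mod v ≡.refl) = mod (u · y′ ⊞ x′ · v ⊞ (ζ′ ⊞ ⊟ oneζ) · (u · v))
    (Iζ.solve 5 (λ x y l u v → (x Iζ.:+ l Iζ.:* u) Iζ.:* (y Iζ.:+ l Iζ.:* v) Iζ.:= x Iζ.:* y Iζ.:+ l Iζ.:* (u Iζ.:* y Iζ.:+ x Iζ.:* v Iζ.:+ l Iζ.:* (u Iζ.:* v))) ≡.refl x′ y′ (ζ′ ⊞ ⊟ oneζ) u v)

  ~-⊞ : ∀ {x x′ y y′} → x ~ x′ → y ~ y′ → x ⊞ y ~ x′ ⊞ y′
  ~-⊞ {x′ = x′} {y′ = y′} (mod u ≡.refl) (mod v ≡.refl) = mod (u ⊞ v)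
    (Iζ.solve 5 (λ x y l u v → (x Iζ.:+ l Iζ.:* u) Iζ.:+ (y Iζ.:+ l Iζ.:* v) Iζ.:= x Iζ.:+ y Iζ.:+ l Iζ.:* (u Iζ.:+ v)) ≡.refl x′ y′ (ζ′ ⊞ ⊟ oneζ) u v)

  ~-sum : ∀ {A : Set} {f h : A → ℤζ} → (∀ x → f x ~ h x) → ∀ xs → Lζ.sum xs f ~ Lζ.sum xs h
  ~-sum eq []       = ~-reflexive ≡.refl
  ~-sum eq (x ∷ xs) = ~-⊞ (eq x) (~-sum eq xs)

  -- Reduction modulo 1 - ζ is the sum of the two coordinates modulo 3; on a + b √-3 that sum is a +
  -- 3 b.
  eisen~-1 : ∀ a b → eisen a b ~ ⊟ oneζ → ∃ λ c → a ≡ ℤ.- (+ 1) ℤ.+ (+ 3) ℤ.* c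
  eisen~-1 a b (mod (u + v ζ) eq) = ℤ.- v ℤ.- b , ≡.trans
    (solve 2 (λ a b → a := (a :+ b) :+ con (+ 2) :* b :- con (+ 3) :* b) ≡.refl a b)
    (≡.trans (≡.cong₂ (λ x y → x ℤ.+ y ℤ.- (+ 3) ℤ.* b) (≡.cong re₀ eq) (≡.cong im₀ eq))
    (solve 3 (λ u v b → (con (ℤ.- (+ 1)) :+ (con (ℤ.- (+ 1)) :* u :- con (+ 1) :* v))
      :+ (con (+ 0) :+ (con (ℤ.- (+ 1)) :* v :+ con (+ 1) :* u :- con (+ 1) :* v)) :- con (+ 3) :* b
      := con (ℤ.- (+ 1)) :+ con (+ 3) :* (:- v :- b)) ≡.refl u v b))
    where open ℤSolver.+-*-Solver

  -- Elements of ℤ[√-3] are those of ℤ[ζ] with even ζ-coordinate, and K ≡ 1 modulo 2 makes it even.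
  odd⇒eisen : ∀ K Z → K ≡ oneζ ⊞ (Z ⊞ Z) → K ≡ eisen (re₀ K ℤ.- im₀ Z) (im₀ Z)
  odd⇒eisen (x + y ζ) (u + v ζ) eq = ≡.cong₂ _+_ζ
    (solve 2 (λ x v → x := x :- v :+ v) ≡.refl x v)
    (≡.trans (≡.cong im₀ eq) (solve 1 (λ v → con (+ 0) :+ (v :+ v) := con (+ 2) :* v) ≡.refl v))
    where open ℤSolver.+-*-Solver

  ζ^~1 : ∀ i → ζ′ ^ζ i ~ oneζ
  ζ^~1 zero    = ~-reflexive ≡.refl
  ζ^~1 (suc i) = ~-· {ζ′} {oneζ} (mod oneζ ≡.refl) (ζ^~1 i)

  χ~1 : ∀ {x} → ¬ (x ≈ 0#) → χ x ~ oneζ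
  χ~1 x≉0 with dlog x≉0
  ... | i , eq = ~-trans (~-reflexive (χ-power i eq)) (ζ^~1 i)

  -- The p - 2 terms with x different from 0 and 1 are each congruent to 1, the other two are 0, and
  -- p - 2 is -1 modulo 3.
  J~-1 : J ~ ⊟ oneζ
  J~-1 = ~-trans (~-sum term elements) (~-trans (~-reflexive total) reduce)
    where
    open ≡.≡-Reasoning
    E : Carrier → ℤζ
    E x = (oneζ ⊞ ⊟ [ x ≈0]) ⊞ ⊟ [ 1# - x ≈0]
    term : ∀ x → χ x · χ (1# - x) ~ E x
    term x with x ≟ 0# | (1# - x) ≟ 0#
    ... | yes x≈0 | yes 1-x≈0 = ⊥-elim (1≉0 (trans (x∙y⁻¹≈ε⇒x≈y 1# x 1-x≈0) x≈0))
    ... | yes x≈0 | no _ = ~-reflexive (≡.trans (≡.cong (_· χ (1# - x)) (χ-zero x≈0)) (Rζ.zeroˡ (χ (1# - x))))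
    ... | no _ | yes 1-x≈0 = ~-reflexive (≡.trans (≡.cong (χ x ·_) (χ-zero 1-x≈0)) (Rζ.zeroʳ (χ x)))
    ... | no x≉0 | no 1-x≉0 = ~-· {χ x} {oneζ} {χ (1# - x)} {oneζ} (χ~1 x≉0) (χ~1 1-x≉0)
    zeros : Lζ.sum elements [_≈0] ≡ oneζ
    zeros = EnumSum.once-in semiringζ fieldEnum 0#
    total : Lζ.sum elements E ≡ (pζ ⊞ ⊟ oneζ) ⊞ ⊟ oneζ
    total = begin
      Lζ.sum elements E
        ≡⟨ sum-sub (λ x → oneζ ⊞ ⊟ [ x ≈0]) (λ x → [ 1# - x ≈0]) ⟩
      Lζ.sum elements (λ x → oneζ ⊞ ⊟ [ x ≈0]) ⊞ ⊟ Lζ.sum elements (λ x → [ 1# - x ≈0])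
        ≡⟨ ≡.cong₂ (λ u v → u ⊞ ⊟ v) (≡.trans (sum-sub (λ _ → oneζ) [_≈0]) (≡.cong₂ (λ u v → u ⊞ ⊟ v) sum-one zeros))
             (≡.trans (≡.sym (reindex-reflect 1# [_≈0] [≈0]-cong)) zeros) ⟩
      (pζ ⊞ ⊟ oneζ) ⊞ ⊟ oneζ ∎
    reduce : (pζ ⊞ ⊟ oneζ) ⊞ ⊟ oneζ ~ ⊟ oneζ
    -- The witness comes from 3 = (ζ - 1)(-2 - ζ), multiplied by e to give p - 1.
    reduce = mod (ofℤ (+ e) · ((ℤ.- (+ 2)) + (ℤ.- (+ 1)) ζ)) (begin
      (pζ ⊞ ⊟ oneζ) ⊞ ⊟ oneζ
        ≡⟨ ≡.cong (λ z → (ofℤ z ⊞ ⊟ oneζ) ⊞ ⊟ oneζ) (≡.trans (≡.cong +_ (≡.trans p≡1+M (≡.cong suc groupOrder≡)))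
             (≡.trans (ℤₚ.pos-+ 1 (e ℕ.* 3)) (≡.cong (λ z → (+ 1) ℤ.+ z) (ℤₚ.pos-* e 3)))) ⟩
      (ofℤ ((+ 1) ℤ.+ (+ e) ℤ.* (+ 3)) ⊞ ⊟ oneζ) ⊞ ⊟ oneζ
        ≡⟨ ≡.cong (λ z → ((oneζ ⊞ z) ⊞ ⊟ oneζ) ⊞ ⊟ oneζ) (ofℤ-* (+ e) (+ 3)) ⟩
      ((oneζ ⊞ ofℤ (+ e) · ofℤ (+ 3)) ⊞ ⊟ oneζ) ⊞ ⊟ oneζ
        ≡⟨ ≡.cong (λ z → ((oneζ ⊞ ofℤ (+ e) · z) ⊞ ⊟ oneζ) ⊞ ⊟ oneζ) (≡.refl {x = ofℤ (+ 3)}) ⟩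
      ((oneζ ⊞ ofℤ (+ e) · ((ζ′ ⊞ ⊟ oneζ) · w₃)) ⊞ ⊟ oneζ) ⊞ ⊟ oneζ
        ≡⟨ Iζ.solve 3 (λ e l w → ((Iζ.con (+ 1) Iζ.:+ e Iζ.:* (l Iζ.:* w)) Iζ.:+ Iζ.:- Iζ.con (+ 1)) Iζ.:+ Iζ.:- Iζ.con (+ 1)
             Iζ.:= Iζ.:- Iζ.con (+ 1) Iζ.:+ l Iζ.:* (e Iζ.:* w)) ≡.refl (ofℤ (+ e)) (ζ′ ⊞ ⊟ oneζ) w₃ ⟩
      ⊟ oneζ ⊞ (ζ′ ⊞ ⊟ oneζ) · (ofℤ (+ e) · w₃) ∎)
      where
      w₃ : ℤζ
      w₃ = (ℤ.- (+ 2)) + (ℤ.- (+ 1)) ζ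

  -- Evaluation at ζ = ω, i.e. reduction modulo a prime above p.
  ω : Carrier
  ω = pow g e

  ω-cube : ω * (ω * ω) ≈ 1#
  ω-cube = trans (*-congˡ (*-congˡ (sym (*-identityʳ ω)))) (trans (sym (pow-* g e 3))
    (trans (reflexive (≡.cong (pow g) (≡.sym groupOrder≡))) γ-order))

  0<e : 0 ℕ.< e
  0<e = positive e groupOrder≡
    where
    positive : ∀ e → groupOrder ≡ e ℕ.* 3 → 0 ℕ.< e
    positive zero eq = ⊥-elim (ℕₚ.<-irrefl (≡.sym eq) M>0)
    positive (suc e) _ = s≤s z≤n

  -- ω³ = 1 while ω ≠ 1, because e is smaller than the order 3 e of g; the factor ω - 1 of ω³ - 1
  -- cancels.
  ω-minimal : ω * ω ≈ - 1# - ω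
  ω-minimal = trans (I.solve 1 (λ w → w I.:* w I.:= (I.con (+ 1) I.:+ w I.:+ w I.:* w) I.:+ (I.:- I.con (+ 1) I.:- w)) refl ω)
    (trans (+-congʳ (domain ω-1≉0 (trans (I.solve 1 (λ w → (w I.:- I.con (+ 1)) I.:* (I.con (+ 1) I.:+ w I.:+ w I.:* w) I.:= w I.:* (w I.:* w) I.:- I.con (+ 1)) refl ω)
      (x≈y⇒x∙y⁻¹≈ε ω-cube)))) (+-identityˡ _))
    where
    ω-1≉0 : ¬ (ω - 1# ≈ 0#)
    ω-1≉0 eq = ∣.>⇒∤ {{ℕ.>-nonZero 0<e}} (≡.subst (e ℕ.<_) (≡.sym groupOrder≡) (ℕₚ.m<m*n e 3 {{ℕ.>-nonZero 0<e}} (s≤s (s≤s z≤n))))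
      (γ-power≈1 e (x∙y⁻¹≈ε⇒x≈y ω 1# eq))

  θ : ℤζ → Carrier
  θ (u + v ζ) = fromℤ u + fromℤ v * ω

  θ-⊞ : ∀ x y → θ (x ⊞ y) ≈ θ x + θ y
  θ-⊞ (a + b ζ) (c + d ζ) = trans (+-cong (fromℤ-+ a c) (*-congʳ (fromℤ-+ b d)))
    (I.solve 5 (λ a b c d w → a I.:+ c I.:+ (b I.:+ d) I.:* w I.:= a I.:+ b I.:* w I.:+ (c I.:+ d I.:* w)) refl _ _ _ _ ω)

  θ-· : ∀ x y → θ (x · y) ≈ θ x * θ y
  θ-· (a + b ζ) (c + d ζ) = trans (+-cong re (*-congʳ im)) (trans
    (I.solve 5 (λ a b c d w → a I.:* c I.:- b I.:* d I.:+ (a I.:* d I.:+ b I.:* c I.:- b I.:* d) I.:* w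
       I.:= a I.:* c I.:+ (a I.:* d I.:+ b I.:* c) I.:* w I.:+ b I.:* d I.:* (I.:- I.con (+ 1) I.:- w)) refl (fromℤ a) (fromℤ b) (fromℤ c) (fromℤ d) ω)
    (trans (+-congˡ (*-congˡ (sym ω-minimal)))
    (I.solve 5 (λ a b c d w → a I.:* c I.:+ (a I.:* d I.:+ b I.:* c) I.:* w I.:+ b I.:* d I.:* (w I.:* w)
       I.:= (a I.:+ b I.:* w) I.:* (c I.:+ d I.:* w)) refl (fromℤ a) (fromℤ b) (fromℤ c) (fromℤ d) ω)))
    where
    re : fromℤ (a ℤ.* c ℤ.- b ℤ.* d) ≈ fromℤ a * fromℤ c - fromℤ b * fromℤ d
    re = trans (fromℤ-+ (a ℤ.* c) (ℤ.- (b ℤ.* d))) (+-cong (fromℤ-* a c) (trans (fromℤ-neg (b ℤ.* d)) (-‿cong (fromℤ-* b d))))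
    im : fromℤ (a ℤ.* d ℤ.+ b ℤ.* c ℤ.- b ℤ.* d) ≈ fromℤ a * fromℤ d + fromℤ b * fromℤ c - fromℤ b * fromℤ d
    im = trans (fromℤ-+ (a ℤ.* d ℤ.+ b ℤ.* c) (ℤ.- (b ℤ.* d))) (+-cong
      (trans (fromℤ-+ (a ℤ.* d) (b ℤ.* c)) (+-cong (fromℤ-* a d) (fromℤ-* b c)))
      (trans (fromℤ-neg (b ℤ.* d)) (-‿cong (fromℤ-* b d))))

  θ-1 : θ oneζ ≈ 1#
  θ-1 = trans (+-congˡ (zeroˡ ω)) (+-identityʳ 1#)

  θ-ζ^ : ∀ i → θ (ζ′ ^ζ i) ≈ pow ω i
  θ-ζ^ zero    = θ-1
  θ-ζ^ (suc i) = trans (θ-· ζ′ (ζ′ ^ζ i)) (*-cong (trans (+-identityˡ _) (*-identityˡ ω)) (θ-ζ^ i))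

  -- At x = g^i both sides are g^(e i): modulo the chosen prime above p, χ becomes the power map
  -- with exponent (p - 1)/3. This turns J into a power sum.
  θ-χ : ∀ x → θ (χ x) ≈ pow x e
  θ-χ x with x ≟ 0#
  ... | yes x≈0 = trans (reflexive (≡.cong θ (χ-zero x≈0))) (trans (trans (+-congˡ (zeroˡ ω)) (+-identityʳ 0#))
          (sym (trans (pow-cong e x≈0) (pow-0 e 0<e))))
  ... | no x≉0 with dlog x≉0
  ...   | i , eq = trans (reflexive (≡.cong θ (χ-power i eq))) (trans (θ-ζ^ i)
            (trans (sym (pow-* g e i)) (trans (pow-*′ g e i) (pow-cong e (sym eq)))))

  θ-sum : ∀ {A : Set} (xs : List A) f → θ (Lζ.sum xs f) ≈ Lk.sum xs (θ ∘ f)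
  θ-sum [] f       = trans (+-congˡ (zeroˡ ω)) (+-identityʳ 0#)
  θ-sum (x ∷ xs) f = trans (θ-⊞ (f x) (Lζ.sum xs f)) (+-congˡ (θ-sum xs f))

  -- Exponent 0 gives p, with the convention 0^0 = 1. For a positive exponent below p - 1,
  -- substituting g x for x multiplies the sum by a power of g different from 1.
  power-sum : ∀ i → i ℕ.< groupOrder → Lk.sum elements (λ x → pow x i) ≈ 0#
  power-sum zero    _   = trans (Lk.sum-const 1# elements) (trans (reflexive (≡.cong (λ z → z ·1) (≡.trans order (ℕₚ.^-identityʳ p)))) characteristic)
  power-sum (suc i) i<M = domain gⁱ-1≉0 (trans (I.solve 2 (λ c s → (c I.:- I.con (+ 1)) I.:* s I.:= c I.:* s I.:- s) refl (pow g (suc i)) Σx)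
    (x≈y⇒x∙y⁻¹≈ε scaled))
    where
    Σx = Lk.sum elements (λ x → pow x (suc i))
    gⁱ-1≉0 : ¬ (pow g (suc i) - 1# ≈ 0#)
    gⁱ-1≉0 eq = ∣.>⇒∤ i<M (γ-power≈1 (suc i) (x∙y⁻¹≈ε⇒x≈y _ _ eq))
    scaled : pow g (suc i) * Σx ≈ Σx
    scaled with inverse g g≉0
    ... | g⁻¹ , gg⁻¹≈1 = trans (sym (Lk.*-sum (pow g (suc i)) elements (λ x → pow x (suc i))))
      (trans (Lk.sum-cong (λ x → sym (pow-*-base (suc i) g x)) elements)
        (EnumSum.sum-bijection commutativeSemiring fieldEnum fieldEnum (g *_) (g⁻¹ *_) *-congˡ *-congˡ
          (λ x → trans (sym (*-assoc _ _ _)) (trans (*-congʳ (trans (*-comm _ _) gg⁻¹≈1)) (*-identityˡ x)))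
          (λ x → trans (sym (*-assoc _ _ _)) (trans (*-congʳ gg⁻¹≈1) (*-identityˡ x)))
          (λ x → pow x (suc i)) (pow-cong (suc i))))

  -- The summand is a polynomial in x of degree i + n, below p - 1, so it is a combination of
  -- vanishing power sums; the induction expands one factor 1 - x at a time.
  mixed-power-sum : ∀ n i → i ℕ.+ n ℕ.< groupOrder → Lk.sum elements (λ x → pow x i * pow (1# - x) n) ≈ 0#
  mixed-power-sum zero i lt = trans (Lk.sum-cong (λ x → *-identityʳ (pow x i)) elements) (power-sum i (≡.subst (ℕ._< groupOrder) (ℕₚ.+-identityʳ i) lt))
  mixed-power-sum (suc n) i lt = trans
    (Lk.sum-cong (λ x → I.solve 3 (λ x a b → a I.:* ((I.con (+ 1) I.:- x) I.:* b) I.:= a I.:* b I.:+ I.con (ℤ.- (+ 1)) I.:* (x I.:* a I.:* b)) refl x (pow x i) (pow (1# - x) n)) elements)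
    (trans (Lk.sum-+ elements _ _) (trans (+-cong
      (mixed-power-sum n i (ℕₚ.<-trans (ℕₚ.+-monoʳ-< i (ℕₚ.n<1+n n)) lt))
      (trans (Lk.*-sum (- 1#) elements _) (trans (*-congˡ (mixed-power-sum n (suc i) (≡.subst (ℕ._< groupOrder) (ℕₚ.+-suc i n) lt))) (zeroʳ _))))
      (+-identityˡ 0#)))

  -- Both exponents are e, and 2 e < 3 e = p - 1.
  θ-J : θ J ≈ 0#
  θ-J = trans (θ-sum elements _) (trans (Lk.sum-cong (λ x → trans (θ-· (χ x) (χ (1# - x))) (*-cong (θ-χ x) (θ-χ (1# - x)))) elements)
    (mixed-power-sum e e (≡.subst (e ℕ.+ e ℕ.<_) (≡.sym (≡.trans groupOrder≡ (≡.trans (ℕₚ.*-comm e 3) (≡.trans (≡.sym (ℕₚ.+-assoc e e (e ℕ.+ 0))) (≡.cong (λ z → e ℕ.+ e ℕ.+ z) (ℕₚ.+-identityʳ e))))))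
      (ℕₚ.m<m+n (e ℕ.+ e) 0<e))))

module JacobiSumValue
  (k : FiniteField) (p : ℕ) (prime : Prime p) (order : length (FiniteField.elements k) ≡ p ℕ.^ 1)
  (g : FiniteField.Carrier k) (g-primitive : FF.Primitive k p 1 g)
  (e : ℕ) (groupOrder≡ : p ℕ.^ 1 ℕ.∸ 1 ≡ e ℕ.* 3) where

  open FiniteField k hiding (zero)
  open FF k using (pow)
  open CyclicField k p 1 prime order g g-primitive
    using (groupOrder; γ-power≈1; γ-order; powers; powers-unique; powers-complete; fromℤ≈0⇒∣; 1<p)
    renaming (γ≉0 to g≉0)
  open Powers k
  open Factorization k using (decSetoid; fieldEnum; domain)
  open JacobiSum k p prime order g g-primitive e groupOrder≡
  open Eisenstein
  open IntegerLemmas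
  open IntegerMultiples commRing using (fromℤ; fromℤ-+; fromℤ-*; fromℤ-neg)
  private
    module I = IntegerMultiples commRing
    module Lζ = ListSum semiringζ
  open RingP ring using (-0#≈0#; x∙y⁻¹≈ε⇒x≈y; x≈y⇒x∙y⁻¹≈ε)

  module Identify (h : ℕ) (M≡h+h : groupOrder ≡ h ℕ.+ h) (k₂ : ℕ) (two≈ : 1# + 1# ≈ pow g k₂)
    (a b : ℤ) (norm : a ℤ.* a ℤ.+ (+ 3) ℤ.* b ℤ.* b ≡ + p)
    (a≡-1 : ∃ λ c → a ≡ ℤ.- (+ 1) ℤ.+ (+ 3) ℤ.* c)
    (b≡ : fromℤ ((+ 3) ℤ.* b) ≈ ((1# + 1#) * ω + 1#) * fromℤ a) where

    two : Carrier
    two = 1# + 1#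

    two≉0 : ¬ (two ≈ 0#)
    two≉0 eq = pow-nonzero k₂ g≉0 (trans (sym two≈) eq)

    private
      f : Carrier → ℤζ
      f u = χ (1# + u) · χ (1# - u)

      f-cong : ∀ {x y} → x ≈ y → f x ≡ f y
      f-cong eq = ≡.cong₂ _·_ (χ-cong (+-congˡ eq)) (χ-cong (+-congˡ (-‿cong eq)))

      f-even : ∀ x → f (- x) ≡ f x
      f-even x = ≡.trans (≡.cong (χ (1# - x) ·_) (χ-cong (+-congˡ (-‿involutive x)))) (·-comm (χ (1# - x)) (χ (1# + x)))
        where open RingP ring using (-‿involutive)

      0<h : 0 ℕ.< h
      0<h = positive h M≡h+h
        where
        positive : ∀ h → groupOrder ≡ h ℕ.+ h → 0 ℕ.< h
        positive zero eq = ⊥-elim (ℕₚ.<-irrefl (≡.sym eq) M>0)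
        positive (suc h) _ = s≤s z≤n

      gʰ≈-1 : pow g h ≈ - 1#
      gʰ≈-1 = x∙y⁻¹≈ε⇒x≈y _ _ (domain gʰ-1≉0 (trans
        (I.solve 1 (λ x → (x I.:- I.con (+ 1)) I.:* (x I.:- (I.:- I.con (+ 1))) I.:= x I.:* x I.:- I.con (+ 1)) refl (pow g h))
        (x≈y⇒x∙y⁻¹≈ε (trans (sym (pow-+ g h h)) (trans (reflexive (≡.cong (pow g) (≡.sym M≡h+h))) γ-order)))))
        where
        gʰ-1≉0 : ¬ (pow g h - 1# ≈ 0#)
        gʰ-1≉0 eq = ∣.>⇒∤ {{ℕ.>-nonZero 0<h}} (≡.subst (h ℕ.<_) (≡.sym M≡h+h) (ℕₚ.m<m+n h 0<h)) (γ-power≈1 h (x∙y⁻¹≈ε⇒x≈y _ _ eq))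

      Z : ℤζ
      Z = Lζ.sum (upTo h) (λ i → f (pow g i))

    abstract
      -- This is χ(4) J, since χ(4) = χ(2)² = χ̄(2). It is opaque outside the block and unfolds only
      -- through `K-def`.
      K : ℤζ
      K = J · χ̄ two

      K-def : K ≡ J · χ̄ two
      K-def = ≡.refl

    abstract
      K-norm : K · conj K ≡ ofℤ (+ p)
      K-norm = ≡.trans (≡.cong (λ z → z · conj z) K-def)
        (≡.trans (≡.cong ((J · χ̄ two) ·_) (≡.trans (conj-· J (χ̄ two)) (≡.cong (conj J ·_) (conj-conj (χ two)))))
        (≡.trans (Iζ.solve 4 (λ j u j′ v → j Iζ.:* u Iζ.:* (j′ Iζ.:* v) Iζ.:= j Iζ.:* j′ Iζ.:* (u Iζ.:* v)) ≡.refl J (χ̄ two) (conj J) (χ two))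
        (≡.trans (≡.cong₂ _·_ J-norm (χ-unit two≉0)) (Rζ.*-identityʳ pζ))))

      K~-1 : K ~ ⊟ oneζ
      K~-1 = ~-trans (~-reflexive K-def) (~-· {J} {⊟ oneζ} {χ̄ two} {oneζ} J~-1
        (~-trans (~-reflexive (conj-χ two)) (~-· {χ two} {oneζ} {χ two} {oneζ} (χ~1 two≉0) (χ~1 two≉0))))

      -- K is the sum of χ(x) χ(2 - x). With x = 1 + u the summand is even in u; the nonzero u fall
      -- into pairs ±g^i with i < h, and u = 0 contributes 1.
      K≡1+2Z : K ≡ oneζ ⊞ (Z ⊞ Z)
      K≡1+2Z = begin
        K            ≡⟨ K-def ⟩
        J · χ̄ two
          ≡⟨ χ★χ two ⟨
        Lζ.sum elements (λ x → χ x · χ (two - x))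
          ≡⟨ reindex (λ u → 1# + u) (λ x → x - 1#) +-congˡ +-congʳ
               (λ u → I.solve 1 (λ u → I.con (+ 1) I.:+ u I.:- I.con (+ 1) I.:= u) refl u)
               (λ x → I.solve 1 (λ x → I.con (+ 1) I.:+ (x I.:- I.con (+ 1)) I.:= x) refl x)
               (λ x → χ x · χ (two - x)) (λ eq → ≡.cong₂ _·_ (χ-cong eq) (χ-cong (+-congˡ (-‿cong eq)))) ⟩
        Lζ.sum elements (λ u → χ (1# + u) · χ (two - (1# + u)))
          ≡⟨ Lζ.sum-cong (λ u → ≡.cong (χ (1# + u) ·_) (χ-cong
               (I.solve 1 (λ u → I.con (+ 1) I.:+ I.con (+ 1) I.:- (I.con (+ 1) I.:+ u) I.:= I.con (+ 1) I.:- u) refl u))) elements ⟩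
        Lζ.sum elements f
          -- The field is listed anew as 0 and the powers of g, where g^h = -1 puts u and -u exactly
          -- h places apart.
          ≡⟨ EnumSum.sum-bijection semiringζ fieldEnum (unique⇒enumeration decSetoid powers powers-complete powers-unique)
               (λ x → x) (λ x → x) (λ eq → eq) (λ eq → eq) (λ _ → refl) (λ _ → refl) f f-cong ⟩
        f 0# ⊞ Lζ.sum (applyUpTo (pow g) groupOrder) f
          ≡⟨ ≡.cong₂ _⊞_ f-zero (≡.trans (≡.cong (λ xs → Lζ.sum xs f) (≡.sym (Listₚ.map-upTo (pow g) groupOrder))) (Lζ.sum-map (pow g) (upTo groupOrder) f)) ⟩
        oneζ ⊞ Lζ.sum (upTo groupOrder) (f ∘ pow g)
          ≡⟨ ≡.cong (λ n → oneζ ⊞ Lζ.sum (upTo n) (f ∘ pow g)) M≡h+h ⟩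
        oneζ ⊞ Lζ.sum (upTo (h ℕ.+ h)) (f ∘ pow g)
          ≡⟨ ≡.cong (oneζ ⊞_) (IntervalSum.sum-upTo-+ semiringζ h h (f ∘ pow g)) ⟩
        oneζ ⊞ (Z ⊞ Lζ.sum (upTo h) (λ i → f (pow g (h ℕ.+ i))))
          ≡⟨ ≡.cong (λ z → oneζ ⊞ (Z ⊞ z)) (Lζ.sum-cong (λ i → ≡.trans (f-cong (trans (pow-+ g h i) (trans (*-congʳ gʰ≈-1)
               (I.solve 1 (λ x → I.con (ℤ.- (+ 1)) I.:* x I.:= I.:- x) refl (pow g i))))) (f-even (pow g i))) (upTo h)) ⟩
        oneζ ⊞ (Z ⊞ Z) ∎
        where
        open ≡.≡-Reasoning
        f-zero : f 0# ≡ oneζ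
        f-zero = ≡.trans (≡.cong₂ _·_ (≡.trans (χ-cong (+-identityʳ 1#)) χ-1) (≡.trans (χ-cong (trans (+-congˡ -0#≈0#) (+-identityʳ 1#))) χ-1)) ≡.refl

    -- Read off from K = 1 + 2 Z: the element `eisen A B` has coordinates A + B and 2 B.
    A B : ℤ
    B = im₀ Z
    A = re₀ K ℤ.- B

    abstract
      K≡eisen : K ≡ eisen A B
      K≡eisen = odd⇒eisen K Z K≡1+2Z

      normK : A ℤ.* A ℤ.+ (+ 3) ℤ.* B ℤ.* B ≡ + p
      normK = ofℤ-injective (≡.trans (≡.sym (eisen-norm A B)) (≡.trans (≡.cong (λ z → z · conj z) (≡.sym K≡eisen)) K-norm))

      A≡-1 : ∃ λ c → A ≡ ℤ.- (+ 1) ℤ.+ (+ 3) ℤ.* c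
      A≡-1 = eisen~-1 A B (≡.subst (_~ ⊟ oneζ) K≡eisen K~-1)

      -- J, and with it K, vanishes at ζ = ω, where √-3 = 2 ζ + 1 takes the value 2 ω + 1.
      θ-K : fromℤ A ≈ - (fromℤ B * ((1# + 1#) * ω + 1#))
      θ-K = trans (I.solve 3 (λ α β w → α I.:= (α I.:+ β I.:+ (I.con (+ 1) I.:+ I.con (+ 1)) I.:* β I.:* w) I.:- β I.:* ((I.con (+ 1) I.:+ I.con (+ 1)) I.:* w I.:+ I.con (+ 1))) refl (fromℤ A) (fromℤ B) ω)
        (trans (+-congʳ (trans (sym (+-cong (fromℤ-+ A B) (*-congʳ (fromℤ-* (+ 2) B))))
           (trans (reflexive (≡.cong θ (≡.trans (≡.sym K≡eisen) K-def))) (trans (θ-· J (χ̄ two)) (trans (*-congʳ θ-J) (zeroˡ _))))))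
        (+-identityˡ _))

      -- The hypothesis on b reads 3 b = (2 ω + 1) a in the field. Since (2 ω + 1)² = -3, the
      -- product A · 3 b is -B (2 ω + 1)² a = 3 a B.
      3X≈0 : fromℤ ((+ 3) ℤ.* (A ℤ.* b ℤ.- a ℤ.* B)) ≈ 0#
      3X≈0 = trans (reflexive (≡.cong fromℤ rearranged))
        (trans (fromℤ-+ (A ℤ.* ((+ 3) ℤ.* b)) (ℤ.- ((+ 3) ℤ.* (a ℤ.* B))))
        (trans (+-cong (trans (fromℤ-* A ((+ 3) ℤ.* b)) (*-cong θ-K b≡))
           (trans (fromℤ-neg ((+ 3) ℤ.* (a ℤ.* B))) (-‿cong (trans (fromℤ-* (+ 3) (a ℤ.* B)) (*-congˡ (fromℤ-* a B))))))
        (in-field (fromℤ B) (fromℤ a))))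
        where
        rearranged : (+ 3) ℤ.* (A ℤ.* b ℤ.- a ℤ.* B) ≡ A ℤ.* ((+ 3) ℤ.* b) ℤ.+ ℤ.- ((+ 3) ℤ.* (a ℤ.* B))
        rearranged = solve 4 (λ A B a b → con (+ 3) :* (A :* b :- a :* B) := A :* (con (+ 3) :* b) :+ :- (con (+ 3) :* (a :* B))) ≡.refl A B a b
          where open ℤSolver.+-*-Solver
        in-field : ∀ β c → - (β * (two * ω + 1#)) * ((two * ω + 1#) * c) - fromℤ (+ 3) * (c * β) ≈ 0#
        in-field β c = trans
          (I.solve 3 (λ β w c → (I.:- (β I.:* ((I.con (+ 1) I.:+ I.con (+ 1)) I.:* w I.:+ I.con (+ 1)))) I.:* (((I.con (+ 1) I.:+ I.con (+ 1)) I.:* w I.:+ I.con (+ 1)) I.:* c)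
             I.:- I.con (+ 3) I.:* (c I.:* β) I.:= I.:- (I.con (+ 4) I.:* (β I.:* c)) I.:* (w I.:* w I.:- (I.:- I.con (+ 1) I.:- w))) refl β ω c)
          (trans (*-congˡ (x≈y⇒x∙y⁻¹≈ε ω-minimal)) (zeroʳ _))

      p∣X : (+ p) ℤ∣.∣ (A ℤ.* b ℤ.- a ℤ.* B)
      p∣X = [ (λ p∣3 → ⊥-elim (∣.>⇒∤ 3<p p∣3)) , (λ d → d) ]′ (euclidsLemma 3 ℤ.∣ A ℤ.* b ℤ.- a ℤ.* B ∣ prime
        (≡.subst (p ∣_) (ℤₚ.abs-* (+ 3) (A ℤ.* b ℤ.- a ℤ.* B)) (fromℤ≈0⇒∣ ((+ 3) ℤ.* (A ℤ.* b ℤ.- a ℤ.* B)) 3X≈0)))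
        where
        3<p : 3 ℕ.< p
        3<p = ≡.subst (3 ℕ.<_) (≡.sym (≡.trans p≡1+M (≡.cong suc groupOrder≡))) (s≤s (ℕₚ.m≤n*m 3 e {{ℕ.>-nonZero 0<e}}))

    jacobi-sum : (ζ′ ^ζ k₂) · eisen a b ≡ J
    jacobi-sum = begin
      (ζ′ ^ζ k₂) · eisen a b                   ≡⟨ ≡.cong₂ (λ x y → (ζ′ ^ζ k₂) · eisen x y) (proj₁ AB≡ab) (proj₂ AB≡ab) ⟨
      (ζ′ ^ζ k₂) · eisen A B                   ≡⟨ ≡.cong₂ _·_ (χ-power k₂ two≈) (≡.trans (≡.sym K-def) K≡eisen) ⟨
      χ two · (J · χ̄ two)                      ≡⟨ Iζ.solve 3 (λ x j y → x Iζ.:* (j Iζ.:* y) Iζ.:= j Iζ.:* (y Iζ.:* x)) ≡.refl (χ two) J (χ̄ two) ⟩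
      J · (χ̄ two · χ two)                      ≡⟨ ≡.cong (J ·_) (χ-unit two≉0) ⟩
      J · oneζ                                 ≡⟨ Rζ.*-identityʳ J ⟩
      J                                        ∎
      where
      open ≡.≡-Reasoning
      AB≡ab : A ≡ a × B ≡ b
      AB≡ab = representation-unique A B a b p (ℕₚ.<-trans (s≤s z≤n) 1<p) normK norm p∣X A≡-1 a≡-1

-- Counting

module Counting
  (F : FiniteField) (p m : ℕ) (prime : Prime p)
  (order : length (FiniteField.elements F) ≡ p ℕ.^ m)
  (γ : FiniteField.Carrier F) (γ-primitive : FF.Primitive F p m γ) (0<m : 0 ℕ.< m)
  (t n : ℕ) (m≡nt : m ≡ n ℕ.* t) (0<n : 0 ℕ.< n) (0<t : 0 ℕ.< t)
  (e : ℕ) (p-1≡3e : p ℕ.^ 1 ℕ.∸ 1 ≡ e ℕ.* 3) where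

  module F = FiniteField F
  open FF F using (pow; Tr; Nm; fromℕ; count; Ncount)
  open Powers F using (pow-cong; pow-+; pow-*; pow-0)
  open CyclicField F p m prime order γ γ-primitive using (frob; frob-cong; frob-zero; _·1)
  open Correspondence F p m prime order γ γ-primitive 0<m t n m≡nt 0<n 0<t
  open Eisenstein
  private
    module Sk = PrimePowerSums k
    module L = ListSum semiringζ

  g : k.Carrier
  g = Subk.generatorₛ

  pow-k : ∀ x i → proj₁ (FF.pow k x i) F.≈ pow (proj₁ x) i
  pow-k x zero    = F.refl
  pow-k x (suc i) = F.*-congˡ (pow-k x i)

  abstract
    k-primitive : FF.Primitive k p 1 g
    k-primitive = Subk.generator≉0 , λ i 0<i i<M eq → ∣.>⇒∤ {{ℕ.>-nonZero 0<i}} i<M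
      (Subk.generator-power≈1 i (F.trans (F.sym (pow-k g i)) eq))

  open JacobiSum k p prime Subk.subfield-order g k-primitive e p-1≡3e public

  norm trace : K.Carrier → k.Carrier
  norm x  = proj₁ (char x) 0
  trace x = Sk.sub t (proj₁ (char x))

  norm-pow : ∀ x → proj₁ (norm x) F.≈ Prod*.prod t (λ i → frob i (proj₁ x))
  norm-pow = char-constant

  norm-zero : ∀ {x} → norm x k.≈ k.0# → proj₁ x F.≈ F.0#
  norm-zero {x , fx} eq with x F.≟ F.0#
  ... | yes x≈0 = x≈0
  ... | no x≉0 = ⊥-elim (nonzero t {0} (F.trans (F.sym (norm-pow (x , fx))) eq))
    where
    nonzero : ∀ s {d} → ¬ (Prod*.prod s (λ i → frob (d ℕ.+ i) x) F.≈ F.0#)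
    nonzero zero eq = F.1≉0 eq
    nonzero (suc s) {d} eq = nonzero s {suc d} (F.trans (Prod*.prod-cong s (λ i → F.reflexive (≡.cong (λ z → frob z x) (≡.sym (ℕₚ.+-suc d i)))))
      (PF.domain (Powers.pow-nonzero F (p ℕ.^ (d ℕ.+ 0)) x≉0) eq))

  norm-zero⁻ : ∀ {x} → proj₁ x F.≈ F.0# → norm x k.≈ k.0#
  norm-zero⁻ {x , fx} x≈0 = F.trans (norm-pow (x , fx)) (go t 0<t)
    where
    go : ∀ s → 0 ℕ.< s → Prod*.prod s (λ i → frob i x) F.≈ F.0#
    go (suc s) _ = F.trans (F.*-congʳ (F.trans (frob-cong 0 x≈0) (frob-zero 0))) (F.zeroˡ _)

  trace-cong : ∀ {x y} → x K.≈ y → trace x k.≈ trace y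
  trace-cong {x} {y} eq = F.trans (char-sub x) (F.trans (Sum+.prod-cong t (λ i → frob-cong i eq)) (F.sym (char-sub y)))

  trace-0 : trace K.0# k.≈ k.0#
  trace-0 = F.trans (char-sub K.0#) (F.trans (Sum+.prod-cong t (λ i → frob-zero i)) (zeros t))
    where
    zeros : ∀ s → Sum+.prod s (λ _ → F.0#) F.≈ F.0#
    zeros zero    = F.refl
    zeros (suc s) = F.trans (F.+-identityˡ _) (zeros s)

  KSetoid : DecSetoid 0ℓ 0ℓ
  KSetoid = Factorization.decSetoid K

  KEnum : Enumeration KSetoid
  KEnum = Factorization.fieldEnum K

  private
    open MultP Rζ.semiring using () renaming (_×_ to _×ζ_)
    open MultP (CommutativeSemiring.semiring ℕₚ.+-*-commutativeSemiring) using () renaming (_×_ to _×ℕ_)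

    ×-ofℤ : ∀ c → c ×ζ oneζ ≡ ofℤ (+ c)
    ×-ofℤ zero    = ≡.refl
    ×-ofℤ (suc c) = ≡.cong (oneζ ⊞_) (×-ofℤ c)

    ×-ℕ : ∀ c → c ×ℕ 1 ≡ c
    ×-ℕ zero    = ≡.refl
    ×-ℕ (suc c) = ≡.cong suc (×-ℕ c)

  [_≟_] : k.Carrier → k.Carrier → ℤζ
  [ x ≟ y ] = L.⟦ x k.≟ y ⟧

  -- The fibres of the trace are counted without linear algebra: the correspondence with prime
  -- powers turns the count into `degree-sum-sub`.
  trace-count : ∀ a → L.sum K.elements (λ x → [ trace x ≟ a ]) ≡ ofℤ (+ (p ℕ.^ (t ℕ.∸ 1)))
  trace-count a = begin
    L.sum K.elements (λ x → [ trace x ≟ a ])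
      ≡⟨ L.sum-cong (λ x → ⟦⟧-fromℕ semiringζ (trace x k.≟ a)) K.elements ⟨
    L.sum K.elements (λ x → ℕSum.⟦ trace x k.≟ a ⟧ ×ζ oneζ)
      ≡⟨ sum-fromℕ semiringζ (λ x → ℕSum.⟦ trace x k.≟ a ⟧) K.elements ⟨
    ℕSum.sum K.elements (λ x → ℕSum.⟦ trace x k.≟ a ⟧) ×ζ oneζ
      ≡⟨ ×-ofℤ _ ⟩
    ofℤ (+ ℕSum.sum K.elements (λ x → ℕSum.⟦ trace x k.≟ a ⟧))
      ≡⟨ ≡.cong (ofℤ ∘ +_) (≡.trans (sum-correspondence ℕₚ.+-*-commutativeSemiring (λ P → ℕSum.⟦ Sk.sub t P k.≟ a ⟧)
           (λ {P} {Q} eq → ℕSum.⟦⟧-cong (k.trans {Sk.sub t Q} {Sk.sub t P} {a} (k.sym {Sk.sub t P} {Sk.sub t Q} (Sk.sub-cong t {P} {Q} eq)))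
              (k.trans {Sk.sub t P} {Sk.sub t Q} {a} (Sk.sub-cong t {P} {Q} eq)) (Sk.sub t P k.≟ a) (Sk.sub t Q k.≟ a)))
         (≡.trans (ℕSum.sum-cong (λ H → ≡.cong (ℕ._* (ℕSum.⟦ Pk.PrimePower.size H ℕ.≟ t ⟧ ℕ.* ℕSum.⟦ Sk.sub t (Pk.PrimePower.value H) k.≟ a ⟧)) (×-ℕ (Pk.PrimePower.degree H))) (Pk.primePowers t))
           (go t 0<t))) ⟩
    ofℤ (+ (p ℕ.^ (t ℕ.∸ 1))) ∎
    where
    open ≡.≡-Reasoning
    go : ∀ s → 0 ℕ.< s → ℕSum.sum (Pk.primePowers s) (λ H → Pk.PrimePower.degree H ℕ.* (ℕSum.⟦ Pk.PrimePower.size H ℕ.≟ s ⟧ ℕ.* ℕSum.⟦ Sk.sub s (Pk.PrimePower.value H) k.≟ a ⟧)) ≡ p ℕ.^ (s ℕ.∸ 1)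
    go (suc s) _ = ≡.trans (Sk.degree-sum-sub ℕₚ.≤-refl a) (≡.cong (ℕ._^ s) (≡.trans Subk.subfield-order (ℕₚ.^-identityʳ p)))

  private module Ch = Sk.Character.ForCharacter semiringζ χ χ-cong χ-* χ-1 χ-sum

  characterSum : ℕ → k.Carrier → ℤζ
  characterSum = Ch.primePowerSum t

  open ClosedForm t characterSum Ch.primePowerSum-one (λ s le a → Ch.primePowerSum-suc le a) public

  character-sum : ∀ a → L.sum K.elements (λ x → χ (norm x) · [ trace x ≟ a ]) ≡ characterSum t a
  character-sum a = sum-correspondence semiringζ (λ P → χ (P 0) · [ Sk.sub t P ≟ a ])
    (λ {P} {Q} eq → ≡.cong₂ _·_ (χ-cong {P 0} {Q 0} (eq 0)) (L.⟦⟧-cong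
      (k.trans {Sk.sub t Q} {Sk.sub t P} {a} (k.sym {Sk.sub t P} {Sk.sub t Q} (Sk.sub-cong t {P} {Q} eq)))
      (k.trans {Sk.sub t P} {Sk.sub t Q} {a} (Sk.sub-cong t {P} {Q} eq)) (Sk.sub t P k.≟ a) (Sk.sub t Q k.≟ a)))

  -- Only x = 0 has norm 0, and its trace is 0.
  norm-zero-sum : ∀ a → L.sum K.elements (λ x → [ norm x ≈0] · [ trace x ≟ a ]) ≡ [ a ≈0]
  norm-zero-sum a = begin
    L.sum K.elements (λ x → [ norm x ≈0] · [ trace x ≟ a ])
      ≡⟨ L.sum-cong (λ x → ≡.cong (_· [ trace x ≟ a ]) (L.⟦⟧-cong (norm-zero {x}) (norm-zero⁻ {x}) (norm x k.≟ k.0#) (x K.≟ K.0#))) K.elements ⟩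
    L.sum K.elements (λ x → L.⟦ x K.≟ K.0# ⟧ · [ trace x ≟ a ])
      ≡⟨ EnumSum.delta semiringζ KEnum (λ x → [ trace x ≟ a ])
           (λ {x} {y} eq → L.⟦⟧-cong (F.trans (F.sym (trace-cong {x} {y} eq))) (F.trans (trace-cong {x} {y} eq)) (trace x k.≟ a) (trace y k.≟ a)) K.0# ⟩
    [ trace K.0# ≟ a ]
      ≡⟨ L.⟦⟧-cong (λ eq → F.trans (F.sym eq) trace-0) (λ eq → F.trans trace-0 (F.sym eq)) (trace K.0# k.≟ a) (a k.≟ k.0#) ⟩
    [ a ≈0] ∎
    where open ≡.≡-Reasoning

  private
    nonzero-trace-sum : {A : Set} (xs : List A) (τ ν : A → ℤζ) {P δ : ℤζ} → L.sum xs τ ≡ P → L.sum xs (λ x → ν x · τ x) ≡ δ →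
      L.sum xs (λ x → τ x · (oneζ ⊞ ⊟ ν x)) ≡ P ⊞ ⊟ δ
    nonzero-trace-sum xs τ ν {P} {δ} eqP eqδ = begin
      L.sum xs (λ x → τ x · (oneζ ⊞ ⊟ ν x))
        ≡⟨ L.sum-cong (λ x → Iζ.solve 2 (λ τ ν → τ Iζ.:* (Iζ.con (+ 1) Iζ.:+ Iζ.:- ν) Iζ.:= τ Iζ.:+ Iζ.con (ℤ.- (+ 1)) Iζ.:* (ν Iζ.:* τ)) ≡.refl (τ x) (ν x)) xs ⟩
      L.sum xs (λ x → τ x ⊞ (⊟ oneζ) · (ν x · τ x))
        ≡⟨ L.sum-+ xs τ (λ x → (⊟ oneζ) · (ν x · τ x)) ⟩
      L.sum xs τ ⊞ L.sum xs (λ x → (⊟ oneζ) · (ν x · τ x))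
        ≡⟨ ≡.cong₂ _⊞_ eqP (≡.trans (L.*-sum (⊟ oneζ) xs (λ x → ν x · τ x)) (≡.cong ((⊟ oneζ) ·_) eqδ)) ⟩
      P ⊞ (⊟ oneζ) · δ
        ≡⟨ Iζ.solve 2 (λ P ν → P Iζ.:+ Iζ.con (ℤ.- (+ 1)) Iζ.:* ν Iζ.:= P Iζ.:+ Iζ.:- ν) ≡.refl P δ ⟩
      P ⊞ ⊟ δ ∎
      where open ≡.≡-Reasoning

    -- Stated for arbitrary functions on a list. A real weight τ lets conjugation pass through the
    -- sum, so that the two character terms combine to twice a real part.
    combined-sum : {A : Set} (xs : List A) (τ ν y : A → ℤζ) (c : ℤζ) {P δ S : ℤζ} → (∀ x → conj (τ x) ≡ τ x) →
      L.sum xs τ ≡ P → L.sum xs (λ x → ν x · τ x) ≡ δ → L.sum xs (λ x → y x · τ x) ≡ S →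
      L.sum xs (λ x → τ x · ((oneζ ⊞ ⊟ ν x) ⊞ (c · y x ⊞ conj (c · y x)))) ≡ (P ⊞ ⊟ δ) ⊞ ofℤ (twoRe (c · S))
    combined-sum xs τ ν y c {P} {δ} {S} real eqP eqδ eqS = begin
      L.sum xs (λ x → τ x · ((oneζ ⊞ ⊟ ν x) ⊞ (c · y x ⊞ conj (c · y x))))
        ≡⟨ L.sum-cong term xs ⟩
      L.sum xs (λ x → τ x · (oneζ ⊞ ⊟ ν x) ⊞ (f x ⊞ conj (f x)))
        ≡⟨ ≡.trans (L.sum-+ xs (λ x → τ x · (oneζ ⊞ ⊟ ν x)) (λ x → f x ⊞ conj (f x)))
             (≡.cong₂ _⊞_ (nonzero-trace-sum xs τ ν eqP eqδ) (L.sum-+ xs f (conj ∘ f))) ⟩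
      (P ⊞ ⊟ δ) ⊞ (L.sum xs f ⊞ L.sum xs (conj ∘ f))
        ≡⟨ ≡.cong (λ z → (P ⊞ ⊟ δ) ⊞ (L.sum xs f ⊞ z)) (≡.sym (conj-sum xs f)) ⟩
      (P ⊞ ⊟ δ) ⊞ (L.sum xs f ⊞ conj (L.sum xs f))
        ≡⟨ ≡.cong (λ z → (P ⊞ ⊟ δ) ⊞ (z ⊞ conj z)) (≡.trans (L.*-sum c xs (λ x → y x · τ x)) (≡.cong (c ·_) eqS)) ⟩
      (P ⊞ ⊟ δ) ⊞ (c · S ⊞ conj (c · S))
        ≡⟨ ≡.cong ((P ⊞ ⊟ δ) ⊞_) (⊞-conj (c · S)) ⟩
      (P ⊞ ⊟ δ) ⊞ ofℤ (twoRe (c · S)) ∎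
      where
      open ≡.≡-Reasoning
      f : _ → ℤζ
      f x = c · (y x · τ x)
      term : ∀ x → τ x · ((oneζ ⊞ ⊟ ν x) ⊞ (c · y x ⊞ conj (c · y x))) ≡ τ x · (oneζ ⊞ ⊟ ν x) ⊞ (f x ⊞ conj (f x))
      term x = ≡.trans (Iζ.solve 5 (λ τ u c y y′ → τ Iζ.:* (u Iζ.:+ (c Iζ.:* y Iζ.:+ y′)) Iζ.:= τ Iζ.:* u Iζ.:+ (c Iζ.:* (y Iζ.:* τ) Iζ.:+ y′ Iζ.:* τ)) ≡.refl
          (τ x) (oneζ ⊞ ⊟ ν x) c (y x) (conj (c · y x)))
        (≡.cong (λ z → τ x · (oneζ ⊞ ⊟ ν x) ⊞ (f x ⊞ z)) (≡.trans
          (≡.trans (≡.cong (conj (c · y x) ·_) (≡.sym (real x))) (≡.sym (conj-· (c · y x) (τ x))))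
          (≡.cong conj (Rζ.*-assoc c (y x) (τ x)))))

    conj-⟦⟧ : ∀ {Q : Set} (d : Dec Q) → conj L.⟦ d ⟧ ≡ L.⟦ d ⟧
    conj-⟦⟧ (yes _) = ≡.refl
    conj-⟦⟧ (no _)  = ≡.refl

  nonzero-trace-count : ∀ a → L.sum K.elements (λ x → [ trace x ≟ a ] · (oneζ ⊞ ⊟ [ norm x ≈0])) ≡ ofℤ (+ (p ℕ.^ (t ℕ.∸ 1))) ⊞ ⊟ [ a ≈0]
  nonzero-trace-count a = nonzero-trace-sum K.elements (λ x → [ trace x ≟ a ]) (λ x → [ norm x ≈0]) (trace-count a) (norm-zero-sum a)

  coset-sum : ∀ c a → L.sum K.elements (λ x → [ trace x ≟ a ] · ((oneζ ⊞ ⊟ [ norm x ≈0]) ⊞ (c · χ (norm x) ⊞ conj (c · χ (norm x))))) ≡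
              (ofℤ (+ (p ℕ.^ (t ℕ.∸ 1))) ⊞ ⊟ [ a ≈0]) ⊞ ofℤ (twoRe (c · characterSum t a))
  coset-sum c a = combined-sum K.elements (λ x → [ trace x ≟ a ]) (λ x → [ norm x ≈0]) (χ ∘ norm) c
    (λ x → conj-⟦⟧ (trace x k.≟ a)) (trace-count a) (norm-zero-sum a) (character-sum a)

  private
    count≡sum : (P : F.Carrier → Bool) → ∀ xs → count P xs ≡ ℕSum.sum xs (λ x → ℕSum.⟦ T? (P x) ⟧)
    count≡sum P [] = ≡.refl
    count≡sum P (x ∷ xs) with P x
    ... | true  = ≡.cong suc (count≡sum P xs)
    ... | false = count≡sum P xs

    geometric-pow : ∀ q s (y : F.Carrier) → Prod*.prod s (λ i → pow y (q ℕ.^ i)) F.≈ pow y (geometric q s)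
    geometric-pow q zero    y = F.refl
    geometric-pow q (suc s) y = F.*-cong (F.*-identityʳ y) (F.trans (Prod*.prod-cong s (λ i → pow-* y q (q ℕ.^ i)))
      (F.trans (geometric-pow q s (pow y q)) (F.sym (pow-* y q (geometric q s)))))

  -- Nm(γ) is γ raised to 1 + p + ... + p^(m-1), which is the index of F_p^× in the unit group of F.
  -- So the g of the statement is the generator constructed for the prime field.
  norm-γ : Nm p m γ F.≈ Subk.generator
  norm-γ = F.trans (F.reflexive (FoldProduct.foldr-upTo F.*-commutativeMonoid m (λ i → frob i γ)))
    (F.trans (geometric-pow p m γ) (F.reflexive (≡.cong (λ q → pow γ (geometric q m)) (≡.sym (ℕₚ.^-identityʳ p)))))

  private
    M : ℕ
    M = p ℕ.^ 1 ℕ.∸ 1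

    M≡p∸1 : M ≡ p ℕ.∸ 1
    M≡p∸1 = ≡.cong (ℕ._∸ 1) (ℕₚ.^-identityʳ p)

    gen = Subk.generator

    gen-period : ∀ c → pow gen (c ℕ.* M) F.≈ F.1#
    gen-period c = F.trans (Powers.pow-*′ F gen c M) (F.trans (pow-cong c Subk.generator-order) (Powers.pow-1 F c))

    gen-shift : ∀ i c → pow gen (i ℕ.+ c ℕ.* M) F.≈ pow gen i
    gen-shift i c = F.trans (pow-+ gen i (c ℕ.* M)) (F.trans (F.*-congˡ (gen-period c)) (F.*-identityʳ _))

  ζ^≡1 : ∀ s → ζ′ ^ζ s ≡ oneζ → 3 ∣ s
  ζ^≡1 s eq = by-remainder (s ℕ.% 3) (m%n<n s 3) ≡.refl
    where
    reduced : ζ′ ^ζ (s ℕ.% 3) ≡ oneζ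
    reduced = begin
      ζ′ ^ζ (s ℕ.% 3)                                    ≡⟨ Rζ.*-identityʳ (ζ′ ^ζ (s ℕ.% 3)) ⟨
      (ζ′ ^ζ (s ℕ.% 3)) · oneζ                           ≡⟨ ≡.cong ((ζ′ ^ζ (s ℕ.% 3)) ·_) (ζ³ᵐ (s ℕ./ 3)) ⟨
      (ζ′ ^ζ (s ℕ.% 3)) · (ζ′ ^ζ (s ℕ./ 3 ℕ.* 3))        ≡⟨ ^ζ-+ ζ′ (s ℕ.% 3) (s ℕ./ 3 ℕ.* 3) ⟨
      ζ′ ^ζ (s ℕ.% 3 ℕ.+ s ℕ./ 3 ℕ.* 3)                  ≡⟨ ≡.cong (ζ′ ^ζ_) (m≡m%n+[m/n]*n s 3) ⟨
      ζ′ ^ζ s                                            ≡⟨ eq ⟩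
      oneζ                                               ∎
      where open ≡.≡-Reasoning
    by-remainder : ∀ r → r ℕ.< 3 → s ℕ.% 3 ≡ r → 3 ∣ s
    by-remainder 0 _ r≡ = ∣.m%n≡0⇒n∣m s 3 r≡
    by-remainder 1 _ r≡ with ≡.trans (≡.cong (ζ′ ^ζ_) (≡.sym r≡)) reduced
    ... | ()
    by-remainder 2 _ r≡ with ≡.trans (≡.cong (ζ′ ^ζ_) (≡.sym r≡)) reduced
    ... | ()
    by-remainder (suc (suc (suc r))) (s≤s (s≤s (s≤s ()))) _

  -- The conjugate of ζ^s is ζ^(-s), so the right side sums the three characters of ℤ/3 at s.
  orthogonality : ∀ s → ofℤ (+ 3) · L.⟦ 3 ∣.∣? s ⟧ ≡ oneζ ⊞ (ζ′ ^ζ s ⊞ conj (ζ′ ^ζ s))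
  orthogonality s = by-remainder (s ℕ.% 3) (m%n<n s 3) ≡.refl (3 ∣.∣? s)
    where
    value : ∀ r → s ℕ.% 3 ≡ r → ζ′ ^ζ s ≡ ζ′ ^ζ r
    value r eq = ≡.trans (≡.cong (ζ′ ^ζ_) (≡.trans (m≡m%n+[m/n]*n s 3) (≡.cong (ℕ._+ s ℕ./ 3 ℕ.* 3) eq)))
      (≡.trans (^ζ-+ ζ′ r (s ℕ./ 3 ℕ.* 3)) (≡.trans (≡.cong ((ζ′ ^ζ r) ·_) (ζ³ᵐ (s ℕ./ 3))) (Rζ.*-identityʳ (ζ′ ^ζ r))))
    not-divisible : ∀ {r} → s ℕ.% 3 ≡ suc r → ¬ (3 ∣ s)
    not-divisible eq d with ≡.trans (≡.sym (∣.n∣m⇒m%n≡0 s 3 d)) eq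
    ... | ()
    by-remainder : ∀ r → r ℕ.< 3 → s ℕ.% 3 ≡ r → (d : Dec (3 ∣ s)) → ofℤ (+ 3) · L.⟦ d ⟧ ≡ oneζ ⊞ (ζ′ ^ζ s ⊞ conj (ζ′ ^ζ s))
    by-remainder 0 _ eq (yes _) = ≡.cong (λ z → oneζ ⊞ (z ⊞ conj z)) (≡.sym (value 0 eq))
    by-remainder 0 _ eq (no ∤)  = ⊥-elim (∤ (∣.m%n≡0⇒n∣m s 3 eq))
    by-remainder 1 _ eq (yes d) = ⊥-elim (not-divisible eq d)
    by-remainder 1 _ eq (no _)  = ≡.cong (λ z → oneζ ⊞ (z ⊞ conj z)) (≡.sym (value 1 eq))
    by-remainder 2 _ eq (yes d) = ⊥-elim (not-divisible eq d)
    by-remainder 2 _ eq (no _)  = ≡.cong (λ z → oneζ ⊞ (z ⊞ conj z)) (≡.sym (value 2 eq))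
    by-remainder (suc (suc (suc r))) (s≤s (s≤s (s≤s ()))) _ _

  module CosetTest (a h : ℕ) (a′ : k.Carrier) (na′≈a : (n ·1) F.* proj₁ a′ F.≈ fromℕ a) (n≉0 : ¬ ((n ·1) F.≈ F.0#)) where

    inCoset : F.Carrier → Bool
    inCoset x = any (λ j → ⌊ Nm p m x F.≟ pow (Nm p m γ) (h ℕ.+ 3 ℕ.* j) ⌋) (upTo (p ℕ.∸ 1))

    test : F.Carrier → Bool
    test x = ⌊ Tr p m x F.≟ fromℕ a ⌋ ∧ inCoset x

    coset⇒ : ∀ {x} → T (inCoset x) → ∃ λ j → Nm p m x F.≈ pow gen (h ℕ.+ 3 ℕ.* j)
    coset⇒ {x} t with Anyₚ.applyUpTo⁻ (λ i → i) (Anyₚ.any⁻ _ (upTo (p ℕ.∸ 1)) t)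
    ... | j , _ , hit = j , F.trans (toWitness hit) (pow-cong (h ℕ.+ 3 ℕ.* j) norm-γ)

    -- The Boolean test only tries j < p - 1; an arbitrary j is first reduced modulo the order of
    -- the generator.
    coset⇐ : ∀ {x} j → Nm p m x F.≈ pow gen (h ℕ.+ 3 ℕ.* j) → T (inCoset x)
    coset⇐ {x} j eq = Anyₚ.any⁺ _ (Anyₚ.applyUpTo⁺ (λ i → i) (fromWitness {a? = Nm p m x F.≟ _}
        (F.trans eq (F.trans reduce (F.sym (pow-cong (h ℕ.+ 3 ℕ.* j′) norm-γ))))) (≡.subst (j′ ℕ.<_) M≡p∸1 (m%n<n j M)))
      where
      instance M≢0 = Subk.subOrder≢0
      j′ = j ℕ.% M
      reduce : pow gen (h ℕ.+ 3 ℕ.* j) F.≈ pow gen (h ℕ.+ 3 ℕ.* j′)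
      reduce = F.trans (F.reflexive (≡.cong (pow gen) (≡.trans (≡.cong (λ z → h ℕ.+ 3 ℕ.* z) (m≡m%n+[m/n]*n j M))
          (solve 4 (λ h r d M → h :+ con 3 :* (r :+ d :* M) := h :+ con 3 :* r :+ con 3 :* d :* M) ≡.refl h j′ (j ℕ./ M) M))))
        (gen-shift (h ℕ.+ 3 ℕ.* j′) (3 ℕ.* (j ℕ./ M)))
        where open ℕSolver.+-*-Solver

    private
      trace⇔ : ∀ (x : K.Carrier) → (Tr p m (proj₁ x) F.≈ fromℕ a → trace x k.≈ a′) × (trace x k.≈ a′ → Tr p m (proj₁ x) F.≈ fromℕ a)
      trace⇔ x = (λ eq → Powers.*-cancelˡ F n≉0 (F.trans (F.sym (trace-fixed x)) (F.trans eq (F.sym na′≈a)))) ,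
                 (λ eq → F.trans (trace-fixed x) (F.trans (F.*-congˡ eq) na′≈a))

      norm-at : ∀ (x : K.Carrier) i → norm x k.≈ FF.pow k g i → Nm p m (proj₁ x) F.≈ pow gen (i ℕ.* n)
      norm-at x i eq = F.trans (norm-fixed x) (F.trans (pow-cong n (F.trans eq (pow-k g i))) (F.sym (pow-* gen i n)))

      1≤e : 1 ℕ.≤ e
      1≤e = 0<e

      -- 2 h plays the role of -h modulo 3, which keeps the condition within ℕ. The character χ
      -- reads off the exponents modulo 3.
      cubic⇒ : ∀ i j → pow gen (i ℕ.* n) F.≈ pow gen (h ℕ.+ 3 ℕ.* j) → 3 ∣ i ℕ.* n ℕ.+ 2 ℕ.* h
      cubic⇒ i j eq = ζ^≡1 _ (begin
        ζ′ ^ζ (i ℕ.* n ℕ.+ 2 ℕ.* h)                        ≡⟨ ^ζ-+ ζ′ (i ℕ.* n) (2 ℕ.* h) ⟩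
        (ζ′ ^ζ (i ℕ.* n)) · (ζ′ ^ζ (2 ℕ.* h))              ≡⟨ ≡.cong (_· (ζ′ ^ζ (2 ℕ.* h))) (≡.trans
             (≡.sym (χ-power {FF.pow k g (i ℕ.* n)} (i ℕ.* n) F.refl)) (χ-power {FF.pow k g (i ℕ.* n)} (h ℕ.+ 3 ℕ.* j)
               (F.trans (pow-k g (i ℕ.* n)) (F.trans eq (F.sym (pow-k g (h ℕ.+ 3 ℕ.* j))))))) ⟩
        (ζ′ ^ζ (h ℕ.+ 3 ℕ.* j)) · (ζ′ ^ζ (2 ℕ.* h))        ≡⟨ ^ζ-+ ζ′ (h ℕ.+ 3 ℕ.* j) (2 ℕ.* h) ⟨
        ζ′ ^ζ (h ℕ.+ 3 ℕ.* j ℕ.+ 2 ℕ.* h)                  ≡⟨ ≡.cong (ζ′ ^ζ_) (solve 2 (λ h j → h :+ con 3 :* j :+ con 2 :* h := (h :+ j) :* con 3) ≡.refl h j) ⟩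
        ζ′ ^ζ ((h ℕ.+ j) ℕ.* 3)                            ≡⟨ ζ³ᵐ (h ℕ.+ j) ⟩
        oneζ                                               ∎)
        where
        open ≡.≡-Reasoning
        open ℕSolver.+-*-Solver

      cubic⇐ : ∀ i → 3 ∣ i ℕ.* n ℕ.+ 2 ℕ.* h → ∃ λ j → pow gen (i ℕ.* n) F.≈ pow gen (h ℕ.+ 3 ℕ.* j)
      -- To solve i n = h + 3 j in ℕ, h times the group order 3 e is added on the left: i n + 3 e h
      -- = h + (i n + 2 h) + 3 h (e - 1), and i n + 2 h = 3 c.
      cubic⇐ i (∣.divides c eq) = c ℕ.+ h ℕ.* (e ℕ.∸ 1) , F.trans (F.sym (gen-shift (i ℕ.* n) h)) (F.reflexive (≡.cong (pow gen) (begin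
        i ℕ.* n ℕ.+ h ℕ.* M                              ≡⟨ ≡.cong (λ z → i ℕ.* n ℕ.+ h ℕ.* z) (≡.trans p-1≡3e (≡.cong (ℕ._* 3) (≡.sym (ℕₚ.m+[n∸m]≡n 1≤e)))) ⟩
        i ℕ.* n ℕ.+ h ℕ.* ((1 ℕ.+ (e ℕ.∸ 1)) ℕ.* 3)      ≡⟨ solve 3 (λ u h e → u :+ h :* ((con 1 :+ e) :* con 3) := h :+ (u :+ con 2 :* h) :+ con 3 :* (h :* e)) ≡.refl (i ℕ.* n) h (e ℕ.∸ 1) ⟩
        h ℕ.+ (i ℕ.* n ℕ.+ 2 ℕ.* h) ℕ.+ 3 ℕ.* (h ℕ.* (e ℕ.∸ 1)) ≡⟨ ≡.cong (λ z → h ℕ.+ z ℕ.+ 3 ℕ.* (h ℕ.* (e ℕ.∸ 1))) eq ⟩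
        h ℕ.+ c ℕ.* 3 ℕ.+ 3 ℕ.* (h ℕ.* (e ℕ.∸ 1))        ≡⟨ solve 3 (λ h c w → h :+ c :* con 3 :+ con 3 :* w := h :+ con 3 :* (c :+ w)) ≡.refl h c (h ℕ.* (e ℕ.∸ 1)) ⟩
        h ℕ.+ 3 ℕ.* (c ℕ.+ h ℕ.* (e ℕ.∸ 1))              ∎)))
        where
        open ≡.≡-Reasoning
        open ℕSolver.+-*-Solver

    test-zero : ∀ (x : K.Carrier) → norm x k.≈ k.0# → ¬ T (test (proj₁ x))
    test-zero x eq t with coset⇒ (proj₂ (Equivalence.to (T-∧ {⌊ Tr p m (proj₁ x) F.≟ fromℕ a ⌋}) t))
    ... | j , hit = Powers.pow-nonzero F (h ℕ.+ 3 ℕ.* j) Subk.generator≉0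
      (F.trans (F.sym hit) (F.trans (norm-fixed x) (F.trans (pow-cong n eq) (pow-0 n 0<n))))

    test-power : ∀ (x : K.Carrier) i → norm x k.≈ FF.pow k g i → L.⟦ T? (test (proj₁ x)) ⟧ ≡ [ trace x ≟ a′ ] · L.⟦ 3 ∣.∣? (i ℕ.* n ℕ.+ 2 ℕ.* h) ⟧
    test-power x i eq = L.⟦⟧-× to from (T? (test (proj₁ x))) (trace x k.≟ a′) (3 ∣.∣? (i ℕ.* n ℕ.+ 2 ℕ.* h))
      where
      to : T (test (proj₁ x)) → trace x k.≈ a′ × 3 ∣ (i ℕ.* n ℕ.+ 2 ℕ.* h)
      to t with Equivalence.to (T-∧ {⌊ Tr p m (proj₁ x) F.≟ fromℕ a ⌋}) t
      ... | tr , co with coset⇒ co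
      ...   | j , hit = proj₁ (trace⇔ x) (toWitness tr) , cubic⇒ i j (F.trans (F.sym (norm-at x i eq)) hit)
      from : trace x k.≈ a′ → 3 ∣ (i ℕ.* n ℕ.+ 2 ℕ.* h) → T (test (proj₁ x))
      from tr d with cubic⇐ i d
      ... | j , hit = Equivalence.from (T-∧ {⌊ Tr p m (proj₁ x) F.≟ fromℕ a ⌋})
        (fromWitness (proj₂ (trace⇔ x) tr) , coset⇐ j (F.trans (norm-at x i eq) hit))

    Tr-cong : ∀ {x y} → x F.≈ y → Tr p m x F.≈ Tr p m y
    Tr-cong {x} {y} eq = F.trans (F.reflexive (FoldProduct.foldr-upTo F.+-commutativeMonoid m (λ i → frob i x)))
      (F.trans (Sum+.prod-cong m (λ i → frob-cong i eq)) (F.sym (F.reflexive (FoldProduct.foldr-upTo F.+-commutativeMonoid m (λ i → frob i y)))))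

    Nm-cong : ∀ {x y} → x F.≈ y → Nm p m x F.≈ Nm p m y
    Nm-cong {x} {y} eq = F.trans (F.reflexive (FoldProduct.foldr-upTo F.*-commutativeMonoid m (λ i → frob i x)))
      (F.trans (Prod*.prod-cong m (λ i → frob-cong i eq)) (F.sym (F.reflexive (FoldProduct.foldr-upTo F.*-commutativeMonoid m (λ i → frob i y)))))

    test-resp : ∀ {x y} → x F.≈ y → T (test x) → T (test y)
    test-resp {x} {y} eq t with Equivalence.to (T-∧ {⌊ Tr p m x F.≟ fromℕ a ⌋}) t
    ... | tr , co with coset⇒ co
    ...   | j , hit = Equivalence.from (T-∧ {⌊ Tr p m y F.≟ fromℕ a ⌋})
      (fromWitness (F.trans (Tr-cong (F.sym eq)) (toWitness tr)) , coset⇐ j (F.trans (Nm-cong (F.sym eq)) hit))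

    -- The condition x^(p^t) = x cuts out the image of K in F, so that factor of the test restricts
    -- the sum over F to a sum over K.
    Ncount-sum : ofℤ (+ Ncount p m t a h γ) ≡ L.sum K.elements (λ x → L.⟦ T? (test (proj₁ x)) ⟧)
    Ncount-sum = begin
      ofℤ (+ Ncount p m t a h γ)
        ≡⟨ ≡.cong (ofℤ ∘ +_) (count≡sum full F.elements) ⟩
      ofℤ (+ ℕSum.sum F.elements (λ x → ℕSum.⟦ T? (full x) ⟧))
        ≡⟨ ×-ofℤ (ℕSum.sum F.elements (λ x → ℕSum.⟦ T? (full x) ⟧)) ⟨
      ℕSum.sum F.elements (λ x → ℕSum.⟦ T? (full x) ⟧) ×ζ oneζ
        ≡⟨ sum-fromℕ semiringζ (λ x → ℕSum.⟦ T? (full x) ⟧) F.elements ⟩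
      L.sum F.elements (λ x → ℕSum.⟦ T? (full x) ⟧ ×ζ oneζ)
        ≡⟨ L.sum-cong (λ x → ⟦⟧-fromℕ semiringζ (T? (full x))) F.elements ⟩
      L.sum F.elements (λ x → L.⟦ T? (full x) ⟧)
        ≡⟨ L.sum-cong (λ x → L.⟦⟧-× (λ t → let f , r = Equivalence.to (T-∧ {⌊ pow x (p ℕ.^ t₀) F.≟ x ⌋}) t in toWitness f , r)
             (λ f r → Equivalence.from (T-∧ {⌊ pow x (p ℕ.^ t₀) F.≟ x ⌋}) (fromWitness f , r)) (T? (full x)) (pow x (p ℕ.^ t₀) F.≟ x) (T? (test x))) F.elements ⟩
      L.sum F.elements (λ x → L.⟦ pow x (p ℕ.^ t₀) F.≟ x ⟧ · L.⟦ T? (test x) ⟧)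
        ≡⟨ EnumSum.sum-image semiringζ KEnum (Factorization.fieldEnum F) proj₁ (λ eq → eq) (λ eq → eq)
             {Image = λ x → pow x (p ℕ.^ t₀) F.≈ x} (λ x → pow x (p ℕ.^ t₀) F.≟ x)
             (λ {x} fx → (x , fx) , F.refl) (λ x eq → SubK.fixed-resp eq (proj₂ x))
             (λ x → L.⟦ T? (test x) ⟧) (λ {x} {y} eq → L.⟦⟧-cong (test-resp eq) (test-resp (F.sym eq)) (T? (test x)) (T? (test y))) ⟩
      L.sum K.elements (λ x → L.⟦ T? (test (proj₁ x)) ⟧) ∎
      where
      open ≡.≡-Reasoning
      t₀ = t
      full : F.Carrier → Bool
      full x = ⌊ pow x (p ℕ.^ t₀) F.≟ x ⌋ ∧ test x

    private
      P : ℤ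
      P = + (p ℕ.^ (t ℕ.∸ 1))

      by-dlog : ∀ {Q : Set} (x : K.Carrier) → (norm x k.≈ k.0# → Q) → (∀ i → norm x k.≈ FF.pow k g i → Q) → Q
      by-dlog x zero-case power-case with norm x k.≟ k.0#
      ... | yes eq = zero-case eq
      ... | no neq = let i , eq = dlog {norm x} neq in power-case i eq

    -- Nm_m(x) is an n-th power of a norm to F_p, hence a cube when 3 divides n. With h = 0 the
    -- coset condition then excludes x = 0 alone.
    Ncount-3∣n : 3 ∣ n → h ≡ 0 → ofℤ (+ Ncount p m t a h γ) ≡ ofℤ P ⊞ ⊟ [ a′ ≈0]
    Ncount-3∣n 3∣n h≡0 = ≡.trans Ncount-sum (≡.trans (L.sum-cong term K.elements) (nonzero-trace-count a′))
      where
      term : ∀ x → L.⟦ T? (test (proj₁ x)) ⟧ ≡ [ trace x ≟ a′ ] · (oneζ ⊞ ⊟ [ norm x ≈0])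
      term x = by-dlog x
        (λ eq → ≡.trans (L.⟦⟧-false (test-zero x eq) (T? (test (proj₁ x)))) (≡.sym (≡.trans
           (≡.cong (λ z → [ trace x ≟ a′ ] · (oneζ ⊞ ⊟ z)) (L.⟦⟧-true eq (norm x k.≟ k.0#))) (Rζ.zeroʳ [ trace x ≟ a′ ]))))
        (λ i eq → ≡.trans (test-power x i eq) (≡.cong ([ trace x ≟ a′ ] ·_) (≡.trans
           (L.⟦⟧-true (∣.∣m∣n⇒∣m+n (∣.∣n⇒∣m*n i 3∣n) (≡.subst (λ z → 3 ∣ 2 ℕ.* z) (≡.sym h≡0) (3 ∣.∣0))) (3 ∣.∣? (i ℕ.* n ℕ.+ 2 ℕ.* h)))
           (≡.sym (≡.cong (λ z → oneζ ⊞ ⊟ z) (L.⟦⟧-false (λ z → Powers.pow-nonzero k i Subk.generator≉0 (F.trans (F.sym eq) z)) (norm x k.≟ k.0#)))))))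

    -- The hypothesis says that i n ≡ h exactly when i ≡ i₀ modulo 3, with 2 i₀ for -i₀. For a norm
    -- g^i, orthogonality at 2 i₀ + i turns three times the indicator into 1 + 2 Re(ζ^(2 i₀)
    -- χ(g^i)).
    Ncount-3∤n : ∀ i₀ → (∀ i → (3 ∣ i ℕ.* n ℕ.+ 2 ℕ.* h → 3 ∣ 2 ℕ.* i₀ ℕ.+ i) × (3 ∣ 2 ℕ.* i₀ ℕ.+ i → 3 ∣ i ℕ.* n ℕ.+ 2 ℕ.* h)) →
      ofℤ ((+ 3) ℤ.* (+ Ncount p m t a h γ)) ≡ (ofℤ P ⊞ ⊟ [ a′ ≈0]) ⊞ ofℤ (twoRe ((ζ′ ^ζ (2 ℕ.* i₀)) · characterSum t a′))
    Ncount-3∤n i₀ iff = ≡.trans (ofℤ-* (+ 3) (+ Ncount p m t a h γ)) (≡.trans (≡.cong (ofℤ (+ 3) ·_) Ncount-sum)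
      (≡.trans (≡.sym (L.*-sum (ofℤ (+ 3)) K.elements (λ x → L.⟦ T? (test (proj₁ x)) ⟧))) (≡.trans (L.sum-cong term K.elements) (coset-sum c a′))))
      where
      c : ℤζ
      c = ζ′ ^ζ (2 ℕ.* i₀)
      U : K.Carrier → ℤζ
      U x = (oneζ ⊞ ⊟ [ norm x ≈0]) ⊞ (c · χ (norm x) ⊞ conj (c · χ (norm x)))
      term : ∀ x → ofℤ (+ 3) · L.⟦ T? (test (proj₁ x)) ⟧ ≡ [ trace x ≟ a′ ] · U x
      term x = by-dlog x
        (λ eq → ≡.trans (≡.cong (ofℤ (+ 3) ·_) (L.⟦⟧-false (test-zero x eq) (T? (test (proj₁ x))))) (≡.sym (≡.trans
           (≡.cong ([ trace x ≟ a′ ] ·_) (≡.trans (≡.cong₂ (λ y z → (oneζ ⊞ ⊟ y) ⊞ (c · z ⊞ conj (c · z))) (L.⟦⟧-true eq (norm x k.≟ k.0#)) (χ-zero {norm x} eq))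
              (≡.cong (λ z → 0ζ ⊞ (z ⊞ conj z)) (Rζ.zeroʳ c)))) (Rζ.zeroʳ [ trace x ≟ a′ ]))))
        (λ i eq → ≡.trans (≡.cong (ofℤ (+ 3) ·_) (test-power x i eq)) (≡.trans
           (Iζ.solve 3 (λ u v w → u Iζ.:* (v Iζ.:* w) Iζ.:= v Iζ.:* (u Iζ.:* w)) ≡.refl (ofℤ (+ 3)) [ trace x ≟ a′ ] L.⟦ 3 ∣.∣? (i ℕ.* n ℕ.+ 2 ℕ.* h) ⟧)
           (≡.cong ([ trace x ≟ a′ ] ·_) (≡.trans (≡.cong (ofℤ (+ 3) ·_) (L.⟦⟧-cong (proj₁ (iff i)) (proj₂ (iff i)) (3 ∣.∣? (i ℕ.* n ℕ.+ 2 ℕ.* h)) (3 ∣.∣? (2 ℕ.* i₀ ℕ.+ i))))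
           (≡.trans (orthogonality (2 ℕ.* i₀ ℕ.+ i)) (≡.cong₂ (λ y z → y ⊞ (z ⊞ conj z))
             (≡.sym (≡.cong (λ z → oneζ ⊞ ⊟ z) (L.⟦⟧-false (λ z → Powers.pow-nonzero k i Subk.generator≉0 (F.trans (F.sym eq) z)) (norm x k.≟ k.0#))))
             (≡.trans (^ζ-+ ζ′ (2 ℕ.* i₀) i) (≡.cong (c ·_) (≡.sym (χ-power {norm x} i eq))))))))))

-- From integer data to the field, and the closed formulas

module Evaluation
  (F : FiniteField) (p m : ℕ) (prime : Prime p)
  (order : length (FiniteField.elements F) ≡ p ℕ.^ m)
  (γ : FiniteField.Carrier F) (γ-primitive : FF.Primitive F p m γ) (0<m : 0 ℕ.< m)
  (t n : ℕ) (m≡nt : m ≡ n ℕ.* t) (0<n : 0 ℕ.< n) (0<t : 0 ℕ.< t) (p∤n : ¬ (p ∣ n))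
  (e : ℕ) (p-1≡3e : p ℕ.^ 1 ℕ.∸ 1 ≡ e ℕ.* 3)
  (g₀ : ℕ) (g₀≈ : FiniteField._≈_ F (FF.fromℕ F g₀) (FF.Nm F p m γ)) where

  open Counting F p m prime order γ γ-primitive 0<m t n m≡nt 0<n 0<t e p-1≡3e
  open Correspondence F p m prime order γ γ-primitive 0<m t n m≡nt 0<n 0<t using (k; module k; module Subk)
  open Eisenstein
  open IntegerMultiples k.commRing using (fromℤ; fromℤ-+; fromℤ-*; fromℤ-neg)
  private
    module CF = CyclicField F p m prime order γ γ-primitive
    module Ck = CyclicField k p 1 prime Subk.subfield-order g k-primitive
    module I = IntegerMultiples k.commRing

  reduce-mod : ∀ x y → x ≡[mod p ] y → fromℤ x k.≈ fromℤ y
  reduce-mod x y x≡y = x∙y⁻¹≈ε⇒x≈y (fromℤ x) (fromℤ y)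
    (k.trans {fromℤ x k.- fromℤ y} {fromℤ (x ℤ.- y)} {k.0#}
      (k.sym {fromℤ (x ℤ.- y)} {fromℤ x k.- fromℤ y} (k.trans {fromℤ (x ℤ.- y)} {fromℤ x k.+ fromℤ (ℤ.- y)} {fromℤ x k.- fromℤ y}
        (fromℤ-+ x (ℤ.- y)) (k.+-congˡ {fromℤ x} {fromℤ (ℤ.- y)} {k.- fromℤ y} (fromℤ-neg y))))
      (Ck.∣⇒fromℤ≈0 (x ℤ.- y) x≡y))
    where open RingP k.ring using (x∙y⁻¹≈ε⇒x≈y)

  ·1-k : ∀ c → proj₁ (c Ck.·1) F.≈ FF.fromℕ F c
  ·1-k zero    = F.refl
  ·1-k (suc c) = F.+-congˡ (·1-k c)

  ·1-F : ∀ c → (c CF.·1) F.≈ FF.fromℕ F c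
  ·1-F zero    = F.refl
  ·1-F (suc c) = F.+-congˡ (·1-F c)

  g₀≈g : fromℤ (+ g₀) k.≈ g
  g₀≈g = F.trans (Ck.fromℤ-pos g₀) (F.trans (·1-k g₀) (F.trans g₀≈ norm-γ))

  g₀-power : ∀ j → fromℤ (+ (g₀ ℕ.^ j)) k.≈ FF.pow k g j
  g₀-power zero    = F.refl
  g₀-power (suc j) = F.trans (F.reflexive (≡.cong (proj₁ ∘ fromℤ) (ℤₚ.pos-* g₀ (g₀ ℕ.^ j))))
    (F.trans (fromℤ-* (+ g₀) (+ (g₀ ℕ.^ j))) (F.*-cong g₀≈g (g₀-power j)))

  e≡ : (p ℕ.∸ 1) ℕ./ 3 ≡ e
  e≡ = ≡.trans (≡.cong (ℕ._/ 3) (≡.trans (≡.cong (ℕ._∸ 1) (≡.sym (ℕₚ.^-identityʳ p))) p-1≡3e)) (m*n/n≡m e 3)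

  module Jacobi (h₂ : ℕ) (M≡h₂+h₂ : p ℕ.^ 1 ℕ.∸ 1 ≡ h₂ ℕ.+ h₂)
    (k₂ : ℕ) (k₂≡ : (+ (g₀ ℕ.^ k₂)) ≡[mod p ] (+ 2))
    (a₃ b₃ : ℤ) (norm₃ : a₃ ℤ.* a₃ ℤ.+ (+ 3) ℤ.* b₃ ℤ.* b₃ ≡ + p) (a₃≡ : a₃ ≡[mod 3 ] (ℤ.- (+ 1)))
    (b₃≡ : ((+ 3) ℤ.* b₃) ≡[mod p ] (((+ 2) ℤ.* (+ (g₀ ℕ.^ ((p ℕ.∸ 1) ℕ./ 3))) ℤ.+ (+ 1)) ℤ.* a₃)) where

    G : ℕ
    G = g₀ ℕ.^ ((p ℕ.∸ 1) ℕ./ 3)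

    two≈ : k.1# k.+ k.1# k.≈ FF.pow k g k₂
    two≈ = F.trans (F.sym (reduce-mod (+ (g₀ ℕ.^ k₂)) (+ 2) k₂≡)) (g₀-power k₂)

    G≈ω : fromℤ (+ G) k.≈ ω
    G≈ω = F.trans (g₀-power ((p ℕ.∸ 1) ℕ./ 3)) (F.reflexive (≡.cong (λ z → proj₁ (FF.pow k g z)) e≡))

    b≈ : fromℤ ((+ 3) ℤ.* b₃) k.≈ ((k.1# k.+ k.1#) k.* ω k.+ k.1#) k.* fromℤ a₃
    b≈ = F.trans (reduce-mod ((+ 3) ℤ.* b₃) (((+ 2) ℤ.* (+ G) ℤ.+ (+ 1)) ℤ.* a₃) b₃≡)
      (F.trans (fromℤ-* ((+ 2) ℤ.* (+ G) ℤ.+ (+ 1)) a₃) (F.*-congʳ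
        (F.trans (fromℤ-+ ((+ 2) ℤ.* (+ G)) (+ 1)) (F.+-congʳ (F.trans (fromℤ-* (+ 2) (+ G)) (F.*-congˡ G≈ω))))))

    π₃≡J : (ζ′ ^ζ k₂) · eisen a₃ b₃ ≡ J
    π₃≡J = JacobiSumValue.Identify.jacobi-sum k p prime Subk.subfield-order g k-primitive e p-1≡3e
      h₂ M≡h₂+h₂ k₂ two≈ a₃ b₃ norm₃ (IntegerLemmas.mod-witness a₃ (ℤ.- (+ 1)) 3 a₃≡) b≈

  module Scaled (a : ℕ) where
    ν α : k.Carrier
    ν = n Ck.·1
    α = a Ck.·1

    ν≉0 : ¬ (ν k.≈ k.0#)
    ν≉0 eq = p∤n (Ck.·1≈0⇒∣ eq)

    -- The quotient a / n: as Tr_m = n Tr_t on F_{p^t}, the condition Tr_m(x) = a becomes Tr_t(x) =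
    -- a / n, which makes sense because p does not divide n.
    a′ : k.Carrier
    a′ = proj₁ (k.inverse ν ν≉0) k.* α

    νa′≈α : ν k.* a′ k.≈ α
    νa′≈α = F.trans (F.sym (F.*-assoc _ _ _)) (F.trans (F.*-congʳ (proj₂ (k.inverse ν ν≉0))) (F.*-identityˡ (proj₁ α)))

    n≉0 : ¬ ((n CF.·1) F.≈ F.0#)
    n≉0 eq = ν≉0 (F.trans (·1-k n) (F.trans (F.sym (·1-F n)) eq))

    na′≈a : (n CF.·1) F.* proj₁ a′ F.≈ FF.fromℕ F a
    na′≈a = F.trans (F.*-congʳ (F.trans (·1-F n) (F.sym (·1-k n)))) (F.trans νa′≈α (·1-k a))

    a≡0⇒ : a ≡ 0 → a′ k.≈ k.0#
    a≡0⇒ ≡.refl = F.zeroʳ _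

    a≢0⇒ : a ℕ.< p → ¬ (a ≡ 0) → ¬ (a′ k.≈ k.0#)
    a≢0⇒ a<p a≢0 a′≈0 = ∣.>⇒∤ {{ℕ.≢-nonZero a≢0}} a<p (Ck.·1≈0⇒∣ (F.trans (F.sym νa′≈α) (F.trans (F.*-congˡ a′≈0) (F.zeroʳ _))))

    -- a₀ a′ = −1, so χ(a′) is the conjugate of χ(a₀).
    χ-a′ : ∀ (a₀ k₀ : ℕ) → ¬ (a′ k.≈ k.0#) → (+ (a₀ ℕ.* a)) ≡[mod p ] (ℤ.- (+ n)) → (+ (g₀ ℕ.^ k₀)) ≡[mod p ] (+ a₀) → χ a′ ≡ ζ′ ^ζ (2 ℕ.* k₀)
    χ-a′ a₀ k₀ a′≉0 a₀a≡-n g₀≡a₀ = begin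
      χ a′                                 ≡⟨ Rζ.*-identityˡ (χ a′) ⟨
      oneζ · χ a′                          ≡⟨ ≡.cong (_· χ a′) (χ-unit {u} (λ z → Powers.pow-nonzero k k₀ Ck.γ≉0 z)) ⟨
      (conj (χ u) · χ u) · χ a′            ≡⟨ Rζ.*-assoc (conj (χ u)) (χ u) (χ a′) ⟩
      conj (χ u) · (χ u · χ a′)            ≡⟨ ≡.cong (conj (χ u) ·_) (≡.trans (≡.sym (χ-* u a′)) (≡.trans (χ-cong {u k.* a′} {k.- k.1#} ua′≈-1) (≡.trans (χ-neg k.1#) χ-1))) ⟩
      conj (χ u) · oneζ                    ≡⟨ Rζ.*-identityʳ (conj (χ u)) ⟩
      conj (χ u)                           ≡⟨ ≡.cong conj (χ-power {u} k₀ F.refl) ⟩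
      conj (ζ′ ^ζ k₀)                      ≡⟨ conj-ζ^ k₀ ⟩
      ζ′ ^ζ (2 ℕ.* k₀)                     ∎
      where
      open ≡.≡-Reasoning
      u : k.Carrier
      u = FF.pow k g k₀
      u≈a₀ : u k.≈ fromℤ (+ a₀)
      u≈a₀ = F.trans (F.sym (g₀-power k₀)) (reduce-mod (+ (g₀ ℕ.^ k₀)) (+ a₀) g₀≡a₀)
      uα≈-ν : u k.* α k.≈ k.- ν
      uα≈-ν = F.trans (F.*-cong u≈a₀ (F.sym (Ck.fromℤ-pos a))) (F.trans (F.sym (fromℤ-* (+ a₀) (+ a)))
        (F.trans (F.reflexive (≡.cong (proj₁ ∘ fromℤ) (≡.sym (ℤₚ.pos-* a₀ a)))) (F.trans (reduce-mod (+ (a₀ ℕ.* a)) (ℤ.- (+ n)) a₀a≡-n)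
        (F.trans (fromℤ-neg (+ n)) (F.-‿cong (Ck.fromℤ-pos n))))))
      ua′≈-1 : u k.* a′ k.≈ k.- k.1#
      ua′≈-1 = Powers.*-cancelˡ k {ν} {u k.* a′} {k.- k.1#} ν≉0 (F.trans (I.solve 3 (λ ν u a → ν I.:* (u I.:* a) I.:= u I.:* (ν I.:* a)) F.refl ν u a′)
        (F.trans (F.*-congˡ νa′≈α) (F.trans uα≈-ν (I.solve 1 (λ ν → I.:- ν I.:= ν I.:* (I.:- I.con (+ 1))) F.refl ν))))

    conj-χ-a′ : ∀ (a₀ k₀ : ℕ) → ¬ (a′ k.≈ k.0#) → (+ (a₀ ℕ.* a)) ≡[mod p ] (ℤ.- (+ n)) → (+ (g₀ ℕ.^ k₀)) ≡[mod p ] (+ a₀) → χ̄ a′ ≡ ζ′ ^ζ k₀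
    conj-χ-a′ a₀ k₀ a′≉0 a₀a≡-n g₀≡a₀ = ≡.trans (≡.cong conj (≡.trans (χ-a′ a₀ k₀ a′≉0 a₀a≡-n g₀≡a₀) (≡.sym (conj-ζ^ k₀)))) (conj-conj (ζ′ ^ζ k₀))

  module Formulas (a h i₀ : ℕ) (π : ℤζ) (π≡J : π ≡ J) where
    open Scaled a
    open CosetTest a h a′ na′≈a n≉0
    private
      module L = ListSum semiringζ
      open ℤSolver.+-*-Solver using (solve; _:+_; _:*_; _:-_; :-_; con; _:=_)

    N P s : ℤ
    N = + FF.Ncount F p m t a h γ
    P = + (p ℕ.^ (t ℕ.∸ 1))
    s = sgn t

    c X : ℤζ
    c = ζ′ ^ζ (2 ℕ.* i₀)
    X = c · characterSum t a′

    Residue : Set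
    Residue = ∀ i → (3 ∣ i ℕ.* n ℕ.+ 2 ℕ.* h → 3 ∣ 2 ℕ.* i₀ ℕ.+ i) × (3 ∣ 2 ℕ.* i₀ ℕ.+ i → 3 ∣ i ℕ.* n ℕ.+ 2 ℕ.* h)

    value-zero : Residue → a′ k.≈ k.0# → (+ 3) ℤ.* N ≡ P ℤ.- (+ 1) ℤ.+ twoRe X
    value-zero iff a′≈0 = ofℤ-injective (≡.trans (Ncount-3∤n i₀ iff) (≡.cong (λ z → (ofℤ P ⊞ ⊟ z) ⊞ ofℤ (twoRe X)) (L.⟦⟧-true a′≈0 (a′ k.≟ k.0#))))

    value-nonzero : Residue → ¬ (a′ k.≈ k.0#) → (+ 3) ℤ.* N ≡ P ℤ.+ twoRe X
    value-nonzero iff a′≉0 = ≡.trans (ofℤ-injective (≡.trans (Ncount-3∤n i₀ iff) (≡.cong (λ z → (ofℤ P ⊞ ⊟ z) ⊞ ofℤ (twoRe X)) (L.⟦⟧-false a′≉0 (a′ k.≟ k.0#)))))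
      (≡.cong (ℤ._+ twoRe X) (ℤₚ.+-identityʳ P))

    value-3∣n : 3 ∣ n → h ≡ 0 → (a′ k.≈ k.0# → N ≡ P ℤ.- (+ 1)) × (¬ (a′ k.≈ k.0#) → N ≡ P)
    value-3∣n 3∣n h≡0 =
      (λ a′≈0 → ofℤ-injective (≡.trans (Ncount-3∣n 3∣n h≡0) (≡.cong (λ z → ofℤ P ⊞ ⊟ z) (L.⟦⟧-true a′≈0 (a′ k.≟ k.0#))))) ,
      (λ a′≉0 → ≡.trans (ofℤ-injective (≡.trans (Ncount-3∣n 3∣n h≡0) (≡.cong (λ z → ofℤ P ⊞ ⊟ z) (L.⟦⟧-false a′≉0 (a′ k.≟ k.0#))))) (ℤₚ.+-identityʳ P))

    π^ : ∀ j → J ^ζ j ≡ π ^ζ j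
    π^ j = ≡.cong (_^ζ j) (≡.sym π≡J)

    private
      extract : ∀ u q W z → twoRe (c · (ofℤ u · (ofℤ q · W) · z)) ≡ u ℤ.* twoRe (ofℤ q · W · (z · c))
      extract u q W z = ≡.trans (≡.cong twoRe (Iζ.solve 5 (λ c u q W z → c Iζ.:* (u Iζ.:* (q Iζ.:* W) Iζ.:* z) Iζ.:= u Iζ.:* (q Iζ.:* W Iζ.:* (z Iζ.:* c))) ≡.refl
          c (ofℤ u) (ofℤ q) W z)) (twoRe-ofℤ u (ofℤ q · W · (z · c)))

      extract-real : ∀ u q W r → twoRe (c · (ofℤ u · (ofℤ q · W) · ofℤ r)) ≡ u ℤ.* q ℤ.* r ℤ.* twoRe (W · c)
      extract-real u q W r = ≡.trans (≡.cong twoRe (≡.trans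
          (Iζ.solve 5 (λ c u q W z → c Iζ.:* (u Iζ.:* (q Iζ.:* W) Iζ.:* z) Iζ.:= u Iζ.:* q Iζ.:* z Iζ.:* (W Iζ.:* c)) ≡.refl c (ofℤ u) (ofℤ q) W (ofℤ r))
          (≡.cong (_· (W · c)) (≡.sym (≡.trans (ofℤ-* (u ℤ.* q) r) (≡.cong (_· ofℤ r) (ofℤ-* u q)))))))
        (twoRe-ofℤ (u ℤ.* q ℤ.* r) (W · c))

      at₁ : ∀ j → t ≡ suc (j ℕ.* 3) → characterSum t a′ ≡ coeff t j j · χ a′
      at₁ j t≡ = ≡.subst (λ s → characterSum s a′ ≡ coeff s j j · χ a′) (≡.sym t≡) (closed₁ j (ℕₚ.≤-reflexive (≡.sym t≡)) a′)

      at₂ : ∀ j → t ≡ suc (suc (j ℕ.* 3)) → characterSum t a′ ≡ coeff t j (suc j) · χ̄ a′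
      at₂ j t≡ = ≡.subst (λ s → characterSum s a′ ≡ coeff s j (suc j) · χ̄ a′) (≡.sym t≡) (closed₂ j (ℕₚ.≤-reflexive (≡.sym t≡)) a′)

      at₃ : ∀ j → t ≡ suc j ℕ.* 3 → characterSum t a′ ≡ coeff t j (suc j) · D a′
      at₃ j t≡ = ≡.subst (λ s → characterSum s a′ ≡ coeff s j (suc j) · D a′) (≡.sym t≡) (closed₃ j (ℕₚ.≤-reflexive (≡.sym t≡)) a′)

    -- χ vanishes at 0, so for a = 0 and t prime to 3 the character sum leaves no trace; the same
    -- holds for χ̄ below.
    twoRe₁-zero : ∀ j → t ≡ suc (j ℕ.* 3) → a′ k.≈ k.0# → twoRe X ≡ + 0
    twoRe₁-zero j t≡ a′≈0 = ≡.cong twoRe (≡.trans (≡.cong (c ·_) (≡.trans (at₁ j t≡) (≡.trans (≡.cong (coeff t j j ·_) (χ-zero {a′} a′≈0)) (Rζ.zeroʳ (coeff t j j))))) (Rζ.zeroʳ c))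

    twoRe₂-zero : ∀ j → t ≡ suc (suc (j ℕ.* 3)) → a′ k.≈ k.0# → twoRe X ≡ + 0
    twoRe₂-zero j t≡ a′≈0 = ≡.cong twoRe (≡.trans (≡.cong (c ·_) (≡.trans (at₂ j t≡) (≡.trans (≡.cong (λ z → coeff t j (suc j) · conj z) (χ-zero {a′} a′≈0)) (Rζ.zeroʳ (coeff t j (suc j)))))) (Rζ.zeroʳ c))

    twoRe₁ : ∀ j κ → t ≡ suc (j ℕ.* 3) → χ a′ ≡ ζ′ ^ζ κ →
      twoRe X ≡ (ℤ.- s) ℤ.* twoRe (ofℤ (+ (p ℕ.^ j)) · (π ^ζ j) · (ζ′ ^ζ (κ ℕ.+ 2 ℕ.* i₀)))
    twoRe₁ j κ t≡ χa′ = ≡.trans (≡.cong (λ z → twoRe (c · z)) (≡.trans (at₁ j t≡) (≡.cong₂ (λ W z → ofℤ (ℤ.- s) · (ofℤ (+ (p ℕ.^ j)) · W) · z) (π^ j) χa′)))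
      (≡.trans (extract (ℤ.- s) (+ (p ℕ.^ j)) (π ^ζ j) (ζ′ ^ζ κ)) (≡.cong (λ z → (ℤ.- s) ℤ.* twoRe (ofℤ (+ (p ℕ.^ j)) · (π ^ζ j) · z)) (≡.sym (^ζ-+ ζ′ κ (2 ℕ.* i₀)))))

    twoRe₂ : ∀ j κ → t ≡ suc (suc (j ℕ.* 3)) → χ̄ a′ ≡ ζ′ ^ζ κ →
      twoRe X ≡ (ℤ.- s) ℤ.* twoRe (ofℤ (+ (p ℕ.^ j)) · (π ^ζ suc j) · (ζ′ ^ζ (κ ℕ.+ 2 ℕ.* i₀)))
    twoRe₂ j κ t≡ χ̄a′ = ≡.trans (≡.cong (λ z → twoRe (c · z)) (≡.trans (at₂ j t≡) (≡.cong₂ (λ W z → ofℤ (ℤ.- s) · (ofℤ (+ (p ℕ.^ j)) · W) · z) (π^ (suc j)) χ̄a′)))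
      (≡.trans (extract (ℤ.- s) (+ (p ℕ.^ j)) (π ^ζ suc j) (ζ′ ^ζ κ)) (≡.cong (λ z → (ℤ.- s) ℤ.* twoRe (ofℤ (+ (p ℕ.^ j)) · (π ^ζ suc j) · z)) (≡.sym (^ζ-+ ζ′ κ (2 ℕ.* i₀)))))

    -- For t divisible by 3 the function is D, which takes the integer values p - 1 and -1; such a
    -- value r leaves the real part as a factor.
    twoRe₃ : ∀ j r → t ≡ suc j ℕ.* 3 → D a′ ≡ ofℤ r →
      twoRe X ≡ (ℤ.- s) ℤ.* (+ (p ℕ.^ j)) ℤ.* r ℤ.* twoRe ((π ^ζ suc j) · c)
    twoRe₃ j r t≡ Da′ = ≡.trans (≡.cong (λ z → twoRe (c · z)) (≡.trans (at₃ j t≡) (≡.cong₂ (λ W z → ofℤ (ℤ.- s) · (ofℤ (+ (p ℕ.^ j)) · W) · z) (π^ (suc j)) Da′)))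
      (extract-real (ℤ.- s) (+ (p ℕ.^ j)) (π ^ζ suc j) r)

    D-zero : a′ k.≈ k.0# → D a′ ≡ ofℤ (+ (p ℕ.∸ 1))
    D-zero a′≈0 = ≡.trans (≡.cong (λ z → pζ · z ⊞ ⊟ oneζ) (L.⟦⟧-true a′≈0 (a′ k.≟ k.0#)))
      (≡.trans (≡.cong (_⊞ ⊟ oneζ) (Rζ.*-identityʳ pζ)) (≡.cong ofℤ (≡.trans (≡.cong (λ z → + z ℤ.- (+ 1)) p≡1+M) (≡.sym (≡.cong (λ z → + (z ℕ.∸ 1)) p≡1+M)))))

    D-nonzero : ¬ (a′ k.≈ k.0#) → D a′ ≡ ofℤ (ℤ.- (+ 1))
    D-nonzero a′≉0 = ≡.trans (≡.cong (λ z → pζ · z ⊞ ⊟ oneζ) (L.⟦⟧-false a′≉0 (a′ k.≟ k.0#))) (≡.cong (_⊞ ⊟ oneζ) (Rζ.zeroʳ pζ))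

-- Arithmetic modulo 3 and the assembled statement

open import Data.Nat using (_<_; _≤_; _∸_; _%_; _/_)
open import Data.Integer using (-_)

remainder-3 : ∀ t → ¬ (3 ∣ t) → (∃ λ j → t ≡ suc (j ℕ.* 3)) ⊎ (∃ λ j → t ≡ suc (suc (j ℕ.* 3)))
remainder-3 t 3∤t = go (t % 3) (m%n<n t 3) (m≡m%n+[m/n]*n t 3)
  where
  go : ∀ r → r < 3 → t ≡ r ℕ.+ t / 3 ℕ.* 3 → (∃ λ j → t ≡ suc (j ℕ.* 3)) ⊎ (∃ λ j → t ≡ suc (suc (j ℕ.* 3)))
  go 0 _ eq = ⊥-elim (3∤t (∣.divides (t / 3) eq))
  go 1 _ eq = inj₁ (t / 3 , eq)
  go 2 _ eq = inj₂ (t / 3 , eq)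
  go (suc (suc (suc r))) (s≤s (s≤s (s≤s ()))) _

-- The condition i n ≡ h (mod 3) is divided by n using n i₀ ≡ h.
residue-equivalence : ∀ n h i₀ → ¬ (3 ∣ n) → (+ (n ℕ.* i₀)) ≡[mod 3 ] (+ h) →
  ∀ i → (3 ∣ i ℕ.* n ℕ.+ 2 ℕ.* h → 3 ∣ 2 ℕ.* i₀ ℕ.+ i) × (3 ∣ 2 ℕ.* i₀ ℕ.+ i → 3 ∣ i ℕ.* n ℕ.+ 2 ℕ.* h)
residue-equivalence n h i₀ 3∤n n*i₀≡h i = forward , backward
  where
  open ℕSolver.+-*-Solver
  3∣ni₀+2h : 3 ∣ n ℕ.* i₀ ℕ.+ 2 ℕ.* h
  3∣ni₀+2h with IntegerLemmas.mod-witness (+ (n ℕ.* i₀)) (+ h) 3 n*i₀≡h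
  ... | c , eq = ∣.divides ℤ.∣ + h ℤ.+ c ∣ (≡.trans (≡.cong ℤ.∣_∣ {+ (n ℕ.* i₀ ℕ.+ 2 ℕ.* h)} {(+ h ℤ.+ c) ℤ.* (+ 3)}
      (≡.trans (≡.cong₂ ℤ._+_ eq (ℤₚ.pos-* 2 h)) (ℤS.solve 2 (λ h c → h ℤS.:+ ℤS.con (+ 3) ℤS.:* c ℤS.:+ ℤS.con (+ 2) ℤS.:* h ℤS.:= (h ℤS.:+ c) ℤS.:* ℤS.con (+ 3)) ≡.refl (+ h) c)))
      (ℤₚ.abs-* (+ h ℤ.+ c) (+ 3)))
    where module ℤS = ℤSolver.+-*-Solver
  -- Modulo 3 this is -(n i₀ - h) + (i n - h) = n (i - i₀), written without subtraction.
  identity : 2 ℕ.* (n ℕ.* i₀ ℕ.+ 2 ℕ.* h) ℕ.+ (i ℕ.* n ℕ.+ 2 ℕ.* h) ≡ h ℕ.* 2 ℕ.* 3 ℕ.+ n ℕ.* (2 ℕ.* i₀ ℕ.+ i)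
  identity = solve 4 (λ n i₀ h i → con 2 :* (n :* i₀ :+ con 2 :* h) :+ (i :* n :+ con 2 :* h) := h :* con 2 :* con 3 :+ n :* (con 2 :* i₀ :+ i)) ≡.refl n i₀ h i
  forward : 3 ∣ i ℕ.* n ℕ.+ 2 ℕ.* h → 3 ∣ 2 ℕ.* i₀ ℕ.+ i
  forward d = [ (λ 3∣n → ⊥-elim (3∤n 3∣n)) , (λ d → d) ]′ (euclidsLemma n (2 ℕ.* i₀ ℕ.+ i) (toWitness {a? = prime? 3} _)
    (∣.∣m+n∣m⇒∣n (≡.subst (3 ∣_) identity (∣.∣m∣n⇒∣m+n (∣.∣n⇒∣m*n 2 3∣ni₀+2h) d)) (∣.n∣m*n (h ℕ.* 2))))
  backward : 3 ∣ 2 ℕ.* i₀ ℕ.+ i → 3 ∣ i ℕ.* n ℕ.+ 2 ℕ.* h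
  backward d = ∣.∣m+n∣m⇒∣n (≡.subst (3 ∣_) (≡.sym identity) (∣.∣m∣n⇒∣m+n (∣.n∣m*n (h ℕ.* 2)) (∣.∣n⇒∣m*n n d))) (∣.∣n⇒∣m*n 2 3∣ni₀+2h)

gcd-3 : ∀ n → ¬ (3 ∣ n) → gcd n 3 ≡ 1
gcd-3 n 3∤n with prime⇒irreducible (toWitness {a? = prime? 3} _) (GCD.gcd[m,n]∣n n 3)
... | inj₁ gcd≡1 = gcd≡1
... | inj₂ gcd≡3 = ⊥-elim (3∤n (≡.subst (_∣ n) gcd≡3 (GCD.gcd[m,n]∣m n 3)))

third : ∀ {x} j → x ≡ j ℕ.* 3 → x / 3 ≡ j
third j eq = ≡.trans (≡.cong (_/ 3) eq) (m*n/n≡m j 3)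

-- p is odd because 2 is not 1 modulo 3. The half of p - 1 is the exponent at which g becomes -1.
odd-prime-half : ∀ {p e} → Prime p → p ℕ.^ 1 ∸ 1 ≡ e ℕ.* 3 → ∃ λ h → p ℕ.^ 1 ∸ 1 ≡ h ℕ.+ h
odd-prime-half {p} {e} pr eq = go (p % 2) (m%n<n p 2) (m≡m%n+[m/n]*n p 2)
  where
  no-triple : ∀ e → ¬ (1 ≡ e ℕ.* 3)
  no-triple zero ()
  no-triple (suc e) ()
  go : ∀ r → r < 2 → p ≡ r ℕ.+ p / 2 ℕ.* 2 → ∃ λ h → p ℕ.^ 1 ∸ 1 ≡ h ℕ.+ h
  go 0 _ p≡ with prime⇒irreducible pr (∣.divides (p / 2) p≡)
  ... | inj₁ ()
  ... | inj₂ 2≡p = ⊥-elim (no-triple e (≡.subst (λ q → q ℕ.^ 1 ∸ 1 ≡ e ℕ.* 3) (≡.sym 2≡p) eq))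
  go 1 _ p≡ = p / 2 , ≡.trans (≡.cong (_∸ 1) (ℕₚ.^-identityʳ p)) (≡.trans (≡.cong (_∸ 1) p≡)
    (≡.trans (ℕₚ.*-comm (p / 2) 2) (≡.cong (p / 2 ℕ.+_) (ℕₚ.+-identityʳ (p / 2)))))
  go (suc (suc r)) (s≤s (s≤s ())) _

prime≡1-mod-3 : ∀ {p} → Prime p → (+ p) ≡[mod 3 ] (+ 1) → ∃ λ e → p ℕ.^ 1 ∸ 1 ≡ e ℕ.* 3
prime≡1-mod-3 {zero} pr _ = ⊥-elim (ℕₚ.n≮0 (ℕ.nonTrivial⇒n>1 0 {{prime⇒nonTrivial pr}}))
prime≡1-mod-3 {suc p} _ (∣.divides e eq) = e , ≡.trans (≡.cong (_∸ 1) (ℕₚ.^-identityʳ (suc p))) eq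

-- Encoding: n is m / t, and a and g₀ are natural numbers representing elements of F_p. The values
-- χ₃(2) and χ₃(a₀) appear as ζ^k₂ and ζ^k₀, where g₀^k₂ ≡ 2 and g₀^k₀ ≡ a₀; conjugation doubles the
-- exponent. Formulas with the factor 1/3 are multiplied by 3, and 2 Re is the integer `twoRe`.
theorem3 :
  (F : FiniteField) →
  (p m t a h n : ℕ) →
  Prime p → (+ p) ≡[mod 3 ] (+ 1) →
  length (FiniteField.elements F) ≡ p Data.Nat.^ m →
  (γ : FiniteField.Carrier F) → FF.Primitive F p m γ →
  (g₀ : ℕ) → FiniteField._≈_ F (FF.fromℕ F g₀) (FF.Nm F p m γ) →
  h < 3 → 2 ≤ m → a < p →
  m ≡ n Data.Nat.* t → ¬ (p ∣ n) →
  gcd n 3 ∣ h →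
  (i₀ : ℕ) → i₀ < 3 /′ gcd n 3 →
  (+ ((n /′ gcd n 3) Data.Nat.* i₀)) ≡[mod 3 /′ gcd n 3 ] (+ (h /′ gcd n 3)) →
  (k₂ : ℕ) → (+ (g₀ Data.Nat.^ k₂)) ≡[mod p ] (+ 2) →
  (a₃ b₃ : ℤ) →
  a₃ ℤ.* a₃ ℤ.+ (+ 3) ℤ.* b₃ ℤ.* b₃ ≡ + p →
  a₃ ≡[mod 3 ] (- (+ 1)) →
  ((+ 3) ℤ.* b₃) ≡[mod p ] (((+ 2) ℤ.* (+ (g₀ Data.Nat.^ ((p ∸ 1) / 3))) ℤ.+ (+ 1)) ℤ.* a₃) →
  let π₃ = (ζ′ ^ζ k₂) · eisen a₃ b₃
      N = + FF.Ncount F p m t a h γ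
      P = + (p Data.Nat.^ (t ∸ 1))
      R = twoRe ((π₃ ^ζ (t / 3)) · (ζ′ ^ζ (2 Data.Nat.* i₀)))
  in
  (a ≡ 0 →
      (¬ (3 ∣ n) → ¬ (3 ∣ t) → (+ 3) ℤ.* N ≡ P ℤ.- (+ 1))
    × (¬ (3 ∣ n) → 3 ∣ t →
         (+ 3) ℤ.* N ≡ P ℤ.- (+ 1) ℤ.- sgn t ℤ.* (+ (p Data.Nat.^ ((t ∸ 3) / 3)))
                                             ℤ.* (+ (p ∸ 1)) ℤ.* R)
    × (3 ∣ n → N ≡ P ℤ.- (+ 1)))
  ×
  (¬ (a ≡ 0) → (a₀ k₀ : ℕ) →
      (+ (a₀ Data.Nat.* a)) ≡[mod p ] (- (+ n)) →
      (+ (g₀ Data.Nat.^ k₀)) ≡[mod p ] (+ a₀) →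
      (¬ (3 ∣ n) → t % 3 ≡ 1 →
         (+ 3) ℤ.* N ≡ P ℤ.- sgn t ℤ.* twoRe
           (ofℤ (+ (p Data.Nat.^ ((t ∸ 1) / 3))) · (π₃ ^ζ ((t ∸ 1) / 3))
              · (ζ′ ^ζ (2 Data.Nat.* k₀ Data.Nat.+ 2 Data.Nat.* i₀))))
    × (¬ (3 ∣ n) → t % 3 ≡ 2 →
         (+ 3) ℤ.* N ≡ P ℤ.- sgn t ℤ.* twoRe
           (ofℤ (+ (p Data.Nat.^ ((t ∸ 2) / 3))) · (π₃ ^ζ ((t Data.Nat.+ 1) / 3))
              · (ζ′ ^ζ (k₀ Data.Nat.+ 2 Data.Nat.* i₀))))
    × (¬ (3 ∣ n) → 3 ∣ t →
         (+ 3) ℤ.* N ≡ P ℤ.+ sgn t ℤ.* (+ (p Data.Nat.^ ((t ∸ 3) / 3))) ℤ.* R)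
    × (3 ∣ n → N ≡ P))
theorem3 F p m t a h n p-prime p≡1 order γ γ-primitive g₀ g₀≈ h<3 2≤m a<p m≡nt p∤n gcd∣h i₀ i₀< i₀≡ k₂ k₂≡ a₃ b₃ norm₃ a₃≡ b₃≡ =
  (λ a≡0 →
      (λ 3∤n 3∤t → [ (λ (j , t≡) → vanishing 3∤n a≡0 (twoRe₁-zero j t≡ (a≡0⇒ a≡0)))
                   , (λ (j , t≡) → vanishing 3∤n a≡0 (twoRe₂-zero j t≡ (a≡0⇒ a≡0))) ]′ (remainder-3 t 3∤t))
    , (λ 3∤n 3∣t → divisible-zero 3∤n a≡0 3∣t)
    , (λ 3∣n → proj₁ (value-3∣n 3∣n (h≡0 3∣n)) (a≡0⇒ a≡0)))
  , (λ a≢0 a₀ k₀ a₀≡ k₀≡ →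
      (λ 3∤n t%3≡1 → remainder-one 3∤n a≢0 a₀ k₀ a₀≡ k₀≡ t%3≡1)
    , (λ 3∤n t%3≡2 → remainder-two 3∤n a≢0 a₀ k₀ a₀≡ k₀≡ t%3≡2)
    , (λ 3∤n 3∣t → divisible-nonzero 3∤n a≢0 3∣t)
    , (λ 3∣n → proj₂ (value-3∣n 3∣n (h≡0 3∣n)) (a≢0⇒ a<p a≢0)))
  where
  open ≡ using (refl; sym; trans; cong; cong₂; subst)
  open ℤSolver.+-*-Solver using (solve; _:+_; _:*_; _:-_; :-_; con; _:=_)

  0<m : 0 < m
  0<m = ℕₚ.<-trans (s≤s z≤n) 2≤m

  0<n : 0 < n
  0<n = ℕₚ.n≢0⇒n>0 (λ n≡0 → ℕₚ.<-irrefl (sym (trans m≡nt (cong (ℕ._* t) n≡0))) 0<m)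

  0<t : 0 < t
  0<t = ℕₚ.n≢0⇒n>0 (λ t≡0 → ℕₚ.<-irrefl (sym (trans m≡nt (trans (cong (n ℕ.*_) t≡0) (ℕₚ.*-zeroʳ n)))) 0<m)

  e-eq : ∃ λ e → p ℕ.^ 1 ∸ 1 ≡ e ℕ.* 3
  e-eq = prime≡1-mod-3 p-prime p≡1

  h₂-eq : ∃ λ h₂ → p ℕ.^ 1 ∸ 1 ≡ h₂ ℕ.+ h₂
  h₂-eq = odd-prime-half {p} {proj₁ e-eq} p-prime (proj₂ e-eq)

  open Evaluation F p m p-prime order γ γ-primitive 0<m t n m≡nt 0<n 0<t p∤n (proj₁ e-eq) (proj₂ e-eq) g₀ g₀≈
  open Jacobi (proj₁ h₂-eq) (proj₂ h₂-eq) k₂ k₂≡ a₃ b₃ norm₃ a₃≡ b₃≡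
  open Scaled a
  open Formulas a h i₀ ((ζ′ ^ζ k₂) · eisen a₃ b₃) π₃≡J

  π₃ : ℤζ
  π₃ = (ζ′ ^ζ k₂) · eisen a₃ b₃

  -- If 3 divides n then d = 3, and d ∣ h with h < 3 leaves only 0.
  h≡0 : 3 ∣ n → h ≡ 0
  h≡0 3∣n = below h h<3 (∣.∣-trans (GCD.gcd-greatest 3∣n ∣.∣-refl) gcd∣h)
    where
    below : ∀ h → h < 3 → 3 ∣ h → h ≡ 0
    below zero    _   _ = refl
    below (suc h) h<3 d = ⊥-elim (∣.>⇒∤ h<3 d)

  -- Here d = 1, so the scaled congruence defining i₀ is n i₀ ≡ h modulo 3 itself.
  residue : ¬ (3 ∣ n) → Residue
  residue 3∤n = residue-equivalence n h i₀ 3∤n (unscaled (n/1≡n n) (n/1≡n h)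
    (subst (λ d → (+ ((n /′ d) ℕ.* i₀)) ≡[mod 3 /′ d ] (+ (h /′ d))) (gcd-3 n 3∤n) i₀≡))
    where
    unscaled : ∀ {x x′ y y′} → x ≡ x′ → y ≡ y′ → (+ (x ℕ.* i₀)) ≡[mod 3 ] (+ y) → (+ (x′ ℕ.* i₀)) ≡[mod 3 ] (+ y′)
    unscaled refl refl eq = eq

  vanishing : ¬ (3 ∣ n) → a ≡ 0 → twoRe X ≡ + 0 → (+ 3) ℤ.* N ≡ P ℤ.- (+ 1)
  vanishing 3∤n a≡0 eq = trans (value-zero (residue 3∤n) (a≡0⇒ a≡0)) (trans (cong (λ z → P ℤ.- (+ 1) ℤ.+ z) eq) (ℤₚ.+-identityʳ _))

  positive-multiple : 3 ∣ t → ∃ λ j → t ≡ suc j ℕ.* 3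
  positive-multiple (∣.divides zero t≡)    = ⊥-elim (ℕₚ.<-irrefl (sym t≡) 0<t)
  positive-multiple (∣.divides (suc j) t≡) = j , t≡

  q₃ R : ℤ
  q₃ = + (p ℕ.^ ((t ∸ 3) / 3))
  R = twoRe ((π₃ ^ζ (t / 3)) · (ζ′ ^ζ (2 ℕ.* i₀)))

  twoRe-divisible : ∀ j r → t ≡ suc j ℕ.* 3 → twoRe X ≡ (ℤ.- s) ℤ.* (+ (p ℕ.^ j)) ℤ.* r ℤ.* twoRe ((π₃ ^ζ suc j) · c) → twoRe X ≡ (ℤ.- s) ℤ.* q₃ ℤ.* r ℤ.* R
  twoRe-divisible j r t≡ eq = trans eq (cong₂ (λ u v → (ℤ.- s) ℤ.* (+ (p ℕ.^ u)) ℤ.* r ℤ.* twoRe ((π₃ ^ζ v) · c))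
    (sym (third j (cong (_∸ 3) t≡))) (sym (third (suc j) t≡)))

  divisible-zero : ¬ (3 ∣ n) → a ≡ 0 → 3 ∣ t → (+ 3) ℤ.* N ≡ P ℤ.- (+ 1) ℤ.- s ℤ.* q₃ ℤ.* (+ (p ∸ 1)) ℤ.* R
  divisible-zero 3∤n a≡0 3∣t with positive-multiple 3∣t
  ... | j , t≡ = trans (value-zero (residue 3∤n) (a≡0⇒ a≡0)) (trans (cong (λ z → P ℤ.- (+ 1) ℤ.+ z)
        (twoRe-divisible j (+ (p ∸ 1)) t≡ (twoRe₃ j (+ (p ∸ 1)) t≡ (D-zero (a≡0⇒ a≡0)))))
      (solve 5 (λ u s q r R → u :+ (:- s) :* q :* r :* R := u :- s :* q :* r :* R) refl (P ℤ.- (+ 1)) s q₃ (+ (p ∸ 1)) R))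

  divisible-nonzero : ¬ (3 ∣ n) → ¬ (a ≡ 0) → 3 ∣ t → (+ 3) ℤ.* N ≡ P ℤ.+ s ℤ.* q₃ ℤ.* R
  divisible-nonzero 3∤n a≢0 3∣t with positive-multiple 3∣t
  ... | j , t≡ = trans (value-nonzero (residue 3∤n) (a≢0⇒ a<p a≢0)) (trans (cong (λ z → P ℤ.+ z)
        (twoRe-divisible j (ℤ.- (+ 1)) t≡ (twoRe₃ j (ℤ.- (+ 1)) t≡ (D-nonzero (a≢0⇒ a<p a≢0)))))
      (solve 4 (λ u s q R → u :+ (:- s) :* q :* con (ℤ.- (+ 1)) :* R := u :+ s :* q :* R) refl P s q₃ R))

  remainder-one : ¬ (3 ∣ n) → ¬ (a ≡ 0) → ∀ a₀ k₀ → (+ (a₀ ℕ.* a)) ≡[mod p ] (ℤ.- (+ n)) → (+ (g₀ ℕ.^ k₀)) ≡[mod p ] (+ a₀) → t % 3 ≡ 1 →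
    (+ 3) ℤ.* N ≡ P ℤ.- s ℤ.* twoRe (ofℤ (+ (p ℕ.^ ((t ∸ 1) / 3))) · (π₃ ^ζ ((t ∸ 1) / 3)) · (ζ′ ^ζ (2 ℕ.* k₀ ℕ.+ 2 ℕ.* i₀)))
  remainder-one 3∤n a≢0 a₀ k₀ a₀≡ k₀≡ t%3≡1 =
    trans (value-nonzero (residue 3∤n) (a≢0⇒ a<p a≢0)) (trans (cong (λ z → P ℤ.+ z)
        (twoRe₁ ((t ∸ 1) / 3) (2 ℕ.* k₀) t≡ (χ-a′ a₀ k₀ (a≢0⇒ a<p a≢0) a₀≡ k₀≡)))
      (solve 3 (λ u s R → u :+ (:- s) :* R := u :- s :* R) refl P s _))
    where
    t≡′ : t ≡ suc (t / 3 ℕ.* 3)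
    t≡′ = trans (m≡m%n+[m/n]*n t 3) (cong (ℕ._+ t / 3 ℕ.* 3) t%3≡1)
    t≡ : t ≡ suc ((t ∸ 1) / 3 ℕ.* 3)
    t≡ = trans t≡′ (cong (λ j → suc (j ℕ.* 3)) (sym (third (t / 3) (cong (_∸ 1) t≡′))))

  remainder-two : ¬ (3 ∣ n) → ¬ (a ≡ 0) → ∀ a₀ k₀ → (+ (a₀ ℕ.* a)) ≡[mod p ] (ℤ.- (+ n)) → (+ (g₀ ℕ.^ k₀)) ≡[mod p ] (+ a₀) → t % 3 ≡ 2 →
    (+ 3) ℤ.* N ≡ P ℤ.- s ℤ.* twoRe (ofℤ (+ (p ℕ.^ ((t ∸ 2) / 3))) · (π₃ ^ζ ((t ℕ.+ 1) / 3)) · (ζ′ ^ζ (k₀ ℕ.+ 2 ℕ.* i₀)))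
  remainder-two 3∤n a≢0 a₀ k₀ a₀≡ k₀≡ t%3≡2 =
    trans (value-nonzero (residue 3∤n) (a≢0⇒ a<p a≢0)) (trans (cong (λ z → P ℤ.+ z)
        (trans (twoRe₂ (t / 3) k₀ t≡ χ̄a′) (cong₂ (λ u v → (ℤ.- s) ℤ.* twoRe (ofℤ (+ (p ℕ.^ u)) · (π₃ ^ζ v) · (ζ′ ^ζ (k₀ ℕ.+ 2 ℕ.* i₀))))
          (sym (third (t / 3) (cong (_∸ 2) t≡))) (sym (third (suc (t / 3)) (trans (ℕₚ.+-comm t 1) (cong suc t≡)))))))
      (solve 3 (λ u s R → u :+ (:- s) :* R := u :- s :* R) refl P s _))
    where
    t≡ : t ≡ suc (suc (t / 3 ℕ.* 3))
    t≡ = trans (m≡m%n+[m/n]*n t 3) (cong (ℕ._+ t / 3 ℕ.* 3) t%3≡2)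
    χ̄a′ = conj-χ-a′ a₀ k₀ (a≢0⇒ a<p a≢0) a₀≡ k₀≡
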